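{- Suppose $V_0\subseteq V_1$ are models of set theory, $\kappa$ is an infinite ordinal, $X,\mathscr{L}\in V_0$ with $X$ infinite and $\mathscr{L}$ a relational language, and let $\mu\in V_0$ be an invariant measure on $[\mathrm{Str}^\kappa_{\mathscr{L}}(X)]^{V_0}$. Then $\mu$ is extreme in $V_0$ if and only if $\mu^{V_1}$ is extreme in $V_1$.
   Context: A model of set theory is a transitive model of ZFC (contained in a fixed background model); $\kappa\in V_0$ need not be a cardinal in any given model. Structures and measures: $\mathrm{Str}_{\mathscr{L}}(X)$ is the set of $\mathscr{L}$-structures with underlying set $X$. An $\mathscr{L}$-literal is an atomic formula or a (possibly iterated) negation of one. $\sigma_\kappa(\mathrm{Str}_{\mathscr{L}}(X))$ is the smallest family of subsets of $\mathrm{Str}_{\mathscr{L}}(X)$ closed under complements and under unions of size $\le\kappa$ and containing all sets $\{\mathcal{M}:\mathcal{M}\models\varphi(\bar a)\}$ for $\varphi$ a literal and $\bar a$ a tuple from $X$. $\mathrm{Str}^\kappa_{\mathscr{L}}(X)$ is $\mathrm{Str}_{\mathscr{L}}(X)$ with this family of measurable sets. A probability $\kappa$-measure on it is a probability measure $\mu$ with $\mu(\bigcup_{i\in\kappa}A_i)=\sum_{i\in\kappa}\mu(A_i)$ for pairwise disjoint measurable $A_i$. $\mathrm{Sym}(X)$ acts by $g\mathcal{M}\models R(g(a_0),\dots)$ iff $\mathcal{M}\models R(a_0,\dots)$; $\mu$ is invariant if $\mu(g[A])=\mu(A)$ for all $g\in\mathrm{Sym}(X)$ and measurable $A$. "Invariant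 measure" means invariant probability $\kappa$-measure. An invariant measure $\mu$ on $\mathrm{Str}^\kappa_{\mathscr{L}}(X)$ is extreme if, whenever $\nu$ and $\eta$ are distinct invariant measures on $\mathrm{Str}^\kappa_{\mathscr{L}}(X)$ with $\mu=r\nu+s\eta$ a convex combination ($r,s\ge0$, $r+s=1$), then $r=0$ or $s=0$. Relativization: $\mu^{V_1}$ denotes the relativization of $\mu$ to $V_1$, i.e. the unique probability $\kappa$-measure in $V_1$ on $[\mathrm{Str}^\kappa_{\mathscr{L}}(X)]^{V_1}$ such that for every finite conjunction $\varphi$ of $\mathscr{L}$-literals and tuple $\bar a$ from $X$, the set $\{\mathcal{M}:\mathcal{M}\models\varphi(\bar a)\}$ computed in $V_1$ has the same $\mu^{V_1}$-measure as the $\mu$-measure of that set computed in $V_0$. -}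

module Defs where

open import Data.Fin.Base using (Fin)
open import Data.Nat.Base using (ℕ; suc)
open import Data.Product.Base using (Σ; _×_)
open import Data.Sum.Base using (_⊎_)
open import Data.Unit.Polymorphic.Base using (⊤)
open import Data.Vec.Functional using (Vector; _∷_)
open import Function.Bundles using (_⇔_)
open import Level using (Level)
open import Relation.Binary.Core using (Rel)
open import Relation.Binary.PropositionalEquality.Core using (_≡_)
open import Relation.Nullary.Negation.Core using (¬_)
open import Relation.Unary using (Pred)

-- First-order formulas of the language {∈, =} with n free variables
-- (de Bruijn indices), in a classically complete set of connectives.

data Formula (n : ℕ) : Set where
  _∈̇_ _≐_ : Fin n → Fin n → Formula n
  ¬̇_      : Formula n → Formula n
  _∧̇_     : Formula n → Formula n → Formula n
  ∀̇_      : Formula (suc n) → Formula n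

-- Everything below is relativized to a class V of elements of an
-- ∈-structure (𝕌 , _∈_): a notion P of set theory, read in this module,
-- is P computed in V (written P^V or [P]^V).  All quantifiers range over V,
-- and no notion refers to numbers, reals, ... of the metatheory.

module Relative {ℓ : Level} {𝕌 : Set ℓ} (_∈_ : Rel 𝕌 ℓ) (V : Pred 𝕌 ℓ) where

  ∀ⱽ ∃ⱽ ∃!ⱽ : Pred 𝕌 ℓ → Set ℓ
  ∀ⱽ P  = ∀ x → V x → P x
  ∃ⱽ P  = Σ 𝕌 λ x → V x × P x
  ∃!ⱽ P = ∃ⱽ λ x → P x × ∀ⱽ λ y → P y → y ≡ x

  ∀∈ ∃∈ : 𝕌 → Pred 𝕌 ℓ → Set ℓ
  ∀∈ a P = ∀ⱽ λ x → x ∈ a → P x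
  ∃∈ a P = ∃ⱽ λ x → x ∈ a × P x

  ----------------------------------------------------------------------
  -- Basic set theory

  infix 4 _⊆_ _∶_↦_

  _⊆_ : Rel 𝕌 ℓ
  a ⊆ b = ∀∈ a λ x → x ∈ b

  IsEmpty : 𝕌 → Set ℓ
  IsEmpty e = ∀ⱽ λ x → ¬ (x ∈ e)

  -- z = {x , y}
  IsUPair : 𝕌 → 𝕌 → 𝕌 → Set ℓ
  IsUPair z x y = ∀ⱽ λ w → w ∈ z ⇔ (w ≡ x ⊎ w ≡ y)

  -- p = (x , y) = {{x} , {x , y}}
  IsPair : 𝕌 → 𝕌 → 𝕌 → Set ℓ
  IsPair p x y =
    ∃ⱽ λ s → ∃ⱽ λ t → IsUPair s x x × IsUPair t x y × IsUPair p s t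

  -- b = ⋃ a
  IsUnion : 𝕌 → 𝕌 → Set ℓ
  IsUnion b a = ∀ⱽ λ x → x ∈ b ⇔ (∃∈ a λ y → x ∈ y)

  -- y = x ∪ {x}
  IsSucc : 𝕌 → 𝕌 → Set ℓ
  IsSucc y x = ∀ⱽ λ w → w ∈ y ⇔ (w ∈ x ⊎ w ≡ x)

  IsOne : 𝕌 → Set ℓ
  IsOne u = ∃ⱽ λ e → IsEmpty e × IsSucc u e

  Inductive : 𝕌 → Set ℓ
  Inductive w = (∃∈ w λ e → IsEmpty e)
              × (∀∈ w λ x → ∃∈ w λ y → IsSucc y x)

  ----------------------------------------------------------------------
  -- V ⊨ ZFC

  Sat : ∀ {n} → Formula n → Vector 𝕌 n → Set ℓ
  Sat (i ∈̇ j) ρ = ρ i ∈ ρ j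
  Sat (i ≐ j) ρ = ρ i ≡ ρ j
  Sat (¬̇ φ)   ρ = ¬ Sat φ ρ
  Sat (φ ∧̇ ψ) ρ = Sat φ ρ × Sat ψ ρ
  Sat (∀̇ φ)   ρ = ∀ⱽ λ x → Sat φ (x ∷ ρ)

  record ZFC : Set ℓ where
    field
      extensionality : ∀ⱽ λ a → ∀ⱽ λ b →
        (∀ⱽ λ x → x ∈ a ⇔ x ∈ b) → a ≡ b
      foundation : ∀ⱽ λ a → (∃ⱽ λ x → x ∈ a) →
        ∃∈ a λ x → ∀∈ x λ y → ¬ (y ∈ a)
      pairing : ∀ⱽ λ x → ∀ⱽ λ y → ∃ⱽ λ z → IsUPair z x y
      union : ∀ⱽ λ a → ∃ⱽ λ b → IsUnion b a
      powerset : ∀ⱽ λ a → ∃ⱽ λ b → ∀ⱽ λ x → x ∈ b ⇔ x ⊆ a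
      infinity : ∃ⱽ λ w → Inductive w
      separation : ∀ {n} (φ : Formula (suc n)) (ρ : Vector 𝕌 n) →
        (∀ i → V (ρ i)) → ∀ⱽ λ a →
        ∃ⱽ λ b → ∀ⱽ λ x → x ∈ b ⇔ (x ∈ a × Sat φ (x ∷ ρ))
      replacement : ∀ {n} (φ : Formula (suc (suc n))) (ρ : Vector 𝕌 n) →
        (∀ i → V (ρ i)) → ∀ⱽ λ a →
        (∀∈ a λ x → ∃!ⱽ λ y → Sat φ (x ∷ y ∷ ρ)) →
        ∃ⱽ λ b → ∀ⱽ λ y → y ∈ b ⇔ (∃∈ a λ x → Sat φ (x ∷ y ∷ ρ))
      choice : ∀ⱽ λ a →
        (∀∈ a λ x → ∃ⱽ λ y → y ∈ x) →
        (∀∈ a λ x → ∀∈ a λ x′ → ¬ (x ≡ x′) → ∀∈ x λ y → ¬ (y ∈ x′)) →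
        ∃ⱽ λ c → ∀∈ a λ x → ∃!ⱽ λ y → y ∈ x × y ∈ c

  record IsModelOfSetTheory : Set ℓ where
    field
      transitive : ∀ x y → x ∈ y → V y → V x
      zfc        : ZFC

  ----------------------------------------------------------------------
  -- Functions, natural numbers, ordinals

  -- (x , y) ∈ f
  _∶_↦_ : 𝕌 → 𝕌 → 𝕌 → Set ℓ
  f ∶ x ↦ y = ∃∈ f λ p → IsPair p x y

  -- f is a function with domain the set a and values in the class B.
  IsFun : 𝕌 → 𝕌 → Pred 𝕌 ℓ → Set ℓ
  IsFun f a B = (∀∈ f λ p → ∃∈ a λ x → ∃ⱽ λ y → B y × IsPair p x y)
              × (∀∈ a λ x → ∃!ⱽ λ y → f ∶ x ↦ y)

  IsInjective : 𝕌 → Set ℓ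
  IsInjective f = ∀ⱽ λ x → ∀ⱽ λ x′ → ∀ⱽ λ y →
    f ∶ x ↦ y → f ∶ x′ ↦ y → x ≡ x′

  IsBijection : 𝕌 → 𝕌 → 𝕌 → Set ℓ
  IsBijection f a b = IsFun f a (_∈ b) × IsInjective f
                    × (∀∈ b λ y → ∃ⱽ λ x → f ∶ x ↦ y)

  -- h = g ∘ f
  IsComp : 𝕌 → 𝕌 → 𝕌 → Set ℓ
  IsComp h g f = ∀ⱽ λ p → p ∈ h ⇔
    (∃ⱽ λ x → ∃ⱽ λ y → ∃ⱽ λ z → f ∶ x ↦ y × g ∶ y ↦ z × IsPair p x z)

  -- |a| ≤ |b|
  SizeAtMost : 𝕌 → 𝕌 → Set ℓ
  SizeAtMost a b = ∃ⱽ λ f → IsFun f a (_∈ b) × IsInjective f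

  -- von Neumann naturals
  IsNat : 𝕌 → Set ℓ
  IsNat n = ∀ⱽ λ w → Inductive w → n ∈ w

  Infinite : 𝕌 → Set ℓ
  Infinite a = ¬ (∃ⱽ λ n → IsNat n × ∃ⱽ λ f → IsBijection f n a)

  -- A transitive set of transitive sets (an ordinal, by foundation).
  IsOrdinal : 𝕌 → Set ℓ
  IsOrdinal a = (∀∈ a λ x → x ⊆ a) × (∀∈ a λ x → ∀∈ x λ y → y ⊆ x)

  -- z = f(n) for some f with domain {0,…,n}, f(0) satisfying Z, and
  -- step i f(i) f(i+1) for all i < n.
  Rec : Pred 𝕌 ℓ → (𝕌 → 𝕌 → 𝕌 → Set ℓ) → 𝕌 → 𝕌 → Set ℓ
  Rec Z step n z = ∃ⱽ λ f →
      (∃ⱽ λ n⁺ → IsSucc n⁺ n × IsFun f n⁺ V)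
    × (∃ⱽ λ e → IsEmpty e × ∃ⱽ λ x → f ∶ e ↦ x × Z x)
    × (∀∈ n λ i → ∀ⱽ λ j → IsSucc j i → ∀ⱽ λ x → ∀ⱽ λ y →
         f ∶ i ↦ x → f ∶ j ↦ y → step i x y)
    × f ∶ n ↦ z

  -- m + n = k  and  m · n = k
  Plus Times : 𝕌 → 𝕌 → 𝕌 → Set ℓ
  Plus m n k  = Rec (_≡ m) (λ _ x y → IsSucc y x) n k
  Times m n k = Rec IsEmpty (λ _ x y → Plus x m y) n k

  ----------------------------------------------------------------------
  -- Nonnegative rationals and reals

  -- A nonnegative fraction m / n is the pair (m , n) with n ≠ 0.
  -- Different fractions may represent the same rational.
  IsFrac : 𝕌 → Set ℓ
  IsFrac q = ∃ⱽ λ m → ∃ⱽ λ n → IsNat m × IsNat n × ¬ IsEmpty n × IsPair q m n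

  -- For p = m/n and q = m′/n′:  j = m · n′  and  k = m′ · n.
  CrossProducts : 𝕌 → 𝕌 → 𝕌 → 𝕌 → Set ℓ
  CrossProducts p q j k =
    ∃ⱽ λ m → ∃ⱽ λ n → ∃ⱽ λ m′ → ∃ⱽ λ n′ →
    IsPair p m n × IsPair q m′ n′ × Times m n′ j × Times m′ n k

  infix 4 _<ᶠ_ _≤ᶠ_

  _<ᶠ_ _≤ᶠ_ : Rel 𝕌 ℓ
  p <ᶠ q = ∃ⱽ λ j → ∃ⱽ λ k → CrossProducts p q j k × j ∈ k
  p ≤ᶠ q = ∃ⱽ λ j → ∃ⱽ λ k → CrossProducts p q j k × (j ∈ k ⊎ j ≡ k)

  -- x = p + q, as the fraction (m·n′ + m′·n) / (n·n′)
  FracPlus : 𝕌 → 𝕌 → 𝕌 → Set ℓ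
  FracPlus p q x =
    ∃ⱽ λ m → ∃ⱽ λ n → ∃ⱽ λ m′ → ∃ⱽ λ n′ →
    ∃ⱽ λ j → ∃ⱽ λ k → ∃ⱽ λ a → ∃ⱽ λ b →
    IsPair p m n × IsPair q m′ n′ × Times m n′ j × Times m′ n k ×
    Plus j k a × Times n n′ b × IsPair x a b

  -- x = p · q, as the fraction (m·m′) / (n·n′)
  FracTimes : 𝕌 → 𝕌 → 𝕌 → Set ℓ
  FracTimes p q x =
    ∃ⱽ λ m → ∃ⱽ λ n → ∃ⱽ λ m′ → ∃ⱽ λ n′ → ∃ⱽ λ a → ∃ⱽ λ b →
    IsPair p m n × IsPair q m′ n′ ×
    Times m m′ a × Times n n′ b × IsPair x a b

  -- A nonnegative real r is the upper Dedekind cut of all nonnegative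
  -- fractions q > r.  (Openness excludes fractions equal to 0.)
  record IsReal (r : 𝕌) : Set ℓ where
    field
      fractions : ∀∈ r λ q → IsFrac q
      inhabited : ∃ⱽ λ q → q ∈ r
      upward    : ∀∈ r λ p → ∀ⱽ λ q → IsFrac q → p ≤ᶠ q → q ∈ r
      open-cut  : ∀∈ r λ q → ∃∈ r λ p → p <ᶠ q

  infix 4 _≤ᴿ_

  _≤ᴿ_ : Rel 𝕌 ℓ
  r ≤ᴿ s = s ⊆ r

  -- r is the real given by the fraction q
  IsFracReal : 𝕌 → 𝕌 → Set ℓ
  IsFracReal q r = ∀ⱽ λ x → x ∈ r ⇔ (IsFrac x × q <ᶠ x)

  IsZeroᴿ IsOneᴿ : 𝕌 → Set ℓ
  IsZeroᴿ r = ∃ⱽ λ q → ∃ⱽ λ m → ∃ⱽ λ n →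
    IsEmpty m × IsOne n × IsPair q m n × IsFracReal q r
  IsOneᴿ r = ∃ⱽ λ q → ∃ⱽ λ n → IsOne n × IsPair q n n × IsFracReal q r

  -- r + s = t  and  r · s = t.  A fraction x exceeds r + s iff
  -- x ≥ p + q for some p > r, q > s; similarly for products.
  Plusᴿ Timesᴿ : 𝕌 → 𝕌 → 𝕌 → Set ℓ
  Plusᴿ r s t = ∀ⱽ λ x → x ∈ t ⇔
    (IsFrac x × ∃∈ r λ p → ∃∈ s λ q → ∃ⱽ λ z → FracPlus p q z × z ≤ᶠ x)
  Timesᴿ r s t = ∀ⱽ λ x → x ∈ t ⇔
    (IsFrac x × ∃∈ r λ p → ∃∈ s λ q → ∃ⱽ λ z → FracTimes p q z × z ≤ᶠ x)

  -- For c : κ → ℝ, t is the sum of c over finitely many distinct indices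
  -- e(0), …, e(n-1).
  IsFinitePartialSum : 𝕌 → 𝕌 → 𝕌 → Set ℓ
  IsFinitePartialSum κ c t = ∃ⱽ λ n → ∃ⱽ λ e →
      IsNat n × IsFun e n (_∈ κ) × IsInjective e
    × Rec IsZeroᴿ
          (λ i x y → ∃ⱽ λ k → ∃ⱽ λ d → e ∶ i ↦ k × c ∶ k ↦ d × Plusᴿ x d y)
          n t

  -- s = Σ_{i ∈ κ} c(i), the supremum of the finite partial sums
  record IsSum (κ c s : 𝕌) : Set ℓ where
    field
      real  : IsReal s
      upper : ∀ⱽ λ t → IsFinitePartialSum κ c t → t ≤ᴿ s
      least : ∀ⱽ λ u → IsReal u →
        (∀ⱽ λ t → IsFinitePartialSum κ c t → t ≤ᴿ u) → s ≤ᴿ u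

  ----------------------------------------------------------------------
  -- Relational languages, structures, literals

  -- A relational language is the arity function on its set of relation
  -- symbols.
  IsLanguage : 𝕌 → Set ℓ
  IsLanguage L = ∃ⱽ λ D → IsFun L D IsNat

  -- The interpretation M assigns to each k-ary symbol a set of functions
  -- k → X; the underlying set X is kept as a separate parameter.
  IsStructure : 𝕌 → 𝕌 → 𝕌 → Set ℓ
  IsStructure L X M =
      (∃ⱽ λ D → IsFun L D V × IsFun M D V)
    × (∀ⱽ λ R → ∀ⱽ λ k → ∀ⱽ λ P → L ∶ R ↦ k → M ∶ R ↦ P →
         ∀∈ P λ a → IsFun a k (_∈ X))

  -- M ⊨ R(a)
  HoldsRel : 𝕌 → 𝕌 → 𝕌 → Set ℓ
  HoldsRel M R a = ∃ⱽ λ P → M ∶ R ↦ P × a ∈ P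

  IsTuple : 𝕌 → 𝕌 → 𝕌 → Set ℓ
  IsTuple n X a = IsNat n × IsFun a n (_∈ X)

  -- Codes of atomic formulas: R(x_{v(0)}, …, x_{v(k-1)}) is (0 , (R , v)),
  -- and x_i = x_j is (1 , (i , j)).
  RelAtom EqAtom : 𝕌 → 𝕌 → 𝕌 → Set ℓ
  RelAtom φ R v = ∃ⱽ λ e → ∃ⱽ λ p → IsEmpty e × IsPair p R v × IsPair φ e p
  EqAtom φ i j  = ∃ⱽ λ u → ∃ⱽ λ p → IsOne u × IsPair p i j × IsPair φ u p

  -- Atomic formulas in the variables x_0, …, x_{n-1}
  IsAtom : 𝕌 → 𝕌 → 𝕌 → Set ℓ
  IsAtom L n φ =
      (∃ⱽ λ R → ∃ⱽ λ k → ∃ⱽ λ v →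
         L ∶ R ↦ k × IsFun v k (_∈ n) × RelAtom φ R v)
    ⊎ (∃∈ n λ i → ∃∈ n λ j → EqAtom φ i j)

  -- M ⊨ φ(a) for φ atomic
  SatAtom : 𝕌 → 𝕌 → 𝕌 → Set ℓ
  SatAtom M φ a =
      (∃ⱽ λ R → ∃ⱽ λ v → ∃ⱽ λ b →
         RelAtom φ R v × IsComp b a v × HoldsRel M R b)
    ⊎ (∃ⱽ λ i → ∃ⱽ λ j → ∃ⱽ λ x →
         EqAtom φ i j × a ∶ i ↦ x × a ∶ j ↦ x)

  -- The k-fold negation ¬…¬φ of an atomic formula φ is coded by (k , φ).
  IsLiteral : 𝕌 → 𝕌 → 𝕌 → Set ℓ
  IsLiteral L n l = ∃ⱽ λ k → ∃ⱽ λ φ → IsNat k × IsAtom L n φ × IsPair l k φ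

  -- t ∈ {0 , 1} is the truth value of P.
  TruthValue : Set ℓ → 𝕌 → Set ℓ
  TruthValue P t = (IsOne t × P) ⊎ (IsEmpty t × ¬ P)

  -- M ⊨ l(a): the truth value of φ is flipped k times.
  SatLiteral : 𝕌 → 𝕌 → 𝕌 → Set ℓ
  SatLiteral M l a = ∃ⱽ λ k → ∃ⱽ λ φ → ∃ⱽ λ t →
      IsPair l k φ × IsOne t
    × Rec (TruthValue (SatAtom M φ a)) (λ _ x y → TruthValue (IsEmpty x) y) k t

  -- A finite conjunction of literals is a finite sequence of literals.
  IsConjunction : 𝕌 → 𝕌 → 𝕌 → Set ℓ
  IsConjunction L n Φ = ∃ⱽ λ m → IsNat m × IsFun Φ m (IsLiteral L n)

  SatConjunction : 𝕌 → 𝕌 → 𝕌 → Set ℓ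
  SatConjunction M Φ a = ∀ⱽ λ i → ∀ⱽ λ l → Φ ∶ i ↦ l → SatLiteral M l a

  -- A = {M ∈ Str_L(X) : P M}
  IsStructuresWith : 𝕌 → 𝕌 → Pred 𝕌 ℓ → 𝕌 → Set ℓ
  IsStructuresWith L X P A = ∀ⱽ λ M → M ∈ A ⇔ (IsStructure L X M × P M)

  -- S = Str_L(X)
  IsStr : 𝕌 → 𝕌 → 𝕌 → Set ℓ
  IsStr L X S = IsStructuresWith L X (λ _ → ⊤) S

  ----------------------------------------------------------------------
  -- σ_κ(Str_L(X)) and probability κ-measures

  record IsClosedFamily (κ L X F : 𝕌) : Set ℓ where
    field
      structures  : ∀∈ F λ A → ∀∈ A λ M → IsStructure L X M
      literals    : ∀ⱽ λ n → ∀ⱽ λ a → ∀ⱽ λ l → ∀ⱽ λ A →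
        IsTuple n X a → IsLiteral L n l →
        IsStructuresWith L X (λ M → SatLiteral M l a) A → A ∈ F
      complements : ∀∈ F λ A → ∀ⱽ λ B →
        IsStructuresWith L X (λ M → ¬ (M ∈ A)) B → B ∈ F
      unions      : ∀ⱽ λ G → G ⊆ F → SizeAtMost G κ → ∀ⱽ λ B →
        IsUnion B G → B ∈ F

  -- S = σ_κ(Str_L(X))
  IsSigma : 𝕌 → 𝕌 → 𝕌 → 𝕌 → Set ℓ
  IsSigma κ L X S =
    IsClosedFamily κ L X S × (∀ⱽ λ F → IsClosedFamily κ L X F → S ⊆ F)

  record IsProbabilityMeasure (κ L X μ : 𝕌) : Set ℓ where
    field
      domain   : ∃ⱽ λ S → IsSigma κ L X S × IsFun μ S IsReal
      total    : ∀ⱽ λ S → IsStr L X S → ∃ⱽ λ u → IsOneᴿ u × μ ∶ S ↦ u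
      -- A is a κ-sequence of pairwise disjoint measurable sets with union B,
      -- and c(i) = μ(A(i)).
      additive : ∀ⱽ λ S → IsSigma κ L X S → ∀ⱽ λ A → IsFun A κ (_∈ S) →
        (∀ⱽ λ i → ∀ⱽ λ j → ∀ⱽ λ C → ∀ⱽ λ D → ¬ (i ≡ j) →
           A ∶ i ↦ C → A ∶ j ↦ D → ∀∈ C λ M → ¬ (M ∈ D)) →
        ∀ⱽ λ B → (∀ⱽ λ M → M ∈ B ⇔ (∃ⱽ λ i → ∃ⱽ λ C → A ∶ i ↦ C × M ∈ C)) →
        ∀ⱽ λ c → IsComp c μ A →
        ∀ⱽ λ t → μ ∶ B ↦ t → IsSum κ c t

  -- N = g M
  IsAction : 𝕌 → 𝕌 → 𝕌 → 𝕌 → 𝕌 → Set ℓ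
  IsAction L X g M N = IsStructure L X N
    × (∀ⱽ λ R → ∀ⱽ λ k → ∀ⱽ λ a → ∀ⱽ λ b →
         L ∶ R ↦ k → IsFun a k (_∈ X) → IsComp b g a →
         HoldsRel N R b ⇔ HoldsRel M R a)

  -- B = g[A]
  IsImage : 𝕌 → 𝕌 → 𝕌 → 𝕌 → 𝕌 → Set ℓ
  IsImage L X g A B = ∀ⱽ λ N → N ∈ B ⇔ (∃∈ A λ M → IsAction L X g M N)

  record IsInvariantMeasure (κ L X μ : 𝕌) : Set ℓ where
    field
      measure   : IsProbabilityMeasure κ L X μ
      invariant : ∀ⱽ λ g → IsBijection g X X → ∀ⱽ λ A → ∀ⱽ λ B →
        IsImage L X g A B → ∀ⱽ λ y → μ ∶ A ↦ y → μ ∶ B ↦ y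

  -- μ = r ν + s η
  IsCombination : 𝕌 → 𝕌 → 𝕌 → 𝕌 → 𝕌 → Set ℓ
  IsCombination μ r ν s η =
    ∀ⱽ λ A → ∀ⱽ λ y → ∀ⱽ λ a → ∀ⱽ λ b → ∀ⱽ λ c → ∀ⱽ λ d →
    μ ∶ A ↦ y → ν ∶ A ↦ a → η ∶ A ↦ b → Timesᴿ r a c → Timesᴿ s b d →
    Plusᴿ c d y

  record IsExtreme (κ L X μ : 𝕌) : Set ℓ where
    field
      invariant : IsInvariantMeasure κ L X μ
      extreme   : ∀ⱽ λ ν → ∀ⱽ λ η →
        IsInvariantMeasure κ L X ν → IsInvariantMeasure κ L X η → ¬ (ν ≡ η) →
        ∀ⱽ λ r → ∀ⱽ λ s → IsReal r → IsReal s →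
        (∃ⱽ λ u → IsOneᴿ u × Plusᴿ r s u) →
        IsCombination μ r ν s η → IsZeroᴿ r ⊎ IsZeroᴿ s

-- μ₁ is the relativization μ^{V₁} of the measure μ ∈ V₀.  Cuts are sets of
-- pairs of natural numbers, so equality of values across V₀ ⊆ V₁ is
-- equality of sets.

record IsRelativization {ℓ : Level} {𝕌 : Set ℓ} (_∈_ : Rel 𝕌 ℓ)
                        (V₀ V₁ : Pred 𝕌 ℓ) (κ L X μ μ₁ : 𝕌) : Set ℓ where
  private
    module M₀ = Relative _∈_ V₀
    module M₁ = Relative _∈_ V₁
  field
    member  : V₁ μ₁
    measure : M₁.IsProbabilityMeasure κ L X μ₁
    agrees  : M₀.∀ⱽ λ n → M₀.∀ⱽ λ a → M₀.∀ⱽ λ Φ →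
      M₀.IsTuple n X a → M₀.IsConjunction L n Φ →
      M₀.∀ⱽ λ A₀ → M₁.∀ⱽ λ A₁ →
      M₀.IsStructuresWith L X (λ M → M₀.SatConjunction M Φ a) A₀ →
      M₁.IsStructuresWith L X (λ M → M₁.SatConjunction M Φ a) A₁ →
      M₀.∀ⱽ λ y → (M₀._∶_↦_ μ A₀ y) ⇔ (M₁._∶_↦_ μ₁ A₁ y)

{-# OPTIONS --safe #-}
-- Call an invariant measure μ dissociated if finite sets of atoms with disjoint
-- supports are independent.  In a single model this is equivalent to extremality.
-- If μ is extreme and D is a basic set, let the permutation g tend to infinity: then
-- μ(Dᶜ)·μ(B) + lim μ(B ∩ gD) and μ(D)·μ(B) + lim μ(B ∩ gDᶜ) are invariant measures
-- with average μ, and if they coincide, lim μ(B ∩ gD) = μ(B)·μ(D).  Conversely a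
-- dissociated measure is mixing, μ(C ∩ gD) → μ(C)·μ(D) for all measurable C and D,
-- and a mixing measure is not a proper convex combination.  Dissociation only
-- involves the values of μ on basic sets, which are the same in V₀ and in V₁, since
-- finite sets and real arithmetic are absolute.  Finally μ^{V₁} is invariant because
-- a permutation in V₁ agrees on each finite set with one in V₀.

module Submission where

open import Defs
open import Axiom.ExcludedMiddle using (ExcludedMiddle)
open import Data.Empty using (⊥; ⊥-elim)
open import Data.Fin.Base using (Fin; zero; suc; _↑ˡ_; _↑ʳ_)
open import Data.Nat.Base using (ℕ; zero; suc) renaming (_+_ to _+ℕ_)
open import Data.Product.Base using (Σ; _×_; _,_; proj₁; proj₂)
open import Data.Sum.Base using (_⊎_; inj₁; inj₂; reduce) renaming (map to ⊎-map;  [_,_]′ to ⊎-elim)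
open import Data.Unit.Polymorphic.Base using (⊤; tt)
open import Data.Vec.Functional using (Vector; _∷_; []; head; tail; _++_)
open import Data.Vec.Functional.Properties using (lookup-++ˡ; lookup-++ʳ)
open import Function.Bundles using (_⇔_; mk⇔; Equivalence)
open import Level using (Level) renaming (suc to lsuc)
open import Relation.Binary.Core using (Rel)
open import Relation.Binary.PropositionalEquality using (_≡_; refl; sym; trans; cong; cong₂; subst; subst₂; isEquivalence; module ≡-Reasoning)
open import Relation.Nullary.Negation.Core using (¬_)
open import Relation.Nullary.Decidable.Core using (yes; no; recompute; Dec)
open import Relation.Unary using (Pred) renaming (_⊆_ to _⊆ᵖ_)
open import Algebra.Bundles using (CommutativeMonoid; CommutativeSemiring)
import Algebra.Solver.Ring.NaturalCoefficients.Default as SemiringSolver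
import Algebra.Solver.CommutativeMonoid as MonoidSolver

record Model (ℓ : Level) : Set (lsuc ℓ) where
  field
    em      : ExcludedMiddle ℓ
    𝕌       : Set ℓ
    _∈_     : Rel 𝕌 ℓ
    V       : Pred 𝕌 ℓ
    isModel : Relative.IsModelOfSetTheory _∈_ V

infix 1 _⟺_
_⟺_ : ∀ {a b} → Set a → Set b → Set _
A ⟺ B = (A → B) × (B → A)

module Theory {ℓ : Level} (𝔐 : Model ℓ) where

 module Core where

   open Model 𝔐 public
   module R = Relative _∈_ V
   open R.IsModelOfSetTheory isModel public using (transitive; zfc)

   private variable
     A B C : Set ℓ
     n m : ℕ

   it : ⦃ A ⦄ → A
   it ⦃ a ⦄ = a

   dne : ¬ ¬ A → A
   dne {A} h with em {A}
   ... | yes a = a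
   ... | no na = ⊥-elim (h na)

   ⟺-sym : (A ⟺ B) → (B ⟺ A)
   ⟺-sym (f , g) = g , f

   ⟺-trans : (A ⟺ B) → (B ⟺ C) → (A ⟺ C)
   ⟺-trans (f , g) (h , k) = (λ a → h (f a)) , (λ c → g (k c))

   from⇔ : A ⇔ B → A ⟺ B
   from⇔ e = Equivalence.to e , Equivalence.from e

   to⇔ : A ⟺ B → A ⇔ B
   to⇔ (f , g) = mk⇔ f g

   -- The elements of V.  The irrelevant field makes elements equal as soon as
   -- they are equal in 𝕌; excluded middle recovers it.
   record W : Set ℓ where
     no-eta-equality
     pattern
     constructor ⟪_,_⟫
     field
       el   : 𝕌
       .inV : V el
   open W public using (el)

   isV : (w : W) → V (el w)
   isV ⟪ x , v ⟫ = recompute em v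

   el-inj : {x y : W} → el x ≡ el y → x ≡ y
   el-inj {⟪ x , _ ⟫} {⟪ .x , _ ⟫} refl = refl

   infix 4 _ε_
   opaque
     _ε_ : W → W → Set ℓ
     x ε y = el x ∈ el y

     ε→∈ : {x y : W} → x ε y → el x ∈ el y
     ε→∈ h = h

     ∈→ε : {x y : W} → el x ∈ el y → x ε y
     ∈→ε h = h

   lower : {x : 𝕌} {a : W} → x ∈ el a → Σ W λ y → (el y ≡ x) × (y ε a)
   lower {x} {a} h = ⟪ x , transitive x (el a) h (isV a) ⟫ , refl , ∈→ε h

   Env : ℕ → Set ℓ
   Env n = Vector W n

   data Tm (n : ℕ) : Set ℓ where
     var : Fin n → Tm n
     con : W → Tm n

   data Fm (n : ℕ) : Set ℓ where
     mem eqn : Tm n → Tm n → Fm n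
     neg     : Fm n → Fm n
     conj    : Fm n → Fm n → Fm n
     all     : Fm (suc n) → Fm n

   ⟦_⟧ : Tm n → Env n → W
   ⟦ var i ⟧ ρ = ρ i
   ⟦ con c ⟧ ρ = c

   _⊨_ : Env n → Fm n → Set ℓ
   ρ ⊨ mem s t  = ⟦ s ⟧ ρ ε ⟦ t ⟧ ρ
   ρ ⊨ eqn s t  = ⟦ s ⟧ ρ ≡ ⟦ t ⟧ ρ
   ρ ⊨ neg φ    = ¬ (ρ ⊨ φ)
   ρ ⊨ conj φ ψ = (ρ ⊨ φ) × (ρ ⊨ ψ)
   ρ ⊨ all φ    = ∀ x → (x ∷ ρ) ⊨ φ

   renT : (Fin n → Fin m) → Tm n → Tm m
   renT f (var i) = var (f i)
   renT f (con c) = con c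

   liftR : (Fin n → Fin m) → Fin (suc n) → Fin (suc m)
   liftR f zero    = zero
   liftR f (suc i) = suc (f i)

   ren : (Fin n → Fin m) → Fm n → Fm m
   ren f (mem s t)  = mem (renT f s) (renT f t)
   ren f (eqn s t)  = eqn (renT f s) (renT f t)
   ren f (neg φ)    = neg (ren f φ)
   ren f (conj φ ψ) = conj (ren f φ) (ren f ψ)
   ren f (all φ)    = all (ren (liftR f) φ)

   renT-sem : (f : Fin n → Fin m) (ρ : Env m) (σ : Env n) → (∀ i → σ i ≡ ρ (f i)) →
              (t : Tm n) → ⟦ t ⟧ σ ≡ ⟦ renT f t ⟧ ρ
   renT-sem f ρ σ h (var i) = h i
   renT-sem f ρ σ h (con c) = refl

   ren-sem : (f : Fin n → Fin m) (ρ : Env m) (σ : Env n) → (∀ i → σ i ≡ ρ (f i)) →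
             (φ : Fm n) → (σ ⊨ φ) ⟺ (ρ ⊨ ren f φ)
   ren-sem f ρ σ h (mem s t)
     rewrite renT-sem f ρ σ h s | renT-sem f ρ σ h t = (λ a → a) , (λ a → a)
   ren-sem f ρ σ h (eqn s t)
     rewrite renT-sem f ρ σ h s | renT-sem f ρ σ h t = (λ a → a) , (λ a → a)
   ren-sem f ρ σ h (neg φ) =
     (λ k a → k (proj₂ (ren-sem f ρ σ h φ) a)) , (λ k a → k (proj₁ (ren-sem f ρ σ h φ) a))
   ren-sem f ρ σ h (conj φ ψ) =
     (λ (a , b) → proj₁ (ren-sem f ρ σ h φ) a , proj₁ (ren-sem f ρ σ h ψ) b) ,
     (λ (a , b) → proj₂ (ren-sem f ρ σ h φ) a , proj₂ (ren-sem f ρ σ h ψ) b)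
   ren-sem f ρ σ h (all φ) =
     (λ k x → proj₁ (ren-sem (liftR f) (x ∷ ρ) (x ∷ σ) (h′ x) φ) (k x)) ,
     (λ k x → proj₂ (ren-sem (liftR f) (x ∷ ρ) (x ∷ σ) (h′ x) φ) (k x))
     where
     h′ : ∀ x i → (x ∷ σ) i ≡ (x ∷ ρ) (liftR f i)
     h′ x zero    = refl
     h′ x (suc i) = h i

   -- P is definable in V with parameters; proofs are irrelevant, so that it
   -- does not matter which derivation instance search finds.
   record Def {n} (P : Env n → Set ℓ) : Set ℓ where
     constructor mkDef
     field .formula : Σ (Fm n) λ φ → ∀ ρ → P ρ ⟺ (ρ ⊨ φ)

   fm : {P : Env n → Set ℓ} → .(Def P) → Σ (Fm n) λ φ → ∀ ρ → P ρ ⟺ (ρ ⊨ φ)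
   fm d = open-up (recompute em d)
     where
     open-up : ∀ {P} → Def P → _
     open-up (mkDef p) = recompute em p

   record DefT {n} (t : Env n → W) : Set ℓ where
     constructor mkDefT
     field graph : Def {suc n} λ ρ → head ρ ≡ t (tail ρ)

   Def-≈ : {P Q : Env n → Set ℓ} → (∀ ρ → P ρ ⟺ Q ρ) → (Def Q) → Def P
   Def-≈ e d = mkDef (let (φ , h) = fm d in φ , λ ρ → ⟺-trans (e ρ) (h ρ))

   Def-ren : {P : Env n → Set ℓ} (f : Fin n → Fin m) → (Def P) → Def {m} λ ρ → P (λ i → ρ (f i))
   Def-ren f d = mkDef (let (φ , h) = fm d in
     ren f φ , λ ρ → ⟺-trans (h _) (ren-sem f ρ _ (λ _ → refl) φ))

   exF : Fm (suc n) → Fm n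
   exF φ = neg (all (neg φ))

   opaque
    instance
     dAnd : {P Q : Env n → Set ℓ} → ⦃ Def P ⦄ → ⦃ Def Q ⦄ → Def λ ρ → P ρ × Q ρ
     dAnd ⦃ d ⦄ ⦃ e ⦄ = mkDef (let (φ , h) = fm d ; (ψ , k) = fm e in conj φ ψ , λ ρ →
       (λ (a , b) → proj₁ (h ρ) a , proj₁ (k ρ) b) , (λ (a , b) → proj₂ (h ρ) a , proj₂ (k ρ) b))

     dNot : {P : Env n → Set ℓ} → ⦃ Def P ⦄ → Def λ ρ → ¬ P ρ
     dNot ⦃ d ⦄ = mkDef (let (φ , h) = fm d in neg φ , λ ρ →
       (λ k a → k (proj₂ (h ρ) a)) , (λ k a → k (proj₁ (h ρ) a)))

     dImp : {P Q : Env n → Set ℓ} → ⦃ Def P ⦄ → ⦃ Def Q ⦄ → Def λ ρ → P ρ → Q ρ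
     dImp ⦃ d ⦄ ⦃ e ⦄ = mkDef (let (φ , h) = fm d ; (ψ , k) = fm e in neg (conj φ (neg ψ)) , λ ρ →
       (λ f (a , b) → b (proj₁ (k ρ) (f (proj₂ (h ρ) a)))) ,
       (λ f a → dne λ nb → f (proj₁ (h ρ) a , λ b → nb (proj₂ (k ρ) b))))

     dOr : {P Q : Env n → Set ℓ} → ⦃ Def P ⦄ → ⦃ Def Q ⦄ → Def λ ρ → P ρ ⊎ Q ρ
     dOr ⦃ d ⦄ ⦃ e ⦄ = mkDef (let (φ , h) = fm d ; (ψ , k) = fm e in neg (conj (neg φ) (neg ψ)) , λ ρ →
       (λ { (inj₁ a) (x , y) → x (proj₁ (h ρ) a) ; (inj₂ b) (x , y) → y (proj₁ (k ρ) b) }) ,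
       (λ f → dne λ g → f ((λ a → g (inj₁ (proj₂ (h ρ) a))) , (λ b → g (inj₂ (proj₂ (k ρ) b))))))

     dAll : {P : Env n → W → Set ℓ} → ⦃ Def λ ρ → P (tail ρ) (head ρ) ⦄ → Def λ ρ → ∀ x → P ρ x
     dAll ⦃ d ⦄ = mkDef (let (φ , h) = fm d in all φ , λ ρ →
       (λ f x → proj₁ (h (x ∷ ρ)) (f x)) , (λ f x → proj₂ (h (x ∷ ρ)) (f x)))

     dEx : {P : Env n → W → Set ℓ} → ⦃ Def λ ρ → P (tail ρ) (head ρ) ⦄ → Def λ ρ → Σ W λ x → P ρ x
     dEx ⦃ d ⦄ = mkDef (let (φ , h) = fm d in exF φ , λ ρ →
       (λ (x , p) k → k x (proj₁ (h (x ∷ ρ)) p)) ,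
       (λ f → dne λ g → f λ x p → g (x , proj₂ (h (x ∷ ρ)) p)))

     tVar : {i : Fin n} → DefT λ ρ → ρ i
     tVar {i = i} = mkDefT (mkDef (eqn (var zero) (var (suc i)) , λ ρ → (λ e → e) , (λ e → e)))

     tCon : {c : W} → DefT {n} λ _ → c
     tCon {c = c} = mkDefT (mkDef (eqn (var zero) (con c) , λ ρ → (λ e → e) , (λ e → e)))

   var₀ : DefT {suc n} λ ρ → ρ zero
   var₀ = tVar {i = zero}

   var₁ : DefT {suc (suc n)} λ ρ → ρ (suc zero)
   var₁ = tVar {i = suc zero}

   var₂ : DefT {suc (suc (suc n))} λ ρ → ρ (suc (suc zero))
   var₂ = tVar {i = suc (suc zero)}

   private
     graphOf : {t : Env n → W} → (DefT t) → Def {suc n} λ ρ → head ρ ≡ t (tail ρ)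
     graphOf d = mkDef (fm (DefT.graph d))

     skip : Fin (suc n) → Fin (suc (suc n))
     skip zero    = zero
     skip (suc i) = suc (suc i)

   tWeak : {t : Env n → W} → (DefT t) → DefT {suc n} λ ρ → t (tail ρ)
   tWeak d = mkDefT (Def-ren skip (graphOf d))

   DefT-≈ : {s t : Env n → W} → (∀ ρ → s ρ ≡ t ρ) → DefT t → DefT s
   DefT-≈ e d = mkDefT (Def-≈ (λ ρ → (λ h → trans h (e (tail ρ))) , (λ h → trans h (sym (e (tail ρ))))) (graphOf d))

   tRen : {t : Env n → W} (f : Fin n → Fin m) → (DefT t) → DefT {m} λ ρ → t (λ i → ρ (f i))
   tRen f d = mkDefT (Def-ren (liftR f) (graphOf d))

   Def₁ : (P : W → Set ℓ) → (Def {1} λ ρ → P (ρ zero)) →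
          {t : Env n → W} → (DefT t) → Def λ ρ → P (t ρ)
   Def₁ P d {t} e = Def-≈ {Q = λ ρ → Σ W λ y → (y ≡ t ρ) × P y}
     (λ ρ → (λ p → _ , refl , p) , (λ { (_ , refl , p) → p }))
     (dEx ⦃ dAnd ⦃ graphOf e ⦄ ⦃ Def-ren {P = λ ρ → P (ρ zero)} (λ _ → zero) d ⦄ ⦄)

   Def₂ : (P : W → W → Set ℓ) → (Def {2} λ ρ → P (ρ zero) (ρ (suc zero))) →
          {s t : Env n → W} → (DefT s) → (DefT t) → Def λ ρ → P (s ρ) (t ρ)
   Def₂ P d {s} {t} e f = Def-≈ {Q = λ ρ → Σ W λ y → (y ≡ t ρ) × P (s ρ) y}
     (λ ρ → (λ p → _ , refl , p) , (λ { (_ , refl , p) → p }))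
     (dEx ⦃ dAnd ⦃ graphOf f ⦄ ⦃ Def-≈ {Q = λ ρ → Σ W λ z → (z ≡ s (tail ρ)) × P z (head ρ)}
        (λ ρ → (λ p → _ , refl , p) , (λ { (_ , refl , p) → p }))
        (dEx ⦃ dAnd ⦃ graphOf (tWeak e) ⦄ ⦃ Def-ren {P = λ ρ → P (ρ zero) (ρ (suc zero))} (zero ∷ suc zero ∷ []) d ⦄ ⦄) ⦄ ⦄)

   Def₃ : (P : W → W → W → Set ℓ) → (Def {3} λ ρ → P (ρ zero) (ρ (suc zero)) (ρ (suc (suc zero)))) →
          {s t u : Env n → W} → (DefT s) → (DefT t) → (DefT u) → Def λ ρ → P (s ρ) (t ρ) (u ρ)
   Def₃ P d {s} {t} {u} e f g = Def-≈ {Q = λ ρ → Σ W λ y → (y ≡ u ρ) × P (s ρ) (t ρ) y}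
     (λ ρ → (λ p → _ , refl , p) , (λ { (_ , refl , p) → p }))
     (dEx ⦃ dAnd ⦃ graphOf g ⦄ ⦃ Def-≈ {Q = λ ρ → Σ W λ z → (z ≡ t (tail ρ)) × P (s (tail ρ)) z (head ρ)}
        (λ ρ → (λ p → _ , refl , p) , (λ { (_ , refl , p) → p }))
        (dEx ⦃ dAnd ⦃ graphOf (tWeak f) ⦄ ⦃ Def-≈ {Q = λ ρ → Σ W λ z → (z ≡ s (tail (tail ρ))) × P z (head ρ) (head (tail ρ))}
           (λ ρ → (λ p → _ , refl , p) , (λ { (_ , refl , p) → p }))
           (dEx ⦃ dAnd ⦃ graphOf (tWeak (tWeak e)) ⦄
              ⦃ Def-ren {P = λ ρ → P (ρ zero) (ρ (suc zero)) (ρ (suc (suc zero)))} (zero ∷ suc zero ∷ suc (suc zero) ∷ []) d ⦄ ⦄) ⦄ ⦄) ⦄ ⦄)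

   DefT₁ : (f : W → W) → (Def {2} λ ρ → ρ zero ≡ f (ρ (suc zero))) →
           {t : Env n → W} → (DefT t) → DefT λ ρ → f (t ρ)
   DefT₁ f d e = mkDefT (Def₂ (λ y x → y ≡ f x) d var₀ (tWeak e))

   DefT₂ : (f : W → W → W) → (Def {3} λ ρ → ρ zero ≡ f (ρ (suc zero)) (ρ (suc (suc zero)))) →
           {s t : Env n → W} → (DefT s) → (DefT t) → DefT λ ρ → f (s ρ) (t ρ)
   DefT₂ f d e g = mkDefT (Def₃ (λ y x z → y ≡ f x z) d var₀ (tWeak e) (tWeak g))

   opaque
    instance
     dMem : {s t : Env n → W} → ⦃ DefT s ⦄ → ⦃ DefT t ⦄ → Def λ ρ → s ρ ε t ρ
     dMem ⦃ d ⦄ ⦃ e ⦄ = Def₂ _ε_ (mkDef (mem (var zero) (var (suc zero)) , λ ρ → (λ e → e) , (λ e → e))) d e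

     dEqn : {s t : Env n → W} → ⦃ DefT s ⦄ → ⦃ DefT t ⦄ → Def λ ρ → s ρ ≡ t ρ
     dEqn ⦃ d ⦄ ⦃ e ⦄ = Def₂ _≡_ (mkDef (eqn (var zero) (var (suc zero)) , λ ρ → (λ e → e) , (λ e → e))) d e

   -- A formula with constants is a formula of {∈, =} with its constants as
   -- additional free variables.
   private
     countT : Tm n → ℕ
     countT (var _) = 0
     countT (con _) = 1

     count : Fm n → ℕ
     count (mem s t)  = countT s +ℕ countT t
     count (eqn s t)  = countT s +ℕ countT t
     count (neg φ)    = count φ
     count (conj φ ψ) = count φ +ℕ count ψ
     count (all φ)    = count φ

     constsT : (t : Tm n) → Env (countT t)
     constsT (var _) ()
     constsT (con c) _ = c

     consts : (φ : Fm n) → Env (count φ)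
     consts (mem s t)  = constsT s ++ constsT t
     consts (eqn s t)  = constsT s ++ constsT t
     consts (neg φ)    = consts φ
     consts (conj φ ψ) = consts φ ++ consts ψ
     consts (all φ)    = consts φ

     trT : ∀ {k} (t : Tm n) → (Fin (countT t) → Fin k) → Fin (n +ℕ k)
     trT {k = k} (var i) f = i ↑ˡ k
     trT {n}     (con c) f = n ↑ʳ f zero

     tr : ∀ {k} (φ : Fm n) → (Fin (count φ) → Fin k) → Formula (n +ℕ k)
     tr (mem s t)  f = trT s (λ i → f (i ↑ˡ _)) ∈̇ trT t (λ i → f (countT s ↑ʳ i))
     tr (eqn s t)  f = trT s (λ i → f (i ↑ˡ _)) ≐ trT t (λ i → f (countT s ↑ʳ i))
     tr (neg φ)    f = ¬̇ tr φ f
     tr (conj φ ψ) f = tr φ (λ i → f (i ↑ˡ _)) ∧̇ tr ψ (λ i → f (count φ ↑ʳ i))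
     tr (all φ)    f = ∀̇ tr φ f

     record Fits {k} (ρ : Env n) (Γ : Env k) (σ : Vector 𝕌 (n +ℕ k)) : Set ℓ where
       field
         left  : ∀ i → el (ρ i) ≡ σ (i ↑ˡ k)
         right : ∀ j → el (Γ j) ≡ σ (n ↑ʳ j)
     open Fits

     trT-sem : ∀ {k} {ρ : Env n} {Γ : Env k} {σ} → Fits ρ Γ σ → (t : Tm n) (f : Fin (countT t) → Fin k) →
               (∀ i → Γ (f i) ≡ constsT t i) → el (⟦ t ⟧ ρ) ≡ σ (trT t f)
     trT-sem F (var i) f h = F .left i
     trT-sem F (con c) f h = trans (cong el (sym (h zero))) (F .right (f zero))

     splitˡ : ∀ {k a b} (Γ : Env k) (f : Fin (a +ℕ b) → Fin k) (u : Env a) (v : Env b) →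
              (∀ i → Γ (f i) ≡ (u ++ v) i) → ∀ i → Γ (f (i ↑ˡ b)) ≡ u i
     splitˡ Γ f u v h i = trans (h _) (lookup-++ˡ u v i)

     splitʳ : ∀ {k a b} (Γ : Env k) (f : Fin (a +ℕ b) → Fin k) (u : Env a) (v : Env b) →
              (∀ i → Γ (f i) ≡ (u ++ v) i) → ∀ i → Γ (f (a ↑ʳ i)) ≡ v i
     splitʳ Γ f u v h i = trans (h _) (lookup-++ʳ u v i)

     tr-sem : ∀ {k} {ρ : Env n} {Γ : Env k} {σ} → Fits ρ Γ σ → (φ : Fm n) (f : Fin (count φ) → Fin k) →
              (∀ i → Γ (f i) ≡ consts φ i) → (ρ ⊨ φ) ⟺ R.Sat (tr φ f) σ
     tr-sem {Γ = Γ} F (mem s t) f h =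
       (λ a → subst₂ _∈_ (trT-sem F s _ (splitˡ Γ f (constsT s) (constsT t) h)) (trT-sem F t _ (splitʳ Γ f (constsT s) (constsT t) h)) (ε→∈ a)) ,
       (λ a → ∈→ε (subst₂ _∈_ (sym (trT-sem F s _ (splitˡ Γ f (constsT s) (constsT t) h))) (sym (trT-sem F t _ (splitʳ Γ f (constsT s) (constsT t) h))) a))
     tr-sem {Γ = Γ} F (eqn s t) f h =
       (λ a → trans (sym (trT-sem F s _ (splitˡ Γ f (constsT s) (constsT t) h))) (trans (cong el a) (trT-sem F t _ (splitʳ Γ f (constsT s) (constsT t) h)))) ,
       (λ a → el-inj (trans (trT-sem F s _ (splitˡ Γ f (constsT s) (constsT t) h)) (trans a (sym (trT-sem F t _ (splitʳ Γ f (constsT s) (constsT t) h))))))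
     tr-sem F (neg φ) f h = (λ k a → k (proj₂ (tr-sem F φ f h) a)) , (λ k a → k (proj₁ (tr-sem F φ f h) a))
     tr-sem {Γ = Γ} F (conj φ ψ) f h =
       (λ (a , b) → proj₁ (tr-sem F φ _ (splitˡ Γ f (consts φ) (consts ψ) h)) a , proj₁ (tr-sem F ψ _ (splitʳ Γ f (consts φ) (consts ψ) h)) b) ,
       (λ (a , b) → proj₂ (tr-sem F φ _ (splitˡ Γ f (consts φ) (consts ψ) h)) a , proj₂ (tr-sem F ψ _ (splitʳ Γ f (consts φ) (consts ψ) h)) b)
     tr-sem {ρ = ρ} {Γ} {σ} F (all φ) f h =
       (λ k x vx → proj₁ (tr-sem (F′ ⟪ x , vx ⟫) φ f h) (k _)) , (λ k x → proj₂ (tr-sem (F′ x) φ f h) (k (el x) (isV x)))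
       where
       F′ : ∀ x → Fits (x ∷ ρ) Γ (el x ∷ σ)
       F′ x .left zero    = refl
       F′ x .left (suc i) = F .left i
       F′ x .right j      = F .right j

   separation : (P : W → Set ℓ) → ⦃ Def {1} λ ρ → P (ρ zero) ⦄ → (a : W) →
                Σ W λ b → ∀ x → x ε b ⟺ (x ε a × P x)
   separation P ⦃ d ⦄ a =
     let (φ , s) = fm d
         Γ = consts φ
         (b , vb , h) = R.ZFC.separation zfc (tr φ (λ i → i)) (λ j → el (Γ j)) (λ j → isV (Γ j)) (el a) (isV a)
         e : ∀ x → P x ⟺ R.Sat (tr φ (λ i → i)) (el x ∷ λ j → el (Γ j))
         e x = ⟺-trans (s (x ∷ [])) (tr-sem (F x) φ (λ i → i) λ _ → refl)
     in ⟪ b , vb ⟫ , λ x →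
       (λ x∈b → let (p , q) = Equivalence.to (h (el x) (isV x)) (ε→∈ x∈b) in ∈→ε p , proj₂ (e x) q) ,
       (λ (p , q) → ∈→ε (Equivalence.from (h (el x) (isV x)) (ε→∈ p , proj₁ (e x) q)))
     where
     F : ∀ {k} x {Γ : Env k} → Fits (x ∷ []) Γ (el x ∷ λ j → el (Γ j))
     F x .left zero = refl
     F x .right j   = refl

   replacement : (F : W → W) → ⦃ Def {2} λ ρ → ρ (suc zero) ≡ F (ρ zero) ⦄ → (a : W) →
                 Σ W λ b → ∀ y → y ε b ⟺ (Σ W λ x → x ε a × y ≡ F x)
   replacement F ⦃ d ⦄ a =
     let (φ , s) = fm d
         Γ = consts φ
         e : ∀ x y → (y ≡ F x) ⟺ R.Sat (tr φ (λ i → i)) (el x ∷ el y ∷ λ j → el (Γ j))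
         e x y = ⟺-trans (s (x ∷ y ∷ [])) (tr-sem (G x y) φ (λ i → i) λ _ → refl)
         (b , vb , h) = R.ZFC.replacement zfc (tr φ (λ i → i)) (λ j → el (Γ j)) (λ j → isV (Γ j)) (el a) (isV a)
           (λ x vx x∈a → el (F ⟪ x , vx ⟫) , isV (F ⟪ x , vx ⟫) , proj₁ (e _ _) refl ,
              λ y vy p → cong el (proj₂ (e ⟪ x , vx ⟫ ⟪ y , vy ⟫) p))
     in ⟪ b , vb ⟫ , λ y →
       (λ y∈b → let (x , vx , p , q) = Equivalence.to (h (el y) (isV y)) (ε→∈ y∈b) in
                ⟪ x , vx ⟫ , ∈→ε p , proj₂ (e ⟪ x , vx ⟫ y) q) ,
       (λ (x , p , q) → ∈→ε (Equivalence.from (h (el y) (isV y)) (el x , isV x , ε→∈ p , proj₁ (e x y) q)))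
     where
     G : ∀ {k} x y {Γ : Env k} → Fits (x ∷ y ∷ []) Γ (el x ∷ el y ∷ λ j → el (Γ j))
     G x y .left zero       = refl
     G x y .left (suc zero) = refl
     G x y .right j         = refl

 open Core

 module Sets where

   private variable
     a b c f g p x y z x′ y′ : W

   infix 4 _⊆_ _∉_
   infixl 6 _∪_ _∖_
   infixl 7 _∩_

   _⊆_ _∉_ : W → W → Set ℓ
   a ⊆ b = ∀ x → x ε a → x ε b
   x ∉ a = ¬ (x ε a)

   ext : (∀ x → x ε a ⟺ x ε b) → a ≡ b
   ext {a} {b} h = el-inj (R.ZFC.extensionality zfc (el a) (isV a) (el b) (isV b) λ x vx →
     mk⇔ (λ i → ε→∈ (proj₁ (h ⟪ x , vx ⟫) (∈→ε i))) (λ i → ε→∈ (proj₂ (h ⟪ x , vx ⟫) (∈→ε i))))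

   ⊆-antisym : a ⊆ b → b ⊆ a → a ≡ b
   ⊆-antisym h k = ext λ x → h x , k x

   ext-char : {P : W → Set ℓ} → (∀ x → x ε a ⟺ P x) → (b ≡ a) ⟺ (∀ x → x ε b ⟺ P x)
   ext-char h = (λ { refl → h }) , (λ k → ext λ x → ⟺-trans (k x) (⟺-sym (h x)))

   dSet₁ : ∀ {n} (f : W → W) {P : W → W → Set ℓ} → (∀ a x → x ε f a ⟺ P x a) →
           ⦃ Def {2} λ ρ → P (ρ zero) (ρ (suc zero)) ⦄ →
           {s : Env n → W} → ⦃ DefT s ⦄ → DefT λ ρ → f (s ρ)
   dSet₁ f {P} h ⦃ d ⦄ ⦃ e ⦄ = DefT₁ f
     (Def-≈ {Q = λ ρ → ∀ x → x ε ρ zero ⟺ P x (ρ (suc zero))} (λ ρ → ext-char (h (ρ (suc zero))))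
       (dAll ⦃ dAnd ⦃ dImp ⦃ dMem ⦄ ⦃ d′ ⦄ ⦄ ⦃ dImp ⦃ d′ ⦄ ⦃ dMem ⦄ ⦄ ⦄)) e
     where
     d′ = Def₂ P d var₀ var₂

   dSet₂ : ∀ {n} (f : W → W → W) {P : W → W → W → Set ℓ} → (∀ a b x → x ε f a b ⟺ P x a b) →
           ⦃ Def {3} λ ρ → P (ρ zero) (ρ (suc zero)) (ρ (suc (suc zero))) ⦄ →
           {s t : Env n → W} → ⦃ DefT s ⦄ → ⦃ DefT t ⦄ → DefT λ ρ → f (s ρ) (t ρ)
   dSet₂ f {P} h ⦃ d ⦄ ⦃ e ⦄ ⦃ e′ ⦄ = DefT₂ f
     (Def-≈ {Q = λ ρ → ∀ x → x ε ρ zero ⟺ P x (ρ (suc zero)) (ρ (suc (suc zero)))}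
       (λ ρ → ext-char (h (ρ (suc zero)) (ρ (suc (suc zero)))))
       (dAll ⦃ dAnd ⦃ dImp ⦃ dMem ⦄ ⦃ d′ ⦄ ⦄ ⦃ dImp ⦃ d′ ⦄ ⦃ dMem ⦄ ⦄ ⦄)) e e′
     where
     d′ = Def₃ P d var₀ var₂ (tVar {i = suc (suc (suc zero))})

   opaque
     sep : (P : W → Set ℓ) → ⦃ Def {1} λ ρ → P (ρ zero) ⦄ → W → W
     sep P a = proj₁ (separation P a)

     sep-spec : (P : W → Set ℓ) ⦃ d : Def {1} λ ρ → P (ρ zero) ⦄ (a x : W) → x ε sep P a ⟺ (x ε a × P x)
     sep-spec P a = proj₂ (separation P a)

     img : (F : W → W) → ⦃ DefT {1} λ ρ → F (ρ zero) ⦄ → W → W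
     img F ⦃ d ⦄ a = proj₁ (replacement F ⦃ dEqn ⦃ var₁ ⦄ ⦃ tRen (λ _ → zero) d ⦄ ⦄ a)

     img-spec : (F : W → W) ⦃ d : DefT {1} λ ρ → F (ρ zero) ⦄ (a y : W) →
                y ε img F a ⟺ (Σ W λ x → x ε a × y ≡ F x)
     img-spec F ⦃ d ⦄ a = proj₂ (replacement F ⦃ dEqn ⦃ var₁ ⦄ ⦃ tRen (λ _ → zero) d ⦄ ⦄ a)

     ω₀ : W
     ω₀ = let (w , v , _) = R.ZFC.infinity zfc in ⟪ w , v ⟫

     ω₀-inductive : R.Inductive (el ω₀)
     ω₀-inductive = proj₂ (proj₂ (R.ZFC.infinity zfc))

     upair : W → W → W
     upair x y = let (z , v , _) = R.ZFC.pairing zfc (el x) (isV x) (el y) (isV y) in ⟪ z , v ⟫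

     upair-spec : ∀ x y z → z ε upair x y ⟺ (z ≡ x ⊎ z ≡ y)
     upair-spec x y z = let (_ , _ , h) = R.ZFC.pairing zfc (el x) (isV x) (el y) (isV y) in
       (λ i → ⊎-map el-inj el-inj (Equivalence.to (h (el z) (isV z)) (ε→∈ i))) ,
       (λ i → ∈→ε (Equivalence.from (h (el z) (isV z)) (⊎-map (cong el) (cong el) i)))

     ⋃ : W → W
     ⋃ a = let (z , v , _) = R.ZFC.union zfc (el a) (isV a) in ⟪ z , v ⟫

     ⋃-spec : ∀ a x → x ε ⋃ a ⟺ (Σ W λ y → y ε a × x ε y)
     ⋃-spec a x = let (_ , _ , h) = R.ZFC.union zfc (el a) (isV a) in
       (λ i → let (y , vy , p , q) = Equivalence.to (h (el x) (isV x)) (ε→∈ i) in ⟪ y , vy ⟫ , ∈→ε p , ∈→ε q) ,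
       (λ (y , p , q) → ∈→ε (Equivalence.from (h (el x) (isV x)) (el y , isV y , ε→∈ p , ε→∈ q)))

     𝒫 : W → W
     𝒫 a = let (z , v , _) = R.ZFC.powerset zfc (el a) (isV a) in ⟪ z , v ⟫

     𝒫-spec : ∀ a x → x ε 𝒫 a ⟺ x ⊆ a
     𝒫-spec a x = let (_ , _ , h) = R.ZFC.powerset zfc (el a) (isV a) in
       (λ i y p → ∈→ε (Equivalence.to (h (el x) (isV x)) (ε→∈ i) (el y) (isV y) (ε→∈ p))) ,
       (λ i → ∈→ε (Equivalence.from (h (el x) (isV x)) λ y vy p → ε→∈ (i ⟪ y , vy ⟫ (∈→ε p))))

   upair⁻ : z ε upair x y → z ≡ x ⊎ z ≡ y
   upair⁻ = proj₁ (upair-spec _ _ _)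

   upair⁺ : z ≡ x ⊎ z ≡ y → z ε upair x y
   upair⁺ = proj₂ (upair-spec _ _ _)

   ⋃⁻ : x ε ⋃ a → Σ W λ y → y ε a × x ε y
   ⋃⁻ = proj₁ (⋃-spec _ _)

   ⋃⁺ : (Σ W λ y → y ε a × x ε y) → x ε ⋃ a
   ⋃⁺ = proj₂ (⋃-spec _ _)

   foundation : Σ W (λ x → x ε a) → Σ W λ x → x ε a × ∀ y → y ε x → y ∉ a
   foundation {a} (x , i) =
     let (m , vm , j , k) = R.ZFC.foundation zfc (el a) (isV a) (el x , isV x , ε→∈ i) in
     ⟪ m , vm ⟫ , ∈→ε j , λ y p q → k (el y) (isV y) (ε→∈ p) (ε→∈ q)

   opaque
    instance
     dUpair : ∀ {n} {s t : Env n → W} → ⦃ DefT s ⦄ → ⦃ DefT t ⦄ → DefT λ ρ → upair (s ρ) (t ρ)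
     dUpair = dSet₂ upair upair-spec

   opaque
     ∅ : W
     ∅ = sep (_∉ ω₀) ω₀

     ∉∅ : x ∉ ∅
     ∉∅ h = let (p , q) = proj₁ (sep-spec (_∉ ω₀) ω₀ _) h in q p

     ｛_｝ : W → W
     ｛ x ｝ = upair x x

     ｛｝-spec : ∀ x y → y ε ｛ x ｝ ⟺ (y ≡ x)
     ｛｝-spec x y = (λ i → reduce (upair⁻ i)) ,
       (λ e → upair⁺ (inj₁ e))

     _∪_ : W → W → W
     a ∪ b = ⋃ (upair a b)

     ∪-spec : ∀ a b x → x ε a ∪ b ⟺ (x ε a ⊎ x ε b)
     ∪-spec a b x =
       (λ i → case (⋃⁻ i)) ,
       (λ { (inj₁ i) → ⋃⁺ (a , upair⁺ (inj₁ refl) , i)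
          ; (inj₂ i) → ⋃⁺ (b , upair⁺ (inj₂ refl) , i) })
       where
       case : Σ W (λ y → y ε upair a b × x ε y) → x ε a ⊎ x ε b
       case (y , p , q) with upair⁻ p
       ... | inj₁ refl = inj₁ q
       ... | inj₂ refl = inj₂ q

     _∩_ _∖_ : W → W → W
     a ∩ b = sep (_ε b) a
     a ∖ b = sep (_∉ b) a

     ∩-spec : ∀ a b x → x ε a ∩ b ⟺ (x ε a × x ε b)
     ∩-spec a b x = sep-spec (_ε b) a x

     ∖-spec : ∀ a b x → x ε a ∖ b ⟺ (x ε a × x ∉ b)
     ∖-spec a b x = sep-spec (_∉ b) a x

   ∅-elim : {P : Set ℓ} → x ε ∅ → P
   ∅-elim i = ⊥-elim (∉∅ i)

   ∪⁻ : x ε a ∪ b → x ε a ⊎ x ε b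
   ∪⁻ = proj₁ (∪-spec _ _ _)

   ∪⁺ : x ε a ⊎ x ε b → x ε a ∪ b
   ∪⁺ = proj₂ (∪-spec _ _ _)

   ∩⁻ : x ε a ∩ b → x ε a × x ε b
   ∩⁻ = proj₁ (∩-spec _ _ _)

   ∩⁺ : x ε a × x ε b → x ε a ∩ b
   ∩⁺ = proj₂ (∩-spec _ _ _)

   ∖⁻ : x ε a ∖ b → x ε a × x ∉ b
   ∖⁻ = proj₁ (∖-spec _ _ _)

   ∖⁺ : x ε a × x ∉ b → x ε a ∖ b
   ∖⁺ = proj₂ (∖-spec _ _ _)

   ∩-comm : a ∩ b ≡ b ∩ a
   ∩-comm = ext λ x → (λ i → let (j , k) = ∩⁻ i in ∩⁺ (k , j)) , (λ i → let (j , k) = ∩⁻ i in ∩⁺ (k , j))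

   ∩-distribʳ-∪ : (a ∪ b) ∩ c ≡ (a ∩ c) ∪ (b ∩ c)
   ∩-distribʳ-∪ = ext λ x →
     (λ i → let (j , k) = ∩⁻ i in ∪⁺ (⊎-map (λ l → ∩⁺ (l , k)) (λ l → ∩⁺ (l , k)) (∪⁻ j))) ,
     (λ i → ⊎-elim (λ j → let (k , l) = ∩⁻ j in ∩⁺ (∪⁺ (inj₁ k) , l)) (λ j → let (k , l) = ∩⁻ j in ∩⁺ (∪⁺ (inj₂ k) , l)) (∪⁻ i))

   opaque
    instance
     d｛｝ : ∀ {n} {s : Env n → W} → ⦃ DefT s ⦄ → DefT λ ρ → ｛ s ρ ｝
     d｛｝ = dSet₁ ｛_｝ ｛｝-spec

     d∪ : ∀ {n} {s t : Env n → W} → ⦃ DefT s ⦄ → ⦃ DefT t ⦄ → DefT λ ρ → s ρ ∪ t ρ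
     d∪ = dSet₂ _∪_ ∪-spec

     d∩ : ∀ {n} {s t : Env n → W} → ⦃ DefT s ⦄ → ⦃ DefT t ⦄ → DefT λ ρ → s ρ ∩ t ρ
     d∩ = dSet₂ _∩_ ∩-spec

     d∖ : ∀ {n} {s t : Env n → W} → ⦃ DefT s ⦄ → ⦃ DefT t ⦄ → DefT λ ρ → s ρ ∖ t ρ
     d∖ = dSet₂ _∖_ ∖-spec

   opaque
     ⟨_,_⟩ : W → W → W
     ⟨ x , y ⟩ = upair (upair x x) (upair x y)

     ⟨⟩-spec : ∀ x y → ⟨ x , y ⟩ ≡ upair (upair x x) (upair x y)
     ⟨⟩-spec x y = refl

     ⟨⟩-inj : ⟨ x , y ⟩ ≡ ⟨ x′ , y′ ⟩ → x ≡ x′ × y ≡ y′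
     ⟨⟩-inj {x} {y} {x′} {y′} e = ex , ey
       where
       in₁ : ∀ {u v} → u ε upair u v
       in₁ = upair⁺ (inj₁ refl)
       in₂ : ∀ {u v} → v ε upair u v
       in₂ = upair⁺ (inj₂ refl)
       sing : ∀ {u v w} → upair u u ≡ upair v w → u ≡ v × u ≡ w
       sing {u} {v} {w} k =
         sym (reduce (upair⁻ (subst (v ε_) (sym k) in₁))) ,
         sym (reduce (upair⁻ (subst (w ε_) (sym k) in₂)))
       ex : x ≡ x′
       ex with upair⁻ (subst (upair x x ε_) e in₁)
       ... | inj₁ k = proj₁ (sing k)
       ... | inj₂ k = proj₁ (sing k)
       ey : y ≡ y′
       ey with upair⁻ (subst (upair x y ε_) e in₂)
            | upair⁻ (subst (upair x′ y′ ε_) (sym e) in₂)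
       ... | inj₁ k | inj₁ l = let (p , q) = sing (sym k) ; (r , s) = sing (sym l) in
                               trans (sym q) (trans (sym ex) s)
       ... | inj₁ k | inj₂ l with upair⁻ (subst (y′ ε_) l in₂)
       ...   | inj₁ m = let (p , q) = sing (sym k) in trans (sym q) (trans (sym ex) (sym m))
       ...   | inj₂ m = sym m
       ey | inj₂ k | _ with upair⁻ (subst (y ε_) k in₂)
       ...   | inj₂ m = m
       ...   | inj₁ m with upair⁻ (subst (y′ ε_) (sym k) in₂)
       ...     | inj₁ r = trans m (trans (sym ex) (sym r))
       ...     | inj₂ r = sym r

   opaque
    instance
     dPair : ∀ {n} {s t : Env n → W} → ⦃ DefT s ⦄ → ⦃ DefT t ⦄ → DefT λ ρ → ⟨ s ρ , t ρ ⟩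
     dPair ⦃ d ⦄ ⦃ e ⦄ = DefT₂ ⟨_,_⟩ (Def-≈ (λ ρ → (λ e → trans e (⟨⟩-spec _ _)) , (λ e → trans e (sym (⟨⟩-spec _ _))))
       (dEqn {s = λ ρ → ρ zero} {t = λ ρ → upair (upair (ρ (suc zero)) (ρ (suc zero))) (upair (ρ (suc zero)) (ρ (suc (suc zero))))})) d e

   opaque
     -- f · x is ∅ (or junk) unless f is a function with x in its domain.
     _·_ : W → W → W
     f · x = ⋃ (sep (λ y → ⟨ x , y ⟩ ε f) (⋃ (⋃ f)))

     ·-spec : ∀ f x z → z ε f · x ⟺ (Σ W λ y → ⟨ x , y ⟩ ε f × z ε y)
     ·-spec f x z =
       (λ i → let (y , p , q) = ⋃⁻ i in y , proj₂ (proj₁ (sep-spec (λ y → ⟨ x , y ⟩ ε f) _ y) p) , q) ,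
       (λ (y , p , q) → ⋃⁺ (y , proj₂ (sep-spec (λ y → ⟨ x , y ⟩ ε f) _ y) (∈⋃⋃ y p , p) , q))
       where
       ∈⋃⋃ : ∀ y → ⟨ x , y ⟩ ε f → y ε ⋃ (⋃ f)
       ∈⋃⋃ y p = ⋃⁺ (upair x y , ⋃⁺ (_ , p ,
         subst (upair x y ε_) (sym (⟨⟩-spec x y)) (upair⁺ (inj₂ refl))) , upair⁺ (inj₂ refl))

   infixl 9 _·_

   opaque
    instance
     d· : ∀ {n} {s t : Env n → W} → ⦃ DefT s ⦄ → ⦃ DefT t ⦄ → DefT λ ρ → s ρ · t ρ
     d· = dSet₂ _·_ ·-spec

   ·-unique : ⟨ x , y ⟩ ε f → (∀ y′ → ⟨ x , y′ ⟩ ε f → y′ ≡ y) → f · x ≡ y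
   ·-unique {x} {y} {f} i u = ext λ z →
     (λ h → let (y′ , p , q) = proj₁ (·-spec f x z) h in subst (z ε_) (u y′ p) q) ,
     (λ h → proj₂ (·-spec f x z) (y , i , h))

   record FunP (f a : W) (B : W → Set ℓ) : Set ℓ where
     field
       pairs : ∀ p → p ε f → Σ W λ x → x ε a × (p ≡ ⟨ x , f · x ⟩)
       total : ∀ x → x ε a → ⟨ x , f · x ⟩ ε f
       value : ∀ x → x ε a → B (f · x)

     graph-dom : ∀ {x y} → ⟨ x , y ⟩ ε f → x ε a × y ≡ f · x
     graph-dom h = let (x′ , i , e) = pairs _ h ; (p , q) = ⟨⟩-inj e in
       subst (_ε a) (sym p) i , trans q (cong (f ·_) (sym p))
   open FunP public

   Fun : W → W → W → Set ℓ
   Fun f a b = FunP f a (_ε b)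

   FunP-map : {B C : W → Set ℓ} → (∀ y → B y → C y) → FunP f a B → FunP f a C
   FunP-map h F .pairs = F .pairs
   FunP-map h F .total = F .total
   FunP-map h F .value x i = h _ (F .value x i)

   fun-ext : {B C : W → Set ℓ} → FunP f a B → FunP g a C → (∀ x → x ε a → f · x ≡ g · x) → f ≡ g
   fun-ext {f} {a} {g} F G h = ⊆-antisym
     (λ p i → let (x , j , e) = F .pairs p i in
       subst (_ε g) (sym (trans e (cong ⟨ x ,_⟩ (h x j)))) (G .total x j))
     (λ p i → let (x , j , e) = G .pairs p i in
       subst (_ε f) (sym (trans e (cong ⟨ x ,_⟩ (sym (h x j))))) (F .total x j))

   opaque
     graph : (F : W → W) → ⦃ DefT {1} λ ρ → F (ρ zero) ⦄ → W → W
     graph F ⦃ d ⦄ a = img (λ x → ⟨ x , F x ⟩) ⦃ dPair ⦃ var₀ ⦄ ⦃ d ⦄ ⦄ a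

     graph-spec : (F : W → W) ⦃ d : DefT {1} λ ρ → F (ρ zero) ⦄ → ∀ a p →
                  p ε graph F a ⟺ (Σ W λ x → x ε a × (p ≡ ⟨ x , F x ⟩))
     graph-spec F ⦃ d ⦄ a p = img-spec (λ x → ⟨ x , F x ⟩) ⦃ dPair ⦃ var₀ ⦄ ⦃ d ⦄ ⦄ a p

   graph-· : (F : W → W) ⦃ d : DefT {1} λ ρ → F (ρ zero) ⦄ → x ε a → graph F a · x ≡ F x
   graph-· {x} {a} F i = ·-unique (proj₂ (graph-spec F a _) (x , i , refl)) λ y′ h →
     let (x′ , _ , e) = proj₁ (graph-spec F a _) h ; (p , q) = ⟨⟩-inj e in trans q (cong F (sym p))

   graph-fun : (F : W → W) ⦃ d : DefT {1} λ ρ → F (ρ zero) ⦄ {B : W → Set ℓ} →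
               (∀ x → x ε a → B (F x)) → FunP (graph F a) a B
   graph-fun {a} F h .pairs p i = let (x , j , e) = proj₁ (graph-spec F a p) i in
     x , j , trans e (cong ⟨ x ,_⟩ (sym (graph-· F j)))
   graph-fun {a} F h .total x i = proj₂ (graph-spec F a _) (x , i , cong ⟨ x ,_⟩ (graph-· F i))
   graph-fun {a} F {B} h .value x i = subst B (sym (graph-· F i)) (h x i)

   opaque
     pair∈ : x ε a → y ε b → ⟨ x , y ⟩ ε 𝒫 (𝒫 (a ∪ b))
     pair∈ {x} {a} {y} {b} i j = proj₂ (𝒫-spec _ _) λ u k → proj₂ (𝒫-spec _ _) λ v l →
       ∪⁺ (⊎-elim
         (λ e → inj₁ (subst (_ε a) (sym (reduce (upair⁻ (subst (v ε_) e l)))) i))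
         (λ e → ⊎-map (λ q → subst (_ε a) (sym q) i) (λ q → subst (_ε b) (sym q) j) (upair⁻ (subst (v ε_) e l)))
         (upair⁻ (subst (u ε_) (⟨⟩-spec x y) k)))

   opaque
     funBound : W → W → W
     funBound a b = 𝒫 (𝒫 (𝒫 (a ∪ b)))

     fun∈ : Fun f a b → f ε funBound a b
     fun∈ {f} {a} {b} F = proj₂ (𝒫-spec _ _) λ p i → let (x , j , e) = F .pairs p i in
       subst (_ε _) (sym e) (pair∈ j (F .value x j))

   Fun-char : Fun f a b ⟺ ((∀ p → p ε f → Σ W λ x → x ε a × (p ≡ ⟨ x , f · x ⟩)) ×
                           (∀ x → x ε a → ⟨ x , f · x ⟩ ε f × f · x ε b))
   Fun-char = (λ F → F .pairs , λ x i → F .total x i , F .value x i) ,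
     (λ (p , t) → record { pairs = p ; total = λ x i → proj₁ (t x i) ; value = λ x i → proj₂ (t x i) })

   private
     dFun₃ : Def {3} λ ρ → Fun (ρ zero) (ρ (suc zero)) (ρ (suc (suc zero)))
     dFun₃ = Def-≈ (λ _ → Fun-char) it

   opaque
    instance
     dFun : ∀ {n} {f a b : Env n → W} → ⦃ DefT f ⦄ → ⦃ DefT a ⦄ → ⦃ DefT b ⦄ →
            Def λ ρ → FunP (f ρ) (a ρ) (λ y → y ε b ρ)
     dFun ⦃ d ⦄ ⦃ e ⦄ ⦃ g ⦄ = Def₃ Fun dFun₃ d e g

   rel-upair : R.IsUPair (el z) (el x) (el y) ⟺ (z ≡ upair x y)
   rel-upair {z} {x} {y} =
     (λ h → ext λ w →
       (λ i → upair⁺ (⊎-map el-inj el-inj (Equivalence.to (h (el w) (isV w)) (ε→∈ i)))) ,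
       (λ i → ∈→ε (Equivalence.from (h (el w) (isV w)) (⊎-map (cong el) (cong el) (upair⁻ i))))) ,
     (λ { refl w vw → mk⇔
       (λ i → ⊎-map (cong el) (cong el) (upair⁻ {z = ⟪ w , vw ⟫} (∈→ε i)))
       (λ i → ε→∈ (upair⁺ {z = ⟪ w , vw ⟫} (⊎-map el-inj el-inj i))) })

   rel-pair : R.IsPair (el p) (el x) (el y) ⟺ (p ≡ ⟨ x , y ⟩)
   rel-pair {p} {x} {y} =
     (λ (s , vs , t , vt , h , k , l) → trans (proj₁ (rel-upair {p} {⟪ s , vs ⟫} {⟪ t , vt ⟫}) l)
        (trans (cong₂ upair (proj₁ (rel-upair {⟪ s , vs ⟫} {x} {x}) h) (proj₁ (rel-upair {⟪ t , vt ⟫} {x} {y}) k)) (sym (⟨⟩-spec x y)))) ,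
     (λ e → el (upair x x) , isV (upair x x) , el (upair x y) , isV (upair x y) , proj₂ (rel-upair {upair x x}) refl , proj₂ (rel-upair {upair x y}) refl ,
            proj₂ (rel-upair {p}) (trans e (⟨⟩-spec x y)))

   rel-↦ : (el f R.∶ el x ↦ el y) ⟺ (⟨ x , y ⟩ ε f)
   rel-↦ {f} {x} {y} = (λ (p , vp , i , h) → subst (_ε f) (proj₁ (rel-pair {p = ⟪ p , vp ⟫} {x} {y}) h) (∈→ε i)) ,
     (λ i → el ⟨ x , y ⟩ , isV ⟨ x , y ⟩ , ε→∈ i , proj₂ (rel-pair {⟨ x , y ⟩}) refl)

   module _ {f a : W} {B : 𝕌 → Set ℓ} where
     fromIsFun : R.IsFun (el f) (el a) B → FunP f a (λ w → B (el w))
     fromIsFun (h , k) = record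
       { pairs = λ p i →
           let (x , vx , j , y , vy , _ , e) = h (el p) (isV p) (ε→∈ i)
               e′ = proj₁ (rel-pair {p = p} {⟪ x , vx ⟫} {⟪ y , vy ⟫}) e
           in ⟪ x , vx ⟫ , ∈→ε j , trans e′ (cong ⟨ ⟪ x , vx ⟫ ,_⟩ (sym (app _ (∈→ε j) _ (subst (_ε f) e′ i))))
       ; total = λ x i → let (y , j) = ex x i in subst (λ z → ⟨ x , z ⟩ ε f) (sym (app x i y j)) j
       ; value = λ x i →
           let (y , j) = ex x i
               (x′ , vx , _ , y′ , vy , b , e) = h (el ⟨ x , y ⟩) (isV ⟨ x , y ⟩) (ε→∈ j)
               (_ , q) = ⟨⟩-inj (proj₁ (rel-pair {p = ⟨ x , y ⟩} {⟪ x′ , vx ⟫} {⟪ y′ , vy ⟫}) e)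
           in subst B (cong el (trans (sym q) (sym (app x i y j)))) b }
       where
       ex : ∀ x → x ε a → Σ W λ y → ⟨ x , y ⟩ ε f
       ex x i = let (y , vy , m , _) = k (el x) (isV x) (ε→∈ i) in ⟪ y , vy ⟫ , proj₁ (rel-↦ {f} {x} {⟪ y , vy ⟫}) m
       app : ∀ x → x ε a → ∀ y → ⟨ x , y ⟩ ε f → f · x ≡ y
       app x i y j = let (_ , _ , _ , u) = k (el x) (isV x) (ε→∈ i)
                         u′ : ∀ y → ⟨ x , y ⟩ ε f → el y ≡ _
                         u′ = λ y j → u (el y) (isV y) (proj₂ (rel-↦ {f} {x} {y}) j)
                     in ·-unique j λ y′ j′ → el-inj (trans {j = _} (u′ y′ j′) (sym (u′ y j)))

     toIsFun : FunP f a (λ w → B (el w)) → R.IsFun (el f) (el a) B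
     toIsFun F =
       (λ p vp i → let (x , j , e) = F .pairs ⟪ p , vp ⟫ (∈→ε i) in
         el x , isV x , ε→∈ j , el (f · x) , isV (f · x) , F .value x j , proj₂ (rel-pair {⟪ p , vp ⟫} {x} {f · x}) e) ,
       (λ x vx i → el (f · ⟪ x , vx ⟫) , isV (f · ⟪ x , vx ⟫) , proj₂ (rel-↦ {f} {⟪ x , vx ⟫} {f · ⟪ x , vx ⟫}) (F .total ⟪ x , vx ⟫ (∈→ε i)) ,
         λ y vy m → cong el (proj₂ (graph-dom F (proj₁ (rel-↦ {f} {⟪ x , vx ⟫} {⟪ y , vy ⟫}) m))))

   rel-⊆ : (el a R.⊆ el b) ⟺ (a ⊆ b)
   rel-⊆ = (λ h x i → ∈→ε (h (el x) (isV x) (ε→∈ i))) , (λ h x vx i → ε→∈ (h ⟪ x , vx ⟫ (∈→ε i)))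

   rel-empty : R.IsEmpty (el a) ⟺ (a ≡ ∅)
   rel-empty = (λ h → ⊆-antisym (λ x i → ⊥-elim (h (el x) (isV x) (ε→∈ i))) (λ x i → ∅-elim i)) ,
     (λ { refl x vx i → ∉∅ {⟪ x , vx ⟫} (∈→ε i) })

   rel-union : R.IsUnion (el b) (el a) ⟺ (b ≡ ⋃ a)
   rel-union {b} {a} =
     (λ h → ext λ x →
       (λ i → let (y , vy , j , k) = Equivalence.to (h (el x) (isV x)) (ε→∈ i) in
              ⋃⁺ (⟪ y , vy ⟫ , ∈→ε j , ∈→ε k)) ,
       (λ i → let (y , j , k) = ⋃⁻ i in
              ∈→ε (Equivalence.from (h (el x) (isV x)) (el y , isV y , ε→∈ j , ε→∈ k)))) ,
     (λ { refl x vx → mk⇔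
       (λ i → let (y , j , k) = ⋃⁻ {x = ⟪ x , vx ⟫} (∈→ε i) in el y , isV y , ε→∈ j , ε→∈ k)
       (λ (y , vy , j , k) → ε→∈ (⋃⁺ {x = ⟪ x , vx ⟫} (⟪ y , vy ⟫ , ∈→ε j , ∈→ε k))) })

   Inj : W → W → Set ℓ
   Inj f a = ∀ x y → x ε a → y ε a → f · x ≡ f · y → x ≡ y

   Bij : W → W → W → Set ℓ
   Bij f a b = Fun f a b × Inj f a × (∀ y → y ε b → Σ W λ x → x ε a × f · x ≡ y)

   rel-inj : {B : W → Set ℓ} → FunP f a B → R.IsInjective (el f) ⟺ Inj f a
   rel-inj {f} {a} F =
     (λ h x y i j e → el-inj (h (el x) (isV x) (el y) (isV y) (el (f · y)) (isV (f · y))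
       (proj₂ (rel-↦ {f} {x} {f · y}) (subst (λ z → ⟨ x , z ⟩ ε f) e (F .total x i))) (proj₂ (rel-↦ {f} {y} {f · y}) (F .total y j)))) ,
     (λ h x vx x′ vx′ y vy m m′ →
       let (i , e) = graph-dom F (proj₁ (rel-↦ {f} {⟪ x , vx ⟫} {⟪ y , vy ⟫}) m)
           (j , e′) = graph-dom F (proj₁ (rel-↦ {f} {⟪ x′ , vx′ ⟫} {⟪ y , vy ⟫}) m′)
       in cong el (h ⟪ x , vx ⟫ ⟪ x′ , vx′ ⟫ i j (trans (sym e) e′)))

   rel-bij : R.IsBijection (el f) (el a) (el b) ⟺ Bij f a b
   rel-bij {f} {a} {b} =
     (λ (h , k , l) → let F = FunP-map (λ _ → ∈→ε) (fromIsFun h) in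
       F , proj₁ (rel-inj F) k , λ y i → let (x , vx , m) = l (el y) (isV y) (ε→∈ i)
                                             (j , e) = graph-dom F (proj₁ (rel-↦ {f} {⟪ x , vx ⟫} {y}) m)
                                         in ⟪ x , vx ⟫ , j , sym e) ,
     (λ (F , k , l) → toIsFun (FunP-map (λ _ → ε→∈) F) , proj₂ (rel-inj F) k ,
       λ y vy i → let (x , j , e) = l ⟪ y , vy ⟫ (∈→ε i) in
         el x , isV x , proj₂ (rel-↦ {f} {x} {⟪ y , vy ⟫}) (subst (λ z → ⟨ x , z ⟩ ε f) e (F .total x j)))

   opaque
     override : W → W → W → W → W
     override f a x z = graph (f ·_) a ∪ ｛ ⟨ x , z ⟩ ｝

     override-spec : ∀ p → p ε override f a x z ⟺ ((Σ W λ u → u ε a × (p ≡ ⟨ u , f · u ⟩)) ⊎ p ≡ ⟨ x , z ⟩)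
     override-spec {f} {a} {x} {z} p =
       (λ i → ⊎-map (proj₁ (graph-spec (f ·_) a p)) (proj₁ (｛｝-spec _ p)) (∪⁻ i)) ,
       (λ i → ∪⁺ (⊎-map (proj₂ (graph-spec (f ·_) a p)) (proj₂ (｛｝-spec _ p)) i))

   override-old : x ∉ a → y ε a → override f a x z · y ≡ f · y
   override-old x∉ i = ·-unique (proj₂ (override-spec _) (inj₁ (_ , i , refl))) λ y′ h → old (proj₁ (override-spec _) h)
     where
     old : ∀ {y′} → _ → y′ ≡ _
     old (inj₁ (u , _ , e)) = let (p , q) = ⟨⟩-inj e in trans q (cong (_ ·_) (sym p))
     old (inj₂ e) = ⊥-elim (x∉ (subst (_ε _) (proj₁ (⟨⟩-inj e)) i))

   override-new : x ∉ a → override f a x z · x ≡ z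
   override-new x∉ = ·-unique (proj₂ (override-spec _) (inj₂ refl)) λ y′ h → new (proj₁ (override-spec _) h)
     where
     new : ∀ {y′} → _ → y′ ≡ _
     new (inj₁ (u , i , e)) = ⊥-elim (x∉ (subst (_ε _) (sym (proj₁ (⟨⟩-inj e))) i))
     new (inj₂ e) = proj₂ (⟨⟩-inj e)

   override-fun : {B : W → Set ℓ} → x ∉ a → (∀ u → u ε a → B (f · u)) → B z → FunP (override f a x z) (a ∪ ｛ x ｝) B
   override-fun {x} {a} {f} {z} {B} x∉ h b = record
     { pairs = λ p i → ps p (proj₁ (override-spec p) i)
     ; total = λ u i → tot u (∪⁻ i)
     ; value = λ u i → val u (∪⁻ i) }
     where
     ps : ∀ p → _ → Σ W λ u → u ε a ∪ ｛ x ｝ × (p ≡ ⟨ u , override f a x z · u ⟩)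
     ps p (inj₁ (u , i , e)) = u , ∪⁺ (inj₁ i) , trans e (cong ⟨ u ,_⟩ (sym (override-old x∉ i)))
     ps p (inj₂ e) = x , ∪⁺ (inj₂ (proj₂ (｛｝-spec x x) refl)) , trans e (cong ⟨ x ,_⟩ (sym (override-new x∉)))
     tot : ∀ u → u ε a ⊎ u ε ｛ x ｝ → ⟨ u , override f a x z · u ⟩ ε override f a x z
     tot u (inj₁ i) = proj₂ (override-spec _) (inj₁ (u , i , cong ⟨ u ,_⟩ (override-old x∉ i)))
     tot u (inj₂ i) with proj₁ (｛｝-spec x u) i
     ... | refl = proj₂ (override-spec _) (inj₂ (cong ⟨ x ,_⟩ (override-new x∉)))
     val : ∀ u → u ε a ⊎ u ε ｛ x ｝ → B (override f a x z · u)
     val u (inj₁ i) = subst B (sym (override-old x∉ i)) (h u i)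
     val u (inj₂ i) with proj₁ (｛｝-spec x u) i
     ... | refl = subst B (sym (override-new x∉)) b

 open Sets

 module Naturals where

   private variable
     a f g p x y z m n k : W

   S : W → W
   S x = x ∪ ｛ x ｝

   S-spec : ∀ x w → w ε S x ⟺ (w ε x ⊎ w ≡ x)
   S-spec x w = (λ i → ⊎-map (λ j → j) (proj₁ (｛｝-spec x w)) (∪⁻ i)) ,
     (λ i → ∪⁺ (⊎-map (λ j → j) (proj₂ (｛｝-spec x w)) i))

   S⁻ : y ε S x → y ε x ⊎ y ≡ x
   S⁻ = proj₁ (S-spec _ _)

   S⁺ : y ε x ⊎ y ≡ x → y ε S x
   S⁺ = proj₂ (S-spec _ _)

   ∈S : x ε S x
   ∈S = S⁺ (inj₂ refl)

   ⊆S : y ε x → y ε S x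
   ⊆S i = S⁺ (inj₁ i)

   ε-asym : x ε y → y ∉ x
   ε-asym {x} {y} i j with foundation {upair x y} (x , upair⁺ (inj₁ refl))
   ... | w , k , h with upair⁻ k
   ...   | inj₁ refl = h y j (upair⁺ (inj₂ refl))
   ...   | inj₂ refl = h x i (upair⁺ (inj₁ refl))

   ε-irrefl : x ∉ x
   ε-irrefl i = ε-asym i i

   Ind : W → Set ℓ
   Ind w = ∅ ε w × (∀ x → x ε w → S x ε w)

   rel-succ : R.IsSucc (el y) (el x) ⟺ (y ≡ S x)
   rel-succ {y} {x} =
     (λ h → ext λ w →
       (λ i → S⁺ (⊎-map ∈→ε el-inj (Equivalence.to (h (el w) (isV w)) (ε→∈ i)))) ,
       (λ i → ∈→ε (Equivalence.from (h (el w) (isV w)) (⊎-map ε→∈ (cong el) (S⁻ i))))) ,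
     (λ { refl w vw → mk⇔
       (λ i → ⊎-map ε→∈ (cong el) (S⁻ {y = ⟪ w , vw ⟫} (∈→ε i)))
       (λ i → ε→∈ (S⁺ {y = ⟪ w , vw ⟫} (⊎-map ∈→ε el-inj i))) })

   rel-ind : R.Inductive (el a) ⟺ Ind a
   rel-ind {a} =
     (λ ((e , ve , i , h) , k) → subst (_ε a) (proj₁ (rel-empty {⟪ e , ve ⟫}) h) (∈→ε i) ,
       λ x j → let (y , vy , l , m) = k (el x) (isV x) (ε→∈ j) in
         subst (_ε a) (proj₁ (rel-succ {⟪ y , vy ⟫} {x}) m) (∈→ε l)) ,
     (λ (i , h) → (el ∅ , isV ∅ , ε→∈ i , proj₂ (rel-empty {∅}) refl) ,
       λ x vx j → let x′ = ⟪ x , vx ⟫ in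
         el (S x′) , isV (S x′) , ε→∈ (h x′ (∈→ε j)) , proj₂ (rel-succ {S x′} {x′}) refl)

   rel-one : {u : W} → R.IsOne (el u) ⟺ (u ≡ S ∅)
   rel-one {u} =
     (λ (e , ve , h , k) → trans (proj₁ (rel-succ {u} {⟪ e , ve ⟫}) k) (cong S (proj₁ (rel-empty {⟪ e , ve ⟫}) h))) ,
     (λ e → el ∅ , isV ∅ , proj₂ (rel-empty {∅}) refl , proj₂ (rel-succ {u} {∅}) e)

   opaque
     ω : W
     ω = sep (λ n → ∀ w → Ind w → n ε w) ω₀

     ω-spec : ∀ n → n ε ω ⟺ (∀ w → Ind w → n ε w)
     ω-spec n = (λ i → proj₂ (proj₁ (sep-spec (λ n → ∀ w → Ind w → n ε w) ω₀ n) i)) ,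
       (λ h → proj₂ (sep-spec (λ n → ∀ w → Ind w → n ε w) ω₀ n) (h ω₀ (proj₁ rel-ind ω₀-inductive) , h))

   rel-nat : R.IsNat (el n) ⟺ (n ε ω)
   rel-nat {n} = (λ h → proj₂ (ω-spec n) λ w i → ∈→ε (h (el w) (isV w) (proj₂ rel-ind i))) ,
     (λ h w vw i → ε→∈ (proj₁ (ω-spec n) h ⟪ w , vw ⟫ (proj₁ (rel-ind {⟪ w , vw ⟫}) i)))

   ∅∈ω : ∅ ε ω
   ∅∈ω = proj₂ (ω-spec ∅) λ w → proj₁

   S∈ω : n ε ω → S n ε ω
   S∈ω {n} h = proj₂ (ω-spec (S n)) λ w i → proj₂ i n (proj₁ (ω-spec n) h w i)

   opaque
    ω-ind : (P : W → Set ℓ) → ⦃ Def {1} λ ρ → P (ρ zero) ⦄ → P ∅ → (∀ n → n ε ω → P n → P (S n)) →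
            ∀ n → n ε ω → P n
    ω-ind P z s n h = proj₂ (proj₁ (sep-spec P ω n) (proj₁ (ω-spec n) h (sep P ω)
      (proj₂ (sep-spec P ω ∅) (∅∈ω , z) , λ x i → let (j , p) = proj₁ (sep-spec P ω x) i in
         proj₂ (sep-spec P ω (S x)) (S∈ω j , s x j p))))

   opaque
     ω-cases : n ε ω → n ≡ ∅ ⊎ Σ W λ m → m ε ω × n ≡ S m
     ω-cases = ω-ind (λ n → n ≡ ∅ ⊎ Σ W λ m → m ε ω × n ≡ S m) (inj₁ refl) (λ m h _ → inj₂ (m , h , refl)) _

   ω-trans : m ε n → n ε ω → m ε ω
   ω-trans {m} {n} i h = ω-ind (λ n → ∀ m → m ε n → m ε ω) (λ m i → ∅-elim i)
     (λ n h k m i → ⊎-elim (k m) (λ { refl → h }) (S⁻ i)) n h m i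

   ω-mono : m ε n → n ε ω → S m ε S n
   ω-mono {m} {n} i h = ω-ind (λ n → ∀ m → m ε n → S m ε S n) (λ m i → ∅-elim i)
     (λ n h k m i → ⊎-elim (λ j → ⊆S (k m j)) (λ { refl → ∈S }) (S⁻ i)) n h m i

   ω-sub : n ε ω → m ε n → S m ⊆ n
   ω-sub {n} {m} h i = ω-ind (λ n → ∀ j → j ε n → S j ⊆ n) (λ j l → ∅-elim l)
     (λ n h k j l x p → ⊎-elim (λ q → ⊆S (k j q x p)) (λ { refl → p }) (S⁻ l)) n h m i

   S-below : n ε ω → S m ε S n → m ε n
   S-below {n} {m} h i = ⊎-elim (λ j → ω-sub h j m (⊆S ∈S)) (λ e → subst (m ε_) e ∈S) (S⁻ i)

   S-inj : S m ≡ S n → m ≡ n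
   S-inj {m} {n} e with S⁻ (subst (m ε_) e ∈S) | S⁻ (subst (n ε_) (sym e) ∈S)
   ... | inj₂ k | _      = k
   ... | inj₁ _ | inj₂ k = sym k
   ... | inj₁ i | inj₁ j = ⊥-elim (ε-asym i j)

   S≢∅ : ¬ (S m ≡ ∅)
   S≢∅ e = ∉∅ (subst (_ ε_) e ∈S)

   Rec : (W → Set ℓ) → (W → W → W → Set ℓ) → W → W → Set ℓ
   Rec Z step n z = Σ W λ f → Z (f · ∅) × (∀ i → i ε n → step i (f · i) (f · S i)) × (z ≡ f · n)

   ∅∈S : n ε ω → ∅ ε S n
   ∅∈S = ω-ind (λ n → ∅ ε S n) ∈S (λ n _ i → ⊆S i) _

   rel-rec : {Z : 𝕌 → Set ℓ} {step : 𝕌 → 𝕌 → 𝕌 → Set ℓ} → n ε ω →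
             R.Rec Z step (el n) (el z) ⟺ Rec (λ x → Z (el x)) (λ i x y → step (el i) (el x) (el y)) n z
   rel-rec {n} {z} {Z} {step} h =
     (λ (f , vf , (n⁺ , vn , s , F) , (e , ve , em′ , x , vx , m , zx) , st , l) →
       let f = ⟪ f , vf ⟫
           F′ = subst (λ a → FunP f a (λ w → V (el w))) (proj₁ (rel-succ {⟪ n⁺ , vn ⟫} {n}) s) (fromIsFun {a = ⟪ n⁺ , vn ⟫} {B = V} F)
       in f ,
          subst Z (cong el (trans (proj₂ (graph-dom F′ (proj₁ (rel-↦ {f} {⟪ e , ve ⟫} {⟪ x , vx ⟫}) m)))
                                  (cong (f ·_) (proj₁ (rel-empty {⟪ e , ve ⟫}) em′)))) zx ,
          (λ i j → st (el i) (isV i) (ε→∈ j) (el (S i)) (isV (S i)) (proj₂ (rel-succ {S i} {i}) refl)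
             (el (f · i)) (isV (f · i)) (el (f · S i)) (isV (f · S i))
             (proj₂ (rel-↦ {f} {i}) (F′ .total i (⊆S j))) (proj₂ (rel-↦ {f} {S i}) (F′ .total (S i) (ω-mono j h)))) ,
          proj₂ (graph-dom F′ (proj₁ (rel-↦ {f} {n} {z}) l))) ,
     (λ (f , zf , st , e) →
       let g = graph (f ·_) (S n)
           G : FunP g (S n) (λ w → V (el w))
           G = graph-fun (f ·_) λ x _ → isV (f · x)
           ap : ∀ {i} → i ε S n → g · i ≡ f · i
           ap = graph-· (f ·_)
           gr : ∀ {i y} → (el g R.∶ i ↦ y) → (vi : V i) → (vy : V y) → y ≡ el (f · ⟪ i , vi ⟫)
           gr m vi vy = let (j , q) = graph-dom G (proj₁ (rel-↦ {g} {⟪ _ , vi ⟫} {⟪ _ , vy ⟫}) m) in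
                        cong el (trans q (ap j))
           at : ∀ {i} → i ε S n → ⟨ i , f · i ⟩ ε g
           at {i} j = subst (λ y → ⟨ i , y ⟩ ε g) (ap j) (G .total i j)
       in el g , isV g ,
          (el (S n) , isV (S n) , proj₂ (rel-succ {S n} {n}) refl , toIsFun {f = g} {B = V} G) ,
          (el ∅ , isV ∅ , proj₂ (rel-empty {∅}) refl , el (f · ∅) , isV (f · ∅) ,
            proj₂ (rel-↦ {g} {∅} {f · ∅}) (at (∅∈S h)) , zf) ,
          (λ i vi j i′ vi′ s x vx y vy m m′ →
            subst₂ (step i) (sym (gr m vi vx))
              (sym (trans (gr m′ vi′ vy) (cong (λ w → el (f · w)) (proj₁ (rel-succ {⟪ i′ , vi′ ⟫} {⟪ i , vi ⟫}) s))))
              (st ⟪ i , vi ⟫ (∈→ε j))) ,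
          subst (λ w → el g R.∶ el n ↦ el w) (sym e) (proj₂ (rel-↦ {g} {n} {f · n}) (at ∈S)))

   Rec-zero : {Z : W → Set ℓ} {step : W → W → W → Set ℓ} → Rec Z step ∅ z ⟺ Z z
   Rec-zero {z} {Z} = (λ (f , h , _ , e) → subst Z (sym e) h) ,
     (λ h → let e = graph-· (λ _ → z) (∈S {∅}) in
       graph (λ _ → z) (S ∅) , subst Z (sym e) h , (λ i j → ∅-elim j) , sym e)

   Rec-suc : {Z : W → Set ℓ} {step : W → W → W → Set ℓ} → n ε ω →
             Rec Z step (S n) z ⟺ (Σ W λ y → Rec Z step n y × step n y z)
   Rec-suc {n} {z} {Z} {step} h =
     (λ (f , zf , st , e) → f · n , (f , zf , (λ i j → st i (⊆S j)) , refl) ,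
        subst (step n (f · n)) (sym e) (st n ∈S)) ,
     (λ (y , (f , zf , st , e) , s) →
       let g = override f (S n) (S n) z
           old : ∀ {i} → i ε S n → g · i ≡ f · i
           old = override-old ε-irrefl
       in g , subst Z (sym (old (∅∈S h))) zf ,
          (λ i j → ⊎-elim
             (λ k → subst₂ (step i) (sym (old j)) (sym (old (ω-mono k h))) (st i k))
             (λ { refl → subst₂ (step i) (trans e (sym (old j))) (sym (override-new ε-irrefl)) s })
             (S⁻ j)) ,
          sym (override-new ε-irrefl))

   module Recursion (R : W → W → Set ℓ) (d : Def {2} λ ρ → R (ρ zero) (ρ (suc zero)))
     (z₀ : W) (z₀∈ : z₀ ε ω) (F : W → W → W) (F∈ : ∀ n y → n ε ω → y ε ω → F n y ε ω)
     (R∅ : ∀ z → R ∅ z ⟺ (z ≡ z₀))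
     (RS : ∀ n z → n ε ω → R (S n) z ⟺ (Σ W λ y → R n y × (z ≡ F n y))) where

     private
       dR : ∀ {n} (i j : Fin n) → Def λ ρ → R (ρ i) (ρ j)
       dR i j = Def₂ R d (tVar {i = i}) (tVar {i = j})

     exists : ∀ n → n ε ω → Σ W λ k → k ε ω × (∀ z → R n z ⟺ (z ≡ k))
     exists = ω-ind (λ n → Σ W λ k → k ε ω × (∀ z → R n z ⟺ (z ≡ k)))
       ⦃ dEx ⦃ dAnd ⦃ it ⦄ ⦃ dAll ⦃ dAnd ⦃ dImp ⦃ dR (suc (suc zero)) zero ⦄ ⦃ it ⦄ ⦄ ⦃ dImp ⦃ it ⦄ ⦃ dR (suc (suc zero)) zero ⦄ ⦄ ⦄ ⦄ ⦄ ⦄ (z₀ , z₀∈ , R∅)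
       λ n h (k , k∈ , e) → F n k , F∈ n k h k∈ , λ z → ⟺-trans (RS n z h)
         ((λ (y , r , q) → trans q (cong (F n) (proj₁ (e y) r))) , (λ q → k , proj₂ (e k) refl , q))

     value-of : W → W
     value-of n = ⋃ (sep (R n) ⦃ Def₂ R d tCon var₀ ⦄ ω)

     private
       value≡ : ∀ {n k} → k ε ω → (∀ z → R n z ⟺ (z ≡ k)) → value-of n ≡ k
       value≡ {n} {k} k∈ e = ext λ x →
         (λ i → let (y , j , l) = ⋃⁻ i in
           subst (x ε_) (proj₁ (e y) (proj₂ (proj₁ (sep-spec (R n) ⦃ Def₂ R d tCon var₀ ⦄ ω y) j))) l) ,
         (λ i → ⋃⁺ (k , proj₂ (sep-spec (R n) ⦃ Def₂ R d tCon var₀ ⦄ ω k) (k∈ , proj₂ (e k) refl) , i))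

     value∈ : n ε ω → value-of n ε ω
     value∈ {n} h = let (k , k∈ , e) = exists n h in subst (_ε ω) (sym (value≡ k∈ e)) k∈

     value-spec : n ε ω → ∀ z → R n z ⟺ (z ≡ value-of n)
     value-spec {n} h z = let (k , k∈ , e) = exists n h in subst (λ v → R n z ⟺ (z ≡ v)) (sym (value≡ k∈ e)) (e z)

     value-∅ : value-of ∅ ≡ z₀
     value-∅ = sym (proj₁ (value-spec ∅∈ω z₀) (proj₂ (R∅ z₀) refl))

     value-S : n ε ω → value-of (S n) ≡ F n (value-of n)
     value-S {n} h = sym (proj₁ (value-spec (S∈ω h) _)
       (proj₂ (RS n _ h) (value-of n , proj₂ (value-spec h _) refl , refl)))

   PlusR : W → W → W → Set ℓ
   PlusR m = Rec (_≡ m) (λ _ x y → y ≡ S x)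

   infixl 6 _+_

   private
     plus-∅ : ∀ m z → PlusR m ∅ z ⟺ (z ≡ m)
     plus-∅ m z = Rec-zero {step = λ _ x y → y ≡ S x}

     plus-S : ∀ m n z → n ε ω → PlusR m (S n) z ⟺ (Σ W λ y → PlusR m n y × (z ≡ S y))
     plus-S m n z = Rec-suc {Z = _≡ m} {step = λ _ x y → y ≡ S x}

     dPlus : ∀ m → Def {2} λ ρ → PlusR m (ρ zero) (ρ (suc zero))
     dPlus m = it

     next : W → W → W
     next _ y = S y

     module P (m : W) (h : m ε ω) =
       Recursion (PlusR m) (dPlus m) m h next (λ _ _ _ → S∈ω) (plus-∅ m) (plus-S m)

   -- Junk values outside ω.
   opaque
     _+_ : W → W → W
     m + n = ⋃ (sep (PlusR m n) ω)

     +-elems : ∀ m n x → x ε m + n ⟺ (Σ W λ k → (k ε ω × PlusR m n k) × x ε k)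
     +-elems m n x =
       (λ i → let (k , p , q) = ⋃⁻ i in k , proj₁ (sep-spec (PlusR m n) ω k) p , q) ,
       (λ (k , p , q) → ⋃⁺ (k , proj₂ (sep-spec (PlusR m n) ω k) p , q))

     +∈ω : m ε ω → n ε ω → m + n ε ω
     +∈ω h k = P.value∈ _ h k

     +-spec : m ε ω → n ε ω → PlusR m n z ⟺ (z ≡ m + n)
     +-spec h k = P.value-spec _ h k _

     +-∅ : m ε ω → m + ∅ ≡ m
     +-∅ h = P.value-∅ _ h

     +-S : m ε ω → n ε ω → m + S n ≡ S (m + n)
     +-S h k = P.value-S _ h k

   opaque
    instance
     d+ : ∀ {n} {s t : Env n → W} → ⦃ DefT s ⦄ → ⦃ DefT t ⦄ → DefT λ ρ → s ρ + t ρ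
     d+ = dSet₂ _+_ +-elems

   infixl 7 _*_

   TimesR : W → W → W → Set ℓ
   TimesR m = Rec (_≡ ∅) (λ _ x y → y ≡ x + m)

   private
     times-∅ : ∀ m z → TimesR m ∅ z ⟺ (z ≡ ∅)
     times-∅ m z = Rec-zero {step = λ _ x y → y ≡ x + m}

     times-S : ∀ m n z → n ε ω → TimesR m (S n) z ⟺ (Σ W λ y → TimesR m n y × (z ≡ y + m))
     times-S m n z = Rec-suc {Z = _≡ ∅} {step = λ _ x y → y ≡ x + m}

     dTimes : ∀ m → Def {2} λ ρ → TimesR m (ρ zero) (ρ (suc zero))
     dTimes m = it

     plus : W → W → W → W
     plus m _ y = y + m

     plus∈ : ∀ m → m ε ω → ∀ n y → n ε ω → y ε ω → plus m n y ε ω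
     plus∈ m h _ _ _ k = +∈ω k h

     module T (m : W) (h : m ε ω) =
       Recursion (TimesR m) (dTimes m) ∅ ∅∈ω (plus m) (plus∈ m h) (times-∅ m) (times-S m)

   opaque
     _*_ : W → W → W
     m * n = ⋃ (sep (TimesR m n) ω)

     *-elems : ∀ m n x → x ε m * n ⟺ (Σ W λ k → (k ε ω × TimesR m n k) × x ε k)
     *-elems m n x =
       (λ i → let (k , p , q) = ⋃⁻ i in k , proj₁ (sep-spec (TimesR m n) ω k) p , q) ,
       (λ (k , p , q) → ⋃⁺ (k , proj₂ (sep-spec (TimesR m n) ω k) p , q))

     *∈ω : m ε ω → n ε ω → m * n ε ω
     *∈ω h k = T.value∈ _ h k

     *-spec : m ε ω → n ε ω → TimesR m n z ⟺ (z ≡ m * n)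
     *-spec h k = T.value-spec _ h k _

     *-∅ : m ε ω → m * ∅ ≡ ∅
     *-∅ h = T.value-∅ _ h

     *-S : m ε ω → n ε ω → m * S n ≡ m * n + m
     *-S h k = T.value-S _ h k

   opaque
    instance
     d* : ∀ {n} {s t : Env n → W} → ⦃ DefT s ⦄ → ⦃ DefT t ⦄ → DefT λ ρ → s ρ * t ρ
     d* = dSet₂ _*_ *-elems

   rel-+ : m ε ω → n ε ω → R.Plus (el m) (el n) (el k) ⟺ (k ≡ m + n)
   rel-+ {m} {n} {k} h i = ⟺-trans (rel-rec {n} {k} {_≡ el m} {λ _ x y → R.IsSucc y x} i) (⟺-trans
     ((λ (f , z , s , e) → f , el-inj z , (λ i j → proj₁ (rel-succ {f · S i} {f · i}) (s i j)) , e) ,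
      (λ (f , z , s , e) → f , cong el z , (λ i j → proj₂ (rel-succ {f · S i} {f · i}) (s i j)) , e))
     (+-spec h i))

   private
     RecTimes : W → W → W → Set ℓ
     RecTimes m = Rec (λ x → R.IsEmpty (el x)) (λ _ x y → R.Plus (el x) (el m) (el y))

     step∈ : m ε ω → n ε ω → ∀ f → f · ∅ ≡ ∅ → (∀ i → i ε n → f · i ε ω → f · S i ≡ f · i + m) → ∀ i → i ε n → f · i ε ω
     step∈ {m} {n} h i f z s j l = ω-ind (λ j → S j ⊆ n → f · j ε ω)
       (λ _ → subst (_ε ω) (sym z) ∅∈ω)
       (λ j _ IH sub → let q = IH λ x p → sub x (⊆S p) in
         subst (_ε ω) (sym (s j (sub j (⊆S ∈S)) q)) (+∈ω q h)) j (ω-trans l i) (ω-sub i l)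

     rt→ : m ε ω → n ε ω → RecTimes m n k → TimesR m n k
     rt→ {m} {n} h hn (f , z , s , e) = f , z′ , (λ i j → s′ i j (step∈ h hn f z′ s′ i j)) , e
       where
       z′ : f · ∅ ≡ ∅
       z′ = proj₁ (rel-empty {f · ∅}) z
       s′ : ∀ i → i ε n → f · i ε ω → f · S i ≡ f · i + m
       s′ i j l = proj₁ (rel-+ {f · i} {m} {f · S i} l h) (s i j)

     rt← : m ε ω → n ε ω → TimesR m n k → RecTimes m n k
     rt← {m} {n} h hn (f , z , s , e) = f , proj₂ (rel-empty {f · ∅}) z ,
       (λ i j → proj₂ (rel-+ {f · i} {m} {f · S i} (step∈ h hn f z (λ i j _ → s i j) i j) h) (s i j)) , e

   rel-* : m ε ω → n ε ω → R.Times (el m) (el n) (el k) ⟺ (k ≡ m * n)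
   rel-* {m} {n} {k} h i = ⟺-trans (rel-rec {n} {k} {R.IsEmpty} {λ _ x y → R.Plus x (el m) y} i)
     (⟺-trans (rt→ h i , rt← h i) (*-spec h i))

 open Naturals

 module FiniteSets where

   private variable
     a b c f h x y z n : W

   Finite : W → Set ℓ
   Finite a = Σ W λ n → n ε ω × Σ W λ f → Bij f n a

   rel-infinite : R.Infinite (el a) ⟺ (¬ Finite a)
   rel-infinite {a} =
     (λ h (n , i , f , b) → h (el n , isV n , proj₂ (rel-nat {n}) i , el f , isV f , proj₂ (rel-bij {f} {n} {a}) b)) ,
     (λ h (n , vn , i , f , vf , b) → h (⟪ n , vn ⟫ , proj₁ (rel-nat {⟪ n , vn ⟫}) i , ⟪ f , vf ⟫ ,
        proj₁ (rel-bij {⟪ f , vf ⟫} {⟪ n , vn ⟫} {a}) b))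

   adj-∈ : ∀ {a x y} → y ε a ∪ ｛ x ｝ → y ε a ⊎ y ≡ x
   adj-∈ {a} {x} {y} i = ⊎-map (λ j → j) (proj₁ (｛｝-spec x y)) (∪⁻ i)

   adj-old : ∀ {a x y} → y ε a → y ε a ∪ ｛ x ｝
   adj-old i = ∪⁺ (inj₁ i)

   adj-new : ∀ {a x} → x ε a ∪ ｛ x ｝
   adj-new = ∪⁺ (inj₂ (proj₂ (｛｝-spec _ _) refl))

   adj-absorb : x ε a → a ∪ ｛ x ｝ ≡ a
   adj-absorb i = ⊆-antisym (λ y j → ⊎-elim (λ k → k) (λ { refl → i }) (adj-∈ j)) (λ y → adj-old)

   finite-∅ : Finite ∅
   finite-∅ = ∅ , ∅∈ω , ∅ ,
     record { pairs = λ p i → ∅-elim i ; total = λ x i → ∅-elim i ; value = λ x i → ∅-elim i } ,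
     (λ x y i → ∅-elim i) , (λ y i → ∅-elim i)

   opaque
    finite-adj : ∀ x → Finite a → Finite (a ∪ ｛ x ｝)
    finite-adj {a} x (n , n∈ , f , F , inj , sur) with em {x ε a}
    ... | yes i = subst Finite (sym (adj-absorb i)) (n , n∈ , f , F , inj , sur)
    ... | no x∉ = S n , S∈ω n∈ , f⁺ , override-fun ε-irrefl (λ u i → adj-old (F .value u i)) adj-new , inj′ , sur′
      where
      f⁺ : W
      f⁺ = override f n n x
      old : ∀ {u} → u ε n → f⁺ · u ≡ f · u
      old = override-old ε-irrefl
      new : f⁺ · n ≡ x
      new = override-new ε-irrefl
      inj′ : Inj f⁺ (S n)
      inj′ u v i j e with adj-∈ i | adj-∈ j
      ... | inj₁ k | inj₁ l = inj u v k l (trans (sym (old k)) (trans e (old l)))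
      ... | inj₁ k | inj₂ refl = ⊥-elim (x∉ (subst (_ε a) (trans (sym (old k)) (trans e new)) (F .value u k)))
      ... | inj₂ refl | inj₁ l = ⊥-elim (x∉ (subst (_ε a) (trans (sym (old l)) (trans (sym e) new)) (F .value v l)))
      ... | inj₂ refl | inj₂ refl = refl
      sur′ : ∀ y → y ε a ∪ ｛ x ｝ → Σ W λ u → u ε S n × f⁺ · u ≡ y
      sur′ y i with adj-∈ i
      ... | inj₁ j = let (u , k , e) = sur y j in u , ⊆S k , trans (old k) e
      ... | inj₂ refl = n , ∈S , new

   dFinite : Def {1} λ ρ → Finite (ρ zero)
   dFinite = it

   opaque
    finite-ind : (P : W → Set ℓ) ⦃ d : Def {1} λ ρ → P (ρ zero) ⦄ → P ∅ →
                 (∀ a x → a ⊆ b → x ε b → x ∉ a → Finite a → P a → P (a ∪ ｛ x ｝)) → Finite b → P b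
    finite-ind {b} P ⦃ d ⦄ z s (n , n∈ , f , F , inj , sur) =
      let (q , q⊆ , _ , p , e) = stages n n∈ in
      subst P (⊆-antisym q⊆ (λ y i → let (u , j , e′) = sur y i in proj₂ (e y) (u , j , j , sym e′))) p
      where
      Stage : W → W → Set ℓ
      Stage k q = ∀ y → y ε q ⟺ (Σ W λ i → i ε k × i ε n × y ≡ f · i)
      stages : ∀ k → k ε ω → Σ W λ q → q ⊆ b × Finite q × P q × Stage k q
      stages = ω-ind (λ k → Σ W λ q → q ⊆ b × Finite q × P q × Stage k q)
        ⦃ dEx ⦃ dAnd ⦃ it ⦄ ⦃ dAnd ⦃ Def₁ Finite dFinite var₀ ⦄ ⦃ dAnd ⦃ Def₁ P d var₀ ⦄ ⦃ it ⦄ ⦄ ⦄ ⦄ ⦄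
        (∅ , (λ x i → ∅-elim i) , finite-∅ , z , λ y → (λ i → ∅-elim i) , λ (_ , i , _) → ∅-elim i)
        λ k k∈ (q , q⊆ , fin , p , st) → step k q q⊆ fin p st
        where
        step : ∀ k q → q ⊆ b → Finite q → P q → Stage k q → Σ W λ q → q ⊆ b × Finite q × P q × Stage (S k) q
        step k q q⊆ fin p st with em {k ε n}
        ... | yes i = q ∪ ｛ f · k ｝ , (λ x j → ⊎-elim (q⊆ x) (λ { refl → F .value k i }) (adj-∈ j)) , finite-adj _ fin ,
              s q (f · k) q⊆ (F .value k i)
                (λ j → let (l , l∈ , l∈n , e) = proj₁ (st _) j in ε-irrefl (subst (_ε k) (inj l k l∈n i (sym e)) l∈)) fin p ,
              λ y → (λ j → ⊎-elim (λ j → let (l , l∈ , r) = proj₁ (st y) j in l , ⊆S l∈ , r) (λ e → k , ∈S , i , e) (adj-∈ j)) ,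
                    (λ (l , l∈ , l∈n , e) → ⊎-elim (λ m → adj-old (proj₂ (st y) (l , m , l∈n , e)))
                       (λ { refl → subst (_ε q ∪ ｛ f · k ｝) (sym e) adj-new }) (S⁻ l∈))
        ... | no k∉ = q , q⊆ , fin , p , λ y →
              (λ j → let (l , l∈ , r) = proj₁ (st y) j in l , ⊆S l∈ , r) ,
              (λ (l , l∈ , l∈n , e) → ⊎-elim (λ m → proj₂ (st y) (l , m , l∈n , e))
                 (λ { refl → ⊥-elim (k∉ l∈n) }) (S⁻ l∈))

   opaque
    finite-∪ : Finite a → Finite b → Finite (a ∪ b)
    finite-∪ {a} {b} fa fb = finite-ind (λ b → Finite (a ∪ b)) ⦃ Def₁ Finite dFinite (d∪ ⦃ tCon ⦄ ⦃ var₀ ⦄) ⦄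
      (subst Finite (⊆-antisym (λ x i → ∪⁺ (inj₁ i))
        (λ x i → ⊎-elim (λ j → j) (λ j → ∅-elim j) (∪⁻ i))) fa)
      (λ c x _ _ _ _ fc → subst Finite (assoc c x) (finite-adj x fc)) fb
      where
      assoc : ∀ c x → a ∪ c ∪ ｛ x ｝ ≡ a ∪ (c ∪ ｛ x ｝)
      assoc c x = ext λ y →
        (λ i → ⊎-elim (λ j → ⊎-elim (λ k → ∪⁺ (inj₁ k)) (λ k → ∪⁺ (inj₂ (adj-old k))) (∪⁻ j))
                      (λ { refl → ∪⁺ (inj₂ adj-new) }) (adj-∈ i)) ,
        (λ i → ⊎-elim (λ j → adj-old (∪⁺ (inj₁ j)))
                      (λ j → ⊎-elim (λ k → adj-old (∪⁺ (inj₂ k))) (λ { refl → adj-new }) (adj-∈ j)) (∪⁻ i))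

   opaque
    finite-⊆ : Finite b → a ⊆ b → Finite a
    finite-⊆ {b} {a} fb = finite-ind (λ b → ∀ a → a ⊆ b → Finite a) ⦃ dAll ⦃ dImp ⦃ it ⦄ ⦃ Def₁ Finite dFinite var₀ ⦄ ⦄ ⦄
      (λ a h → subst Finite (⊆-antisym (λ x i → ∅-elim i) h) finite-∅)
      (λ c x _ _ _ _ IH a h → split c x a h (IH (a ∖ ｛ x ｝) λ y i → let (j , k) = ∖⁻ i in
         ⊎-elim (λ l → l) (λ { refl → ⊥-elim (k (proj₂ (｛｝-spec x x) refl)) }) (adj-∈ (h y j)))) fb a
      where
      split : ∀ c x a → a ⊆ c ∪ ｛ x ｝ → Finite (a ∖ ｛ x ｝) → Finite a
      split c x a h fin with em {x ε a}
      ... | no x∉ = subst Finite (⊆-antisym (λ y i → proj₁ (∖⁻ i))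
                      (λ y i → ∖⁺ (i , λ k → x∉ (subst (_ε a) (proj₁ (｛｝-spec x y) k) i)))) fin
      ... | yes x∈ = subst Finite (⊆-antisym
                      (λ y i → ⊎-elim (λ j → proj₁ (∖⁻ j)) (λ { refl → x∈ }) (adj-∈ i))
                      (λ y i → back y i em)) (finite-adj x fin)
        where
        back : ∀ y → y ε a → Dec (y ≡ x) → y ε a ∖ ｛ x ｝ ∪ ｛ x ｝
        back y i (yes refl) = adj-new
        back y i (no ne) = adj-old (∖⁺ (i , λ k → ne (proj₁ (｛｝-spec x y) k)))

   opaque
    finite-img : (F : W → W) ⦃ d : DefT {1} λ ρ → F (ρ zero) ⦄ → Finite a → Σ W λ b → Finite b × (∀ x → x ε a → F x ε b)
    finite-img F ⦃ d ⦄ = finite-ind (λ a → Σ W λ b → Finite b × (∀ x → x ε a → F x ε b))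
      ⦃ dEx ⦃ dAnd ⦃ it ⦄ ⦃ dAll ⦃ dImp ⦃ it ⦄ ⦃ dMem ⦃ tRen (λ _ → zero) d ⦄ ⦃ it ⦄ ⦄ ⦄ ⦄ ⦄ ⦄
      (∅ , finite-∅ , λ x i → ∅-elim i)
      (λ a x _ _ _ _ (b , fb , h) → b ∪ ｛ F x ｝ , finite-adj _ fb ,
         λ y i → ⊎-elim (λ j → adj-old (h y j)) (λ { refl → adj-new }) (adj-∈ i))

   finite-nat : n ε ω → Finite n
   finite-nat {n} h = n , h , graph (λ x → x) n , graph-fun (λ x → x) (λ x i → i) ,
     (λ x y i j e → trans (sym (graph-· (λ x → x) i)) (trans e (graph-· (λ x → x) j))) ,
     (λ y i → y , i , graph-· (λ x → x) i)

 module Permutations (X : W) where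

   open FiniteSets

   private variable
     g h x y z Y Z : W

   Perm : W → Set ℓ
   Perm g = Bij g X X

   perm-in : Perm g → x ε X → g · x ε X
   perm-in (F , _) = F .value _

   perm-inj : Perm g → x ε X → y ε X → g · x ≡ g · y → x ≡ y
   perm-inj (_ , h , _) = h _ _

   mkPerm : (F F′ : W → W) ⦃ d : DefT {1} λ ρ → F (ρ zero) ⦄ → (∀ x → x ε X → F x ε X × F′ (F x) ≡ x) →
            (∀ x → x ε X → F′ x ε X × F (F′ x) ≡ x) → Perm (graph F X)
   mkPerm F F′ h k = graph-fun F (λ x i → proj₁ (h x i)) ,
     (λ x y i j e → trans (sym (proj₂ (h x i))) (trans (cong F′ (trans (sym (graph-· F i)) (trans e (graph-· F j)))) (proj₂ (h y j)))) ,
     (λ y i → F′ y , proj₁ (k y i) , trans (graph-· F (proj₁ (k y i))) (proj₂ (k y i)))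

   idP : W
   idP = graph (λ x → x) X

   idP-· : x ε X → idP · x ≡ x
   idP-· = graph-· (λ x → x)

   perm-id : Perm idP
   perm-id = mkPerm (λ x → x) (λ x → x) (λ x i → i , refl) (λ x i → i , refl)

   opaque
     preimage : W → W → W
     preimage g y = ⋃ (sep (λ x → g · x ≡ y) X)

     preimage-spec : ∀ g y z → z ε preimage g y ⟺ (Σ W λ x → (x ε X × g · x ≡ y) × z ε x)
     preimage-spec g y z =
       (λ i → let (x , j , k) = ⋃⁻ i in x , proj₁ (sep-spec (λ x → g · x ≡ y) X x) j , k) ,
       (λ (x , j , k) → ⋃⁺ (x , proj₂ (sep-spec (λ x → g · x ≡ y) X x) j , k))

   opaque
    instance
     dPreimage : ∀ {n} {s t : Env n → W} → ⦃ DefT s ⦄ → ⦃ DefT t ⦄ → DefT λ ρ → preimage (s ρ) (t ρ)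
     dPreimage = dSet₂ preimage preimage-spec

   preimage-· : Perm g → x ε X → preimage g (g · x) ≡ x
   preimage-· {g} {x} p i = ext λ z →
     (λ j → let (u , (k , e) , l) = proj₁ (preimage-spec g _ z) j in subst (z ε_) (perm-inj p k i e) l) ,
     (λ j → proj₂ (preimage-spec g _ z) (x , (i , refl) , j))

   inv : W → W
   inv g = graph (preimage g) X

   private
     preimage-sec : Perm g → y ε X → preimage g y ε X × g · preimage g y ≡ y
     preimage-sec {g} {y} p@(_ , _ , sur) i with sur y i
     ... | x , j , refl = subst (_ε X) (sym (preimage-· p j)) j , cong (g ·_) (preimage-· p j)

   perm-inv : Perm g → Perm (inv g)
   perm-inv {g} p = mkPerm (preimage g) (g ·_) (λ x i → preimage-sec p i) (λ x i → perm-in p i , preimage-· p i)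

   inv-·ˡ : Perm g → x ε X → inv g · (g · x) ≡ x
   inv-·ˡ p i = trans (graph-· (preimage _) (perm-in p i)) (preimage-· p i)

   inv-·ʳ : Perm g → x ε X → g · (inv g · x) ≡ x
   inv-·ʳ p i = trans (cong (_ ·_) (graph-· (preimage _) i)) (proj₂ (preimage-sec p i))

   infixr 8 _∘_
   _∘_ : W → W → W
   g ∘ h = graph (λ x → g · (h · x)) X

   ∘-· : x ε X → (g ∘ h) · x ≡ g · (h · x)
   ∘-· {x} {g} {h} = graph-· (λ x → g · (h · x))

   perm-∘ : Perm g → Perm h → Perm (g ∘ h)
   perm-∘ {g} {h} p q = mkPerm (λ x → g · (h · x)) (λ x → inv h · (inv g · x))
     (λ x i → perm-in p (perm-in q i) , trans (cong (inv h ·_) (inv-·ˡ p (perm-in q i))) (inv-·ˡ q i))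
     (λ x i → let j = perm-in (perm-inv p) i in perm-in (perm-inv q) j , trans (cong (g ·_) (inv-·ʳ q j)) (inv-·ʳ p i))

   swap : W → W → W → W
   swap a b x with em {x ≡ a} | em {x ≡ b}
   ... | yes _ | _     = b
   ... | no _  | yes _ = a
   ... | no _  | no _  = x

   swap-a : ∀ a b → swap a b a ≡ b
   swap-a a b with em {a ≡ a} | em {a ≡ b}
   ... | yes _ | _ = refl
   ... | no h  | _ = ⊥-elim (h refl)

   swap-b : ∀ a b → swap a b b ≡ a
   swap-b a b with em {b ≡ a} | em {b ≡ b}
   ... | yes e | _     = e
   ... | no _  | yes _ = refl
   ... | no _  | no h  = ⊥-elim (h refl)

   swap-else : ∀ a b → ¬ (x ≡ a) → ¬ (x ≡ b) → swap a b x ≡ x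
   swap-else {x} a b h k with em {x ≡ a} | em {x ≡ b}
   ... | yes e | _     = ⊥-elim (h e)
   ... | no _  | yes e = ⊥-elim (k e)
   ... | no _  | no _  = refl

   private
     swap-char : ∀ a b x y → (y ≡ swap a b x) ⟺ ((x ≡ a × y ≡ b) ⊎ (¬ (x ≡ a) × x ≡ b × y ≡ a) ⊎ (¬ (x ≡ a) × ¬ (x ≡ b) × y ≡ x))
     swap-char a b x y with em {x ≡ a} | em {x ≡ b}
     ... | yes h | _ = (λ e → inj₁ (h , e)) , λ { (inj₁ (_ , e)) → e ; (inj₂ (inj₁ (k , _))) → ⊥-elim (k h) ; (inj₂ (inj₂ (k , _))) → ⊥-elim (k h) }
     ... | no h | yes k = (λ e → inj₂ (inj₁ (h , k , e))) , λ { (inj₁ (l , _)) → ⊥-elim (h l) ; (inj₂ (inj₁ (_ , _ , e))) → e ; (inj₂ (inj₂ (_ , l , _))) → ⊥-elim (l k) }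
     ... | no h | no k = (λ e → inj₂ (inj₂ (h , k , e))) , λ { (inj₁ (l , _)) → ⊥-elim (h l) ; (inj₂ (inj₁ (_ , l , _))) → ⊥-elim (k l) ; (inj₂ (inj₂ (_ , _ , e))) → e }

     dSwap : ∀ a b → DefT {1} λ ρ → swap a b (ρ zero)
     dSwap a b = mkDefT (Def-≈ (λ ρ → swap-char a b (ρ (suc zero)) (ρ zero)) it)

   swap-invol : ∀ a b x → swap a b (swap a b x) ≡ x
   swap-invol a b x with em {x ≡ a} | em {x ≡ b}
   ... | yes refl | _        = swap-b a b
   ... | no _     | yes refl = swap-a a b
   ... | no h     | no k     = swap-else a b h k

   swap-in : ∀ {a b} → a ε X → b ε X → x ε X → swap a b x ε X
   swap-in {x} {a} {b} i j k with em {x ≡ a} | em {x ≡ b}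
   ... | yes _ | _     = j
   ... | no _  | yes _ = i
   ... | no _  | no _  = k

   tr : W → W → W
   tr a b = graph (swap a b) ⦃ dSwap a b ⦄ X

   tr-· : ∀ {a b} → x ε X → tr a b · x ≡ swap a b x
   tr-· {a = a} {b} = graph-· (swap a b) ⦃ dSwap a b ⦄

   perm-tr : ∀ {a b} → a ε X → b ε X → Perm (tr a b)
   perm-tr {a} {b} i j = mkPerm (swap a b) (swap a b) ⦃ dSwap a b ⦄
     (λ x k → swap-in i j k , swap-invol a b x) (λ x k → swap-in i j k , swap-invol a b x)

   PartialInj : W → Set ℓ
   PartialInj j = (∀ t → t ε j → Σ W λ u → Σ W λ v → t ≡ ⟨ u , v ⟩ × u ε X × v ε X) ×
     (∀ u v v′ → ⟨ u , v ⟩ ε j → ⟨ u , v′ ⟩ ε j → v ≡ v′) × (∀ u u′ v → ⟨ u , v ⟩ ε j → ⟨ u′ , v ⟩ ε j → u ≡ u′)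

   -- The partial injection j is extended one pair at a time, each time composing
   -- with a transposition.
   module Extension {j : W} (s : W) (id∈ : idP ε s) (perm : ∀ h → h ε s → Perm h)
     (closed : ∀ h a b → h ε s → a ε X → b ε X → (tr a b ∘ h) ε s) (fin : Finite j) (pj : PartialInj j) where

     private
       Extends : W → W → Set ℓ
       Extends i h = ∀ u v → ⟨ u , v ⟩ ε i → h · u ≡ v

       left∈ : ∀ {u v} → ⟨ u , v ⟩ ε j → u ε X
       left∈ i = let (u′ , v′ , e , u∈ , _) = proj₁ pj _ i in subst (_ε X) (sym (proj₁ (⟨⟩-inj e))) u∈

       step : ∀ i x y → ⟨ x , y ⟩ ε j → ⟨ x , y ⟩ ∉ i → i ⊆ j → x ε X → y ε X → ∀ h → h ε s → Extends i h →
              Extends (i ∪ ｛ ⟨ x , y ⟩ ｝) (tr (h · x) y ∘ h)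
       step i x y t∈j t∉i i⊆j x∈ y∈ h h∈ ok u v k = ⊎-elim old (λ e → new (⟨⟩-inj e)) (adj-∈ k)
         where
         new : u ≡ x × v ≡ y → (tr (h · x) y ∘ h) · u ≡ v
         new (refl , refl) = trans (∘-· x∈) (trans (tr-· (perm-in (perm h h∈) x∈)) (swap-a (h · x) y))
         old : ⟨ u , v ⟩ ε i → (tr (h · x) y ∘ h) · u ≡ v
         old k = trans (∘-· u∈) (trans (tr-· (perm-in (perm h h∈) u∈)) (trans (swap-else (h · x) y ne₁ ne₂) (ok u v k)))
           where
           u∈ : u ε X
           u∈ = left∈ (i⊆j _ k)
           absurd : u ≡ x → v ≡ y → ⊥
           absurd e e′ = t∉i (subst₂ (λ a b → ⟨ a , b ⟩ ε i) e e′ k)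
           ne₁ : ¬ (h · u ≡ h · x)
           ne₁ e = absurd u≡x (proj₁ (proj₂ pj) x v y (subst (λ w → ⟨ w , v ⟩ ε j) u≡x (i⊆j _ k)) t∈j)
             where
             u≡x : u ≡ x
             u≡x = perm-inj (perm h h∈) u∈ x∈ e
           ne₂ : ¬ (h · u ≡ y)
           ne₂ e = absurd (proj₂ (proj₂ pj) u x y (subst (λ w → ⟨ u , w ⟩ ε j) v≡y (i⊆j _ k)) t∈j) v≡y
             where
             v≡y : v ≡ y
             v≡y = trans (sym (ok u v k)) e

     extend : Σ W λ h → h ε s × (∀ u v → ⟨ u , v ⟩ ε j → h · u ≡ v)
     extend = finite-ind (λ i → i ⊆ j → Σ W λ h → h ε s × Extends i h)
       (λ _ → idP , id∈ , λ u v i → ∅-elim i)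
       (λ i t i⊆j t∈j t∉i _ IH _ →
         let (h , h∈ , ok) = IH i⊆j
             (x , y , e , x∈ , y∈) = proj₁ pj t t∈j
         in tr (h · x) y ∘ h , closed h (h · x) y h∈ (perm-in (perm h h∈) x∈) y∈ ,
            subst (λ t → Extends (i ∪ ｛ t ｝) (tr (h · x) y ∘ h)) (sym e)
              (step i x y (subst (_ε j) e t∈j) (λ k → t∉i (subst (_ε i) (sym e) k)) i⊆j x∈ y∈ h h∈ ok))
       fin (λ x i → i)

   dPerm : Def {1} λ ρ → Perm (ρ zero)
   dPerm = it

   opaque
     symmetric : W
     symmetric = sep Perm ⦃ dPerm ⦄ (funBound X X)

     symmetric-spec : ∀ g → g ε symmetric ⟺ Perm g
     symmetric-spec g = (λ i → proj₂ (proj₁ (sep-spec Perm ⦃ dPerm ⦄ (funBound X X) g) i)) ,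
       (λ p → proj₂ (sep-spec Perm ⦃ dPerm ⦄ (funBound X X) g) (fun∈ (proj₁ p) , p))

   Fixes : W → W → Set ℓ
   Fixes g Y = ∀ y → y ε Y → g · y ≡ y

   Away : W → W → W → Set ℓ
   Away g Z Y = ∀ z → z ε Z → g · z ∉ Y

   -- g and h move Z off Y, hence differ on Z by a permutation fixing Y.
   private
     Moved : W → W → W → W → W → Set ℓ
     Moved Y Z g h t = (Σ W λ y → y ε Y × t ≡ ⟨ y , y ⟩) ⊎ (Σ W λ z → z ε Z × t ≡ ⟨ g · z , h · z ⟩)

     dMoved : ∀ Y Z g h → Def {1} λ ρ → Moved Y Z g h (ρ zero)
     dMoved Y Z g h = it

   transport : Finite Y → Finite Z → Y ⊆ X → Z ⊆ X → Perm g → Perm h → Away g Z Y → Away h Z Y →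
               Σ W λ f → Perm f × Fixes f Y × (∀ z → z ε Z → f · (g · z) ≡ h · z)
   transport {Y} {Z} {g} {h} fy fz Y⊆ Z⊆ pg ph ag ah = proj₁ E , proj₁ (symmetric-spec (proj₁ E)) (proj₁ (proj₂ E)) ,
     (λ y i → proj₂ (proj₂ E) y y (j-in (∪⁺ (inj₁ (proj₂ (proj₂ A) y i))) (inj₁ (y , i , refl)))) ,
     (λ z i → proj₂ (proj₂ E) (g · z) (h · z) (j-in (∪⁺ (inj₂ (proj₂ (proj₂ B) z i))) (inj₂ (z , i , refl))))
     where
     A : Σ W λ a → Finite a × (∀ y → y ε Y → ⟨ y , y ⟩ ε a)
     A = finite-img (λ y → ⟨ y , y ⟩) fy
     B : Σ W λ b → Finite b × (∀ z → z ε Z → ⟨ g · z , h · z ⟩ ε b)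
     B = finite-img (λ z → ⟨ g · z , h · z ⟩) fz
     a b j : W
     a = proj₁ A
     b = proj₁ B
     J : W → Set ℓ
     J = Moved Y Z g h
     j = sep J ⦃ dMoved Y Z g h ⦄ (a ∪ b)
     j-out : ∀ {t} → t ε j → t ε a ∪ b × J t
     j-out {t} = proj₁ (sep-spec J ⦃ dMoved Y Z g h ⦄ (a ∪ b) t)
     j-in : ∀ {t} → t ε a ∪ b → J t → t ε j
     j-in {t} i k = proj₂ (sep-spec J ⦃ dMoved Y Z g h ⦄ (a ∪ b) t) (i , k)
     fun : ∀ u v v′ → J ⟨ u , v ⟩ → J ⟨ u , v′ ⟩ → v ≡ v′
     fun u v v′ (inj₁ (y , i , e)) (inj₁ (y′ , i′ , e′)) = let (p , q) = ⟨⟩-inj e ; (p′ , q′) = ⟨⟩-inj e′ in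
       trans q (trans (sym p) (trans p′ (sym q′)))
     fun u v v′ (inj₁ (y , i , e)) (inj₂ (z , k , e′)) = let (p , _) = ⟨⟩-inj e ; (p′ , _) = ⟨⟩-inj e′ in
       ⊥-elim (ag z k (subst (_ε Y) (trans (sym p) p′) i))
     fun u v v′ (inj₂ (z , k , e)) (inj₁ (y , i , e′)) = let (p , _) = ⟨⟩-inj e ; (p′ , _) = ⟨⟩-inj e′ in
       ⊥-elim (ag z k (subst (_ε Y) (trans (sym p′) p) i))
     fun u v v′ (inj₂ (z , k , e)) (inj₂ (z′ , k′ , e′)) = let (p , q) = ⟨⟩-inj e ; (p′ , q′) = ⟨⟩-inj e′ in
       trans q (trans (cong (h ·_) (perm-inj pg (Z⊆ z k) (Z⊆ z′ k′) (trans (sym p) p′))) (sym q′))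
     inj : ∀ u u′ v → J ⟨ u , v ⟩ → J ⟨ u′ , v ⟩ → u ≡ u′
     inj u u′ v (inj₁ (y , i , e)) (inj₁ (y′ , i′ , e′)) = let (p , q) = ⟨⟩-inj e ; (p′ , q′) = ⟨⟩-inj e′ in
       trans p (trans (sym q) (trans q′ (sym p′)))
     inj u u′ v (inj₁ (y , i , e)) (inj₂ (z , k , e′)) = let (_ , p) = ⟨⟩-inj e ; (_ , p′) = ⟨⟩-inj e′ in
       ⊥-elim (ah z k (subst (_ε Y) (trans (sym p) p′) i))
     inj u u′ v (inj₂ (z , k , e)) (inj₁ (y , i , e′)) = let (_ , p) = ⟨⟩-inj e ; (_ , p′) = ⟨⟩-inj e′ in
       ⊥-elim (ah z k (subst (_ε Y) (trans (sym p′) p) i))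
     inj u u′ v (inj₂ (z , k , e)) (inj₂ (z′ , k′ , e′)) = let (p , q) = ⟨⟩-inj e ; (p′ , q′) = ⟨⟩-inj e′ in
       trans p (trans (cong (g ·_) (perm-inj ph (Z⊆ z k) (Z⊆ z′ k′) (trans (sym q) q′))) (sym p′))
     pj : PartialInj j
     pj = (λ t i → ⊎-elim (λ (y , k , e) → y , y , e , Y⊆ y k , Y⊆ y k)
                          (λ (z , k , e) → g · z , h · z , e , perm-in pg (Z⊆ z k) , perm-in ph (Z⊆ z k)) (proj₂ (j-out i))) ,
          (λ u v v′ i i′ → fun u v v′ (proj₂ (j-out i)) (proj₂ (j-out i′))) ,
          (λ u u′ v i i′ → inj u u′ v (proj₂ (j-out i)) (proj₂ (j-out i′)))
     E : Σ W λ f → f ε symmetric × (∀ u v → ⟨ u , v ⟩ ε j → f · u ≡ v)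
     E = Extension.extend symmetric (proj₂ (symmetric-spec idP) perm-id) (λ h → proj₁ (symmetric-spec h))
       (λ h a b i k l → proj₂ (symmetric-spec (tr a b ∘ h)) (perm-∘ (perm-tr k l) (proj₁ (symmetric-spec h) i)))
       (finite-⊆ (finite-∪ (proj₁ (proj₂ A)) (proj₁ (proj₂ B))) (λ t i → proj₁ (j-out i))) pj

   module _ (infinite : ¬ Finite X) where

     fresh : ∀ {a} → Finite a → Σ W λ w → w ε X × w ∉ a
     fresh {a} fa = dne λ k → infinite (finite-⊆ fa λ x i → dne λ j → k (x , i , j))

     away : Finite Y → Finite Z → Z ⊆ X → Σ W λ g → Perm g × Away g Z Y
     away {Y} {Z} fy fz Z⊆ = finite-ind (λ i → i ⊆ Z → Σ W λ g → Perm g × Away g i Y)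
       (λ _ → idP , perm-id , λ z i → ∅-elim i)
       (λ i t i⊆ t∈ t∉ fi IH _ →
         let (g , pg , ag) = IH i⊆
             (b , fb , hb) = finite-img (g ·_) fi
             (w , w∈ , w∉) = fresh (finite-∪ fy fb)
         in tr (g · t) w ∘ g , perm-∘ (perm-tr (perm-in pg (Z⊆ t t∈)) w∈) pg ,
            step i t i⊆ t∈ t∉ g pg ag b hb w (λ k → w∉ (∪⁺ k))) fz (λ z i → i)
       where
       step : ∀ i t → i ⊆ Z → t ε Z → t ∉ i → ∀ g → Perm g → Away g i Y → ∀ b → (∀ z → z ε i → g · z ε b) →
              ∀ w → ¬ (w ε Y ⊎ w ε b) → Away (tr (g · t) w ∘ g) (i ∪ ｛ t ｝) Y
       step i t i⊆ t∈ t∉ g pg ag b hb w w∉ z k = ⊎-elim old new (adj-∈ k)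
         where
         t∈X : t ε X
         t∈X = Z⊆ t t∈
         old : z ε i → (tr (g · t) w ∘ g) · z ∉ Y
         old l = subst (_∉ Y) (sym (trans (∘-· z∈X) (trans (tr-· (perm-in pg z∈X)) (swap-else (g · t) w
                   (λ e → t∉ (subst (_ε i) (perm-inj pg z∈X t∈X e) l))
                   (λ e → w∉ (inj₂ (subst (_ε b) e (hb z l)))))))) (ag z l)
           where
           z∈X : z ε X
           z∈X = Z⊆ z (i⊆ z l)
         new : z ≡ t → (tr (g · t) w ∘ g) · z ∉ Y
         new refl l = w∉ (inj₁ (subst (_ε Y) (trans (∘-· t∈X) (trans (tr-· (perm-in pg t∈X)) (swap-a (g · t) w))) l))

 module OverLanguage (X L D : W) (lang : Fun L D ω) where

  open FiniteSets
  open Permutations X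

  module Structures where

    private variable
      a b c f g h k x y z p q A B Y M N r : W

    opaque
      domain : W → W
      domain c = sep (λ i → Σ W λ x → ⟨ i , x ⟩ ε c) (⋃ (⋃ c))

      domain-spec : ∀ c i → i ε domain c ⟺ (Σ W λ x → ⟨ i , x ⟩ ε c)
      domain-spec c i = (λ j → proj₂ (proj₁ (sep-spec (λ i → Σ W λ x → ⟨ i , x ⟩ ε c) (⋃ (⋃ c)) i) j)) ,
        (λ (x , j) → proj₂ (sep-spec (λ i → Σ W λ x → ⟨ i , x ⟩ ε c) (⋃ (⋃ c)) i)
          (⋃⁺ (upair i i , ⋃⁺ (_ , j ,
            subst (upair i i ε_) (sym (⟨⟩-spec i x)) (upair⁺ (inj₁ refl))) , upair⁺ (inj₁ refl)) , x , j))

    domain-fun : {B : W → Set ℓ} → FunP c k B → domain c ≡ k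
    domain-fun {c} {k} F = ⊆-antisym (λ i j → let (x , l) = proj₁ (domain-spec c i) j in proj₁ (graph-dom F l))
      (λ i j → proj₂ (domain-spec c i) (_ , F .total i j))

    -- g ∘ c, for functions c with arbitrary domain.
    opaque
      cmp : W → W → W
      cmp g c = graph (λ i → g · (c · i)) (domain c)

      cmp-spec : ∀ g c p → p ε cmp g c ⟺ (Σ W λ i → (Σ W λ x → ⟨ i , x ⟩ ε c) × p ≡ ⟨ i , g · (c · i) ⟩)
      cmp-spec g c p =
        (λ j → let (i , l , e) = proj₁ (graph-spec (λ i → g · (c · i)) (domain c) p) j in i , proj₁ (domain-spec c i) l , e) ,
        (λ (i , l , e) → proj₂ (graph-spec (λ i → g · (c · i)) (domain c) p) (i , proj₂ (domain-spec c i) l , e))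

      cmp-· : {B : W → Set ℓ} → FunP c k B → x ε k → cmp g c · x ≡ g · (c · x)
      cmp-· {c} {k} {x} {g} F i = graph-· (λ i → g · (c · i)) (subst (x ε_) (sym (domain-fun F)) i)

      cmp-fun : {C : W → Set ℓ} → Fun c k a → (∀ x → x ε a → C (g · x)) → FunP (cmp g c) k C
      cmp-fun {c} {k} {a} {g} {C} F h = subst (λ k → FunP (graph (λ i → g · (c · i)) (domain c)) k C) (domain-fun F)
        (graph-fun (λ i → g · (c · i)) (λ i j → h _ (F .value i (subst (i ε_) (domain-fun F) j))))

    opaque
     instance
      dCmp : ∀ {n} {s t : Env n → W} → ⦃ DefT s ⦄ → ⦃ DefT t ⦄ → DefT λ ρ → cmp (s ρ) (t ρ)
      dCmp = dSet₂ cmp cmp-spec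

    rel-comp : {B : W → Set ℓ} → Fun f k a → FunP g a B → R.IsComp (el h) (el g) (el f) ⟺ (h ≡ cmp g f)
    rel-comp {f} {k} {a} {g} {h} F G =
      (λ H → ext λ p →
        (λ i → let (x , vx , y , vy , z , vz , m , m′ , e) = Equivalence.to (H (el p) (isV p)) (ε→∈ i) in
          to p ⟪ x , vx ⟫ ⟪ y , vy ⟫ ⟪ z , vz ⟫ (proj₁ (rel-↦ {f} {⟪ x , vx ⟫} {⟪ y , vy ⟫}) m)
            (proj₁ (rel-↦ {g} {⟪ y , vy ⟫} {⟪ z , vz ⟫}) m′) (proj₁ (rel-pair {p} {⟪ x , vx ⟫} {⟪ z , vz ⟫}) e)) ,
        (λ i → ∈→ε (Equivalence.from (H (el p) (isV p)) (from p i)))) ,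
      (λ { refl p vp → mk⇔
        (λ i → from ⟪ p , vp ⟫ (∈→ε i))
        (λ (x , vx , y , vy , z , vz , m , m′ , e) → ε→∈
          (to ⟪ p , vp ⟫ ⟪ x , vx ⟫ ⟪ y , vy ⟫ ⟪ z , vz ⟫ (proj₁ (rel-↦ {f} {⟪ x , vx ⟫} {⟪ y , vy ⟫}) m)
            (proj₁ (rel-↦ {g} {⟪ y , vy ⟫} {⟪ z , vz ⟫}) m′) (proj₁ (rel-pair {⟪ p , vp ⟫} {⟪ x , vx ⟫} {⟪ z , vz ⟫}) e))) })
      where
      to : ∀ p x y z → ⟨ x , y ⟩ ε f → ⟨ y , z ⟩ ε g → p ≡ ⟨ x , z ⟩ → p ε cmp g f
      to p x y z i j e = let (_ , ey) = graph-dom F i ; (_ , ez) = graph-dom G j in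
        proj₂ (cmp-spec g f p) (x , (y , i) , trans e (cong ⟨ x ,_⟩ (trans ez (cong (g ·_) ey))))
      from : ∀ p → p ε cmp g f → R.∃ⱽ λ x → R.∃ⱽ λ y → R.∃ⱽ λ z → (el f R.∶ x ↦ y) × (el g R.∶ y ↦ z) × R.IsPair (el p) x z
      from p i = let (x , (y , j) , e) = proj₁ (cmp-spec g f p) i
                     x∈ = proj₁ (graph-dom F j)
                 in el x , isV x , el (f · x) , isV (f · x) , el (g · (f · x)) , isV (g · (f · x)) ,
                    proj₂ (rel-↦ {f} {x} {f · x}) (F .total x x∈) ,
                    proj₂ (rel-↦ {g} {f · x} {g · (f · x)}) (G .total (f · x) (F .value x x∈)) ,
                    proj₂ (rel-pair {p} {x} {g · (f · x)}) e

    cmp-assoc : Fun c k X → Perm h → cmp g (cmp h c) ≡ cmp (g ∘ h) c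
    cmp-assoc {c} {k} {h} {g} F ph =
      let H : Fun (cmp h c) k X
          H = cmp-fun F (λ x → perm-in ph)
      in fun-ext {B = λ y → y ≡ y} {C = λ y → y ≡ y} (cmp-fun H λ _ _ → refl) (cmp-fun F λ _ _ → refl)
           λ x i → trans (cmp-· H i) (trans (cong (g ·_) (cmp-· F i))
             (sym (trans (cmp-· F i) (∘-· (F .value x i)))))

    cmp-fixed : Fun c k X → (∀ i → i ε k → g · (c · i) ≡ c · i) → cmp g c ≡ c
    cmp-fixed F h = fun-ext {B = λ y → y ≡ y} (cmp-fun F λ _ _ → refl) F λ x i → trans (cmp-· F i) (h x i)

    cmp-X : Fun c k X → Perm g → Fun (cmp g c) k X
    cmp-X F p = cmp-fun F (λ x → perm-in p)

    Tuple : W → W → Set ℓ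
    Tuple r c = Fun c (L · r) X

    arity∈ω : r ε D → L · r ε ω
    arity∈ω i = lang .value _ i

    opaque
      unfolding funBound
      Tuples : W
      Tuples = funBound ω X

      tuple∈ : r ε D → Tuple r c → c ε Tuples
      tuple∈ {r} {c} i F = 𝒫-mono (𝒫-mono (𝒫-mono sub)) c (fun∈ F)
        where
        𝒫-mono : ∀ {a b} → a ⊆ b → 𝒫 a ⊆ 𝒫 b
        𝒫-mono h x i = proj₂ (𝒫-spec _ x) λ y j → h y (proj₁ (𝒫-spec _ x) i y j)
        sub : L · r ∪ X ⊆ ω ∪ X
        sub x j = ∪⁺ (⊎-map (λ k → ω-trans k (arity∈ω i)) (λ k → k) (∪⁻ j))

    opaque
      Relations : W
      Relations = 𝒫 Tuples

      relation∈ : r ε D → (∀ c → c ε a → Tuple r c) → a ε Relations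
      relation∈ {r} {a} i h = proj₂ (𝒫-spec Tuples a) λ c j → tuple∈ i (h c j)

    IsStr : W → Set ℓ
    IsStr M = Fun M D Relations × (∀ r c → r ε D → c ε M · r → Tuple r c)

    opaque
      Str : W
      Str = sep IsStr (funBound D Relations)

      Str-spec : ∀ M → M ε Str ⟺ IsStr M
      Str-spec M = (λ i → proj₂ (proj₁ (sep-spec IsStr (funBound D Relations) M) i)) ,
        (λ h → proj₂ (sep-spec IsStr (funBound D Relations) M) (fun∈ (proj₁ h) , h))

    rel-holds : R.HoldsRel (el M) (el r) (el c) ⟺ (c ε M · r)
    rel-holds {M} {r} {c} =
      (λ (y , vy , m , i) → proj₂ (·-spec M r c) (⟪ y , vy ⟫ , proj₁ (rel-↦ {M} {r} {⟪ y , vy ⟫}) m , ∈→ε i)) ,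
      (λ i → let (y , m , j) = proj₁ (·-spec M r c) i in el y , isV y , proj₂ (rel-↦ {M} {r} {y}) m , ε→∈ j)

    str-holds : M ε Str → c ε M · r → r ε D
    str-holds {M} {c} {r} i j = let (y , m , _) = proj₁ (·-spec M r c) j in proj₁ (graph-dom (proj₁ (proj₁ (Str-spec M) i)) m)

    str-tuple : M ε Str → c ε M · r → Tuple r c
    str-tuple {M} i j = proj₂ (proj₁ (Str-spec M) i) _ _ (str-holds i j) j

    str-ext : M ε Str → N ε Str → (∀ r c → r ε D → Tuple r c → c ε M · r ⟺ c ε N · r) → M ≡ N
    str-ext {M} {N} i j h = fun-ext (proj₁ (proj₁ (Str-spec M) i)) (proj₁ (proj₁ (Str-spec N) j)) λ r k → ext λ c →
      (λ l → proj₁ (h r c k (str-tuple i l)) l) , (λ l → proj₂ (h r c k (str-tuple j l)) l)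

    rel-arity : (el L R.∶ el r ↦ el k) ⟺ (r ε D × k ≡ L · r)
    rel-arity {r} {k} = (λ m → graph-dom lang (proj₁ (rel-↦ {L} {r} {k}) m)) ,
      (λ { (i , refl) → proj₂ (rel-↦ {L} {r} {k}) (lang .total r i) })

    rel-tuple : R.IsFun (el c) (el k) (_∈ el a) ⟺ Fun c k a
    rel-tuple {c} {k} {a} = (λ h → FunP-map (λ _ → ∈→ε) (fromIsFun h)) , (λ F → toIsFun (FunP-map (λ _ → ε→∈) F))

    rel-structure : R.IsStructure (el L) (el X) (el M) ⟺ (M ε Str)
    rel-structure {M} = to , from
      where
      to : R.IsStructure (el L) (el X) (el M) → M ε Str
      to ((D′ , vD , FL , FM) , h) = proj₂ (Str-spec M) (FunP-values , tuples)
        where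
        F : FunP M D (λ w → V (el w))
        F = subst (λ a → FunP M a (λ w → V (el w)))
              (trans (sym (domain-fun (fromIsFun {L} {⟪ D′ , vD ⟫} {V} FL))) (domain-fun lang))
              (fromIsFun {M} {⟪ D′ , vD ⟫} {V} FM)
        tuples : ∀ r c → r ε D → c ε M · r → Tuple r c
        tuples r c i j = proj₁ (rel-tuple {c} {L · r} {X}) (h (el r) (isV r) (el (L · r)) (isV (L · r)) (el (M · r)) (isV (M · r))
          (proj₂ (rel-arity {r} {L · r}) (i , refl)) (proj₂ (rel-↦ {M} {r} {M · r}) (F .total r i)) (el c) (isV c) (ε→∈ j))
        FunP-values : Fun M D Relations
        FunP-values .pairs = F .pairs
        FunP-values .total = F .total
        FunP-values .value r i = relation∈ i (λ c → tuples r c i)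
      from : M ε Str → R.IsStructure (el L) (el X) (el M)
      from i = (el D , isV D , toIsFun {L} {D} {V} (FunP-map (λ y _ → isV y) lang) ,
                toIsFun {M} {D} {V} (FunP-map (λ y _ → isV y) (proj₁ (proj₁ (Str-spec M) i)))) ,
        λ r vr k vk P vP a m c vc j →
          let (r∈ , e) = proj₁ (rel-arity {⟪ r , vr ⟫} {⟪ k , vk ⟫}) a
              (_ , e′) = graph-dom (proj₁ (proj₁ (Str-spec M) i)) (proj₁ (rel-↦ {M} {⟪ r , vr ⟫} {⟪ P , vP ⟫}) m)
          in proj₂ (rel-tuple {⟪ c , vc ⟫} {⟪ k , vk ⟫} {X})
               (subst (λ k → Fun ⟪ c , vc ⟫ k X) (sym e) (str-tuple i (subst (⟪ c , vc ⟫ ε_) e′ (∈→ε j))))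

    -- N = g M
    Acts : W → W → W → Set ℓ
    Acts g M N = ∀ r c → r ε D → Tuple r c → c ε M · r ⟺ cmp g c ε N · r

    private
      dPull : ∀ g k n → Def {1} λ ρ → Fun (ρ zero) k X × cmp g (ρ zero) ε n
      dPull g k n = it

      pullRel : W → W → W → W
      pullRel g N r = sep (λ c → Tuple r c × cmp g c ε N · r) ⦃ dPull g (L · r) (N · r) ⦄ Tuples

      pullRel-spec : ∀ g N r c → c ε pullRel g N r ⟺ (c ε Tuples × Tuple r c × cmp g c ε N · r)
      pullRel-spec g N r c = sep-spec (λ c → Tuple r c × cmp g c ε N · r) ⦃ dPull g (L · r) (N · r) ⦄ Tuples c

      dPullRel : ∀ g N → DefT {1} λ ρ → pullRel g N (ρ zero)
      dPullRel g N = dSet₁ (pullRel g N) (pullRel-spec g N)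

    opaque
      pull : W → W → W
      pull g N = graph (pullRel g N) ⦃ dPullRel g N ⦄ D

      pull-· : r ε D → pull g N · r ≡ pullRel g N r
      pull-· {g = g} {N} = graph-· (pullRel g N) ⦃ dPullRel g N ⦄

      pull-Str : ∀ g N → pull g N ε Str
      pull-Str g N = proj₂ (Str-spec _)
        ( graph-fun (pullRel g N) ⦃ dPullRel g N ⦄ (λ r i → relation∈ i λ c j → proj₁ (proj₂ (proj₁ (pullRel-spec g N r c) j)))
        , λ r c i j → proj₁ (proj₂ (proj₁ (pullRel-spec g N r c) (subst (c ε_) (pull-· i) j))) )

      pull-Acts : ∀ g N → Acts g (pull g N) N
      pull-Acts g N r c i t =
        (λ j → proj₂ (proj₂ (proj₁ (pullRel-spec g N r c) (subst (c ε_) (pull-· i) j)))) ,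
        (λ j → subst (c ε_) (sym (pull-· i)) (proj₂ (pullRel-spec g N r c) (tuple∈ i t , t , j)))

    acts-unique : M ε Str → Acts g M N → M ≡ pull g N
    acts-unique {M} {g} {N} i h = str-ext i (pull-Str g N) λ r c k t → ⟺-trans (h r c k t) (⟺-sym (pull-Acts g N r c k t))

    opaque
      img[_] : W → W → W
      img[ g ] A = sep (λ N → Σ W λ M → M ε A × M ε Str × Acts g M N) Str

      img-elems : ∀ g A N → N ε img[ g ] A ⟺ (N ε Str × Σ W λ M → M ε A × M ε Str × Acts g M N)
      img-elems g A N = sep-spec (λ N → Σ W λ M → M ε A × M ε Str × Acts g M N) Str N

    opaque
     instance
      dImg : ∀ {n} {s t : Env n → W} → ⦃ DefT s ⦄ → ⦃ DefT t ⦄ → DefT λ ρ → img[ s ρ ] (t ρ)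
      dImg = dSet₂ img[_] img-elems

    image-spec : ∀ g A N → N ε img[ g ] A ⟺ (N ε Str × pull g N ε A)
    image-spec g A N = ⟺-trans (img-elems g A N)
      ((λ (i , M , j , k , h) → i , subst (_ε A) (acts-unique k h) j) ,
       (λ (i , j) → i , pull g N , j , pull-Str g N , pull-Acts g N))

    image⁻ : N ε img[ g ] A → N ε Str × pull g N ε A
    image⁻ = proj₁ (image-spec _ _ _)

    image⁺ : N ε Str × pull g N ε A → N ε img[ g ] A
    image⁺ = proj₂ (image-spec _ _ _)

    image-⊆ : img[ g ] A ⊆ Str
    image-⊆ N i = proj₁ (image⁻ i)

    pull-∘ : Perm h → pull h (pull g N) ≡ pull (g ∘ h) N
    pull-∘ {h} {g} {N} ph = acts-unique (pull-Str h _) λ r c i t →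
      ⟺-trans (pull-Acts h (pull g N) r c i t) (⟺-trans (pull-Acts g N r (cmp h c) i (cmp-X t ph))
        (subst (_ε N · r) (cmp-assoc t ph) , subst (_ε N · r) (sym (cmp-assoc t ph))))

    image-∘ : Perm h → img[ g ] (img[ h ] A) ≡ img[ g ∘ h ] A
    image-∘ {h} {g} {A} ph = ext λ N →
      (λ i → let (j , k) = image⁻ i ; (_ , l) = image⁻ k in
        image⁺ (j , subst (_ε A) (pull-∘ ph) l)) ,
      (λ i → let (j , k) = image⁻ i in
        image⁺ (j , image⁺ (pull-Str g N , subst (_ε A) (sym (pull-∘ ph)) k)))

    pull-cong : N ε Str → (∀ x → x ε X → g · x ≡ h · x) → pull g N ≡ pull h N
    pull-cong {N} {g} {h} i e = acts-unique (pull-Str g N) λ r c j t → ⟺-trans (pull-Acts g N r c j t)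
      (subst (_ε N · r) (same t) , subst (_ε N · r) (sym (same t)))
      where
      same : ∀ {r c} → Tuple r c → cmp g c ≡ cmp h c
      same t = fun-ext {B = λ y → y ≡ y} {C = λ y → y ≡ y} (cmp-fun t λ _ _ → refl) (cmp-fun t λ _ _ → refl)
        λ x i → trans (cmp-· t i) (trans (e _ (t .value x i)) (sym (cmp-· t i)))

    pull-id : N ε Str → (∀ x → x ε X → g · x ≡ x) → pull g N ≡ N
    pull-id {N} {g} i e = sym (acts-unique i λ r c j t → subst (_ε N · r) (sym (same t)) , subst (_ε N · r) (same t))
      where
      same : ∀ {r c} → Tuple r c → cmp g c ≡ c
      same t = cmp-fixed t λ x i → e _ (t .value x i)

    image-cong : (∀ x → x ε X → g · x ≡ h · x) → img[ g ] A ≡ img[ h ] A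
    image-cong {g} {h} {A} e = ext λ N →
      (λ i → let (j , k) = image⁻ i in image⁺ (j , subst (_ε A) (pull-cong j e) k)) ,
      (λ i → let (j , k) = image⁻ i in image⁺ (j , subst (_ε A) (sym (pull-cong j e)) k))

    image-id : A ⊆ Str → (∀ x → x ε X → g · x ≡ x) → img[ g ] A ≡ A
    image-id {A} {g} s e = ext λ N →
      (λ i → let (j , k) = image⁻ i in subst (_ε A) (pull-id j e) k) ,
      (λ i → image⁺ (s N i , subst (_ε A) (sym (pull-id (s N i) e)) i))

    image-∩ : img[ g ] (A ∩ B) ≡ img[ g ] A ∩ img[ g ] B
    image-∩ {g} {A} {B} = ext λ N →
      (λ i → let (j , k) = image⁻ i ; (l , m) = ∩⁻ k in
        ∩⁺ (image⁺ (j , l) , image⁺ (j , m))) ,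
      (λ i → let (j , k) = ∩⁻ i ; (l , m) = image⁻ j ; (_ , n) = image⁻ k in
        image⁺ (l , ∩⁺ (m , n)))

    image-Str : img[ g ] Str ≡ Str
    image-Str {g} = ext λ N → image-⊆ N , (λ i → image⁺ (i , pull-Str g N))

    image-∖ : img[ g ] (A ∖ B) ≡ img[ g ] A ∖ img[ g ] B
    image-∖ {g} {A} {B} = ext λ N →
      (λ i → let (j , k) = image⁻ i ; (l , m) = ∖⁻ k in
        ∖⁺ (image⁺ (j , l) , λ n → m (proj₂ (image⁻ n)))) ,
      (λ i → let (j , k) = ∖⁻ i ; (l , m) = image⁻ j in
        image⁺ (l , ∖⁺ (m , λ n → k (image⁺ (l , n)))))

    rel-action : M ε Str → Perm g → R.IsAction (el L) (el X) (el g) (el M) (el N) ⟺ (N ε Str × Acts g M N)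
    rel-action {M} {g} {N} i pg =
      (λ (s , h) → proj₁ rel-structure s , λ r c j t →
        let h′ = h (el r) (isV r) (el (L · r)) (isV (L · r)) (el c) (isV c) (el (cmp g c)) (isV (cmp g c))
                   (proj₂ (rel-arity {r} {L · r}) (j , refl)) (proj₂ (rel-tuple {c} {L · r} {X}) t)
                   (proj₂ (rel-comp t (proj₁ pg)) refl)
        in ⟺-trans (⟺-sym (rel-holds {M} {r} {c})) (⟺-trans (⟺-sym (from⇔ h′)) (rel-holds {N} {r} {cmp g c}))) ,
      (λ (s , h) → proj₂ rel-structure s , λ r vr k vk c vc b vb a t e →
        let r′ = ⟪ r , vr ⟫ ; c′ = ⟪ c , vc ⟫ ; b′ = ⟪ b , vb ⟫
            (j , ek) = proj₁ (rel-arity {r′} {⟪ k , vk ⟫}) a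
            t′ = subst (λ k → Fun c′ k X) ek (proj₁ (rel-tuple {c′} {⟪ k , vk ⟫} {X}) t)
            e′ = proj₁ (rel-comp {c′} {L · r′} {X} {g} {b′} t′ (proj₁ pg)) e
        in to⇔ (⟺-trans (rel-holds {N} {r′} {b′}) (⟺-trans (subst (_ε N · r′) e′ , subst (_ε N · r′) (sym e′))
             (⟺-trans (⟺-sym (h r′ c′ j t′)) (⟺-sym (rel-holds {M} {r′} {c′}))))))

    rel-image : A ⊆ Str → Perm g → R.IsImage (el L) (el X) (el g) (el A) (el B) ⟺ (B ≡ img[ g ] A)
    rel-image {A} {g} {B} s pg =
      (λ H → ext λ N → ⟺-trans
        ((λ i → fwd N (Equivalence.to (H (el N) (isV N)) (ε→∈ i))) , (λ i → ∈→ε (Equivalence.from (H (el N) (isV N)) (bwd N i))))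
        (⟺-sym (img-elems g A N))) ,
      (λ { refl n vn → mk⇔ (λ i → bwd ⟪ n , vn ⟫ (proj₁ (img-elems g A ⟪ n , vn ⟫) (∈→ε i)))
                           (λ h → ε→∈ (proj₂ (img-elems g A ⟪ n , vn ⟫) (fwd ⟪ n , vn ⟫ h))) })
      where
      fwd : ∀ N → R.∃∈ (el A) (λ M → R.IsAction (el L) (el X) (el g) M (el N)) →
            N ε Str × Σ W λ M → M ε A × M ε Str × Acts g M N
      fwd N (M , vM , i , h) = let j = s ⟪ M , vM ⟫ (∈→ε i) ; (k , a) = proj₁ (rel-action {⟪ M , vM ⟫} {g} {N} j pg) h in
        k , ⟪ M , vM ⟫ , ∈→ε i , j , a
      bwd : ∀ N → N ε Str × (Σ W λ M → M ε A × M ε Str × Acts g M N) →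
            R.∃∈ (el A) (λ M → R.IsAction (el L) (el X) (el g) M (el N))
      bwd N (k , M , i , j , a) = el M , isV M , ε→∈ i , proj₂ (rel-action {M} {g} {N} j pg) (k , a)

    opaque
      Bas : W → W
      Bas p = sep (λ M → ∀ r c → ⟨ r , c ⟩ ε p → c ε M · r) Str

      Bas-spec : ∀ p M → M ε Bas p ⟺ (M ε Str × ∀ r c → ⟨ r , c ⟩ ε p → c ε M · r)
      Bas-spec p M = sep-spec (λ M → ∀ r c → ⟨ r , c ⟩ ε p → c ε M · r) Str M

    opaque
     instance
      dBas : ∀ {n} {s : Env n → W} → ⦃ DefT s ⦄ → DefT λ ρ → Bas (s ρ)
      dBas = dSet₁ Bas Bas-spec

    AtomSet : W → Set ℓ
    AtomSet p = ∀ t → t ε p → Σ W λ r → Σ W λ c → t ≡ ⟨ r , c ⟩ × r ε D × Tuple r c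

    atom : AtomSet p → ⟨ r , c ⟩ ε p → r ε D × Tuple r c
    atom {p} {r} {c} h i =
      let (r′ , c′ , e , j , t) = h _ i
          (e₁ , e₂) = ⟨⟩-inj e
      in subst (_ε D) (sym e₁) j , subst₂ Tuple (sym e₁) (sym e₂) t

    Condition : W → Set ℓ
    Condition p = Finite p × AtomSet p

    dCondition : Def {1} λ ρ → Condition (ρ zero)
    dCondition = dAnd ⦃ Def₁ Finite dFinite var₀ ⦄ ⦃ it ⦄

    atomset-∪ : AtomSet p → AtomSet q → AtomSet (p ∪ q)
    atomset-∪ {p} {q} h k t i = ⊎-elim (h t) (k t) (∪⁻ i)

    condition-∪ : Condition p → Condition q → Condition (p ∪ q)
    condition-∪ (f , h) (f′ , h′) = finite-∪ f f′ , atomset-∪ h h′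

    condition-∅ : Condition ∅
    condition-∅ = finite-∅ , λ t i → ∅-elim i

    Bas-⊆ : Bas p ⊆ Str
    Bas-⊆ M i = proj₁ (proj₁ (Bas-spec _ M) i)

    Bas-∪ : Bas (p ∪ q) ≡ Bas p ∩ Bas q
    Bas-∪ {p} {q} = ext λ M →
      (λ i → let (s , h) = proj₁ (Bas-spec _ M) i in ∩⁺
        ( proj₂ (Bas-spec p M) (s , λ r c j → h r c (∪⁺ (inj₁ j)))
        , proj₂ (Bas-spec q M) (s , λ r c j → h r c (∪⁺ (inj₂ j))) )) ,
      (λ i → let (j , k) = ∩⁻ i ; (s , h) = proj₁ (Bas-spec p M) j ; (_ , h′) = proj₁ (Bas-spec q M) k in
        proj₂ (Bas-spec _ M) (s , λ r c j → ⊎-elim (h r c) (h′ r c) (∪⁻ j)))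

    Bas-∅ : Bas ∅ ≡ Str
    Bas-∅ = ext λ M → Bas-⊆ M , (λ i → proj₂ (Bas-spec ∅ M) (i , λ r c j → ∅-elim j))

    Supports : W → W → Set ℓ
    Supports Y p = ∀ r c → ⟨ r , c ⟩ ε p → ∀ i → i ε L · r → c · i ε Y

    image-Bas : Perm g → (∀ r c → ⟨ r , c ⟩ ε p → ⟨ r , cmp g c ⟩ ε q) →
                (∀ t → t ε q → Σ W λ r → Σ W λ c → ⟨ r , c ⟩ ε p × t ≡ ⟨ r , cmp g c ⟩) → AtomSet p → img[ g ] (Bas p) ≡ Bas q
    image-Bas {g} {p} {q} pg h k at = ext λ N →
      (λ i → let (j , l) = image⁻ i ; (_ , m) = proj₁ (Bas-spec p _) l in
        proj₂ (Bas-spec q N) (j , λ r d n → let (r′ , c , o , e) = k _ n ; (e₁ , e₂) = ⟨⟩-inj e ; (r∈ , t) = atom at o in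
          subst₂ (λ u v → u ε N · v) (sym e₂) (sym e₁) (proj₁ (pull-Acts g N r′ c r∈ t) (m r′ c o)))) ,
      (λ i → let (j , l) = proj₁ (Bas-spec q N) i in
        image⁺ (j , proj₂ (Bas-spec p _) (pull-Str g N , λ r c o → let (r∈ , t) = atom at o in
          proj₂ (pull-Acts g N r c r∈ t) (l r (cmp g c) (h r c o)))))

    image-Bas-fixed : Perm g → AtomSet p → Supports Y p → Fixes g Y → img[ g ] (Bas p) ≡ Bas p
    image-Bas-fixed {g} {p} {Y} pg at s fx = image-Bas pg
      (λ r c i → subst (λ d → ⟨ r , d ⟩ ε p) (sym (fixed r c i)) i)
      (λ t i → let (r , c , e , _) = at t i ; j = subst (_ε p) e i in
        r , c , j , trans e (cong ⟨ r ,_⟩ (sym (fixed r c j)))) at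
      where
      fixed : ∀ r c → ⟨ r , c ⟩ ε p → cmp g c ≡ c
      fixed r c i = cmp-fixed (proj₂ (atom at i)) λ x j → fx _ (s r c i x j)

    Shift : W → W → W → Set ℓ
    Shift g p q = (∀ r c → ⟨ r , c ⟩ ε p → ⟨ r , cmp g c ⟩ ε q) ×
                  (∀ t → t ε q → Σ W λ r → Σ W λ c → ⟨ r , c ⟩ ε p × t ≡ ⟨ r , cmp g c ⟩)

    shift : Perm g → Condition p → Σ W λ q → Condition q × Shift g p q
    shift {g} {p} pg (fin , at) =
      let (q , fq , h , k) = finite-ind (λ p → Σ W λ q → Finite q × Shift g p q) ⦃ dEx ⦃ dAnd ⦃ Def₁ Finite dFinite var₀ ⦄ ⦃ it ⦄ ⦄ ⦄
            (∅ , finite-∅ , (λ r c i → ∅-elim i) , λ t i → ∅-elim i)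
            (λ a x a⊆ x∈ _ _ (q , fq , h , k) →
              let (r , c , e , _) = at x x∈ in
              q ∪ ｛ ⟨ r , cmp g c ⟩ ｝ , finite-adj _ fq ,
              (λ r′ c′ i → ⊎-elim (λ j → adj-old (h r′ c′ j))
                 (λ e′ → let (e₁ , e₂) = ⟨⟩-inj (trans e′ e) in
                   subst (_ε q ∪ ｛ ⟨ r , cmp g c ⟩ ｝) (sym (cong₂ (λ u v → ⟨ u , cmp g v ⟩) e₁ e₂)) adj-new) (adj-∈ i)) ,
              (λ t i → ⊎-elim (λ j → let (r′ , c′ , l , e′) = k t j in r′ , c′ , adj-old l , e′)
                 (λ e′ → r , c , subst (_ε a ∪ ｛ x ｝) e adj-new , e′) (adj-∈ i))) fin
      in q , (fq , λ t i → let (r , c , j , e) = k t i ; (r∈ , u) = atom at j in r , cmp g c , e , r∈ , cmp-X u pg) , h , k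

    image-shift : Perm g → Condition p → Shift g p q → img[ g ] (Bas p) ≡ Bas q
    image-shift pg (_ , at) (h , k) = image-Bas pg h k at

    support : Condition p → Σ W λ Y → Finite Y × Y ⊆ X × Supports Y p
    support {p} (fin , at) = finite-ind (λ p → Σ W λ Y → Finite Y × Y ⊆ X × Supports Y p) ⦃ dEx ⦃ dAnd ⦃ Def₁ Finite dFinite var₀ ⦄ ⦃ it ⦄ ⦄ ⦄
      (∅ , finite-∅ , (λ x i → ∅-elim i) , λ r c i → ∅-elim i)
      (λ a x a⊆ x∈ _ _ (Y , fY , Y⊆ , s) →
        let (r , c , e , r∈ , t) = at x x∈
            (Z , fZ , h) = finite-img (c ·_) (finite-nat (arity∈ω r∈))
        in Y ∪ (Z ∩ X) , finite-∪ fY (finite-⊆ fZ λ y i → proj₁ (∩⁻ i)) ,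
           (λ y i → ⊎-elim (Y⊆ y) (λ j → proj₂ (∩⁻ j)) (∪⁻ i)) ,
           λ r′ c′ i j k → ∪⁺ (⊎-elim (λ l → inj₁ (s r′ c′ l j k))
             (λ e′ → let (e₁ , e₂) = ⟨⟩-inj (trans e′ e) ; k′ = subst (λ u → j ε L · u) e₁ k in
               inj₂ (subst (λ u → u · j ε Z ∩ X) (sym e₂) (∩⁺ (h j k′ , t .value j k′)))) (adj-∈ i))) fin

    rel-with : {P : 𝕌 → Set ℓ} → R.IsStructuresWith (el L) (el X) P (el A) ⟺ (∀ M → M ε A ⟺ (M ε Str × P (el M)))
    rel-with {A} {P} =
      (λ h M → (λ i → let (s , p) = Equivalence.to (h (el M) (isV M)) (ε→∈ i) in proj₁ (rel-structure {M}) s , p) ,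
               (λ (s , p) → ∈→ε (Equivalence.from (h (el M) (isV M)) (proj₂ (rel-structure {M}) s , p)))) ,
      (λ h M vM → mk⇔
        (λ i → let (s , p) = proj₁ (h ⟪ M , vM ⟫) (∈→ε i) in proj₂ (rel-structure {⟪ M , vM ⟫}) s , p)
        (λ (s , p) → ε→∈ (proj₂ (h ⟪ M , vM ⟫) (proj₁ (rel-structure {⟪ M , vM ⟫}) s , p))))

  module Literals where

    open Structures

    private variable
      a b c i j k n p r t u v x y z φ M : W

    opaque
      one : W
      one = S ∅

      one-def : one ≡ S ∅
      one-def = refl

    one≢∅ : ¬ (one ≡ ∅)
    one≢∅ e = S≢∅ (trans (sym one-def) e)

    rel-is-one : R.IsOne (el u) ⟺ (u ≡ one)
    rel-is-one {u} = ⟺-trans (rel-one {u}) ((λ e → trans e (sym one-def)) , (λ e → trans e one-def))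

    relCode eqCode : W → W → W
    relCode r v = ⟨ ∅ , ⟨ r , v ⟩ ⟩
    eqCode i j  = ⟨ one , ⟨ i , j ⟩ ⟩

    rel-relAtom : R.RelAtom (el φ) (el r) (el v) ⟺ (φ ≡ relCode r v)
    rel-relAtom {φ} {r} {v} =
      (λ (e , ve , p , vp , h , h′ , h″) → trans (proj₁ (rel-pair {φ} {⟪ e , ve ⟫} {⟪ p , vp ⟫}) h″)
         (cong₂ ⟨_,_⟩ (proj₁ (rel-empty {⟪ e , ve ⟫}) h) (proj₁ (rel-pair {⟪ p , vp ⟫} {r} {v}) h′))) ,
      (λ e → el ∅ , isV ∅ , el ⟨ r , v ⟩ , isV ⟨ r , v ⟩ , proj₂ (rel-empty {∅}) refl ,
         proj₂ (rel-pair {⟨ r , v ⟩} {r} {v}) refl , proj₂ (rel-pair {φ} {∅} {⟨ r , v ⟩}) e)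

    rel-eqAtom : R.EqAtom (el φ) (el i) (el j) ⟺ (φ ≡ eqCode i j)
    rel-eqAtom {φ} {i} {j} =
      (λ (e , ve , p , vp , h , h′ , h″) → trans (proj₁ (rel-pair {φ} {⟪ e , ve ⟫} {⟪ p , vp ⟫}) h″)
         (cong₂ ⟨_,_⟩ (proj₁ (rel-is-one {⟪ e , ve ⟫}) h) (proj₁ (rel-pair {⟪ p , vp ⟫} {i} {j}) h′))) ,
      (λ e → el one , isV one , el ⟨ i , j ⟩ , isV ⟨ i , j ⟩ , proj₂ (rel-is-one {one}) refl ,
         proj₂ (rel-pair {⟨ i , j ⟩} {i} {j}) refl , proj₂ (rel-pair {φ} {one} {⟨ i , j ⟩}) e)

    satAtom-rel : Fun v k n → Fun a n X → R.SatAtom (el M) (el (relCode r v)) (el a) ⟺ (cmp a v ε M · r)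
    satAtom-rel {v} {k} {n} {a} {M} {r} V A = to , λ i →
      inj₁ (el r , isV r , el v , isV v , el (cmp a v) , isV (cmp a v) , proj₂ (rel-relAtom {relCode r v} {r} {v}) refl ,
        proj₂ (rel-comp {v} {k} {n} {a} {cmp a v} V A) refl , proj₂ (rel-holds {M} {r} {cmp a v}) i)
      where
      to : R.SatAtom (el M) (el (relCode r v)) (el a) → cmp a v ε M · r
      to (inj₁ (r′ , vr , v′ , vv , b , vb , h , h′ , h″)) = go {b = ⟪ b , vb ⟫} (⟨⟩-inj (proj₂ (⟨⟩-inj (proj₁ (rel-relAtom {relCode r v} {⟪ r′ , vr ⟫} {⟪ v′ , vv ⟫}) h)))) h′ h″
        where
        go : ∀ {r′ v′ b} → r ≡ r′ × v ≡ v′ → R.IsComp (el b) (el a) (el v′) → R.HoldsRel (el M) (el r′) (el b) → cmp a v ε M · r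
        go {b = b} (refl , refl) h′ h″ = subst (_ε M · r) (proj₁ (rel-comp {v} {k} {n} {a} {b} V A) h′) (proj₁ (rel-holds {M} {r} {b}) h″)
      to (inj₂ (i , vi , j , vj , x , vx , h , _)) =
        ⊥-elim (one≢∅ (sym (proj₁ (⟨⟩-inj (proj₁ (rel-eqAtom {relCode r v} {⟪ i , vi ⟫} {⟪ j , vj ⟫}) h)))))

    satAtom-eq : Fun a n X → i ε n → j ε n → R.SatAtom (el M) (el (eqCode i j)) (el a) ⟺ (a · i ≡ a · j)
    satAtom-eq {a} {n} {i} {j} {M} A hi hj = to , λ e →
      inj₂ (el i , isV i , el j , isV j , el (a · i) , isV (a · i) , proj₂ (rel-eqAtom {eqCode i j} {i} {j}) refl ,
        proj₂ (rel-↦ {a} {i} {a · i}) (A .total i hi) ,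
        proj₂ (rel-↦ {a} {j} {a · i}) (subst (λ y → ⟨ j , y ⟩ ε a) (sym e) (A .total j hj)))
      where
      to : R.SatAtom (el M) (el (eqCode i j)) (el a) → a · i ≡ a · j
      to (inj₁ (r , vr , v , vv , b , vb , h , _)) =
        ⊥-elim (one≢∅ (proj₁ (⟨⟩-inj (proj₁ (rel-relAtom {eqCode i j} {⟪ r , vr ⟫} {⟪ v , vv ⟫}) h))))
      to (inj₂ (i′ , vi , j′ , vj , x , vx , h , h′ , h″)) =
        go (⟨⟩-inj (proj₂ (⟨⟩-inj (proj₁ (rel-eqAtom {eqCode i j} {⟪ i′ , vi ⟫} {⟪ j′ , vj ⟫}) h)))) h′ h″
        where
        go : ∀ {i′ j′} → i ≡ i′ × j ≡ j′ → (el a R.∶ el i′ ↦ x) → (el a R.∶ el j′ ↦ x) → a · i ≡ a · j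
        go (refl , refl) h′ h″ = trans (sym (proj₂ (graph-dom A (proj₁ (rel-↦ {a} {i} {⟪ x , vx ⟫}) h′))))
                                       (proj₂ (graph-dom A (proj₁ (rel-↦ {a} {j} {⟪ x , vx ⟫}) h″)))

    private
      Flip : W → W → Set ℓ
      Flip x y = (x ≡ ∅ × y ≡ one) ⊎ (¬ (x ≡ ∅) × y ≡ ∅)

      FlipR : W → W → W → Set ℓ
      FlipR z = Rec (_≡ z) (λ _ → Flip)

      flip-one : ∀ t → Flip one t ⟺ (t ≡ ∅)
      flip-one t = (λ { (inj₁ (e , _)) → ⊥-elim (one≢∅ e) ; (inj₂ (_ , e)) → e }) , (λ e → inj₂ (one≢∅ , e))

      flip-∅ : ∀ t → Flip ∅ t ⟺ (t ≡ one)
      flip-∅ t = (λ { (inj₁ (_ , e)) → e ; (inj₂ (n , _)) → ⊥-elim (n refl) }) , (λ e → inj₁ (refl , e))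

      flip-suc : ∀ z k u t → k ε ω → (∀ y → FlipR z k y ⟺ (y ≡ u)) → FlipR z (S k) t ⟺ Flip u t
      flip-suc z k u t k∈ h = ⟺-trans (Rec-suc {Z = _≡ z} {step = λ _ → Flip} k∈)
        ((λ (y , f , s) → subst (λ y → Flip y t) (proj₁ (h y) f) s) , (λ s → u , proj₂ (h u) refl , s))

      Even Odd : W → Set ℓ
      Even k = ∀ t → (FlipR one k t ⟺ (t ≡ one)) × (FlipR ∅ k t ⟺ (t ≡ ∅))
      Odd k  = ∀ t → (FlipR one k t ⟺ (t ≡ ∅)) × (FlipR ∅ k t ⟺ (t ≡ one))

      even-∅ : Even ∅
      even-∅ t = Rec-zero {step = λ _ → Flip} , Rec-zero {step = λ _ → Flip}

      dParity : Def {1} λ ρ → Even (ρ zero) ⊎ Odd (ρ zero)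
      dParity = dOr ⦃ dAll ⦃ dAnd ⦃ known one one ⦄ ⦃ known ∅ ∅ ⦄ ⦄ ⦄ ⦃ dAll ⦃ dAnd ⦃ known one ∅ ⦄ ⦃ known ∅ one ⦄ ⦄ ⦄
        where
        dFlip : Def {2} λ ρ → Flip (ρ zero) (ρ (suc zero))
        dFlip = it
        dFlipR : ∀ z → Def {2} λ ρ → FlipR z (ρ zero) (ρ (suc zero))
        dFlipR z = dEx ⦃ dAnd ⦃ it ⦄ ⦃ dAnd ⦃ dAll ⦃ dImp ⦃ it ⦄ ⦃ Def₂ Flip dFlip (d· ⦃ var₁ ⦄ ⦃ var₀ ⦄) (d· ⦃ var₁ ⦄ ⦃ d∪ ⦃ var₀ ⦄ ⦃ d｛｝ ⦃ var₀ ⦄ ⦄ ⦄) ⦄ ⦄ ⦄ ⦃ it ⦄ ⦄ ⦄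
        known : ∀ z u → Def {2} λ ρ → FlipR z (ρ (suc zero)) (ρ zero) ⟺ (ρ zero ≡ u)
        known z u = dAnd ⦃ dImp ⦃ Def₂ (FlipR z) (dFlipR z) var₁ var₀ ⦄ ⦃ it ⦄ ⦄ ⦃ dImp ⦃ it ⦄ ⦃ Def₂ (FlipR z) (dFlipR z) var₁ var₀ ⦄ ⦄

      parity : ∀ k → k ε ω → Even k ⊎ Odd k
      parity = ω-ind (λ k → Even k ⊎ Odd k) ⦃ dParity ⦄ (inj₁ even-∅) λ k k∈ → ⊎-elim
        (λ h → inj₂ λ t → ⟺-trans (flip-suc one k one t k∈ (λ y → proj₁ (h y))) (flip-one t) ,
                          ⟺-trans (flip-suc ∅ k ∅ t k∈ (λ y → proj₂ (h y))) (flip-∅ t))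
        (λ h → inj₁ λ t → ⟺-trans (flip-suc one k ∅ t k∈ (λ y → proj₁ (h y))) (flip-∅ t) ,
                          ⟺-trans (flip-suc ∅ k one t k∈ (λ y → proj₂ (h y))) (flip-one t))

      Rec-map : ∀ {Z Z′ : W → Set ℓ} {s s′ : W → W → W → Set ℓ} → (∀ x → Z x → Z′ x) → (∀ i x y → s i x y → s′ i x y) →
                Rec Z s k t → Rec Z′ s′ k t
      Rec-map h h′ (f , z , s , e) = f , h _ z , (λ i j → h′ i _ _ (s i j)) , e

      TV : Set ℓ → W → Set ℓ
      TV B x = (B × x ≡ one) ⊎ (¬ B × x ≡ ∅)

      rel-tv : ∀ {B} → R.TruthValue B (el x) ⟺ TV B x
      rel-tv {x} = (⊎-map (λ (h , b) → b , proj₁ (rel-is-one {x}) h) (λ (h , b) → b , proj₁ (rel-empty {x}) h)) ,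
                   (⊎-map (λ (b , h) → proj₂ (rel-is-one {x}) h , b) (λ (b , h) → proj₂ (rel-empty {x}) h , b))

      rel-flip : ∀ x y → R.TruthValue (R.IsEmpty (el x)) (el y) ⟺ Flip x y
      rel-flip x y = ⟺-trans (rel-tv {y})
        ( ⊎-map (λ (h , e) → proj₁ (rel-empty {x}) h , e) (λ (h , e) → (λ z → h (proj₂ (rel-empty {x}) z)) , e)
        , ⊎-map (λ (h , e) → proj₂ (rel-empty {x}) h , e) (λ (h , e) → (λ z → h (proj₁ (rel-empty {x}) z)) , e) )

      truth : (B : Set ℓ) → k ε ω → R.Rec (R.TruthValue B) (λ _ x y → R.TruthValue (R.IsEmpty x) y) (el k) (el t) ⟺
              Rec (TV B) (λ _ → Flip) k t
      truth {k} {t} B h = ⟺-trans (rel-rec {k} {t} {R.TruthValue B} {λ _ x y → R.TruthValue (R.IsEmpty x) y} h)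
        ( Rec-map {Z = λ x → R.TruthValue B (el x)} {s = λ _ x y → R.TruthValue (R.IsEmpty (el x)) (el y)} (λ x → proj₁ (rel-tv {x})) (λ _ x y → proj₁ (rel-flip x y))
        , Rec-map {Z = TV B} {s = λ _ → Flip} (λ x → proj₂ (rel-tv {x})) (λ _ x y → proj₂ (rel-flip x y)) )

      TV-true : ∀ {B} → B → ∀ x → TV B x ⟺ (x ≡ one)
      TV-true b x = (λ { (inj₁ (_ , e)) → e ; (inj₂ (n , _)) → ⊥-elim (n b) }) , (λ e → inj₁ (b , e))

      TV-false : ∀ {B} → ¬ B → ∀ x → TV B x ⟺ (x ≡ ∅)
      TV-false b x = (λ { (inj₁ (c , _)) → ⊥-elim (b c) ; (inj₂ (_ , e)) → e }) , (λ e → inj₂ (b , e))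

      truth-flip : ∀ {B z} → (∀ x → TV B x ⟺ (x ≡ z)) → Rec (TV B) (λ _ → Flip) k t ⟺ FlipR z k t
      truth-flip {B = B} {z} h = Rec-map {Z = TV B} {s = λ _ → Flip} (λ x → proj₁ (h x)) (λ _ _ _ s → s) ,
                                 Rec-map {Z = _≡ z} {s = λ _ → Flip} (λ x → proj₂ (h x)) (λ _ _ _ s → s)

      even-truth : ∀ {B} → k ε ω → Even k → R.Rec (R.TruthValue B) (λ _ x y → R.TruthValue (R.IsEmpty x) y) (el k) (el one) ⟺ B
      even-truth {k} {B} h ev = ⟺-trans (truth {k} {one} B h) (decide em)
        where
        decide : Dec B → Rec (TV B) (λ _ → Flip) k one ⟺ B
        decide (yes b) = (λ _ → b) , (λ _ → proj₂ (truth-flip (TV-true b)) (proj₂ (proj₁ (ev one)) refl))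
        decide (no nb) = (λ r → ⊥-elim (one≢∅ (proj₁ (proj₂ (ev one)) (proj₁ (truth-flip (TV-false nb)) r)))) , (λ b → ⊥-elim (nb b))

      odd-truth : ∀ {B} → k ε ω → Odd k → R.Rec (R.TruthValue B) (λ _ x y → R.TruthValue (R.IsEmpty x) y) (el k) (el one) ⟺ (¬ B)
      odd-truth {k} {B} h od = ⟺-trans (truth {k} {one} B h) (decide em)
        where
        decide : Dec B → Rec (TV B) (λ _ → Flip) k one ⟺ (¬ B)
        decide (yes b) = (λ r → ⊥-elim (one≢∅ (proj₁ (proj₁ (od one)) (proj₁ (truth-flip (TV-true b)) r)))) , (λ nb → ⊥-elim (nb b))
        decide (no nb) = (λ _ → nb) , (λ _ → proj₂ (truth-flip (TV-false nb)) (proj₂ (proj₂ (od one)) refl))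

    satLiteral-code : k ε ω → R.SatLiteral (el M) (el ⟨ k , φ ⟩) (el a) ⟺
      R.Rec (R.TruthValue (R.SatAtom (el M) (el φ) (el a))) (λ _ x y → R.TruthValue (R.IsEmpty x) y) (el k) (el one)
    satLiteral-code {k} {M} {φ} {a} h =
      (λ (k′ , vk , φ′ , vφ , t , vt , e , o , r) →
         go (⟨⟩-inj (proj₁ (rel-pair {⟨ k , φ ⟩} {⟪ k′ , vk ⟫} {⟪ φ′ , vφ ⟫}) e)) (proj₁ (rel-is-one {⟪ t , vt ⟫}) o) r) ,
      (λ r → el k , isV k , el φ , isV φ , el one , isV one , proj₂ (rel-pair {⟨ k , φ ⟩} {k} {φ}) refl , proj₂ (rel-is-one {one}) refl , r)
      where
      go : ∀ {k′ φ′ t} → k ≡ k′ × φ ≡ φ′ → t ≡ one →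
           R.Rec (R.TruthValue (R.SatAtom (el M) (el φ′) (el a))) (λ _ x y → R.TruthValue (R.IsEmpty x) y) (el k′) (el t) →
           R.Rec (R.TruthValue (R.SatAtom (el M) (el φ) (el a))) (λ _ x y → R.TruthValue (R.IsEmpty x) y) (el k) (el one)
      go (refl , refl) refl r = r

    satLiteral-pos : R.SatLiteral (el M) (el ⟨ ∅ , φ ⟩) (el a) ⟺ R.SatAtom (el M) (el φ) (el a)
    satLiteral-pos {M} {φ} {a} = ⟺-trans (satLiteral-code {∅} {M} {φ} {a} ∅∈ω) (even-truth {∅} ∅∈ω even-∅)

    satLiteral-parity : k ε ω → (∀ M φ a → R.SatLiteral (el M) (el ⟨ k , φ ⟩) (el a) ⟺ R.SatAtom (el M) (el φ) (el a)) ⊎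
                                (∀ M φ a → R.SatLiteral (el M) (el ⟨ k , φ ⟩) (el a) ⟺ (¬ R.SatAtom (el M) (el φ) (el a)))
    satLiteral-parity {k} h = ⊎-map
      (λ ev M φ a → ⟺-trans (satLiteral-code {k} {M} {φ} {a} h) (even-truth {k} h ev))
      (λ od M φ a → ⟺-trans (satLiteral-code {k} {M} {φ} {a} h) (odd-truth {k} h od)) (parity k h)

  module SigmaAlgebra (κ : W) where

    open Structures
    open Literals

    private variable
      f i j r c p A B F G M : W

    SizeLe : W → Set ℓ
    SizeLe G = Σ W λ f → Fun f G κ × Inj f G

    rel-size : R.SizeAtMost (el G) (el κ) ⟺ SizeLe G
    rel-size {G} =
      (λ (f , vf , h , k) → let F = FunP-map (λ _ → ∈→ε) (fromIsFun {⟪ f , vf ⟫} {G} h) in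
         ⟪ f , vf ⟫ , F , proj₁ (rel-inj F) k) ,
      (λ (f , F , k) → el f , isV f , toIsFun (FunP-map (λ _ → ε→∈) F) , proj₂ (rel-inj F) k)

    record Closed (F : W) : Set ℓ where
      field
        subset : ∀ A → A ε F → A ⊆ Str
        full   : Str ε F
        atoms  : ∀ r c → r ε D → Tuple r c → Bas ｛ ⟨ r , c ⟩ ｝ ε F
        compl  : ∀ A → A ε F → Str ∖ A ε F
        unions : ∀ G → G ⊆ F → SizeLe G → ⋃ G ε F

    Bas-single : M ε Bas ｛ ⟨ r , c ⟩ ｝ ⟺ (M ε Str × c ε M · r)
    Bas-single {M} {r} {c} = ⟺-trans (Bas-spec _ M)
      ( (λ (s , h) → s , h r c (proj₂ (｛｝-spec _ _) refl))
      , (λ (s , h) → s , λ r′ c′ i → let (e , e′) = ⟨⟩-inj (proj₁ (｛｝-spec _ _) i) in subst₂ (λ u v → u ε M · v) (sym e′) (sym e) h) )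

    Str∖Str : ∀ {M} → M ∉ Str ∖ Str
    Str∖Str {M} i = let (j , k) = ∖⁻ i in k j

    module _ (C : Closed F) where
      open Closed C

      private
        Sat : W → W → W → Set ℓ
        Sat φ a M = R.SatAtom (el M) (el φ) (el a)

        atomSet : ∀ {n φ a} → Fun a n X → R.IsAtom (el L) (el n) (el φ) → Σ W λ B → B ε F × (∀ M → M ε B ⟺ (M ε Str × Sat φ a M))
        atomSet {n} {φ} {a} A (inj₁ (r , vr , k , vk , v , vv , h , h′ , h″)) =
          Bas ｛ ⟨ r₀ , cmp a v₀ ⟩ ｝ , atoms r₀ (cmp a v₀) r∈ (cmp-fun Vf λ x → A .value x) ,
          λ M → ⟺-trans Bas-single ((λ (s , i) → s , proj₂ (sat M) i) , (λ (s , i) → s , proj₁ (sat M) i))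
          where
          r₀ v₀ : W
          r₀ = ⟪ r , vr ⟫
          v₀ = ⟪ v , vv ⟫
          r∈ : r₀ ε D
          r∈ = proj₁ (proj₁ (rel-arity {r₀} {⟪ k , vk ⟫}) h)
          Vf : Fun v₀ (L · r₀) n
          Vf = subst (λ k → Fun v₀ k n) (proj₂ (proj₁ (rel-arity {r₀} {⟪ k , vk ⟫}) h)) (proj₁ (rel-tuple {v₀} {⟪ k , vk ⟫} {n}) h′)
          sat : ∀ M → Sat φ a M ⟺ (cmp a v₀ ε M · r₀)
          sat M = subst (λ φ → Sat φ a M ⟺ (cmp a v₀ ε M · r₀)) (sym (proj₁ (rel-relAtom {φ} {r₀} {v₀}) h″)) (satAtom-rel {v₀} {L · r₀} {n} {a} {M} {r₀} Vf A)
        atomSet {n} {φ} {a} A (inj₂ (i , vi , i∈ , j , vj , j∈ , h)) = decide em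
          where
          i₀ j₀ : W
          i₀ = ⟪ i , vi ⟫
          j₀ = ⟪ j , vj ⟫
          sat : ∀ M → Sat φ a M ⟺ (a · i₀ ≡ a · j₀)
          sat M = subst (λ φ → Sat φ a M ⟺ (a · i₀ ≡ a · j₀)) (sym (proj₁ (rel-eqAtom {φ} {i₀} {j₀}) h)) (satAtom-eq {a} {n} {i₀} {j₀} {M} A (∈→ε i∈) (∈→ε j∈))
          decide : Dec (a · i₀ ≡ a · j₀) → Σ W λ B → B ε F × (∀ M → M ε B ⟺ (M ε Str × Sat φ a M))
          decide (yes e) = Str , full , λ M → (λ s → s , proj₂ (sat M) e) , proj₁
          decide (no ne) = Str ∖ Str , compl Str full , λ M → (λ i → ⊥-elim (Str∖Str i)) , (λ (_ , s) → ⊥-elim (ne (proj₁ (sat M) s)))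

        literalSet : ∀ {n a l A} → Fun a n X → R.IsLiteral (el L) (el n) (el l) →
                     (∀ M → M ε A ⟺ (M ε Str × R.SatLiteral (el M) (el l) (el a))) → A ε F
        literalSet {n} {a} {l} {A} T (k , vk , φ , vφ , k∈ , at , e) h = ⊎-elim positive negative (satLiteral-parity {k₀} (proj₁ (rel-nat {k₀}) k∈))
          where
          k₀ φ₀ Ba : W
          k₀ = ⟪ k , vk ⟫
          φ₀ = ⟪ φ , vφ ⟫
          Ba = proj₁ (atomSet {n} {φ₀} {a} T at)
          Ba∈ : Ba ε F
          Ba∈ = proj₁ (proj₂ (atomSet {n} {φ₀} {a} T at))
          Ba-spec : ∀ M → M ε Ba ⟺ (M ε Str × Sat φ₀ a M)
          Ba-spec = proj₂ (proj₂ (atomSet {n} {φ₀} {a} T at))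
          h′ : ∀ M → M ε A ⟺ (M ε Str × R.SatLiteral (el M) (el ⟨ k₀ , φ₀ ⟩) (el a))
          h′ = subst (λ l → ∀ M → M ε A ⟺ (M ε Str × R.SatLiteral (el M) (el l) (el a))) (proj₁ (rel-pair {l} {k₀} {φ₀}) e) h
          positive : (∀ M φ a → R.SatLiteral (el M) (el ⟨ k₀ , φ ⟩) (el a) ⟺ R.SatAtom (el M) (el φ) (el a)) → A ε F
          positive sat = subst (_ε F) (ext λ M →
            (λ i → let (s , t) = proj₁ (Ba-spec M) i in proj₂ (h′ M) (s , proj₂ (sat M φ₀ a) t)) ,
            (λ i → let (s , t) = proj₁ (h′ M) i in proj₂ (Ba-spec M) (s , proj₁ (sat M φ₀ a) t))) Ba∈
          negative : (∀ M φ a → R.SatLiteral (el M) (el ⟨ k₀ , φ ⟩) (el a) ⟺ (¬ R.SatAtom (el M) (el φ) (el a))) → A ε F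
          negative sat = subst (_ε F) (ext λ M →
            (λ i → let (s , t) = ∖⁻ i in proj₂ (h′ M) (s , proj₂ (sat M φ₀ a) λ u → t (proj₂ (Ba-spec M) (s , u)))) ,
            (λ i → let (s , t) = proj₁ (h′ M) i in ∖⁺ (s , λ u → proj₁ (sat M φ₀ a) t (proj₂ (proj₁ (Ba-spec M) u)))))
            (compl Ba Ba∈)

      toClosedFamily : R.IsClosedFamily (el κ) (el L) (el X) (el F)
      toClosedFamily = record
        { structures = λ A vA i M vM j → proj₂ (rel-structure {⟪ M , vM ⟫}) (subset ⟪ A , vA ⟫ (∈→ε i) ⟪ M , vM ⟫ (∈→ε j))
        ; literals = λ n vn a va l vl A vA (_ , t) lit h → ε→∈ (literalSet {⟪ n , vn ⟫} {⟪ a , va ⟫} {⟪ l , vl ⟫} {⟪ A , vA ⟫}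
            (proj₁ (rel-tuple {⟪ a , va ⟫} {⟪ n , vn ⟫} {X}) t) lit (proj₁ (rel-with {⟪ A , vA ⟫}) h))
        ; complements = λ A vA i B vB h → let A₀ = ⟪ A , vA ⟫ ; B₀ = ⟪ B , vB ⟫ ; h′ = proj₁ (rel-with {B₀}) h in
            ε→∈ (subst (_ε F) (ext λ M →
              (λ j → let (s , t) = ∖⁻ j in proj₂ (h′ M) (s , λ u → t (∈→ε u))) ,
              (λ j → let (s , t) = proj₁ (h′ M) j in ∖⁺ (s , λ u → t (ε→∈ u)))) (compl A₀ (∈→ε i)))
        ; unions = λ G vG s sz B vB h → let G₀ = ⟪ G , vG ⟫ in
            ε→∈ (subst (_ε F) (sym (proj₁ (rel-union {⟪ B , vB ⟫} {G₀}) h)) (unions G₀ (proj₁ (rel-⊆ {G₀} {F}) s) (proj₁ (rel-size {G₀}) sz))) }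

    fromClosedFamily : R.IsClosedFamily (el κ) (el L) (el X) (el F) → Str ε F → Closed F
    fromClosedFamily {F} h s = record
      { subset = λ A i M j → proj₁ (rel-structure {M}) (structures (el A) (isV A) (ε→∈ i) (el M) (isV M) (ε→∈ j))
      ; full = s
      ; atoms = λ r c i t → atom∈ r c i t
      ; compl = λ A i → ∈→ε (complements (el A) (isV A) (ε→∈ i) (el (Str ∖ A)) (isV (Str ∖ A)) (proj₂ (rel-with {Str ∖ A}) λ M →
          (λ j → let (s , t) = ∖⁻ j in s , λ u → t (∈→ε u)) ,
          (λ (s , t) → ∖⁺ (s , λ u → t (ε→∈ u)))))
      ; unions = λ G s sz → ∈→ε (unions (el G) (isV G) (proj₂ (rel-⊆ {G} {F}) s) (proj₂ (rel-size {G}) sz) (el (⋃ G)) (isV (⋃ G)) (proj₂ (rel-union {⋃ G} {G}) refl)) }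
      where
      open R.IsClosedFamily h
      atom∈ : ∀ r c → r ε D → Tuple r c → Bas ｛ ⟨ r , c ⟩ ｝ ε F
      atom∈ r c i t = ∈→ε (literals (el n) (isV n) (el c) (isV c) (el ⟨ ∅ , φ ⟩) (isV ⟨ ∅ , φ ⟩) (el At) (isV At)
        (proj₂ (rel-nat {n}) (arity∈ω i) , proj₂ (rel-tuple {c} {n} {X}) t)
        (el ∅ , isV ∅ , el φ , isV φ , proj₂ (rel-nat {∅}) ∅∈ω ,
          inj₁ (el r , isV r , el n , isV n , el v , isV v , proj₂ (rel-arity {r} {n}) (i , refl) , proj₂ (rel-tuple {v} {n} {n}) Vf ,
                proj₂ (rel-relAtom {φ} {r} {v}) refl) ,
          proj₂ (rel-pair {⟨ ∅ , φ ⟩} {∅} {φ}) refl)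
        (proj₂ (rel-with {At}) λ M → ⟺-trans Bas-single
          ( (λ (s , j) → s , proj₂ (satLiteral-pos {M} {φ} {c}) (proj₂ (satAtom-rel {v} {n} {n} {c} {M} {r} Vf t) (subst (_ε M · r) (sym c≡) j)))
          , (λ (s , j) → s , subst (_ε M · r) c≡ (proj₁ (satAtom-rel {v} {n} {n} {c} {M} {r} Vf t) (proj₁ (satLiteral-pos {M} {φ} {c}) j))) )))
        where
        n v φ At : W
        n = L · r
        v = graph (λ x → x) n
        φ = relCode r v
        At = Bas ｛ ⟨ r , c ⟩ ｝
        Vf : Fun v n n
        Vf = graph-fun (λ x → x) λ x i → i
        c≡ : cmp c v ≡ c
        c≡ = fun-ext {B = λ y → y ≡ y} (cmp-fun Vf λ _ _ → refl) t λ x i → trans (cmp-· Vf i) (cong (c ·_) (graph-· (λ x → x) i))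

    Ordinal : Set ℓ
    Ordinal = (∀ x → x ε κ → x ⊆ κ) × (∀ x → x ε κ → ∀ y → y ε x → y ⊆ x)

    rel-ordinal : R.IsOrdinal (el κ) ⟺ Ordinal
    rel-ordinal =
      (λ (h , k) → (λ x i → proj₁ rel-⊆ (h (el x) (isV x) (ε→∈ i))) , (λ x i y j → proj₁ rel-⊆ (k (el x) (isV x) (ε→∈ i) (el y) (isV y) (ε→∈ j)))) ,
      (λ (h , k) → (λ x vx i → proj₂ (rel-⊆ {⟪ x , vx ⟫} {κ}) (h ⟪ x , vx ⟫ (∈→ε i))) ,
         (λ x vx i y vy j → proj₂ (rel-⊆ {⟪ y , vy ⟫} {⟪ x , vx ⟫}) (k ⟪ x , vx ⟫ (∈→ε i) ⟪ y , vy ⟫ (∈→ε j))))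

    minimal : (P : W → Set ℓ) → ⦃ Def {1} λ ρ → P (ρ zero) ⦄ → ∀ a x → x ε a → P x →
              Σ W λ m → m ε a × P m × (∀ y → y ε m → y ε a → ¬ P y)
    minimal P a x i p =
      let (m , j , h) = foundation {sep P a} (x , proj₂ (sep-spec P a x) (i , p))
          (k , q) = proj₁ (sep-spec P a m) j
      in m , k , q , λ y l n r → h y l (proj₂ (sep-spec P a y) (n , r))

    Comparable : W → W → Set ℓ
    Comparable j k = j ε k ⊎ j ≡ k ⊎ k ε j

    opaque
      trichotomy : Ordinal → ∀ {j k} → j ε κ → k ε κ → Comparable j k
      trichotomy (tκ , tt) {j₀} {k₀} hj hk = dne λ bad →
        let (j , j∈ , (k₁ , k₁∈ , nj) , minj) = minimal (λ j → Σ W λ k → k ε κ × ¬ Comparable j k) κ j₀ hj (k₀ , hk , bad)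
            (k , k∈ , nk , mink) = minimal (λ k → ¬ Comparable j k) κ k₁ k₁∈ nj
            j⊆k : j ⊆ k
            j⊆k x i = ⊎-elim (λ l → l) (⊎-elim (λ { refl → ⊥-elim (nk (inj₂ (inj₂ i))) }) (λ l → ⊥-elim (nk (inj₂ (inj₂ (tt j j∈ x i k l))))))
              (dne λ n → minj x i (tκ j j∈ x i) (k , k∈ , n))
            k⊆j : k ⊆ j
            k⊆j x i = ⊎-elim (λ l → ⊥-elim (nk (inj₁ (tt k k∈ x i j l)))) (⊎-elim (λ { refl → ⊥-elim (nk (inj₁ i)) }) (λ l → l))
              (dne λ n → mink x i (tκ k k∈ x i) n)
        in nk (inj₂ (inj₁ (⊆-antisym j⊆k k⊆j)))

    opaque
      seq⋃ : W → W
      seq⋃ A = sep (λ M → Σ W λ i → i ε κ × M ε A · i) Str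

      seq⋃-spec : ∀ A M → M ε seq⋃ A ⟺ (M ε Str × Σ W λ i → i ε κ × M ε A · i)
      seq⋃-spec A M = sep-spec (λ M → Σ W λ i → i ε κ × M ε A · i) Str M

    opaque
     instance
      dSeq⋃ : ∀ {n} {s : Env n → W} → ⦃ DefT s ⦄ → DefT λ ρ → seq⋃ (s ρ)
      dSeq⋃ = dSet₁ seq⋃ seq⋃-spec

    Disjoint : W → Set ℓ
    Disjoint A = ∀ i j → i ε κ → j ε κ → ¬ (i ≡ j) → ∀ M → M ε A · i → M ∉ A · j

    choose : (Z : W) (A B : W) → W → W → W → W
    choose Z A B i₀ i₁ i with em {i ≡ i₀} | em {i ≡ i₁}
    ... | yes _ | _     = A
    ... | no _  | yes _ = B
    ... | no _  | no _  = Z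

    choose₀ : ∀ Z A B i₀ i₁ → choose Z A B i₀ i₁ i₀ ≡ A
    choose₀ Z A B i₀ i₁ with em {i₀ ≡ i₀} | em {i₀ ≡ i₁}
    ... | yes _ | _ = refl
    ... | no h  | _ = ⊥-elim (h refl)

    choose₁ : ∀ Z A B {i₀ i₁} → ¬ (i₀ ≡ i₁) → choose Z A B i₀ i₁ i₁ ≡ B
    choose₁ Z A B {i₀} {i₁} ne with em {i₁ ≡ i₀} | em {i₁ ≡ i₁}
    ... | yes e | _     = ⊥-elim (ne (sym e))
    ... | no _  | yes _ = refl
    ... | no _  | no h  = ⊥-elim (h refl)

    choose-else : ∀ Z A B {i₀ i₁ i} → ¬ (i ≡ i₀) → ¬ (i ≡ i₁) → choose Z A B i₀ i₁ i ≡ Z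
    choose-else Z A B {i₀} {i₁} {i} h k with em {i ≡ i₀} | em {i ≡ i₁}
    ... | yes e | _     = ⊥-elim (h e)
    ... | no _  | yes e = ⊥-elim (k e)
    ... | no _  | no _  = refl

    private
      choose-char : ∀ Z A B i₀ i₁ i y → (y ≡ choose Z A B i₀ i₁ i) ⟺
        ((i ≡ i₀ × y ≡ A) ⊎ (¬ (i ≡ i₀) × i ≡ i₁ × y ≡ B) ⊎ (¬ (i ≡ i₀) × ¬ (i ≡ i₁) × y ≡ Z))
      choose-char Z A B i₀ i₁ i y with em {i ≡ i₀} | em {i ≡ i₁}
      ... | yes h | _ = (λ e → inj₁ (h , e)) , λ { (inj₁ (_ , e)) → e ; (inj₂ (inj₁ (k , _))) → ⊥-elim (k h) ; (inj₂ (inj₂ (k , _))) → ⊥-elim (k h) }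
      ... | no h | yes k = (λ e → inj₂ (inj₁ (h , k , e))) , λ { (inj₁ (l , _)) → ⊥-elim (h l) ; (inj₂ (inj₁ (_ , _ , e))) → e ; (inj₂ (inj₂ (_ , l , _))) → ⊥-elim (l k) }
      ... | no h | no k = (λ e → inj₂ (inj₂ (h , k , e))) , λ { (inj₁ (l , _)) → ⊥-elim (h l) ; (inj₂ (inj₁ (_ , l , _))) → ⊥-elim (k l) ; (inj₂ (inj₂ (_ , _ , e))) → e }

    dChoose : ∀ Z A B i₀ i₁ → DefT {1} λ ρ → choose Z A B i₀ i₁ (ρ zero)
    dChoose Z A B i₀ i₁ = mkDefT (Def-≈ (λ ρ → choose-char Z A B i₀ i₁ (ρ (suc zero)) (ρ zero)) it)

  module PiLambda (κ 𝒮 : W) (closed : SigmaAlgebra.Closed κ 𝒮) (least : ∀ F → SigmaAlgebra.Closed κ F → 𝒮 ⊆ F)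
    (ord : SigmaAlgebra.Ordinal κ) (i₀ i₁ : W) (i₀∈ : i₀ ε κ) (i₁∈ : i₁ ε κ) (i₀≢i₁ : ¬ (i₀ ≡ i₁)) where

    open Structures
    open SigmaAlgebra κ

    private variable
      i j p q A B F M : W

    ∅ˢ∈ : ∅ ε 𝒮
    ∅ˢ∈ = subst (_ε 𝒮) (⊆-antisym (λ M i → ⊥-elim (Str∖Str i)) (λ M i → ∅-elim i)) (Closed.compl closed Str (Closed.full closed))

    𝒮⊆ : A ε 𝒮 → A ⊆ Str
    𝒮⊆ = Closed.subset closed _

    𝒮-∖ : A ε 𝒮 → Str ∖ A ε 𝒮
    𝒮-∖ = Closed.compl closed _

    opaque
      𝒮-∪ : A ε 𝒮 → B ε 𝒮 → A ∪ B ε 𝒮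
      𝒮-∪ {A} {B} a b = subst (_ε 𝒮) ⋃≡ (Closed.unions closed (upair A B) (λ C i → ⊎-elim (λ { refl → a }) (λ { refl → b }) (upair⁻ i))
        (graph ix ⦃ dIx ⦄ (upair A B) , graph-fun ix ⦃ dIx ⦄ (λ C i → in-κ C em) ,
          λ C C′ i j e → inj C C′ (upair⁻ i) (upair⁻ j)
            (trans (sym (graph-· ix ⦃ dIx ⦄ i)) (trans e (graph-· ix ⦃ dIx ⦄ j)))))
        where
        ix : W → W
        ix = choose i₁ i₀ i₁ A B
        dIx : DefT {1} λ ρ → ix (ρ zero)
        dIx = dChoose i₁ i₀ i₁ A B
        ⋃≡ : ⋃ (upair A B) ≡ A ∪ B
        ⋃≡ = ext λ x →
          (λ i → let (C , j , k) = ⋃⁻ i in ∪⁺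
            (⊎-map (λ e → subst (x ε_) e k) (λ e → subst (x ε_) e k) (upair⁻ j))) ,
          (λ i → ⊎-elim (λ k → ⋃⁺ (A , upair⁺ (inj₁ refl) , k))
                        (λ k → ⋃⁺ (B , upair⁺ (inj₂ refl) , k)) (∪⁻ i))
        else-i₁ : ∀ C → ¬ (C ≡ A) → ix C ≡ i₁
        else-i₁ C ne with em {C ≡ A} | em {C ≡ B}
        ... | yes e | _     = ⊥-elim (ne e)
        ... | no _  | yes _ = refl
        ... | no _  | no _  = refl
        in-κ : ∀ C → Dec (C ≡ A) → ix C ε κ
        in-κ C (yes refl) = subst (_ε κ) (sym (choose₀ i₁ i₀ i₁ A B)) i₀∈
        in-κ C (no ne)    = subst (_ε κ) (sym (else-i₁ C ne)) i₁∈
        inj : ∀ C C′ → C ≡ A ⊎ C ≡ B → C′ ≡ A ⊎ C′ ≡ B → ix C ≡ ix C′ → C ≡ C′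
        inj C C′ (inj₁ refl) (inj₁ refl) e = refl
        inj C C′ (inj₁ refl) (inj₂ refl) e = dne λ ne → i₀≢i₁ (trans (sym (choose₀ i₁ i₀ i₁ A B)) (trans e (else-i₁ B λ k → ne (sym k))))
        inj C C′ (inj₂ refl) (inj₁ refl) e = dne λ ne → i₀≢i₁ (sym (trans (sym (else-i₁ B ne)) (trans e (choose₀ i₁ i₀ i₁ A B))))
        inj C C′ (inj₂ refl) (inj₂ refl) e = refl

    ∩-as-∖ : A ⊆ Str → Str ∖ ((Str ∖ A) ∪ (Str ∖ B)) ≡ A ∩ B
    ∩-as-∖ {A} {B} s = ext λ M →
      (λ i → let (j , k) = ∖⁻ i in ∩⁺
        ( dne (λ n → k (∪⁺ (inj₁ (∖⁺ (j , n)))))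
        , dne (λ n → k (∪⁺ (inj₂ (∖⁺ (j , n))))) )) ,
      (λ i → let (j , k) = ∩⁻ i in ∖⁺ (s M j , λ l →
        ⊎-elim (λ n → proj₂ (∖⁻ n) j) (λ n → proj₂ (∖⁻ n) k) (∪⁻ l)))

    𝒮-∩ : A ε 𝒮 → B ε 𝒮 → A ∩ B ε 𝒮
    𝒮-∩ a b = subst (_ε 𝒮) (∩-as-∖ (𝒮⊆ a)) (𝒮-∖ (𝒮-∪ (𝒮-∖ a) (𝒮-∖ b)))

    opaque
      Bas∈ : Condition p → Bas p ε 𝒮
      Bas∈ {p} (fin , at) = finite-ind (λ q → Bas q ε 𝒮) (subst (_ε 𝒮) (sym Bas-∅) (Closed.full closed))
        (λ q t _ t∈ _ _ IH → subst (_ε 𝒮) (sym Bas-∪) (𝒮-∩ IH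
          (let (r , c , e , r∈ , u) = at t t∈ in subst (λ t → Bas ｛ t ｝ ε 𝒮) (sym e) (Closed.atoms closed r c r∈ u)))) fin

    record Lambda (F : W) : Set ℓ where
      field
        within : F ⊆ 𝒮
        basic  : ∀ p → Condition p → Bas p ε F
        compl  : ∀ A → A ε F → Str ∖ A ε F
        unions : ∀ A → Fun A κ F → Disjoint A → seq⋃ A ε 𝒮 → seq⋃ A ε F

    private
      Lambda-char : Lambda F ⟺ (F ⊆ 𝒮 × (∀ p → Condition p → Bas p ε F) × (∀ A → A ε F → Str ∖ A ε F) ×
                                (∀ A → Fun A κ F → Disjoint A → seq⋃ A ε 𝒮 → seq⋃ A ε F))
      Lambda-char = (λ l → let open Lambda l in within , basic , compl , unions) ,
                    (λ (a , b , c , d) → record { within = a ; basic = b ; compl = c ; unions = d })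

      dLambda : Def {1} λ ρ → Lambda (ρ zero)
      dLambda = Def-≈ (λ ρ → Lambda-char)
        (dAnd ⦃ it ⦄ ⦃ dAnd ⦃ dAll ⦃ dImp ⦃ Def₁ Condition dCondition var₀ ⦄ ⦃ it ⦄ ⦄ ⦄ ⦃ dAnd ⦃ it ⦄ ⦃ it ⦄ ⦄ ⦄)

    -- The sequence A, B, ∅, ∅, …
    module Pair {F A B : W} (∅∈ : ∅ ε F) (a : A ε F) (b : B ε F) (A⊆ : A ⊆ Str) (B⊆ : B ⊆ Str)
                (dis : ∀ M → M ε A → M ∉ B) where

      private
        G : W → W
        G = choose ∅ A B i₀ i₁

        dG : DefT {1} λ ρ → G (ρ zero)
        dG = dChoose ∅ A B i₀ i₁

      seq : W
      seq = graph G ⦃ dG ⦄ κ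

      seq₀ : seq · i₀ ≡ A
      seq₀ = trans (graph-· G ⦃ dG ⦄ i₀∈) (choose₀ ∅ A B i₀ i₁)

      seq₁ : seq · i₁ ≡ B
      seq₁ = trans (graph-· G ⦃ dG ⦄ i₁∈) (choose₁ ∅ A B i₀≢i₁)

      seq-else : ∀ {i} → i ε κ → ¬ (i ≡ i₀) → ¬ (i ≡ i₁) → seq · i ≡ ∅
      seq-else hi h k = trans (graph-· G ⦃ dG ⦄ hi) (choose-else ∅ A B h k)

      cases : ∀ {i M} → i ε κ → M ε seq · i → (i ≡ i₀ × M ε A) ⊎ (i ≡ i₁ × M ε B)
      cases {i} {M} hi h = go em em
        where
        go : Dec (i ≡ i₀) → Dec (i ≡ i₁) → (i ≡ i₀ × M ε A) ⊎ (i ≡ i₁ × M ε B)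
        go (yes refl) _          = inj₁ (refl , subst (M ε_) seq₀ h)
        go (no _)     (yes refl) = inj₂ (refl , subst (M ε_) seq₁ h)
        go (no k)     (no l)     = ⊥-elim (∉∅ (subst (M ε_) (seq-else hi k l) h))

      seq-fun : Fun seq κ F
      seq-fun = graph-fun G ⦃ dG ⦄ λ i hi → go i em em
        where
        go : ∀ i → Dec (i ≡ i₀) → Dec (i ≡ i₁) → G i ε F
        go i (yes refl) _ = subst (_ε F) (sym (choose₀ ∅ A B i₀ i₁)) a
        go i (no _) (yes refl) = subst (_ε F) (sym (choose₁ ∅ A B i₀≢i₁)) b
        go i (no h) (no k) = subst (_ε F) (sym (choose-else ∅ A B h k)) ∅∈

      disj : Disjoint seq
      disj i j hi hj ne M m m′ = go (cases hi m) (cases hj m′)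
        where
        go : (i ≡ i₀ × M ε A) ⊎ (i ≡ i₁ × M ε B) → (j ≡ i₀ × M ε A) ⊎ (j ≡ i₁ × M ε B) → ⊥
        go (inj₁ (e , h)) (inj₁ (e′ , h′)) = ne (trans e (sym e′))
        go (inj₁ (e , h)) (inj₂ (e′ , h′)) = dis M h h′
        go (inj₂ (e , h)) (inj₁ (e′ , h′)) = dis M h′ h
        go (inj₂ (e , h)) (inj₂ (e′ , h′)) = ne (trans e (sym e′))

      ⋃≡ : seq⋃ seq ≡ A ∪ B
      ⋃≡ = ext λ M →
        (λ h → let (_ , i , hi , m) = proj₁ (seq⋃-spec seq M) h in ∪⁺ (⊎-map proj₂ proj₂ (cases hi m))) ,
        (λ i → ⊎-elim
          (λ k → proj₂ (seq⋃-spec seq M) (A⊆ M k , i₀ , i₀∈ , subst (M ε_) (sym seq₀) k))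
          (λ k → proj₂ (seq⋃-spec seq M) (B⊆ M k , i₁ , i₁∈ , subst (M ε_) (sym seq₁) k)) (∪⁻ i))

    module LambdaFacts (Λ : Lambda F) where
      open Lambda Λ

      Str∈ : Str ε F
      Str∈ = subst (_ε F) Bas-∅ (basic ∅ condition-∅)

      ∅∈ : ∅ ε F
      ∅∈ = subst (_ε F) (⊆-antisym (λ M i → ⊥-elim (Str∖Str i)) (λ M i → ∅-elim i)) (compl Str Str∈)

      opaque
        ⊔∈ : A ε F → B ε F → (∀ M → M ε A → M ∉ B) → A ∪ B ε F
        ⊔∈ {A} {B} a b dis = subst (_ε F) ⋃≡ (unions seq seq-fun disj (subst (_ε 𝒮) (sym ⋃≡) (𝒮-∪ (within A a) (within B b))))
          where open Pair ∅∈ a b (𝒮⊆ (within A a)) (𝒮⊆ (within B b)) dis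

      ∖∈ : A ε F → B ε F → B ⊆ A → A ∖ B ε F
      ∖∈ {A} {B} a b s = subst (_ε F) eq (compl _ (⊔∈ (compl A a) b λ M i j → proj₂ (∖⁻ i) (s M j)))
        where
        eq : Str ∖ ((Str ∖ A) ∪ B) ≡ A ∖ B
        eq = ext λ M →
          (λ i → let (j , k) = ∖⁻ i in ∖⁺
            ( dne (λ n → k (∪⁺ (inj₁ (∖⁺ (j , n)))))
            , λ n → k (∪⁺ (inj₂ n)) )) ,
          (λ i → let (j , k) = ∖⁻ i in ∖⁺ (𝒮⊆ (within A a) M j , λ l →
            ⊎-elim (λ n → proj₂ (∖⁻ n) j) k (∪⁻ l)))

    opaque
      Λ₀ : W
      Λ₀ = sep (λ A → ∀ F → Lambda F → A ε F) ⦃ dΛ ⦄ 𝒮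
        where
        dΛ : Def {1} λ ρ → ∀ F → Lambda F → ρ zero ε F
        dΛ = dAll ⦃ dImp ⦃ Def₁ Lambda dLambda var₀ ⦄ ⦃ it ⦄ ⦄

      Λ₀-spec : ∀ A → A ε Λ₀ ⟺ (A ε 𝒮 × ∀ F → Lambda F → A ε F)
      Λ₀-spec A = sep-spec (λ A → ∀ F → Lambda F → A ε F) ⦃ _ ⦄ 𝒮 A

    Λ₀-least : Lambda F → Λ₀ ⊆ F
    Λ₀-least {F} l A i = proj₂ (proj₁ (Λ₀-spec A) i) F l

    Λ₀-lambda : Lambda Λ₀
    Λ₀-lambda = record
      { within = λ A i → proj₁ (proj₁ (Λ₀-spec A) i)
      ; basic  = λ p c → proj₂ (Λ₀-spec _) (Bas∈ c , λ F l → Lambda.basic l p c)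
      ; compl  = λ A i → let (j , h) = proj₁ (Λ₀-spec A) i in proj₂ (Λ₀-spec _) (𝒮-∖ j , λ F l → Lambda.compl l A (h F l))
      ; unions = λ A f d s → proj₂ (Λ₀-spec _) (s , λ F l → Lambda.unions l A (FunP-map (λ B i → Λ₀-least l B i) f) d s) }

    private module Λ₀ = LambdaFacts Λ₀-lambda

    private
      trace : W → W
      trace A = sep (λ B → A ∩ B ε Λ₀) 𝒮

      trace-spec : ∀ A B → B ε trace A ⟺ (B ε 𝒮 × A ∩ B ε Λ₀)
      trace-spec A B = sep-spec (λ B → A ∩ B ε Λ₀) 𝒮 B

      trace-lambda : A ε Λ₀ → (∀ p → Condition p → A ∩ Bas p ε Λ₀) → Lambda (trace A)
      trace-lambda {A} a h = record
        { within = λ B i → proj₁ (proj₁ (trace-spec A B) i)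
        ; basic  = λ p c → proj₂ (trace-spec A _) (Bas∈ c , h p c)
        ; compl  = λ B i → let (j , k) = proj₁ (trace-spec A B) i in
            proj₂ (trace-spec A _) (𝒮-∖ j , subst (_ε Λ₀) (eq B) (Λ₀.∖∈ a k λ M l → proj₁ (∩⁻ l)))
        ; unions = λ B f d s → proj₂ (trace-spec A _) (s , subst (_ε Λ₀) (sym (dist B)) (Lambda.unions Λ₀-lambda (graph (λ i → A ∩ (B · i)) κ)
            (graph-fun (λ i → A ∩ (B · i)) λ i hi → proj₂ (proj₁ (trace-spec A _) (f .value i hi)))
            (λ i j hi hj ne M m m′ → d i j hi hj ne M
               (proj₂ (∩⁻ (subst (M ε_) (graph-· (λ i → A ∩ (B · i)) hi) m)))
               (proj₂ (∩⁻ (subst (M ε_) (graph-· (λ i → A ∩ (B · i)) hj) m′))))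
            (subst (_ε 𝒮) (dist B) (𝒮-∩ a′ s)))) }
        where
        a′ : A ε 𝒮
        a′ = Lambda.within Λ₀-lambda A a
        eq : ∀ B → A ∖ (A ∩ B) ≡ A ∩ (Str ∖ B)
        eq B = ext λ M →
          (λ i → let (j , k) = ∖⁻ i in ∩⁺ (j , ∖⁺ (𝒮⊆ a′ M j , λ l → k (∩⁺ (j , l))))) ,
          (λ i → let (j , k) = ∩⁻ i in ∖⁺ (j , λ l → proj₂ (∖⁻ k) (proj₂ (∩⁻ l))))
        dist : ∀ B → A ∩ seq⋃ B ≡ seq⋃ (graph (λ i → A ∩ (B · i)) κ)
        dist B = ext λ M →
          (λ h → let (j , k) = ∩⁻ h ; (s , i , hi , m) = proj₁ (seq⋃-spec B M) k in
            proj₂ (seq⋃-spec _ M) (s , i , hi , subst (M ε_) (sym (graph-· (λ i → A ∩ (B · i)) hi)) (∩⁺ (j , m)))) ,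
          (λ h → let (s , i , hi , m) = proj₁ (seq⋃-spec _ M) h
                     (j , k) = ∩⁻ (subst (M ε_) (graph-· (λ i → A ∩ (B · i)) hi) m)
                 in ∩⁺ (j , proj₂ (seq⋃-spec B M) (s , i , hi , k)))

    ∩∈ : A ε Λ₀ → B ε Λ₀ → A ∩ B ε Λ₀
    ∩∈ {A} {B} a b = proj₂ (proj₁ (trace-spec A B) (Λ₀-least (trace-lambda a with-basic) B b))
      where
      with-basic : ∀ p → Condition p → A ∩ Bas p ε Λ₀
      with-basic p c = subst (_ε Λ₀) ∩-comm (proj₂ (proj₁ (trace-spec (Bas p) A) (Λ₀-least (trace-lambda (Lambda.basic Λ₀-lambda p c)
        (λ q d → subst (_ε Λ₀) Bas-∪ (Lambda.basic Λ₀-lambda _ (condition-∪ c d)))) A a)))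

    private
      module Disjointify (G : W) (G⊆ : G ⊆ Λ₀) (f : W) (F : Fun f G κ) (inj : Inj f G) where

        below : W → W
        below i = sep (λ Z → f · Z ε i) G

        below-spec : ∀ i Z → Z ε below i ⟺ (Z ε G × f · Z ε i)
        below-spec i Z = sep-spec (λ Z → f · Z ε i) G Z

        upto : W → W
        upto i = ⋃ (below i)

        upto-spec : ∀ i M → M ε upto i ⟺ (Σ W λ Z → Z ε G × f · Z ε i × M ε Z)
        upto-spec i M =
          (λ h → let (Z , j , k) = ⋃⁻ h ; (l , m) = proj₁ (below-spec i Z) j in Z , l , m , k) ,
          (λ (Z , l , m , k) → ⋃⁺ (Z , proj₂ (below-spec i Z) (l , m) , k))

        upto∈𝒮 : ∀ i → upto i ε 𝒮
        upto∈𝒮 i = Closed.unions closed _ (λ Z h → Lambda.within Λ₀-lambda Z (G⊆ Z (sub Z h)))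
          (graph (f ·_) (below i) , graph-fun (f ·_) (λ Z h → F .value Z (sub Z h)) ,
            λ Z Z′ h h′ e → inj Z Z′ (sub Z h) (sub Z′ h′) (trans (sym (graph-· (f ·_) h)) (trans e (graph-· (f ·_) h′))))
          where
          sub : below i ⊆ G
          sub Z h = proj₁ (proj₁ (below-spec i Z) h)

        Piece : W → W → W → Set ℓ
        Piece I i M = (Σ W λ Z → Z ε G × f · Z ≡ i × M ε Z) × ¬ (Σ W λ Z → Z ε G × f · Z ε i × M ε Z) × i ε I

        dPiece : ∀ I → Def {2} λ ρ → Piece I (ρ (suc zero)) (ρ zero)
        dPiece I = it

        opaque
          piece : W → W → W
          piece I i = sep (Piece I i) ⦃ Def₂ (λ M i → Piece I i M) (dPiece I) var₀ tCon ⦄ Str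

          piece-spec : ∀ I i M → M ε piece I i ⟺ (M ε Str × Piece I i M)
          piece-spec I i M = sep-spec (Piece I i) ⦃ Def₂ (λ M i → Piece I i M) (dPiece I) var₀ tCon ⦄ Str M

        dPieceT : ∀ I → DefT {1} λ ρ → piece I (ρ zero)
        dPieceT I = dSet₁ (piece I) (piece-spec I) ⦃ dAnd ⦃ it ⦄ ⦃ dPiece I ⦄ ⦄

        Z⊆ : ∀ {Z} → Z ε G → Z ⊆ Str
        Z⊆ h = 𝒮⊆ (Lambda.within Λ₀-lambda _ (G⊆ _ h))

        step : ∀ I → I ⊆ κ → (∀ i → i ε I → i ⊆ I) → (∀ i → i ε I → upto i ε Λ₀) → upto I ε Λ₀
        step I I⊆ I-trans h = subst (_ε Λ₀) (sym ≡⋃) (Lambda.unions Λ₀-lambda seq (graph-fun (piece I) ⦃ dPieceT I ⦄ λ i _ → piece∈ i em em) disj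
          (subst (_ε 𝒮) ≡⋃ (upto∈𝒮 I)))
          where
          seq : W
          seq = graph (piece I) ⦃ dPieceT I ⦄ κ
          seq-out : ∀ {i M} → i ε κ → M ε seq · i → Piece I i M
          seq-out {i} {M} hi m = proj₂ (proj₁ (piece-spec I i M) (subst (M ε_) (graph-· (piece I) ⦃ dPieceT I ⦄ hi) m))
          empty : ∀ i → (∀ M → ¬ Piece I i M) → piece I i ε Λ₀
          empty i n = subst (_ε Λ₀) (⊆-antisym (λ M m → ∅-elim m) (λ M m → ⊥-elim (n M (proj₂ (proj₁ (piece-spec I i M) m))))) Λ₀.∅∈
          piece∈ : ∀ i → Dec (i ε I) → Dec (Σ W λ Z → Z ε G × f · Z ≡ i) → piece I i ε Λ₀
          piece∈ i (no n) _ = empty i λ M (_ , _ , k) → n k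
          piece∈ i (yes _) (no n) = empty i λ M ((Z , z , e , _) , _) → n (Z , z , e)
          piece∈ i (yes k) (yes (Z , z , e)) = subst (_ε Λ₀) eq (Λ₀.∖∈ (G⊆ Z z) (∩∈ (G⊆ Z z) (h i k)) λ M m → proj₁ (∩⁻ m))
            where
            eq : Z ∖ (Z ∩ upto i) ≡ piece I i
            eq = ext λ M →
              (λ m → let (a , b) = ∖⁻ m in proj₂ (piece-spec I i M)
                (Z⊆ z M a , (Z , z , e , a) , (λ w → b (∩⁺ (a , proj₂ (upto-spec i M) w))) , k)) ,
              (λ m → let (_ , (Z′ , z′ , e′ , a) , b , _) = proj₁ (piece-spec I i M) m
                         a′ = subst (M ε_) (inj Z′ Z z′ z (trans e′ (sym e))) a
                     in ∖⁺ (a′ , λ w → b (proj₁ (upto-spec i M) (proj₂ (∩⁻ w)))))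
          disj : Disjoint seq
          disj i j hi hj ne M m m′ = go (trichotomy ord hi hj) (seq-out hi m) (seq-out hj m′)
            where
            go : Comparable i j → Piece I i M → Piece I j M → ⊥
            go (inj₁ l) ((Z , z , e , a) , _) (_ , b , _) = b (Z , z , subst (_ε j) (sym e) l , a)
            go (inj₂ (inj₁ e)) _ _ = ne e
            go (inj₂ (inj₂ l)) (_ , b , _) ((Z , z , e , a) , _) = b (Z , z , subst (_ε i) (sym e) l , a)
          ≡⋃ : upto I ≡ seq⋃ seq
          ≡⋃ = ext λ M →
            (λ m → let (Z , z , l , a) = proj₁ (upto-spec I M) m
                       (i , hi , (Z′ , z′ , e , a′) , least) = minimal (λ i → Σ W λ Z → Z ε G × f · Z ≡ i × M ε Z) I (f · Z) l (Z , z , refl , a)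
                   in proj₂ (seq⋃-spec seq M) (Z⊆ z M a , i , I⊆ i hi , subst (M ε_) (sym (graph-· (piece I) ⦃ dPieceT I ⦄ (I⊆ i hi)))
                        (proj₂ (piece-spec I i M) (Z⊆ z M a , (Z′ , z′ , e , a′) ,
                          (λ (Y , y , k , b) → least (f · Y) k (I-trans i hi _ k) (Y , y , refl , b)) , hi)))) ,
            (λ m → let (_ , i , hi , n) = proj₁ (seq⋃-spec seq M) m ; ((Z , z , e , a) , _ , k) = seq-out hi n in
              proj₂ (upto-spec I M) (Z , z , subst (_ε I) (sym e) k , a))

        upto∈ : ∀ i → i ε κ → upto i ε Λ₀
        upto∈ i hi = dne λ n →
          let (j , hj , nj , least) = minimal (λ i → ¬ (Σ W λ U → U ε Λ₀ × (∀ M → M ε U ⟺ (Σ W λ Z → Z ε G × f · Z ε i × M ε Z)))) κ i hi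
                (λ (U , u , e) → n (subst (_ε Λ₀) (ext λ M → ⟺-trans (e M) (⟺-sym (upto-spec i M))) u))
          in nj (upto j , step j (proj₁ ord j hj) (λ k l → proj₂ ord j hj k l)
               (λ k l → let (U , u , e) = dne (least k l (proj₁ ord j hj k l)) in
                 subst (_ε Λ₀) (ext λ M → ⟺-trans (e M) (⟺-sym (upto-spec k M))) u) , upto-spec j)

        union∈ : ⋃ G ε Λ₀
        union∈ = subst (_ε Λ₀) (ext λ M →
          (λ m → let (Z , z , _ , a) = proj₁ (upto-spec κ M) m in ⋃⁺ (Z , z , a)) ,
          (λ m → let (Z , z , a) = ⋃⁻ m in proj₂ (upto-spec κ M) (Z , z , F .value Z z , a)))
          (step κ (λ i h → h) (proj₁ ord) upto∈)

    private
      Λ₀-closed : Closed Λ₀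
      Λ₀-closed = record
        { subset = λ A a → 𝒮⊆ (Lambda.within Λ₀-lambda A a)
        ; full   = Λ₀.Str∈
        ; atoms  = λ r c i t → Lambda.basic Λ₀-lambda _ (single r c i t)
        ; compl  = Lambda.compl Λ₀-lambda
        ; unions = λ G s (f , F , inj) → Disjointify.union∈ G s f F inj }
        where
        single : ∀ r c → r ε D → Tuple r c → Condition ｛ ⟨ r , c ⟩ ｝
        single r c i t = subst Finite (⊆-antisym (λ x h → ⊎-elim (λ k → ∅-elim k) (proj₂ (｛｝-spec _ x)) (adj-∈ h))
                                                 (λ x h → subst (_ε ∅ ∪ ｛ _ ｝) (sym (proj₁ (｛｝-spec _ x) h)) adj-new)) (finite-adj ⟨ r , c ⟩ finite-∅) ,
                         λ u h → r , c , proj₁ (｛｝-spec _ u) h , i , t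

    opaque
      π-λ : Lambda F → 𝒮 ⊆ F
      π-λ l A a = Λ₀-least l A (least Λ₀ Λ₀-closed A a)

  module Conjunctions where

    open Structures
    open Literals

    private variable
      a c j k m n p r v Φ Y : W

    private
      idx : W → W → W → W
      idx a n y = ⋃ (sep (λ j → a · j ≡ y) n)

      idx-spec : ∀ a n y z → z ε idx a n y ⟺ (Σ W λ j → (j ε n × a · j ≡ y) × z ε j)
      idx-spec a n y z =
        (λ i → let (j , k , l) = ⋃⁻ i in j , proj₁ (sep-spec (λ j → a · j ≡ y) n j) k , l) ,
        (λ (j , k , l) → ⋃⁺ (j , proj₂ (sep-spec (λ j → a · j ≡ y) n j) k , l))

      idx-inv : Bij a n Y → j ε n → idx a n (a · j) ≡ j
      idx-inv {a} {n} {Y} {j} (_ , inj , _) h = ext λ z →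
        (λ i → let (j′ , (h′ , e) , l) = proj₁ (idx-spec a n _ z) i in subst (z ε_) (inj j′ j h′ h e) l) ,
        (λ i → proj₂ (idx-spec a n _ z) (j , (h , refl) , i))

      dIdx : ∀ a n c → DefT {1} λ ρ → idx a n (c · ρ zero)
      dIdx a n c = dSet₁ (idx a n) (idx-spec a n) ⦃ it ⦄ ⦃ it ⦄

    opaque
      factor : Bij a n Y → Fun c k X → (∀ i → i ε k → c · i ε Y) → Σ W λ v → Fun v k n × cmp a v ≡ c
      factor {a} {n} {Y} {c} {k} b@(A , _ , sur) C h = v₀ , v-fun , fun-ext (cmp-fun {C = _ε Y} v-fun (A .value)) C λ i hi →
        trans (cmp-· v-fun hi) (trans (cong (a ·_) (graph-· f ⦃ dIdx a n c ⦄ hi)) (proj₂ (back i hi)))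
        where
        f : W → W
        f i = idx a n (c · i)
        back : ∀ i → i ε k → f i ε n × a · f i ≡ c · i
        back i hi = let (j , hj , e) = sur (c · i) (h i hi) ; q = trans (cong (idx a n) (sym e)) (idx-inv b hj) in
          subst (_ε n) (sym q) hj , trans (cong (a ·_) q) e
        v₀ : W
        v₀ = graph f ⦃ dIdx a n c ⦄ k
        v-fun : Fun v₀ k n
        v-fun = graph-fun f ⦃ dIdx a n c ⦄ λ i hi → proj₁ (back i hi)

    lit : W → W → W
    lit r v = ⟨ ∅ , relCode r v ⟩

    -- Φ : m → literals is a conjunction in the variables x_j (j ∈ n) which, under
    -- the assignment a, lists exactly the atoms in p.
    Encodes : W → W → W → W → W → Set ℓ
    Encodes a n p m Φ = m ε ω × (∀ t → t ε Φ → Σ W λ i → i ε m × t ≡ ⟨ i , Φ · i ⟩) ×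
      (∀ i → i ε m → ⟨ i , Φ · i ⟩ ε Φ × Σ W λ r → Σ W λ v → Φ · i ≡ lit r v × r ε D × Fun v (L · r) n × ⟨ r , cmp a v ⟩ ε p) ×
      (∀ t → t ε p → Σ W λ i → Σ W λ r → Σ W λ v → i ε m × Φ · i ≡ lit r v × t ≡ ⟨ r , cmp a v ⟩)

    private
      dEncodes : ∀ a n → Def {1} λ ρ → Σ W λ m → Σ W λ Φ → Encodes a n (ρ zero) m Φ
      dEncodes a n = it

      extend : ∀ {t} → r ε D → Fun v (L · r) n → t ≡ ⟨ r , cmp a v ⟩ → Encodes a n p m Φ →
               Encodes a n (p ∪ ｛ t ｝) (S m) (override Φ m m (lit r v))
      extend {r} {v} {n} {a} {p} {m} {Φ} {t} r∈ V t≡ (m∈ , ps , vs , en) = S∈ω m∈ , F .pairs ,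
        (λ i hi → F .total i hi , ⊎-elim
           (λ l → let (_ , r′ , v′ , e , d , V′ , q) = vs i l in r′ , v′ , trans (old l) e , d , V′ , adj-old q)
           (λ e → r , v , trans (cong (Φ⁺ ·_) e) new , r∈ , V , subst (_ε p ∪ ｛ t ｝) t≡ adj-new) (adj-∈ hi)) ,
        (λ t′ ht → ⊎-elim
           (λ l → let (i , r′ , v′ , hi , e , q) = en t′ l in i , r′ , v′ , ⊆S hi , trans (old hi) e , q)
           (λ e → m , r , v , ∈S , new , trans e t≡) (adj-∈ ht))
        where
        Φ⁺ : W
        Φ⁺ = override Φ m m (lit r v)
        old : ∀ {i} → i ε m → Φ⁺ · i ≡ Φ · i
        old = override-old ε-irrefl
        new : Φ⁺ · m ≡ lit r v
        new = override-new ε-irrefl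
        F : FunP Φ⁺ (S m) (λ y → y ≡ y)
        F = override-fun ε-irrefl (λ _ _ → refl) refl

    encode : Condition p → Σ W λ n → Σ W λ a → n ε ω × Fun a n X × Σ W λ m → Σ W λ Φ → Encodes a n p m Φ
    encode {p} cp@(fin , at) =
      let (Y , (n , n∈ , a , b@(A , _)) , Y⊆ , sup) = support cp in
      n , a , n∈ , FunP-map (λ y → Y⊆ y) A ,
      finite-ind (λ q → q ⊆ p → Σ W λ m → Σ W λ Φ → Encodes a n q m Φ) ⦃ dImp ⦃ it ⦄ ⦃ dEncodes a n ⦄ ⦄
        (λ _ → ∅ , ∅ , ∅∈ω , (λ t i → ∅-elim i) , (λ t i → ∅-elim i) , (λ t i → ∅-elim i))
        (λ q t q⊆ t∈ _ _ IH _ →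
          let (m , Φ , E) = IH q⊆
              (r , c , e , r∈ , C) = at t t∈
              (v , V , q) = factor b C (sup r c (subst (_ε p) e t∈))
          in S m , override Φ m m (lit r v) , extend r∈ V (trans e (cong ⟨ r ,_⟩ (sym q))) E)
        fin (λ x i → i)

    module _ (A : Fun a n X) (n∈ : n ε ω) (E : Encodes a n p m Φ) where

      private
        F : FunP Φ m (λ l → R.IsLiteral (el L) (el n) (el l))
        F = record { pairs = proj₁ (proj₂ E) ; total = λ i h → proj₁ (proj₁ (proj₂ (proj₂ E)) i h) ; value = λ i h →
          let (_ , r , v , e , r∈ , V , _) = proj₁ (proj₂ (proj₂ E)) i h in
          el ∅ , isV ∅ , el (relCode r v) , isV (relCode r v) , proj₂ (rel-nat {∅}) ∅∈ω ,
          inj₁ (el r , isV r , el (L · r) , isV (L · r) , el v , isV v , proj₂ (rel-arity {r} {L · r}) (r∈ , refl) , proj₂ (rel-tuple {v} {L · r} {n}) V ,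
            proj₂ (rel-relAtom {relCode r v} {r} {v}) refl) , proj₂ (rel-pair {Φ · i} {∅} {relCode r v}) e }

        sat : ∀ {r v M} → Fun v (L · r) n → R.SatLiteral (el M) (el (lit r v)) (el a) ⟺ (cmp a v ε M · r)
        sat {r} {v} {M} V = ⟺-trans (satLiteral-pos {M} {relCode r v} {a}) (satAtom-rel {v} {L · r} {n} {a} {M} {r} V A)

      isTuple : R.IsTuple (el n) (el X) (el a)
      isTuple = proj₂ (rel-nat {n}) n∈ , proj₂ (rel-tuple {a} {n} {X}) A

      isConjunction : R.IsConjunction (el L) (el n) (el Φ)
      isConjunction = el m , isV m , proj₂ (rel-nat {m}) (proj₁ E) , toIsFun {Φ} {m} {R.IsLiteral (el L) (el n)} F

      structuresWith : R.IsStructuresWith (el L) (el X) (λ M → R.SatConjunction M (el Φ) (el a)) (el (Bas p))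
      structuresWith = proj₂ (rel-with {Bas p}) λ M →
        (λ h → let (s , k) = proj₁ (Bas-spec p M) h in s , λ i vi l vl fl →
          let (hi , e) = graph-dom F (proj₁ (rel-↦ {Φ} {⟪ i , vi ⟫} {⟪ l , vl ⟫}) fl)
              (_ , r , v , e′ , _ , V , q) = proj₁ (proj₂ (proj₂ E)) ⟪ i , vi ⟫ hi
          in subst (λ l → R.SatLiteral (el M) l (el a)) (sym (cong el (trans e e′))) (proj₂ (sat {r} {v} {M} V) (k r (cmp a v) q))) ,
        (λ (s , h) → proj₂ (Bas-spec p M) (s , λ r c t∈ →
          let (i , r′ , v , hi , e , t≡) = proj₂ (proj₂ (proj₂ E)) _ t∈
              (_ , r″ , v″ , e″ , _ , V , _) = proj₁ (proj₂ (proj₂ E)) i hi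
              (r≡ , v≡) = ⟨⟩-inj (proj₂ (⟨⟩-inj (proj₂ (⟨⟩-inj (trans (sym e) e″)))))
              (e₁ , e₂) = ⟨⟩-inj (trans t≡ (cong₂ (λ r v → ⟨ r , cmp a v ⟩) r≡ v≡))
          in subst₂ (λ r c → c ε M · r) (sym e₁) (sym e₂) (proj₁ (sat {r″} {v″} {M} V)
               (h (el i) (isV i) (el (lit r″ v″)) (isV (lit r″ v″)) (proj₂ (rel-↦ {Φ} {i} {lit r″ v″}) (subst (λ l → ⟨ i , l ⟩ ε Φ) e″ (F .total i hi)))))))

 module Arithmetic where

   infixl 6 _+ᴺ_
   infixl 7 _*ᴺ_
   infix 4 _≤ᴺ_ _<ᴺ_

   record Nat : Set ℓ where
     no-eta-equality
     pattern
     constructor nat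
     field
       wd   : W
       .inω : wd ε ω
   open Nat public using (wd)

   wd∈ω : (n : Nat) → wd n ε ω
   wd∈ω (nat w h) = recompute em h

   wd-inj : {m n : Nat} → wd m ≡ wd n → m ≡ n
   wd-inj {nat w _} {nat .w _} refl = refl

   opaque
     toNat : W → Nat
     toNat w with em {w ε ω}
     ... | yes h = nat w h
     ... | no _  = nat ∅ ∅∈ω

     wd-toNat : {w : W} → w ε ω → wd (toNat w) ≡ w
     wd-toNat {w} i with em {w ε ω}
     ... | yes h = refl
     ... | no h  = ⊥-elim (h i)

     toNat-wd : (n : Nat) → toNat (wd n) ≡ n
     toNat-wd n = wd-inj (wd-toNat (wd∈ω n))

     toNat-char : (y w : W) → (y ≡ wd (toNat w)) ⟺ ((w ε ω × y ≡ w) ⊎ (w ∉ ω × y ≡ ∅))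
     toNat-char y w with em {w ε ω}
     ... | yes h = (λ e → inj₁ (h , e)) , λ { (inj₁ (_ , e)) → e ; (inj₂ (n , _)) → ⊥-elim (n h) }
     ... | no h  = (λ e → inj₂ (h , e)) , λ { (inj₁ (i , _)) → ⊥-elim (h i) ; (inj₂ (_ , e)) → e }

   opaque
    instance
     dToNat : ∀ {n} {t : Env n → W} → ⦃ DefT t ⦄ → DefT λ ρ → wd (toNat (t ρ))
     dToNat ⦃ d ⦄ = DefT₁ (λ w → wd (toNat w)) (Def-≈ (λ ρ → toNat-char (ρ zero) (ρ (suc zero))) it) d

     dEqNat : ∀ {n} {s t : Env n → Nat} → ⦃ DefT λ ρ → wd (s ρ) ⦄ → ⦃ DefT λ ρ → wd (t ρ) ⦄ → Def λ ρ → s ρ ≡ t ρ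
     dEqNat ⦃ d ⦄ ⦃ e ⦄ = Def-≈ (λ ρ → cong wd , wd-inj) (dEqn ⦃ d ⦄ ⦃ e ⦄)

     dAllNat : ∀ {n} {P : Env n → Nat → Set ℓ} → ⦃ Def λ ρ → P (tail ρ) (toNat (head ρ)) ⦄ → Def λ ρ → (x : Nat) → P ρ x
     dAllNat {P = P} ⦃ d ⦄ = Def-≈ (λ ρ → (λ h w → h (toNat w)) , (λ h x → subst (P ρ) (toNat-wd x) (h (wd x)))) (dAll ⦃ d ⦄)

     dExNat : ∀ {n} {P : Env n → Nat → Set ℓ} → ⦃ Def λ ρ → P (tail ρ) (toNat (head ρ)) ⦄ → Def λ ρ → Σ Nat λ x → P ρ x
     dExNat {P = P} ⦃ d ⦄ = Def-≈ (λ ρ → (λ (x , p) → wd x , subst (P ρ) (sym (toNat-wd x)) p) , (λ (w , p) → toNat w , p)) (dEx ⦃ d ⦄)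

   private variable
     m n k : Nat

   opaque
     0ᴺ : Nat
     0ᴺ = nat ∅ ∅∈ω

     sᴺ : Nat → Nat
     sᴺ n = nat (S (wd n)) (S∈ω (wd∈ω n))

     _+ᴺ_ _*ᴺ_ : Nat → Nat → Nat
     m +ᴺ n = nat (wd m + wd n) (+∈ω (wd∈ω m) (wd∈ω n))
     m *ᴺ n = nat (wd m * wd n) (*∈ω (wd∈ω m) (wd∈ω n))

     wd-0 : wd 0ᴺ ≡ ∅
     wd-0 = refl

     wd-s : ∀ n → wd (sᴺ n) ≡ S (wd n)
     wd-s n = refl

     wd-+ : ∀ m n → wd (m +ᴺ n) ≡ wd m + wd n
     wd-+ m n = refl

     wd-* : ∀ m n → wd (m *ᴺ n) ≡ wd m * wd n
     wd-* m n = refl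

     +0 : ∀ m → m +ᴺ 0ᴺ ≡ m
     +0 m = wd-inj (+-∅ (wd∈ω m))

     +s : ∀ m n → m +ᴺ sᴺ n ≡ sᴺ (m +ᴺ n)
     +s m n = wd-inj (+-S (wd∈ω m) (wd∈ω n))

     *0 : ∀ m → m *ᴺ 0ᴺ ≡ 0ᴺ
     *0 m = wd-inj (*-∅ (wd∈ω m))

     *s : ∀ m n → m *ᴺ sᴺ n ≡ m *ᴺ n +ᴺ m
     *s m n = wd-inj (*-S (wd∈ω m) (wd∈ω n))

     Nat-ind : (P : Nat → Set ℓ) → ⦃ Def {1} λ ρ → P (toNat (ρ zero)) ⦄ →
               P 0ᴺ → (∀ n → P n → P (sᴺ n)) → ∀ n → P n
     Nat-ind P z s n = subst P (toNat-wd n) (ω-ind (λ w → P (toNat w))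
       (subst P (wd-inj (sym (wd-toNat ∅∈ω))) z)
       (λ w h p → subst P (wd-inj (trans (cong S (wd-toNat h)) (sym (wd-toNat (S∈ω h))))) (s (toNat w) p)) (wd n) (wd∈ω n))

   1ᴺ : Nat
   1ᴺ = sᴺ 0ᴺ

   opaque
    instance
     d+ᴺ : ∀ {n} {s t : Env n → Nat} → ⦃ DefT λ ρ → wd (s ρ) ⦄ → ⦃ DefT λ ρ → wd (t ρ) ⦄ → DefT λ ρ → wd (s ρ +ᴺ t ρ)
     d+ᴺ {s = s} {t} = DefT-≈ (λ ρ → wd-+ (s ρ) (t ρ)) d+

     d*ᴺ : ∀ {n} {s t : Env n → Nat} → ⦃ DefT λ ρ → wd (s ρ) ⦄ → ⦃ DefT λ ρ → wd (t ρ) ⦄ → DefT λ ρ → wd (s ρ *ᴺ t ρ)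
     d*ᴺ {s = s} {t} = DefT-≈ (λ ρ → wd-* (s ρ) (t ρ)) d*

     dsᴺ : ∀ {n} {s : Env n → Nat} → ⦃ DefT λ ρ → wd (s ρ) ⦄ → DefT λ ρ → wd (sᴺ (s ρ))
     dsᴺ {s = s} ⦃ d ⦄ = DefT-≈ (λ ρ → wd-s (s ρ)) (d∪ ⦃ d ⦄ ⦃ d｛｝ ⦃ d ⦄ ⦄)

   s-inj : sᴺ m ≡ sᴺ n → m ≡ n
   s-inj {m} {n} e = wd-inj (S-inj (trans (sym (wd-s m)) (trans (cong wd e) (wd-s n))))

   s≢0 : ¬ (sᴺ m ≡ 0ᴺ)
   s≢0 {m} e = S≢∅ (trans (sym (wd-s m)) (trans (cong wd e) wd-0))

   0+ : ∀ m → 0ᴺ +ᴺ m ≡ m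
   0+ = Nat-ind (λ m → 0ᴺ +ᴺ m ≡ m) (+0 0ᴺ) λ m h → trans (+s 0ᴺ m) (cong sᴺ h)

   s+ : ∀ n m → sᴺ m +ᴺ n ≡ sᴺ (m +ᴺ n)
   s+ = Nat-ind (λ n → ∀ m → sᴺ m +ᴺ n ≡ sᴺ (m +ᴺ n)) (λ m → trans (+0 _) (cong sᴺ (sym (+0 m))))
     λ n h m → trans (+s _ n) (cong sᴺ (trans (h m) (sym (+s m n))))

   +-comm : ∀ m n → m +ᴺ n ≡ n +ᴺ m
   +-comm m n = Nat-ind (λ n → ∀ m → m +ᴺ n ≡ n +ᴺ m) (λ m → trans (+0 m) (sym (0+ m)))
     (λ n h m → trans (+s m n) (trans (cong sᴺ (h m)) (sym (s+ m n)))) n m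

   +-assoc : ∀ m n k → (m +ᴺ n) +ᴺ k ≡ m +ᴺ (n +ᴺ k)
   +-assoc m n k = Nat-ind (λ k → ∀ m n → (m +ᴺ n) +ᴺ k ≡ m +ᴺ (n +ᴺ k))
     (λ m n → trans (+0 _) (cong (m +ᴺ_) (sym (+0 n))))
     (λ k h m n → trans (+s _ k) (trans (cong sᴺ (h m n)) (sym (trans (cong (m +ᴺ_) (+s n k)) (+s m _))))) k m n

   0* : ∀ m → 0ᴺ *ᴺ m ≡ 0ᴺ
   0* = Nat-ind (λ m → 0ᴺ *ᴺ m ≡ 0ᴺ) (*0 0ᴺ) λ m h → trans (*s 0ᴺ m) (trans (+0 _) h)

   +-swap : ∀ a b c → (a +ᴺ b) +ᴺ c ≡ (a +ᴺ c) +ᴺ b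
   +-swap a b c = trans (+-assoc a b c) (trans (cong (a +ᴺ_) (+-comm b c)) (sym (+-assoc a c b)))

   s* : ∀ n m → sᴺ m *ᴺ n ≡ m *ᴺ n +ᴺ n
   s* = Nat-ind (λ n → ∀ m → sᴺ m *ᴺ n ≡ m *ᴺ n +ᴺ n)
     (λ m → trans (*0 _) (sym (trans (+0 _) (*0 m))))
     λ n h m → trans (*s _ n) (trans (+s _ m) (sym (trans (+s _ n) (cong sᴺ
       (trans (cong (_+ᴺ n) (*s m n)) (trans (+-swap (m *ᴺ n) m n) (cong (_+ᴺ m) (sym (h m)))))))))

   *-comm : ∀ m n → m *ᴺ n ≡ n *ᴺ m
   *-comm m n = Nat-ind (λ n → ∀ m → m *ᴺ n ≡ n *ᴺ m) (λ m → trans (*0 m) (sym (0* m)))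
     (λ n h m → trans (*s m n) (trans (cong (_+ᴺ m) (h m)) (sym (s* m n)))) n m

   *-distribˡ : ∀ m n k → m *ᴺ (n +ᴺ k) ≡ m *ᴺ n +ᴺ m *ᴺ k
   *-distribˡ m n k = Nat-ind (λ k → ∀ m n → m *ᴺ (n +ᴺ k) ≡ m *ᴺ n +ᴺ m *ᴺ k)
     (λ m n → trans (cong (m *ᴺ_) (+0 n)) (sym (trans (cong (m *ᴺ n +ᴺ_) (*0 m)) (+0 _))))
     (λ k h m n → trans (cong (m *ᴺ_) (+s n k)) (trans (*s m _) (trans (cong (_+ᴺ m) (h m n))
       (trans (+-assoc _ _ m) (cong (m *ᴺ n +ᴺ_) (sym (*s m k))))))) k m n

   *-assoc : ∀ m n k → (m *ᴺ n) *ᴺ k ≡ m *ᴺ (n *ᴺ k)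
   *-assoc m n k = Nat-ind (λ k → ∀ m n → (m *ᴺ n) *ᴺ k ≡ m *ᴺ (n *ᴺ k))
     (λ m n → trans (*0 _) (sym (trans (cong (m *ᴺ_) (*0 n)) (*0 m))))
     (λ k h m n → trans (*s _ k) (trans (cong (_+ᴺ m *ᴺ n) (h m n))
       (sym (trans (cong (m *ᴺ_) (*s n k)) (*-distribˡ m _ n))))) k m n

   1* : ∀ m → 1ᴺ *ᴺ m ≡ m
   1* m = trans (s* m 0ᴺ) (trans (cong (_+ᴺ m) (0* m)) (0+ m))

   semiring : CommutativeSemiring ℓ ℓ
   semiring = record
     { Carrier = Nat ; _≈_ = _≡_ ; _+_ = _+ᴺ_ ; _*_ = _*ᴺ_ ; 0# = 0ᴺ ; 1# = 1ᴺ
     ; isCommutativeSemiring = record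
       { isSemiring = record
         { isSemiringWithoutAnnihilatingZero = record
           { +-isCommutativeMonoid = record
             { isMonoid = record
               { isSemigroup = record
                 { isMagma = record { isEquivalence = isEquivalence ; ∙-cong = cong₂ _+ᴺ_ }
                 ; assoc = +-assoc }
               ; identity = 0+ , +0 }
             ; comm = +-comm }
           ; *-cong = cong₂ _*ᴺ_
           ; *-assoc = *-assoc
           ; *-identity = 1* , (λ m → trans (*-comm m 1ᴺ) (1* m))
           ; distrib = *-distribˡ , (λ m n k → trans (*-comm _ m) (trans (*-distribˡ m n k) (cong₂ _+ᴺ_ (*-comm m n) (*-comm m k)))) }
         ; zero = 0* , *0 }
       ; *-comm = *-comm } }

   module Solve = SemiringSolver semiring

   +-cancelʳ : ∀ k → m +ᴺ k ≡ n +ᴺ k → m ≡ n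
   +-cancelʳ {m} {n} k = Nat-ind (λ k → ∀ m n → m +ᴺ k ≡ n +ᴺ k → m ≡ n)
     (λ m n e → trans (sym (+0 m)) (trans e (+0 n)))
     (λ k h m n e → h m n (s-inj (trans (sym (+s m k)) (trans e (+s n k))))) k m n

   _≤ᴺ_ _<ᴺ_ : Nat → Nat → Set ℓ
   m ≤ᴺ n = Σ Nat λ k → m +ᴺ k ≡ n
   m <ᴺ n = sᴺ m ≤ᴺ n

   opaque
    nonzero : ∀ m → m ≡ 0ᴺ ⊎ Σ Nat λ n → m ≡ sᴺ n
    nonzero = Nat-ind (λ m → m ≡ 0ᴺ ⊎ Σ Nat λ n → m ≡ sᴺ n) (inj₁ refl) (λ n _ → inj₂ (n , refl))

   opaque
    ≤-total : ∀ m n → m ≤ᴺ n ⊎ n <ᴺ m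
    ≤-total m n = Nat-ind (λ n → ∀ m → m ≤ᴺ n ⊎ n <ᴺ m)
      (λ m → ⊎-elim (λ { refl → inj₁ (0ᴺ , +0 _) }) (λ { (k , refl) → inj₂ (k , trans (s+ k 0ᴺ) (cong sᴺ (0+ k))) }) (nonzero m))
      (λ n h m → ⊎-elim (λ { refl → inj₁ (sᴺ n , 0+ _) })
        (λ { (k , refl) → ⊎-map (λ (j , e) → j , trans (s+ j k) (cong sᴺ e)) (λ (j , e) → j , trans (s+ j (sᴺ n)) (cong sᴺ e)) (h k) })
        (nonzero m)) n m

   <-irrefl : ¬ (m <ᴺ m)
   <-irrefl {m} (k , e) = s≢0 (+-cancelʳ m (trans (trans (s+ m k) (trans (cong sᴺ (+-comm k m)) (sym (s+ k m)))) (trans e (sym (0+ m)))))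

   opaque
    ε⟺< : (wd m ε wd n) ⟺ (m <ᴺ n)
    ε⟺< {m} {n} = Nat-ind (λ n → ∀ m → (wd m ε wd n) ⟺ (m <ᴺ n))
      (λ m → (λ i → ⊥-elim (∉∅ (subst (wd m ε_) wd-0 i))) , (λ (k , e) → ⊥-elim (s≢0 (trans (sym (s+ k m)) e))))
      (λ n h m →
        (λ i → ⊎-elim (λ j → let (k , e) = proj₁ (h m) j in sᴺ k , trans (+s _ k) (cong sᴺ e))
                      (λ e → 0ᴺ , trans (+0 _) (cong sᴺ (wd-inj e)))
                      (S⁻ (subst (wd m ε_) (wd-s n) i))) ,
        (λ (k , e) → subst (wd m ε_) (sym (wd-s n)) (S⁺ (⊎-elim
          (λ { refl → inj₂ (cong wd (s-inj (trans (sym (+0 _)) e))) })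
          (λ { (j , refl) → inj₁ (proj₂ (h m) (j , s-inj (trans (sym (+s _ j)) e))) }) (nonzero k)))))
      n m

 module Fractions where

   open Arithmetic
   open Solve using (solve; _:+_; _:*_; _:=_)

   private variable
     m n k l a b c d : Nat

   ≤-refl : m ≤ᴺ m
   ≤-refl {m} = 0ᴺ , +0 m

   ≤-reflexive : m ≡ n → m ≤ᴺ n
   ≤-reflexive refl = ≤-refl

   ≤-trans : m ≤ᴺ n → n ≤ᴺ k → m ≤ᴺ k
   ≤-trans {m} (i , refl) (j , refl) = i +ᴺ j , sym (+-assoc m i j)

   <⇒≤ : m <ᴺ n → m ≤ᴺ n
   <⇒≤ {m} (j , e) = sᴺ j , trans (+s m j) (trans (sym (s+ j m)) e)

   <⇒≱ : m <ᴺ n → ¬ (n ≤ᴺ m)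
   <⇒≱ h k = <-irrefl (≤-trans h k)

   +-mono-≤ : m ≤ᴺ n → k ≤ᴺ l → m +ᴺ k ≤ᴺ n +ᴺ l
   +-mono-≤ {m} {k = k} (i , refl) (j , refl) = i +ᴺ j ,
     solve 4 (λ m i k j → (m :+ k) :+ (i :+ j) := (m :+ i) :+ (k :+ j)) refl m i k j

   *-mono-≤ : m ≤ᴺ n → k ≤ᴺ l → m *ᴺ k ≤ᴺ n *ᴺ l
   *-mono-≤ {m} {k = k} (i , refl) (j , refl) = m *ᴺ j +ᴺ i *ᴺ k +ᴺ i *ᴺ j ,
     solve 4 (λ m i k j → m :* k :+ (m :* j :+ i :* k :+ i :* j) := (m :+ i) :* (k :+ j)) refl m i k j

   *-monoˡ-< : m <ᴺ n → m *ᴺ sᴺ k <ᴺ n *ᴺ sᴺ k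
   *-monoˡ-< {m} {k = k} (i , refl) = k +ᴺ i *ᴺ sᴺ k , trans (s+ _ (m *ᴺ sᴺ k))
     (trans (sym (+s (m *ᴺ sᴺ k) _)) (trans (cong (m *ᴺ sᴺ k +ᴺ_) (sym (s+ _ k)))
       (trans (solve 3 (λ m i k → m :* k :+ (k :+ i :* k) := (m :* k :+ k) :+ i :* k) refl m i (sᴺ k))
         (trans (cong (_+ᴺ i *ᴺ sᴺ k) (sym (s* (sᴺ k) m)))
           (solve 3 (λ m i k → m :* k :+ i :* k := (m :+ i) :* k) refl (sᴺ m) i (sᴺ k))))))

   *-cancel-≤ : m *ᴺ sᴺ k ≤ᴺ n *ᴺ sᴺ k → m ≤ᴺ n
   *-cancel-≤ {m} {k} {n} h with ≤-total m n
   ... | inj₁ i = i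
   ... | inj₂ i = ⊥-elim (<⇒≱ (*-monoˡ-< i) h)

   infix 5 _/s_

   -- p /s q is the fraction p / (q + 1).
   record Frac : Set ℓ where
     no-eta-equality
     pattern
     constructor _/s_
     field num pre : Nat
   open Frac public

   den : Frac → Nat
   den q = sᴺ (pre q)

   private variable
     p q r s x y : Frac

   opaque
    instance
     dAllFrac : ∀ {n} {P : Env n → Frac → Set ℓ} →
       ⦃ Def λ ρ → P (tail (tail ρ)) (toNat (ρ (suc zero)) /s toNat (ρ zero)) ⦄ → Def λ ρ → (x : Frac) → P ρ x
     dAllFrac ⦃ d ⦄ = Def-≈ (λ ρ → (λ h m n → h (m /s n)) , (λ { h (m /s n) → h m n })) (dAllNat ⦃ dAllNat ⦃ d ⦄ ⦄)

     dExFrac : ∀ {n} {P : Env n → Frac → Set ℓ} →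
       ⦃ Def λ ρ → P (tail (tail ρ)) (toNat (ρ (suc zero)) /s toNat (ρ zero)) ⦄ → Def λ ρ → Σ Frac λ x → P ρ x
     dExFrac ⦃ d ⦄ = Def-≈ (λ ρ → (λ { (m /s n , h) → m , n , h }) , (λ { (m , n , h) → (m /s n) , h })) (dExNat ⦃ dExNat ⦃ d ⦄ ⦄)

   infix 4 _≤ᶠ_ _<ᶠ_ _≈_
   infixl 6 _+ᶠ_
   infixl 7 _*ᶠ_

   _≤ᶠ_ _<ᶠ_ _≈_ : Frac → Frac → Set ℓ
   p ≤ᶠ q = num p *ᴺ den q ≤ᴺ num q *ᴺ den p
   p <ᶠ q = num p *ᴺ den q <ᴺ num q *ᴺ den p
   p ≈ q  = num p *ᴺ den q ≡ num q *ᴺ den p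

   Pos : Frac → Set ℓ
   Pos q = 0ᴺ <ᴺ num q

   frac-≡ : num p ≡ num q → den p ≡ den q → p ≡ q
   frac-≡ {_ /s _} {_ /s _} refl e with s-inj e
   ... | refl = refl

   private
     den-prod : ∀ m n → sᴺ (sᴺ m *ᴺ n +ᴺ m) ≡ sᴺ m *ᴺ sᴺ n
     den-prod m n = trans (sym (+s _ m)) (sym (*s (sᴺ m) n))

   opaque
     _+ᶠ_ _*ᶠ_ : Frac → Frac → Frac
     p +ᶠ q = (num p *ᴺ den q +ᴺ num q *ᴺ den p) /s (den p *ᴺ pre q +ᴺ pre p)
     p *ᶠ q = (num p *ᴺ num q) /s (den p *ᴺ pre q +ᴺ pre p)

     num-+ : ∀ p q → num (p +ᶠ q) ≡ num p *ᴺ den q +ᴺ num q *ᴺ den p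
     num-+ p q = refl

     den-+ : ∀ p q → den (p +ᶠ q) ≡ den p *ᴺ den q
     den-+ p q = den-prod (pre p) (pre q)

     num-* : ∀ p q → num (p *ᶠ q) ≡ num p *ᴺ num q
     num-* p q = refl

     den-* : ∀ p q → den (p *ᶠ q) ≡ den p *ᴺ den q
     den-* p q = den-prod (pre p) (pre q)

   ≈⇒≤ : p ≈ q → p ≤ᶠ q
   ≈⇒≤ e = ≤-reflexive e

   ≈-sym : p ≈ q → q ≈ p
   ≈-sym = sym

   <ᶠ⇒≤ᶠ : p <ᶠ q → p ≤ᶠ q
   <ᶠ⇒≤ᶠ = <⇒≤

   ≤ᶠ-refl : ∀ p → p ≤ᶠ p
   ≤ᶠ-refl p = ≤-refl

   ≤ᶠ-total : ∀ p q → p ≤ᶠ q ⊎ q <ᶠ p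
   ≤ᶠ-total p q = ≤-total _ _

   <ᶠ⇒≱ᶠ : p <ᶠ q → ¬ (q ≤ᶠ p)
   <ᶠ⇒≱ᶠ h k = <⇒≱ h k

   ≤ᶠ-trans : p ≤ᶠ q → q ≤ᶠ r → p ≤ᶠ r
   ≤ᶠ-trans {p} {q} {r} h k = *-cancel-≤ {k = pre q} (≤-trans (≤-trans
     (≤-reflexive (solve 3 (λ a d f → a :* f :* d := a :* d :* f) refl (num p) (den q) (den r)))
     (≤-trans (*-mono-≤ h (≤-refl {den r})) (≤-reflexive (solve 3 (λ c b f → c :* b :* f := c :* f :* b) refl (num q) (den p) (den r)))))
     (≤-trans (*-mono-≤ k (≤-refl {den p})) (≤-reflexive (solve 3 (λ e d b → e :* d :* b := e :* b :* d) refl (num r) (den q) (den p)))))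

   ≤-<ᶠ-trans : p ≤ᶠ q → q <ᶠ r → p <ᶠ r
   ≤-<ᶠ-trans {p} {q} {r} h k with ≤ᶠ-total r p
   ... | inj₁ i = ⊥-elim (<ᶠ⇒≱ᶠ {q} {r} k (≤ᶠ-trans {r} {p} {q} i h))
   ... | inj₂ i = i

   <-≤ᶠ-trans : p <ᶠ q → q ≤ᶠ r → p <ᶠ r
   <-≤ᶠ-trans {p} {q} {r} h k with ≤ᶠ-total r p
   ... | inj₁ i = ⊥-elim (<ᶠ⇒≱ᶠ {p} {q} h (≤ᶠ-trans {q} {r} {p} k i))
   ... | inj₂ i = i

   +ᶠ-comm : ∀ p q → p +ᶠ q ≡ q +ᶠ p
   +ᶠ-comm p q = frac-≡ (trans (num-+ p q) (trans (+-comm _ _) (sym (num-+ q p))))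
     (trans (den-+ p q) (trans (*-comm _ _) (sym (den-+ q p))))

   *ᶠ-comm : ∀ p q → p *ᶠ q ≡ q *ᶠ p
   *ᶠ-comm p q = frac-≡ (trans (num-* p q) (trans (*-comm _ _) (sym (num-* q p))))
     (trans (den-* p q) (trans (*-comm _ _) (sym (den-* q p))))

   +ᶠ-assoc : ∀ p q r → (p +ᶠ q) +ᶠ r ≡ p +ᶠ (q +ᶠ r)
   +ᶠ-assoc p q r = frac-≡
     (begin
       num ((p +ᶠ q) +ᶠ r)                         ≡⟨ num-+ (p +ᶠ q) r ⟩
       num (p +ᶠ q) *ᴺ den r +ᴺ num r *ᴺ den (p +ᶠ q) ≡⟨ cong₂ (λ u v → u *ᴺ den r +ᴺ num r *ᴺ v) (num-+ p q) (den-+ p q) ⟩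
       (num p *ᴺ den q +ᴺ num q *ᴺ den p) *ᴺ den r +ᴺ num r *ᴺ (den p *ᴺ den q)
         ≡⟨ solve 6 (λ a b c d e f → (a :* d :+ c :* b) :* f :+ e :* (b :* d) := a :* (d :* f) :+ (c :* f :+ e :* d) :* b)
              refl (num p) (den p) (num q) (den q) (num r) (den r) ⟩
       num p *ᴺ (den q *ᴺ den r) +ᴺ (num q *ᴺ den r +ᴺ num r *ᴺ den q) *ᴺ den p
         ≡⟨ cong₂ (λ u v → num p *ᴺ v +ᴺ u *ᴺ den p) (sym (num-+ q r)) (sym (den-+ q r)) ⟩
       num p *ᴺ den (q +ᶠ r) +ᴺ num (q +ᶠ r) *ᴺ den p ≡⟨ sym (num-+ p (q +ᶠ r)) ⟩
       num (p +ᶠ (q +ᶠ r)) ∎)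
     (trans (den-+ (p +ᶠ q) r) (trans (cong (_*ᴺ den r) (den-+ p q)) (trans (*-assoc _ _ _)
       (trans (cong (den p *ᴺ_) (sym (den-+ q r))) (sym (den-+ p (q +ᶠ r)))))))
     where open ≡-Reasoning

   +ᶠ-monoˡ-≤ : p ≤ᶠ q → p +ᶠ r ≤ᶠ q +ᶠ r
   +ᶠ-monoˡ-≤ {p} {q} {r} h =
     ≤-trans (≤-reflexive (trans (cong₂ _*ᴺ_ (num-+ p r) (den-+ q r))
       (solve 5 (λ a b d e f → (a :* f :+ e :* b) :* (d :* f) := a :* d :* (f :* f) :+ e :* f :* b :* d) refl
         (num p) (den p) (den q) (num r) (den r))))
     (≤-trans (+-mono-≤ (*-mono-≤ h ≤-refl) ≤-refl)
     (≤-reflexive (sym (trans (cong₂ _*ᴺ_ (num-+ q r) (den-+ p r))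
       (solve 5 (λ c b d e f → (c :* f :+ e :* d) :* (b :* f) := c :* b :* (f :* f) :+ e :* f :* b :* d) refl
         (num q) (den p) (den q) (num r) (den r))))))

   +ᶠ-mono-≤ : p ≤ᶠ q → r ≤ᶠ s → p +ᶠ r ≤ᶠ q +ᶠ s
   +ᶠ-mono-≤ {p} {q} {r} {s} h k = ≤ᶠ-trans {p +ᶠ r} {q +ᶠ r} {q +ᶠ s} (+ᶠ-monoˡ-≤ {p} {q} {r} h)
     (subst₂ _≤ᶠ_ (+ᶠ-comm r q) (+ᶠ-comm s q) (+ᶠ-monoˡ-≤ {r} {s} {q} k))

   *ᶠ-monoˡ-≤ : p ≤ᶠ q → p *ᶠ r ≤ᶠ q *ᶠ r
   *ᶠ-monoˡ-≤ {p} {q} {r} h =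
     ≤-trans (≤-reflexive (trans (cong₂ _*ᴺ_ (num-* p r) (den-* q r))
       (solve 4 (λ a d e f → a :* e :* (d :* f) := a :* d :* (e :* f)) refl (num p) (den q) (num r) (den r))))
     (≤-trans (*-mono-≤ h ≤-refl)
     (≤-reflexive (sym (trans (cong₂ _*ᴺ_ (num-* q r) (den-* p r))
       (solve 4 (λ c b e f → c :* e :* (b :* f) := c :* b :* (e :* f)) refl (num q) (den p) (num r) (den r))))))

   *ᶠ-mono-≤ : p ≤ᶠ q → r ≤ᶠ s → p *ᶠ r ≤ᶠ q *ᶠ s
   *ᶠ-mono-≤ {p} {q} {r} {s} h k = ≤ᶠ-trans {p *ᶠ r} {q *ᶠ r} {q *ᶠ s} (*ᶠ-monoˡ-≤ {p} {q} {r} h)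
     (subst₂ _≤ᶠ_ (*ᶠ-comm r q) (*ᶠ-comm s q) (*ᶠ-monoˡ-≤ {r} {s} {q} k))

   *ᶠ-distrib : ∀ p q r → p *ᶠ (q +ᶠ r) ≈ p *ᶠ q +ᶠ p *ᶠ r
   *ᶠ-distrib p q r = begin
     num (p *ᶠ (q +ᶠ r)) *ᴺ den (p *ᶠ q +ᶠ p *ᶠ r)
       ≡⟨ cong₂ _*ᴺ_ (trans (num-* p _) (cong (num p *ᴺ_) (num-+ q r))) (trans (den-+ _ _) (cong₂ _*ᴺ_ (den-* p q) (den-* p r))) ⟩
     num p *ᴺ (num q *ᴺ den r +ᴺ num r *ᴺ den q) *ᴺ (den p *ᴺ den q *ᴺ (den p *ᴺ den r))
       ≡⟨ solve 6 (λ a b c d e f → a :* (c :* f :+ e :* d) :* (b :* d :* (b :* f)) :=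
                    (a :* c :* (b :* f) :+ a :* e :* (b :* d)) :* (b :* (d :* f)))
            refl (num p) (den p) (num q) (den q) (num r) (den r) ⟩
     (num p *ᴺ num q *ᴺ (den p *ᴺ den r) +ᴺ num p *ᴺ num r *ᴺ (den p *ᴺ den q)) *ᴺ (den p *ᴺ (den q *ᴺ den r))
       ≡⟨ sym (cong₂ _*ᴺ_ (trans (num-+ _ _) (cong₂ _+ᴺ_ (cong₂ _*ᴺ_ (num-* p q) (den-* p r)) (cong₂ _*ᴺ_ (num-* p r) (den-* p q))))
                 (trans (den-* p _) (cong (den p *ᴺ_) (den-+ q r)))) ⟩
     num (p *ᶠ q +ᶠ p *ᶠ r) *ᴺ den (p *ᶠ (q +ᶠ r)) ∎
     where open ≡-Reasoning

   +ᶠ-monoˡ-< : p <ᶠ q → p +ᶠ r <ᶠ q +ᶠ r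
   +ᶠ-monoˡ-< {p} {q} {r} h with ≤ᶠ-total (q +ᶠ r) (p +ᶠ r)
   ... | inj₂ k = k
   ... | inj₁ k = ⊥-elim (<⇒≱ h (*-cancel-≤ {k = pre r} (*-cancel-≤ {k = pre r} (+-cancel-≤ {num r *ᴺ den r *ᴺ den p *ᴺ den q}
     (≤-trans (≤-reflexive (trans
       (solve 5 (λ c b d e f → c :* b :* f :* f :+ e :* f :* b :* d := (c :* f :+ e :* d) :* (b :* f)) refl
         (num q) (den p) (den q) (num r) (den r)) (sym (cong₂ _*ᴺ_ (num-+ q r) (den-+ p r)))))
     (≤-trans k (≤-reflexive (trans (cong₂ _*ᴺ_ (num-+ p r) (den-+ q r))
       (solve 5 (λ a b d e f → (a :* f :+ e :* b) :* (d :* f) := a :* d :* f :* f :+ e :* f :* b :* d) refl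
         (num p) (den p) (den q) (num r) (den r)))))))))) 
     where
     +-cancel-≤ : ∀ {k m n} → m +ᴺ k ≤ᴺ n +ᴺ k → m ≤ᴺ n
     +-cancel-≤ {k} {m} {n} (j , e) = j , +-cancelʳ k (trans (+-swap m j k) e)

   +ᶠ-increasing : ∀ p {d} → Pos d → p <ᶠ p +ᶠ d
   +ᶠ-increasing p {d} (j , e) = subst₂ _<ᴺ_
     (sym (trans (cong (num p *ᴺ_) (den-+ p d)) refl))
     (sym (trans (cong (_*ᴺ den p) (num-+ p d)) (solve 4 (λ a b c e → (a :* e :+ c :* b) :* b := a :* (b :* e) :+ c :* b :* b) refl (num p) (den p) (num d) (den d))))
     (subst (λ v → num p *ᴺ (den p *ᴺ den d) <ᴺ num p *ᴺ (den p *ᴺ den d) +ᴺ v)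
       (cong (λ v → v *ᴺ den p *ᴺ den p) (trans (sym (trans (s+ j 0ᴺ) (cong sᴺ (0+ j)))) e))
       (pos (num p *ᴺ (den p *ᴺ den d)) j))
     where
     pos : ∀ m j → m <ᴺ m +ᴺ sᴺ j *ᴺ den p *ᴺ den p
     pos m j = ≤-trans (0ᴺ , trans (+0 _) (trans (cong sᴺ (sym (+0 m))) (sym (+s m 0ᴺ))))
       (+-mono-≤ ≤-refl (≤-trans (≤-reflexive (sym (trans (cong (_*ᴺ 1ᴺ) (1* 1ᴺ)) (1* 1ᴺ))))
         (*-mono-≤ (*-mono-≤ {1ᴺ} {sᴺ j} (j , trans (s+ j 0ᴺ) (cong sᴺ (0+ j))) one≤) one≤)))
       where
       one≤ : 1ᴺ ≤ᴺ den p
       one≤ = pre p , trans (s+ (pre p) 0ᴺ) (cong sᴺ (0+ (pre p)))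

   subtract : p <ᶠ q → Σ Frac λ d → Pos d × p +ᶠ d ≈ q
   subtract {p} {q} (j , h) = δ , (j , trans (s+ j 0ᴺ) (cong sᴺ (0+ j))) , (begin
     num (p +ᶠ δ) *ᴺ den q ≡⟨ cong (_*ᴺ den q) (trans (num-+ p δ) (cong (λ v → num p *ᴺ v +ᴺ sᴺ j *ᴺ den p) (den-* p q))) ⟩
     (num p *ᴺ (den p *ᴺ den q) +ᴺ sᴺ j *ᴺ den p) *ᴺ den q
       ≡⟨ solve 4 (λ a b e j → (a :* (b :* e) :+ j :* b) :* e := b :* e :* (a :* e :+ j)) refl (num p) (den p) (den q) (sᴺ j) ⟩
     den p *ᴺ den q *ᴺ (num p *ᴺ den q +ᴺ sᴺ j) ≡⟨ cong (den p *ᴺ den q *ᴺ_) (trans (+s _ j) (trans (sym (s+ j _)) h)) ⟩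
     den p *ᴺ den q *ᴺ (num q *ᴺ den p)
       ≡⟨ solve 3 (λ b e c → b :* e :* (c :* b) := c :* (b :* (b :* e))) refl (den p) (den q) (num q) ⟩
     num q *ᴺ (den p *ᴺ (den p *ᴺ den q)) ≡⟨ cong (num q *ᴺ_) (sym (trans (den-+ p δ) (cong (den p *ᴺ_) (den-* p q)))) ⟩
     num q *ᴺ den (p +ᶠ δ) ∎)
     where
     open ≡-Reasoning
     δ = sᴺ j /s pre (p *ᶠ q)

   halve : ∀ q → Σ Frac λ h → (Pos q → Pos h) × h +ᶠ h ≈ q
   halve q = h , (λ x → x) , (begin
     num (h +ᶠ h) *ᴺ den q ≡⟨ cong (_*ᴺ den q) (trans (num-+ h h) (cong (λ v → num q *ᴺ v +ᴺ num q *ᴺ v) eq)) ⟩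
     (num q *ᴺ (two *ᴺ den q) +ᴺ num q *ᴺ (two *ᴺ den q)) *ᴺ den q
       ≡⟨ cong (λ v → (num q *ᴺ (v *ᴺ den q) +ᴺ num q *ᴺ (v *ᴺ den q)) *ᴺ den q) two≡ ⟩
     (num q *ᴺ ((1ᴺ +ᴺ 1ᴺ) *ᴺ den q) +ᴺ num q *ᴺ ((1ᴺ +ᴺ 1ᴺ) *ᴺ den q)) *ᴺ den q
       ≡⟨ solve 2 (λ a b → (a :* ((con 1 :+ con 1) :* b) :+ a :* ((con 1 :+ con 1) :* b)) :* b := a :* ((con 1 :+ con 1) :* b :* ((con 1 :+ con 1) :* b))) refl (num q) (den q) ⟩
     num q *ᴺ ((1ᴺ +ᴺ 1ᴺ) *ᴺ den q *ᴺ ((1ᴺ +ᴺ 1ᴺ) *ᴺ den q)) ≡⟨ cong (λ v → num q *ᴺ (v *ᴺ den q *ᴺ (v *ᴺ den q))) (sym two≡) ⟩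
     num q *ᴺ (two *ᴺ den q *ᴺ (two *ᴺ den q)) ≡⟨ cong (num q *ᴺ_) (sym (trans (den-+ h h) (cong₂ _*ᴺ_ eq eq))) ⟩
     num q *ᴺ den (h +ᶠ h) ∎)
     where
     open ≡-Reasoning
     open Solve using (con)
     two = sᴺ 1ᴺ
     two≡ : two ≡ 1ᴺ +ᴺ 1ᴺ
     two≡ = sym (trans (+s 1ᴺ 0ᴺ) (cong sᴺ (+0 1ᴺ)))
     h = num q /s pre ((0ᴺ /s 1ᴺ) *ᶠ q)
     eq : den h ≡ two *ᴺ den q
     eq = den-* (0ᴺ /s 1ᴺ) q

   pos-suc : 0ᴺ <ᴺ m → Σ Nat λ k → m ≡ sᴺ k
   pos-suc (j , e) = j , sym (trans (sym (trans (s+ j 0ᴺ) (cong sᴺ (0+ j)))) e)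

   suc-pos : ∀ k → 0ᴺ <ᴺ sᴺ k
   suc-pos k = k , trans (s+ k 0ᴺ) (cong sᴺ (0+ k))

   *-pos : 0ᴺ <ᴺ m → 0ᴺ <ᴺ n → 0ᴺ <ᴺ m *ᴺ n
   *-pos h k with pos-suc h | pos-suc k
   ... | i , refl | j , refl = subst (0ᴺ <ᴺ_) (sym (trans (*s _ j) (+s _ i))) (suc-pos _)

   divide : Pos p → ∀ x → Σ Frac λ y → (Pos x → Pos y) × p *ᶠ y ≈ x
   divide {p} h x with pos-suc h
   ... | k , e = v , (λ i → *-pos i (suc-pos (pre p))) ,
     trans (cong (_*ᴺ den x) (num-* p v)) (trans
       (solve 4 (λ a b c d → a :* (c :* b) :* d := c :* (b :* (d :* a))) refl (num p) (den p) (num x) (den x))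
       (cong (num x *ᴺ_) (sym (trans (den-* p v) (cong (den p *ᴺ_) (trans (den-* x (0ᴺ /s k)) (cong (den x *ᴺ_) (sym e))))))))
     where
     v = (num x *ᴺ den p) /s pre (x *ᶠ (0ᴺ /s k))

   infixl 7 _•_
   _•_ : Nat → Frac → Frac
   n • q = (n *ᴺ num q) /s pre q

   •-suc : ∀ n q → n • q +ᶠ q ≈ sᴺ n • q
   •-suc n q = trans (cong (_*ᴺ den q) (num-+ (n • q) q)) (trans
     (solve 3 (λ n a b → (n :* a :* b :+ a :* b) :* b := (n :* a :+ a) :* (b :* b)) refl n (num q) (den q))
     (cong₂ _*ᴺ_ (sym (s* (num q) n)) (sym (den-+ (n • q) q))))

   archimedean : ∀ x {δ} → Pos δ → Σ Nat λ n → x ≤ᶠ n • δ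
   archimedean x {δ} h with pos-suc h
   ... | j , e = num x *ᴺ den δ , ≤-trans (m≤m*s _ j) (≤-trans (m≤m*s _ (pre x))
     (≤-reflexive (cong (λ v → num x *ᴺ den δ *ᴺ v *ᴺ den x) (sym e))))
     where
     m≤m*s : ∀ m k → m ≤ᴺ m *ᴺ sᴺ k
     m≤m*s m k = m *ᴺ k , trans (+-comm m _) (sym (*s m k))

   dense : p <ᶠ q → Σ Frac λ m → p <ᶠ m × m <ᶠ q
   dense {p} {q} h =
     let (d , d>0 , e) = subtract {p} {q} h
         (k , k>0 , e′) = halve d
     in p +ᶠ k , +ᶠ-increasing p (k>0 d>0) ,
        <-≤ᶠ-trans {p +ᶠ k} {(p +ᶠ k) +ᶠ k} {q} (+ᶠ-increasing (p +ᶠ k) (k>0 d>0))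
          (≤ᶠ-trans {(p +ᶠ k) +ᶠ k} {p +ᶠ d} {q}
            (subst (_≤ᶠ p +ᶠ d) (sym (+ᶠ-assoc p k k))
              (+ᶠ-mono-≤ {p} {p} {k +ᶠ k} {d} (≤ᶠ-refl p) (≈⇒≤ {k +ᶠ k} {d} e′)))
            (≈⇒≤ {p +ᶠ d} {q} e))

   <⇒Pos : p <ᶠ q → Pos q
   <⇒Pos {p} {q} (j , e) with nonzero (num q)
   ... | inj₁ z = ⊥-elim (s≢0 (trans (sym (s+ j _)) (trans e (trans (cong (_*ᴺ den p) z) (0* _)))))
   ... | inj₂ (k , z) = subst (0ᴺ <ᴺ_) (sym z) (suc-pos k)

   0ᶠ 1ᶠ : Frac
   0ᶠ = 0ᴺ /s 0ᴺ
   1ᶠ = 1ᴺ /s 0ᴺ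

   Pos⇒< : Pos q → 0ᶠ <ᶠ q
   Pos⇒< {q} h = subst₂ _<ᴺ_ (sym (0* _)) (sym (trans (*-comm _ 1ᴺ) (1* (num q)))) h

   1*ᶠ : ∀ q → 1ᶠ *ᶠ q ≈ q
   1*ᶠ q = trans (cong (_*ᴺ den q) (trans (num-* 1ᶠ q) (1* _))) (cong (num q *ᴺ_) (sym (trans (den-* 1ᶠ q) (1* _))))

   *ᶠ-pos : Pos p → Pos q → Pos (p *ᶠ q)
   *ᶠ-pos {p} {q} h k = subst (0ᴺ <ᴺ_) (sym (num-* p q)) (*-pos h k)

   *ᶠ-monoˡ-< : p <ᶠ q → Pos r → p *ᶠ r <ᶠ q *ᶠ r
   *ᶠ-monoˡ-< {p} {q} {r} h i with pos-suc i
   ... | k , e = subst₂ _<ᴺ_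
     (trans (cong (λ v → num p *ᴺ den q *ᴺ v *ᴺ den r) (sym e))
       (trans (solve 4 (λ a d e f → a :* d :* e :* f := a :* e :* (d :* f)) refl (num p) (den q) (num r) (den r))
         (sym (cong₂ _*ᴺ_ (num-* p r) (den-* q r)))))
     (trans (cong (λ v → num q *ᴺ den p *ᴺ v *ᴺ den r) (sym e))
       (trans (solve 4 (λ a d e f → a :* d :* e :* f := a :* e :* (d :* f)) refl (num q) (den p) (num r) (den r))
         (sym (cong₂ _*ᴺ_ (num-* q r) (den-* p r)))))
     (*-monoˡ-< {k = pre r} (*-monoˡ-< {k = k} h))

   opaque
     fw : Frac → W
     fw q = ⟨ wd (num q) , wd (den q) ⟩

     fw-def : ∀ q → fw q ≡ ⟨ wd (num q) , wd (den q) ⟩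
     fw-def q = refl

   fw-inj : fw p ≡ fw q → p ≡ q
   fw-inj {p} {q} e = let (i , j) = ⟨⟩-inj (trans (sym (fw-def p)) (trans e (fw-def q))) in
     frac-≡ (wd-inj i) (wd-inj j)

   opaque
     unfolding _+ᶠ_ fw
     instance
       dfw : ∀ {n} {m k : Env n → Nat} → ⦃ DefT λ ρ → wd (m ρ) ⦄ → ⦃ DefT λ ρ → wd (k ρ) ⦄ → DefT λ ρ → fw (m ρ /s k ρ)
       dfw = dPair

       dnum+ : ∀ {n} {p q : Env n → Frac} → ⦃ DefT λ ρ → wd (num (p ρ)) ⦄ → ⦃ DefT λ ρ → wd (pre (p ρ)) ⦄ →
               ⦃ DefT λ ρ → wd (num (q ρ)) ⦄ → ⦃ DefT λ ρ → wd (pre (q ρ)) ⦄ → DefT λ ρ → wd (num (p ρ +ᶠ q ρ))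
       dnum+ = d+ᴺ

       dpre+ : ∀ {n} {p q : Env n → Frac} → ⦃ DefT λ ρ → wd (pre (p ρ)) ⦄ → ⦃ DefT λ ρ → wd (pre (q ρ)) ⦄ →
               DefT λ ρ → wd (pre (p ρ +ᶠ q ρ))
       dpre+ = d+ᴺ

       dpre* : ∀ {n} {p q : Env n → Frac} → ⦃ DefT λ ρ → wd (pre (p ρ)) ⦄ → ⦃ DefT λ ρ → wd (pre (q ρ)) ⦄ →
               DefT λ ρ → wd (pre (p ρ *ᶠ q ρ))
       dpre* = d+ᴺ

       dnum* : ∀ {n} {p q : Env n → Frac} → ⦃ DefT λ ρ → wd (num (p ρ)) ⦄ → ⦃ DefT λ ρ → wd (num (q ρ)) ⦄ →
               DefT λ ρ → wd (num (p ρ *ᶠ q ρ))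
       dnum* = d*ᴺ

   opaque
     Fracs : W
     Fracs = sep (λ x → Σ Frac λ q → x ≡ fw q) (𝒫 (𝒫 (ω ∪ ω)))

     Fracs-spec : ∀ x → x ε Fracs ⟺ (Σ Frac λ q → x ≡ fw q)
     Fracs-spec x = (λ i → proj₂ (proj₁ (sep-spec (λ x → Σ Frac λ q → x ≡ fw q) (𝒫 (𝒫 (ω ∪ ω))) x) i)) ,
       λ { (q , refl) → proj₂ (sep-spec (λ x → Σ Frac λ q → x ≡ fw q) (𝒫 (𝒫 (ω ∪ ω))) (fw q))
         (subst (_ε 𝒫 (𝒫 (ω ∪ ω))) (sym (fw-def q)) (pair∈ (wd∈ω (num q)) (wd∈ω (den q))) , q , refl) }

   rel-frac : {z : W} → R.IsFrac (el z) ⟺ (Σ Frac λ q → z ≡ fw q)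
   rel-frac {z} =
     (λ (m , vm , n , vn , hm , hn , ne , e) →
       let m′ = nat ⟪ m , vm ⟫ (proj₁ (rel-nat {⟪ m , vm ⟫}) hm)
           n′ = nat ⟪ n , vn ⟫ (proj₁ (rel-nat {⟪ n , vn ⟫}) hn)
       in ⊎-elim (λ z → ⊥-elim (ne (proj₂ (rel-empty {⟪ n , vn ⟫}) (trans (cong wd z) wd-0))))
            (λ (k , eq) → (m′ /s k) , trans (proj₁ (rel-pair {z} {⟪ m , vm ⟫} {⟪ n , vn ⟫}) e)
               (trans (cong (λ v → ⟨ wd m′ , wd v ⟩) eq) (sym (fw-def (m′ /s k)))))
            (nonzero n′)) ,
     (λ (q , e) → el (wd (num q)) , isV (wd (num q)) , el (wd (den q)) , isV (wd (den q)) ,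
        proj₂ (rel-nat {wd (num q)}) (wd∈ω (num q)) , proj₂ (rel-nat {wd (den q)}) (wd∈ω (den q)) ,
        (λ z → s≢0 {pre q} (wd-inj (trans (proj₁ (rel-empty {wd (den q)}) z) (sym wd-0)))) ,
        proj₂ (rel-pair {z} {wd (num q)} {wd (den q)}) (trans e (fw-def q)))

   rel-frac-pair : ∀ q {m n : W} → R.IsPair (el (fw q)) (el m) (el n) → m ≡ wd (num q) × n ≡ wd (den q)
   rel-frac-pair q {m} {n} h = let (i , j) = ⟨⟩-inj (trans (sym (proj₁ (rel-pair {fw q} {m} {n}) h)) (fw-def q)) in i , j

   frac-pair : ∀ q → R.IsPair (el (fw q)) (el (wd (num q))) (el (wd (den q)))
   frac-pair q = proj₂ (rel-pair {fw q} {wd (num q)} {wd (den q)}) (fw-def q)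

   rel-*ᴺ : ∀ m n {k : W} → R.Times (el (wd m)) (el (wd n)) (el k) ⟺ (k ≡ wd (m *ᴺ n))
   rel-*ᴺ m n {k} = subst (λ v → R.Times (el (wd m)) (el (wd n)) (el k) ⟺ (k ≡ v)) (sym (wd-* m n)) (rel-* (wd∈ω m) (wd∈ω n))

   rel-+ᴺ : ∀ m n {k : W} → R.Plus (el (wd m)) (el (wd n)) (el k) ⟺ (k ≡ wd (m +ᴺ n))
   rel-+ᴺ m n {k} = subst (λ v → R.Plus (el (wd m)) (el (wd n)) (el k) ⟺ (k ≡ v)) (sym (wd-+ m n)) (rel-+ (wd∈ω m) (wd∈ω n))

   rel-cross : ∀ p q {j k : W} → R.CrossProducts (el (fw p)) (el (fw q)) (el j) (el k) ⟺
               ((j ≡ wd (num p *ᴺ den q)) × (k ≡ wd (num q *ᴺ den p)))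
   rel-cross p q {j} {k} =
     (λ (m , vm , n , vn , m′ , vm′ , n′ , vn′ , h , h′ , t , t′) →
        go (rel-frac-pair p {⟪ m , vm ⟫} {⟪ n , vn ⟫} h) (rel-frac-pair q {⟪ m′ , vm′ ⟫} {⟪ n′ , vn′ ⟫} h′) t t′) ,
     (λ (e , e′) → el (wd (num p)) , isV (wd (num p)) , el (wd (den p)) , isV (wd (den p)) ,
        el (wd (num q)) , isV (wd (num q)) , el (wd (den q)) , isV (wd (den q)) ,
        frac-pair p , frac-pair q , proj₂ (rel-*ᴺ (num p) (den q) {j}) e , proj₂ (rel-*ᴺ (num q) (den p) {k}) e′)
     where
     go : ∀ {m n m′ n′} → m ≡ wd (num p) × n ≡ wd (den p) → m′ ≡ wd (num q) × n′ ≡ wd (den q) →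
          R.Times (el m) (el n′) (el j) → R.Times (el m′) (el n) (el k) →
          (j ≡ wd (num p *ᴺ den q)) × (k ≡ wd (num q *ᴺ den p))
     go (refl , refl) (refl , refl) t t′ = proj₁ (rel-*ᴺ (num p) (den q) {j}) t , proj₁ (rel-*ᴺ (num q) (den p) {k}) t′

   rel-<ᶠ : ∀ p q → (el (fw p) R.<ᶠ el (fw q)) ⟺ (p <ᶠ q)
   rel-<ᶠ p q =
     (λ (j , vj , k , vk , c , i) → let (e , e′) = proj₁ (rel-cross p q {⟪ j , vj ⟫} {⟪ k , vk ⟫}) c in
        proj₁ (ε⟺< {num p *ᴺ den q} {num q *ᴺ den p}) (subst₂ _ε_ e e′ (∈→ε i))) ,
     (λ h → let j = wd (num p *ᴺ den q) ; k = wd (num q *ᴺ den p) in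
        el j , isV j , el k , isV k , proj₂ (rel-cross p q {j} {k}) (refl , refl) , ε→∈ (proj₂ (ε⟺< {num p *ᴺ den q} {num q *ᴺ den p}) h))

   rel-≤ᶠ : ∀ p q → (el (fw p) R.≤ᶠ el (fw q)) ⟺ (p ≤ᶠ q)
   rel-≤ᶠ p q =
     (λ (j , vj , k , vk , c , i) → let (e , e′) = proj₁ (rel-cross p q {⟪ j , vj ⟫} {⟪ k , vk ⟫}) c in
        ⊎-elim (λ i → <⇒≤ (proj₁ (ε⟺< {num p *ᴺ den q} {num q *ᴺ den p}) (subst₂ _ε_ e e′ (∈→ε i))))
               (λ i → ≤-reflexive (wd-inj (trans (sym e) (trans (el-inj i) e′)))) i) ,
     (λ h → let j = wd (num p *ᴺ den q) ; k = wd (num q *ᴺ den p) in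
        el j , isV j , el k , isV k , proj₂ (rel-cross p q {j} {k}) (refl , refl) ,
        ⊎-elim (λ i → ⊎-elim (λ l → inj₁ (ε→∈ (proj₂ (ε⟺< {num p *ᴺ den q} {num q *ᴺ den p}) l))) (λ e → inj₂ (cong (λ v → el (wd v)) e)) (≤-split i)) (λ i → ⊥-elim (<⇒≱ i h)) (≤-total (num p *ᴺ den q) (num q *ᴺ den p)))
     where
     ≤-split : m ≤ᴺ n → m <ᴺ n ⊎ m ≡ n
     ≤-split {m} (j , e) with nonzero j
     ... | inj₁ refl = inj₂ (trans (sym (+0 m)) e)
     ... | inj₂ (k , refl) = inj₁ (k , trans (s+ k m) (trans (sym (+s m k)) e))

   rel-fplus : ∀ p q {z : W} → R.FracPlus (el (fw p)) (el (fw q)) (el z) ⟺ (z ≡ fw (p +ᶠ q))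
   rel-fplus p q {z} =
     (λ { (m , vm , n , vn , m′ , vm′ , n′ , vn′ , j , vj , k , vk , a , va , b , vb , h , h′ , t , t′ , u , v , w) →
        go (rel-frac-pair p {⟪ m , vm ⟫} {⟪ n , vn ⟫} h) (rel-frac-pair q {⟪ m′ , vm′ ⟫} {⟪ n′ , vn′ ⟫} h′)
           {⟪ j , vj ⟫} {⟪ k , vk ⟫} {⟪ a , va ⟫} {⟪ b , vb ⟫} t t′ u v w }) ,
     (λ e → el (wd (num p)) , isV (wd (num p)) , el (wd (den p)) , isV (wd (den p)) ,
        el (wd (num q)) , isV (wd (num q)) , el (wd (den q)) , isV (wd (den q)) ,
        el (wd J) , isV (wd J) , el (wd K) , isV (wd K) , el (wd (J +ᴺ K)) , isV (wd (J +ᴺ K)) ,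
        el (wd (den p *ᴺ den q)) , isV (wd (den p *ᴺ den q)) ,
        frac-pair p , frac-pair q , proj₂ (rel-*ᴺ (num p) (den q) {wd J}) refl , proj₂ (rel-*ᴺ (num q) (den p) {wd K}) refl ,
        proj₂ (rel-+ᴺ J K {wd (J +ᴺ K)}) refl , proj₂ (rel-*ᴺ (den p) (den q) {wd (den p *ᴺ den q)}) refl ,
        proj₂ (rel-pair {z} {wd (J +ᴺ K)} {wd (den p *ᴺ den q)}) (trans e code))
     where
     J = num p *ᴺ den q
     K = num q *ᴺ den p
     code : fw (p +ᶠ q) ≡ ⟨ wd (J +ᴺ K) , wd (den p *ᴺ den q) ⟩
     code = trans (fw-def (p +ᶠ q)) (cong₂ (λ u v → ⟨ wd u , wd v ⟩) (num-+ p q) (den-+ p q))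
     go : ∀ {m n m′ n′} → m ≡ wd (num p) × n ≡ wd (den p) → m′ ≡ wd (num q) × n′ ≡ wd (den q) → ∀ {j k a b} →
          R.Times (el m) (el n′) (el j) → R.Times (el m′) (el n) (el k) → R.Plus (el j) (el k) (el a) →
          R.Times (el n) (el n′) (el b) → R.IsPair (el z) (el a) (el b) → z ≡ fw (p +ᶠ q)
     go (refl , refl) (refl , refl) {j} {k} {a} {b} t t′ u v w =
       go′ {a = a} (proj₁ (rel-*ᴺ (num p) (den q) {j}) t) (proj₁ (rel-*ᴺ (num q) (den p) {k}) t′) (proj₁ (rel-*ᴺ (den p) (den q) {b}) v) u w
       where
       go″ : ∀ {a} → a ≡ wd (J +ᴺ K) → R.IsPair (el z) (el a) (el (wd (den p *ᴺ den q))) → z ≡ fw (p +ᶠ q)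
       go″ refl w = trans (proj₁ (rel-pair {z} {wd (J +ᴺ K)} {wd (den p *ᴺ den q)}) w) (sym code)
       go′ : ∀ {j k a b} → j ≡ wd J → k ≡ wd K → b ≡ wd (den p *ᴺ den q) → R.Plus (el j) (el k) (el a) →
             R.IsPair (el z) (el a) (el b) → z ≡ fw (p +ᶠ q)
       go′ {a = a} refl refl refl u w = go″ (proj₁ (rel-+ᴺ J K {a}) u) w

   rel-ftimes : ∀ p q {z : W} → R.FracTimes (el (fw p)) (el (fw q)) (el z) ⟺ (z ≡ fw (p *ᶠ q))
   rel-ftimes p q {z} =
     (λ { (m , vm , n , vn , m′ , vm′ , n′ , vn′ , a , va , b , vb , h , h′ , u , v , w) →
        go (rel-frac-pair p {⟪ m , vm ⟫} {⟪ n , vn ⟫} h) (rel-frac-pair q {⟪ m′ , vm′ ⟫} {⟪ n′ , vn′ ⟫} h′)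
           {⟪ a , va ⟫} {⟪ b , vb ⟫} u v w }) ,
     (λ e → el (wd (num p)) , isV (wd (num p)) , el (wd (den p)) , isV (wd (den p)) ,
        el (wd (num q)) , isV (wd (num q)) , el (wd (den q)) , isV (wd (den q)) ,
        el (wd J) , isV (wd J) , el (wd K) , isV (wd K) , frac-pair p , frac-pair q ,
        proj₂ (rel-*ᴺ (num p) (num q) {wd J}) refl , proj₂ (rel-*ᴺ (den p) (den q) {wd K}) refl ,
        proj₂ (rel-pair {z} {wd J} {wd K}) (trans e code))
     where
     J = num p *ᴺ num q
     K = den p *ᴺ den q
     code : fw (p *ᶠ q) ≡ ⟨ wd J , wd K ⟩
     code = trans (fw-def (p *ᶠ q)) (cong₂ (λ u v → ⟨ wd u , wd v ⟩) (num-* p q) (den-* p q))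
     go : ∀ {m n m′ n′} → m ≡ wd (num p) × n ≡ wd (den p) → m′ ≡ wd (num q) × n′ ≡ wd (den q) → ∀ {a b} →
          R.Times (el m) (el m′) (el a) → R.Times (el n) (el n′) (el b) → R.IsPair (el z) (el a) (el b) → z ≡ fw (p *ᶠ q)
     go (refl , refl) (refl , refl) {a} {b} u v w =
       go′ (proj₁ (rel-*ᴺ (num p) (num q) {a}) u) (proj₁ (rel-*ᴺ (den p) (den q) {b}) v) w
       where
       go′ : ∀ {a b} → a ≡ wd J → b ≡ wd K → R.IsPair (el z) (el a) (el b) → z ≡ fw (p *ᶠ q)
       go′ refl refl w = trans (proj₁ (rel-pair {z} {wd J} {wd K}) w) (sym code)

 module Reals where

   open Arithmetic
   open Fractions

   IsCut : W → Set ℓ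
   IsCut w = (∀ x → x ε w → Σ Frac λ q → x ≡ fw q)
           × (Σ Frac λ q → fw q ε w)
           × (∀ p q → fw p ε w → p ≤ᶠ q → fw q ε w)
           × (∀ q → fw q ε w → Σ Frac λ p → p <ᶠ q × fw p ε w)

   record Real : Set ℓ where
     no-eta-equality
     pattern
     constructor real
     field
       rw   : W
       .cut : IsCut rw
   open Real public using (rw)

   isCut : (r : Real) → IsCut (rw r)
   isCut (real w h) = recompute em h

   private variable
     r s t u : Real
     p q x y : Frac

   rw-inj : rw r ≡ rw s → r ≡ s
   rw-inj {real w _} {real .w _} refl = refl

   -- r ∋ q means r < q.
   infix 4 _∋_ _≤_
   _∋_ : Real → Frac → Set ℓ
   r ∋ q = fw q ε rw r

   up : ∀ r → r ∋ p → p ≤ᶠ q → r ∋ q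
   up {p} {q} r = proj₁ (proj₂ (proj₂ (isCut r))) p q

   round : ∀ r → r ∋ q → Σ Frac λ p → p <ᶠ q × r ∋ p
   round {q} r = proj₂ (proj₂ (proj₂ (isCut r))) q

   inhabited : ∀ r → Σ Frac λ q → r ∋ q
   inhabited r = proj₁ (proj₂ (isCut r))

   ∋-Pos : ∀ r → r ∋ q → Pos q
   ∋-Pos {q} r h = let (p , l , _) = round r h in <⇒Pos {p} {q} l

   real-ext : (∀ q → r ∋ q ⟺ s ∋ q) → r ≡ s
   real-ext {r} {s} h = rw-inj (⊆-antisym
     (λ x i → let (q , e) = proj₁ (isCut r) x i in subst (_ε rw s) (sym e) (proj₁ (h q) (subst (_ε rw r) e i)))
     (λ x i → let (q , e) = proj₁ (isCut s) x i in subst (_ε rw r) (sym e) (proj₂ (h q) (subst (_ε rw s) e i))))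

   record _≤_ (r s : Real) : Set ℓ where
     constructor le
     field at : ∀ q → s ∋ q → r ∋ q
   open _≤_ public

   ≤ᴿ-refl : r ≤ r
   ≤ᴿ-refl = le λ q h → h

   ≡⇒≤ : r ≡ s → r ≤ s
   ≡⇒≤ refl = le λ q h → h

   ≤ᴿ-trans : r ≤ s → s ≤ t → r ≤ t
   ≤ᴿ-trans h k = le λ q i → at h q (at k q i)

   ≤ᴿ-antisym : r ≤ s → s ≤ r → r ≡ s
   ≤ᴿ-antisym h k = real-ext λ q → at k q , at h q

   ∋-< : ∀ r → r ∋ p → ¬ (r ∋ q) → q <ᶠ p
   ∋-< {p} {q} r h k = ⊎-elim (λ i → ⊥-elim (k (up r h i))) (λ i → i) (≤ᶠ-total p q)

   ≰⇒ : ¬ (r ≤ s) → Σ Frac λ q → s ∋ q × ¬ (r ∋ q)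
   ≰⇒ h = dne λ k → h (le λ q i → dne λ j → k (q , i , j))

   ≤ᴿ-total : ∀ r s → r ≤ s ⊎ s ≤ r
   ≤ᴿ-total r s with em {r ≤ s}
   ... | yes h = inj₁ h
   ... | no h = let (q , i , j) = ≰⇒ {r} {s} h in
     inj₂ (le λ x k → up {q} {x} s i (<ᶠ⇒≤ᶠ {q} {x} (∋-< r k j)))

   opaque
     bounded : (P : Frac → Set ℓ) → Def {2} (λ ρ → P (toNat (ρ (suc zero)) /s toNat (ρ zero))) → W
     bounded P d = sep (λ x → Σ Frac λ q → x ≡ fw q × Σ Frac λ p → p <ᶠ q × P p) ⦃ dp ⦄ Fracs
       where
       dp : Def {1} λ ρ → Σ Frac λ q → ρ zero ≡ fw q × Σ Frac λ p → p <ᶠ q × P p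
       dp = dExFrac ⦃ dAnd ⦃ it ⦄ ⦃ dExFrac ⦃ dAnd ⦃ it ⦄
              ⦃ Def-ren {P = λ ρ → P (toNat (ρ (suc zero)) /s toNat (ρ zero))} (zero ∷ suc zero ∷ []) d ⦄ ⦄ ⦄ ⦄

     bounded-spec : (P : Frac → Set ℓ) (d : Def {2} (λ ρ → P (toNat (ρ (suc zero)) /s toNat (ρ zero)))) → ∀ x →
       x ε bounded P d ⟺ (Σ Frac λ q → x ≡ fw q × Σ Frac λ p → p <ᶠ q × P p)
     bounded-spec P d x =
       (λ i → proj₂ (proj₁ (sep-spec _ ⦃ _ ⦄ Fracs x) i)) ,
       (λ { (q , e , h) → proj₂ (sep-spec _ ⦃ _ ⦄ Fracs x) (proj₂ (Fracs-spec x) (q , e) , q , e , h) })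

   infℝ : (P : Frac → Set ℓ) → ⦃ Def {2} (λ ρ → P (toNat (ρ (suc zero)) /s toNat (ρ zero))) ⦄ → .(Σ Frac P) → Real
   infℝ P ⦃ d ⦄ ne = real (bounded P d)
     ( (λ x i → let (q , e , _) = proj₁ (bounded-spec P d x) i in q , e)
     , (let (p , h) = ne in p +ᶠ 1ᶠ , proj₂ (bounded-spec P d _) (_ , refl , p , +ᶠ-increasing p {1ᶠ} (suc-pos 0ᴺ) , h))
     , (λ p q i l → let (p′ , e , p″ , l′ , h) = proj₁ (bounded-spec P d _) i in
         proj₂ (bounded-spec P d _) (q , refl , p″ , <-≤ᶠ-trans {p″} {p} {q} (subst (p″ <ᶠ_) (sym (fw-inj e)) l′) l , h))
     , (λ q i → let (q′ , e , p , l , h) = proj₁ (bounded-spec P d _) i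
                    (m , l₁ , l₂) = dense {p} {q′} l
                in m , subst (m <ᶠ_) (sym (fw-inj e)) l₂ , proj₂ (bounded-spec P d _) (m , refl , p , l₁ , h)) )

   infℝ-∋ : (P : Frac → Set ℓ) ⦃ d : Def {2} (λ ρ → P (toNat (ρ (suc zero)) /s toNat (ρ zero))) ⦄ .(ne : Σ Frac P) →
            infℝ P ne ∋ q ⟺ (Σ Frac λ p → p <ᶠ q × P p)
   infℝ-∋ {q} P ⦃ d ⦄ ne =
     (λ i → let (q′ , e , p , l , h) = proj₁ (bounded-spec P d _) i in p , subst (p <ᶠ_) (sym (fw-inj e)) l , h) ,
     (λ (p , l , h) → proj₂ (bounded-spec P d _) (q , refl , p , l , h))

   opaque
     private
       above : (m d : Nat) → Def {2} (λ ρ → m *ᴺ den (toNat (ρ (suc zero)) /s toNat (ρ zero)) ≤ᴺ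
                                            num (toNat (ρ (suc zero)) /s toNat (ρ zero)) *ᴺ d)
       above m d = it

     ι : Frac → Real
     ι q = infℝ (q ≤ᶠ_) ⦃ above (num q) (den q) ⦄ (q , ≤ᶠ-refl q)

     ι-∋ : ι q ∋ x ⟺ (q <ᶠ x)
     ι-∋ {q} {x} = ⟺-trans (infℝ-∋ (q ≤ᶠ_) ⦃ above (num q) (den q) ⦄ (q , ≤ᶠ-refl q))
       ((λ (p , l , h) → ≤-<ᶠ-trans {q} {p} {x} h l) , (λ l → q , l , ≤ᶠ-refl q))

   0ᴿ 1ᴿ : Real
   0ᴿ = ι 0ᶠ
   1ᴿ = ι 1ᶠ

   0ᴿ-∋ : 0ᴿ ∋ q ⟺ Pos q
   0ᴿ-∋ {q} = ⟺-trans ι-∋ (<⇒Pos {0ᶠ} {q} , Pos⇒< {q})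

   private
     InSum InProduct : W → W → W → Set ℓ
     InSum x a b = Σ Frac λ q → x ≡ fw q × Σ Frac λ p → Σ Frac λ p′ → fw p ε a × fw p′ ε b × p +ᶠ p′ ≤ᶠ q
     InProduct x a b = Σ Frac λ q → x ≡ fw q × Σ Frac λ p → Σ Frac λ p′ → fw p ε a × fw p′ ε b × p *ᶠ p′ ≤ᶠ q

     dInSum : Def {3} λ ρ → InSum (ρ zero) (ρ (suc zero)) (ρ (suc (suc zero)))
     dInSum = it

     dInProduct : Def {3} λ ρ → InProduct (ρ zero) (ρ (suc zero)) (ρ (suc (suc zero)))
     dInProduct = it

   opaque
     addW mulW : W → W → W
     addW a b = sep (λ x → InSum x a b) ⦃ Def₃ InSum dInSum var₀ tCon tCon ⦄ Fracs
     mulW a b = sep (λ x → InProduct x a b) ⦃ Def₃ InProduct dInProduct var₀ tCon tCon ⦄ Fracs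

     addW-spec : ∀ a b x → x ε addW a b ⟺ InSum x a b
     addW-spec a b x = (λ i → proj₂ (proj₁ (sep-spec _ ⦃ _ ⦄ Fracs x) i)) ,
       (λ { (q , e , h) → proj₂ (sep-spec _ ⦃ _ ⦄ Fracs x) (proj₂ (Fracs-spec x) (q , e) , q , e , h) })

     mulW-spec : ∀ a b x → x ε mulW a b ⟺ InProduct x a b
     mulW-spec a b x = (λ i → proj₂ (proj₁ (sep-spec _ ⦃ _ ⦄ Fracs x) i)) ,
       (λ { (q , e , h) → proj₂ (sep-spec _ ⦃ _ ⦄ Fracs x) (proj₂ (Fracs-spec x) (q , e) , q , e , h) })

   opaque
    instance
     dAddW : ∀ {n} {s t : Env n → W} → ⦃ DefT s ⦄ → ⦃ DefT t ⦄ → DefT λ ρ → addW (s ρ) (t ρ)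
     dAddW = dSet₂ addW addW-spec ⦃ dInSum ⦄

     dMulW : ∀ {n} {s t : Env n → W} → ⦃ DefT s ⦄ → ⦃ DefT t ⦄ → DefT λ ρ → mulW (s ρ) (t ρ)
     dMulW = dSet₂ mulW mulW-spec ⦃ dInProduct ⦄

   private
     add-∋ : ∀ {a b} → fw q ε addW a b ⟺ (Σ Frac λ p → Σ Frac λ p′ → fw p ε a × fw p′ ε b × p +ᶠ p′ ≤ᶠ q)
     add-∋ {q} {a} {b} = (λ i → let (q′ , e , p , p′ , h , k , l) = proj₁ (addW-spec a b _) i in
         p , p′ , h , k , subst (p +ᶠ p′ ≤ᶠ_) (sym (fw-inj e)) l) ,
       (λ h → proj₂ (addW-spec a b _) (q , refl , h))

     mul-∋ : ∀ {a b} → fw q ε mulW a b ⟺ (Σ Frac λ p → Σ Frac λ p′ → fw p ε a × fw p′ ε b × p *ᶠ p′ ≤ᶠ q)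
     mul-∋ {q} {a} {b} = (λ i → let (q′ , e , p , p′ , h , k , l) = proj₁ (mulW-spec a b _) i in
         p , p′ , h , k , subst (p *ᶠ p′ ≤ᶠ_) (sym (fw-inj e)) l) ,
       (λ h → proj₂ (mulW-spec a b _) (q , refl , h))

     add-cut : ∀ r s → IsCut (addW (rw r) (rw s))
     add-cut r s =
       (λ x i → let (q , e , _) = proj₁ (addW-spec _ _ x) i in q , e) ,
       (let (p , h) = inhabited r ; (p′ , k) = inhabited s in
         p +ᶠ p′ , proj₂ add-∋ (p , p′ , h , k , ≤ᶠ-refl (p +ᶠ p′))) ,
       (λ x y i l → let (p , p′ , h , k , m) = proj₁ add-∋ i in
         proj₂ add-∋ (p , p′ , h , k , ≤ᶠ-trans {p +ᶠ p′} {x} {y} m l)) ,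
       (λ x i → let (p , p′ , h , k , m) = proj₁ add-∋ i
                    (p₀ , l , h₀) = round r h
                in p₀ +ᶠ p′ , <-≤ᶠ-trans {p₀ +ᶠ p′} {p +ᶠ p′} {x} (+ᶠ-monoˡ-< {p₀} {p} {p′} l) m ,
                   proj₂ add-∋ (p₀ , p′ , h₀ , k , ≤ᶠ-refl (p₀ +ᶠ p′)))

     mul-cut : ∀ r s → IsCut (mulW (rw r) (rw s))
     mul-cut r s =
       (λ x i → let (q , e , _) = proj₁ (mulW-spec _ _ x) i in q , e) ,
       (let (p , h) = inhabited r ; (p′ , k) = inhabited s in
         p *ᶠ p′ , proj₂ mul-∋ (p , p′ , h , k , ≤ᶠ-refl (p *ᶠ p′))) ,
       (λ x y i l → let (p , p′ , h , k , m) = proj₁ mul-∋ i in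
         proj₂ mul-∋ (p , p′ , h , k , ≤ᶠ-trans {p *ᶠ p′} {x} {y} m l)) ,
       (λ x i → let (p , p′ , h , k , m) = proj₁ mul-∋ i
                    (p₀ , l , h₀) = round r h
                in p₀ *ᶠ p′ , <-≤ᶠ-trans {p₀ *ᶠ p′} {p *ᶠ p′} {x} (*ᶠ-monoˡ-< {p₀} {p} {p′} l (∋-Pos s k)) m ,
                   proj₂ mul-∋ (p₀ , p′ , h₀ , k , ≤ᶠ-refl (p₀ *ᶠ p′)))

   infixl 6 _+ᴿ_
   infixl 7 _*ᴿ_

   opaque
     _+ᴿ_ _*ᴿ_ : Real → Real → Real
     r +ᴿ s = real (addW (rw r) (rw s)) (add-cut r s)
     r *ᴿ s = real (mulW (rw r) (rw s)) (mul-cut r s)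

     rw-+ : ∀ r s → rw (r +ᴿ s) ≡ addW (rw r) (rw s)
     rw-+ r s = refl

     rw-* : ∀ r s → rw (r *ᴿ s) ≡ mulW (rw r) (rw s)
     rw-* r s = refl

   +-∋ : (r +ᴿ s) ∋ q ⟺ (Σ Frac λ p → Σ Frac λ p′ → r ∋ p × s ∋ p′ × p +ᶠ p′ ≤ᶠ q)
   +-∋ {r} {s} {q} = ⟺-trans (subst (fw q ε_) (rw-+ r s) , subst (fw q ε_) (sym (rw-+ r s))) add-∋

   *-∋ : (r *ᴿ s) ∋ q ⟺ (Σ Frac λ p → Σ Frac λ p′ → r ∋ p × s ∋ p′ × p *ᶠ p′ ≤ᶠ q)
   *-∋ {r} {s} {q} = ⟺-trans (subst (fw q ε_) (rw-* r s) , subst (fw q ε_) (sym (rw-* r s))) mul-∋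

   dIsCut : Def {1} λ ρ → IsCut (ρ zero)
   dIsCut = it

   opaque
     toReal : W → Real
     toReal w with em {IsCut w}
     ... | yes h = real w h
     ... | no _  = 0ᴿ

     rw-toReal : {w : W} → IsCut w → rw (toReal w) ≡ w
     rw-toReal {w} i with em {IsCut w}
     ... | yes h = refl
     ... | no h  = ⊥-elim (h i)

     toReal-rw : (r : Real) → toReal (rw r) ≡ r
     toReal-rw r = rw-inj (rw-toReal (isCut r))

     toReal-char : (z y w : W) → z ≡ rw 0ᴿ → (y ≡ rw (toReal w)) ⟺ ((IsCut w × y ≡ w) ⊎ (¬ IsCut w × y ≡ z))
     toReal-char z y w refl with em {IsCut w}
     ... | yes h = (λ e → inj₁ (h , e)) , λ { (inj₁ (_ , e)) → e ; (inj₂ (n , _)) → ⊥-elim (n h) }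
     ... | no h  = (λ e → inj₂ (h , e)) , λ { (inj₁ (i , _)) → ⊥-elim (h i) ; (inj₂ (_ , e)) → e }

     private
       dChar : (z : W) → Def {2} λ ρ → (IsCut (ρ (suc zero)) × ρ zero ≡ ρ (suc zero)) ⊎ (¬ IsCut (ρ (suc zero)) × ρ zero ≡ z)
       dChar z = dOr ⦃ dAnd ⦃ dC ⦄ ⦃ it ⦄ ⦄ ⦃ dAnd ⦃ dNot ⦃ dC ⦄ ⦄ ⦃ it ⦄ ⦄
         where
         dC : Def {2} λ ρ → IsCut (ρ (suc zero))
         dC = Def-ren {P = λ ρ → IsCut (ρ zero)} (λ _ → suc zero) dIsCut

     instance
       dToReal : ∀ {n} {t : Env n → W} → ⦃ DefT t ⦄ → DefT λ ρ → rw (toReal (t ρ))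
       dToReal ⦃ d ⦄ = DefT₁ (λ w → rw (toReal w))
         (Def-≈ (λ ρ → toReal-char (rw 0ᴿ) (ρ zero) (ρ (suc zero)) refl) (dChar (rw 0ᴿ))) d

       dAllReal : ∀ {n} {P : Env n → Real → Set ℓ} → ⦃ Def λ ρ → P (tail ρ) (toReal (head ρ)) ⦄ → Def λ ρ → (x : Real) → P ρ x
       dAllReal {P = P} ⦃ d ⦄ = Def-≈ (λ ρ → (λ h w → h (toReal w)) , (λ h x → subst (P ρ) (toReal-rw x) (h (rw x)))) (dAll ⦃ d ⦄)

       dExReal : ∀ {n} {P : Env n → Real → Set ℓ} → ⦃ Def λ ρ → P (tail ρ) (toReal (head ρ)) ⦄ → Def λ ρ → Σ Real λ x → P ρ x
       dExReal {P = P} ⦃ d ⦄ = Def-≈ (λ ρ → (λ (x , p) → rw x , subst (P ρ) (sym (toReal-rw x)) p) , (λ (w , p) → toReal w , p)) (dEx ⦃ d ⦄)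

       dEqReal : ∀ {n} {s t : Env n → Real} → ⦃ DefT λ ρ → rw (s ρ) ⦄ → ⦃ DefT λ ρ → rw (t ρ) ⦄ → Def λ ρ → s ρ ≡ t ρ
       dEqReal ⦃ d ⦄ ⦃ e ⦄ = Def-≈ (λ ρ → cong rw , rw-inj) (dEqn ⦃ d ⦄ ⦃ e ⦄)

       d+ᴿ : ∀ {n} {s t : Env n → Real} → ⦃ DefT λ ρ → rw (s ρ) ⦄ → ⦃ DefT λ ρ → rw (t ρ) ⦄ → DefT λ ρ → rw (s ρ +ᴿ t ρ)
       d+ᴿ {s = s} {t} ⦃ d ⦄ ⦃ e ⦄ = DefT-≈ (λ ρ → rw-+ (s ρ) (t ρ)) (dAddW ⦃ d ⦄ ⦃ e ⦄)

       d≤ : ∀ {n} {s t : Env n → Real} → ⦃ DefT λ ρ → rw (s ρ) ⦄ → ⦃ DefT λ ρ → rw (t ρ) ⦄ → Def λ ρ → s ρ ≤ t ρ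
       d≤ ⦃ d ⦄ ⦃ e ⦄ = Def-≈ (λ ρ → at , le) (Def₂ (λ a b → ∀ q → fw q ε b → fw q ε a) it d e)

       d*ᴿ : ∀ {n} {s t : Env n → Real} → ⦃ DefT λ ρ → rw (s ρ) ⦄ → ⦃ DefT λ ρ → rw (t ρ) ⦄ → DefT λ ρ → rw (s ρ *ᴿ t ρ)
       d*ᴿ {s = s} {t} ⦃ d ⦄ ⦃ e ⦄ = DefT-≈ (λ ρ → rw-* (s ρ) (t ρ)) (dMulW ⦃ d ⦄ ⦃ e ⦄)

   0≤ : ∀ r → 0ᴿ ≤ r
   0≤ r = le λ q h → proj₂ 0ᴿ-∋ (∋-Pos r h)

   ≤0⇒≡0 : r ≤ 0ᴿ → r ≡ 0ᴿ
   ≤0⇒≡0 {r} h = ≤ᴿ-antisym h (0≤ r)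

   ∋⇒≤ι : r ∋ q → r ≤ ι q
   ∋⇒≤ι {r} {q} h = le λ x i → up r h (<ᶠ⇒≤ᶠ {q} {x} (proj₁ ι-∋ i))

   ∌⇒ι≤ : ¬ (r ∋ q) → ι q ≤ r
   ∌⇒ι≤ {r} {q} h = le λ x i → proj₂ ι-∋ (∋-< r i h)

   ≢0⇒ : ¬ (r ≡ 0ᴿ) → Σ Frac λ q → Pos q × ¬ (r ∋ q)
   ≢0⇒ {r} h = let (q , i , j) = ≰⇒ {r} {0ᴿ} (λ k → h (≤0⇒≡0 k)) in q , proj₁ 0ᴿ-∋ i , j

   +ᴿ-mono : r ≤ s → t ≤ u → r +ᴿ t ≤ s +ᴿ u
   +ᴿ-mono h k = le λ q i → let (p , p′ , a , b , l) = proj₁ +-∋ i in proj₂ +-∋ (p , p′ , at h p a , at k p′ b , l)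

   *ᴿ-mono : r ≤ s → t ≤ u → r *ᴿ t ≤ s *ᴿ u
   *ᴿ-mono h k = le λ q i → let (p , p′ , a , b , l) = proj₁ *-∋ i in proj₂ *-∋ (p , p′ , at h p a , at k p′ b , l)

   +ᴿ-comm : ∀ r s → r +ᴿ s ≡ s +ᴿ r
   +ᴿ-comm r s = real-ext λ q → sw r s q , sw s r q
     where
     sw : ∀ r s q → (r +ᴿ s) ∋ q → (s +ᴿ r) ∋ q
     sw r s q i = let (p , p′ , a , b , l) = proj₁ +-∋ i in
       proj₂ +-∋ (p′ , p , b , a , subst (_≤ᶠ q) (+ᶠ-comm p p′) l)

   *ᴿ-comm : ∀ r s → r *ᴿ s ≡ s *ᴿ r
   *ᴿ-comm r s = real-ext λ q → sw r s q , sw s r q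
     where
     sw : ∀ r s q → (r *ᴿ s) ∋ q → (s *ᴿ r) ∋ q
     sw r s q i = let (p , p′ , a , b , l) = proj₁ *-∋ i in
       proj₂ *-∋ (p′ , p , b , a , subst (_≤ᶠ q) (*ᶠ-comm p p′) l)

   private
     assoc≤ : ∀ r s t → (r +ᴿ s) +ᴿ t ≤ r +ᴿ (s +ᴿ t)
     assoc≤ r s t = le λ q i →
       let (p , p′ , a , b , l) = proj₁ +-∋ i
           (u , v , c , d , m) = proj₁ +-∋ b
       in proj₂ +-∋ (p +ᶠ u , v , proj₂ +-∋ (p , u , a , c , ≤ᶠ-refl (p +ᶠ u)) , d ,
         subst (_≤ᶠ q) (sym (+ᶠ-assoc p u v)) (≤ᶠ-trans {p +ᶠ (u +ᶠ v)} {p +ᶠ p′} {q}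
           (+ᶠ-mono-≤ {p} {p} {u +ᶠ v} {p′} (≤ᶠ-refl p) m) l))

   +ᴿ-assoc : ∀ r s t → (r +ᴿ s) +ᴿ t ≡ r +ᴿ (s +ᴿ t)
   +ᴿ-assoc r s t = ≤ᴿ-antisym (assoc≤ r s t)
     (≤ᴿ-trans (≡⇒≤ (trans (+ᴿ-comm r _) (cong (_+ᴿ r) (+ᴿ-comm s t))))
       (≤ᴿ-trans (assoc≤ t s r) (≡⇒≤ (trans (+ᴿ-comm t _) (cong (_+ᴿ t) (+ᴿ-comm s r))))))

   +ᴿ-0 : ∀ r → r +ᴿ 0ᴿ ≡ r
   +ᴿ-0 r = real-ext λ q →
     (λ i → let (p , p′ , a , b , l) = proj₁ +-∋ i in
       up r a (≤ᶠ-trans {p} {p +ᶠ p′} {q} (<ᶠ⇒≤ᶠ {p} {p +ᶠ p′} (+ᶠ-increasing p {p′} (proj₁ 0ᴿ-∋ b))) l)) ,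
     (λ i → let (p , l , a) = round r i ; (d , d>0 , e) = subtract {p} {q} l in
       proj₂ +-∋ (p , d , a , proj₂ 0ᴿ-∋ d>0 , ≈⇒≤ {p +ᶠ d} {q} e))

   0+ᴿ : ∀ r → 0ᴿ +ᴿ r ≡ r
   0+ᴿ r = trans (+ᴿ-comm 0ᴿ r) (+ᴿ-0 r)

   ≤+ : ∀ r s → r ≤ r +ᴿ s
   ≤+ r s = ≤ᴿ-trans (≡⇒≤ (sym (+ᴿ-0 r))) (+ᴿ-mono ≤ᴿ-refl (0≤ s))

   +ᴿ-swap : ∀ a b c d → (a +ᴿ b) +ᴿ (c +ᴿ d) ≡ (a +ᴿ c) +ᴿ (b +ᴿ d)
   +ᴿ-swap a b c d = trans (+ᴿ-assoc a b _) (trans (cong (a +ᴿ_) (trans (sym (+ᴿ-assoc b c d))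
     (trans (cong (_+ᴿ d) (+ᴿ-comm b c)) (+ᴿ-assoc c b d)))) (sym (+ᴿ-assoc a c _)))

   private
     jump : (P : Nat → Set ℓ) → ⦃ Def {1} λ ρ → P (toNat (ρ zero)) ⦄ → ¬ P 0ᴺ → ∀ N → P N → Σ Nat λ n → ¬ P n × P (sᴺ n)
     jump P z N h = dne λ no → Nat-ind (λ n → ¬ P n) z (λ n k p → no (n , k , p)) N h

   near : ∀ t {δ} → Pos δ → Σ Nat λ n → ¬ (t ∋ n • δ) × t ∋ sᴺ n • δ
   near t {δ} h =
       let (x , i) = inhabited t ; (N , l) = archimedean x {δ} h in
       jump (λ n → t ∋ n • δ)
         (λ k → let (j , e) = ∋-Pos t k in s≢0 (trans (sym (s+ j 0ᴺ)) (trans e (0* (num δ)))))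
         N (up t i l)

   +ᴿ-cancelʳ : ∀ t → r +ᴿ t ≤ s +ᴿ t → r ≤ s
   +ᴿ-cancelʳ {r} {s} t h = le λ x i →
     let (x′ , l , i′) = round s i
         (d , d>0 , e) = subtract {x′} {x} l
         (n , lo , hi) = near t {d} d>0
         (p , p₂ , a , b , m) = proj₁ +-∋ (at h (x′ +ᶠ sᴺ n • d) (proj₂ +-∋ (x′ , sᴺ n • d , i′ , hi , ≤ᶠ-refl (x′ +ᶠ sᴺ n • d))))
         y = n • d
         m₁ : p +ᶠ y ≤ᶠ x′ +ᶠ sᴺ n • d
         m₁ = ≤ᶠ-trans {p +ᶠ y} {p +ᶠ p₂} {x′ +ᶠ sᴺ n • d} (+ᶠ-mono-≤ {p} {p} {y} {p₂} (≤ᶠ-refl p) (<ᶠ⇒≤ᶠ {y} {p₂} (∋-< t b lo))) m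
         m₂ : p +ᶠ y ≤ᶠ (x′ +ᶠ d) +ᶠ y
         m₂ = subst (p +ᶠ y ≤ᶠ_) (trans (cong (x′ +ᶠ_) (+ᶠ-comm y d)) (sym (+ᶠ-assoc x′ d y)))
           (≤ᶠ-trans {p +ᶠ y} {x′ +ᶠ sᴺ n • d} {x′ +ᶠ (y +ᶠ d)} m₁
             (+ᶠ-mono-≤ {x′} {x′} {sᴺ n • d} {y +ᶠ d} (≤ᶠ-refl x′) (≈⇒≤ {sᴺ n • d} {y +ᶠ d} (≈-sym {y +ᶠ d} {sᴺ n • d} (•-suc n d)))))
     in up r a (⊎-elim (λ k → ≤ᶠ-trans {p} {x′ +ᶠ d} {x} k (≈⇒≤ {x′ +ᶠ d} {x} e))
          (λ k → ⊥-elim (<ᶠ⇒≱ᶠ {(x′ +ᶠ d) +ᶠ y} {p +ᶠ y} (+ᶠ-monoˡ-< {x′ +ᶠ d} {p} {y} k) m₂)) (≤ᶠ-total p (x′ +ᶠ d)))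

   +ᴿ-cancel-≡ : ∀ t → r +ᴿ t ≡ s +ᴿ t → r ≡ s
   +ᴿ-cancel-≡ t e = ≤ᴿ-antisym (+ᴿ-cancelʳ t (≡⇒≤ e)) (+ᴿ-cancelʳ t (≡⇒≤ (sym e)))

   ≤-limit : (∀ δ → Pos δ → r ≤ s +ᴿ ι δ) → r ≤ s
   ≤-limit {r} {s} h = le λ q i →
     let (p , l , a) = round s i
         (d , d>0 , e) = subtract {p} {q} l
         (k , k>0 , e′) = halve d
     in at (h k (k>0 d>0)) q (proj₂ +-∋ (p , d , a , proj₂ ι-∋ (<-≤ᶠ-trans {k} {k +ᶠ k} {d}
          (+ᶠ-increasing k (k>0 d>0)) (≈⇒≤ {k +ᶠ k} {d} e′)) , ≈⇒≤ {p +ᶠ d} {q} e))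

   ι-mono : p ≤ᶠ q → ι p ≤ ι q
   ι-mono {p} {q} h = le λ x i → proj₂ ι-∋ (≤-<ᶠ-trans {p} {q} {x} h (proj₁ ι-∋ i))

   ι-+ : ∀ p q → ι p +ᴿ ι q ≡ ι (p +ᶠ q)
   ι-+ p q = real-ext λ x →
     (λ i → let (a , b , h , k , l) = proj₁ +-∋ i in proj₂ ι-∋
       (<-≤ᶠ-trans {p +ᶠ q} {a +ᶠ b} {x} (<-≤ᶠ-trans {p +ᶠ q} {a +ᶠ q} {a +ᶠ b} (+ᶠ-monoˡ-< {p} {a} {q} (proj₁ ι-∋ h))
         (+ᶠ-mono-≤ {a} {a} {q} {b} (≤ᶠ-refl a) (<ᶠ⇒≤ᶠ {q} {b} (proj₁ ι-∋ k)))) l)) ,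
     (λ i → let (d , d>0 , e) = subtract {p +ᶠ q} {x} (proj₁ ι-∋ i) ; (k , k>0 , e′) = halve d in
       proj₂ +-∋ (p +ᶠ k , q +ᶠ k , proj₂ ι-∋ (+ᶠ-increasing p (k>0 d>0)) , proj₂ ι-∋ (+ᶠ-increasing q (k>0 d>0)) ,
         subst (_≤ᶠ x) (sym (shuffle p k q))
           (≤ᶠ-trans {(p +ᶠ q) +ᶠ (k +ᶠ k)} {(p +ᶠ q) +ᶠ d} {x}
             (+ᶠ-mono-≤ {p +ᶠ q} {p +ᶠ q} {k +ᶠ k} {d} (≤ᶠ-refl (p +ᶠ q)) (≈⇒≤ {k +ᶠ k} {d} e′)) (≈⇒≤ {(p +ᶠ q) +ᶠ d} {x} e))))
     where
     shuffle : ∀ p k q → (p +ᶠ k) +ᶠ (q +ᶠ k) ≡ (p +ᶠ q) +ᶠ (k +ᶠ k)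
     shuffle p k q = trans (+ᶠ-assoc p k _) (trans (cong (p +ᶠ_) (trans (sym (+ᶠ-assoc k q k))
       (trans (cong (_+ᶠ k) (+ᶠ-comm k q)) (+ᶠ-assoc q k k)))) (sym (+ᶠ-assoc p q _)))

   ι-≈ : p ≈ q → ι p ≡ ι q
   ι-≈ {p} {q} e = ≤ᴿ-antisym (ι-mono {p} {q} (≈⇒≤ {p} {q} e)) (ι-mono {q} {p} (≈⇒≤ {q} {p} (≈-sym {p} {q} e)))

   *ᴿ-distribˡ : ∀ r s t → r *ᴿ (s +ᴿ t) ≡ r *ᴿ s +ᴿ r *ᴿ t
   *ᴿ-distribˡ r s t = real-ext λ q →
     (λ i → let (p , x , a , b , l) = proj₁ *-∋ i
                (u , v , c , d , m) = proj₁ +-∋ b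
            in proj₂ +-∋ (p *ᶠ u , p *ᶠ v , proj₂ *-∋ (p , u , a , c , ≤ᶠ-refl (p *ᶠ u)) ,
                 proj₂ *-∋ (p , v , a , d , ≤ᶠ-refl (p *ᶠ v)) ,
                 ≤ᶠ-trans {p *ᶠ u +ᶠ p *ᶠ v} {p *ᶠ (u +ᶠ v)} {q}
                   (≈⇒≤ {p *ᶠ u +ᶠ p *ᶠ v} {p *ᶠ (u +ᶠ v)} (≈-sym {p *ᶠ (u +ᶠ v)} {p *ᶠ u +ᶠ p *ᶠ v} (*ᶠ-distrib p u v)))
                   (≤ᶠ-trans {p *ᶠ (u +ᶠ v)} {p *ᶠ x} {q} (*ᶠ-mono-≤ {p} {p} {u +ᶠ v} {x} (≤ᶠ-refl p) m) l))) ,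
     (λ i → let (x , y , a , b , l) = proj₁ +-∋ i
                (p , u , c , d , m) = proj₁ *-∋ a
                (p′ , v , c′ , d′ , m′) = proj₁ *-∋ b
                common : Σ Frac λ w → r ∋ w × w ≤ᶠ p × w ≤ᶠ p′
                common = ⊎-elim (λ k → p , c , ≤ᶠ-refl p , k) (λ k → p′ , c′ , <ᶠ⇒≤ᶠ {p′} {p} k , ≤ᶠ-refl p′) (≤ᶠ-total p p′)
                (w , e , f , g) = common
            in proj₂ *-∋ (w , u +ᶠ v , e , proj₂ +-∋ (u , v , d , d′ , ≤ᶠ-refl (u +ᶠ v)) ,
                 ≤ᶠ-trans {w *ᶠ (u +ᶠ v)} {w *ᶠ u +ᶠ w *ᶠ v} {q} (≈⇒≤ {w *ᶠ (u +ᶠ v)} {w *ᶠ u +ᶠ w *ᶠ v} (*ᶠ-distrib w u v))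
                   (≤ᶠ-trans {w *ᶠ u +ᶠ w *ᶠ v} {x +ᶠ y} {q}
                     (+ᶠ-mono-≤ {w *ᶠ u} {x} {w *ᶠ v} {y}
                       (≤ᶠ-trans {w *ᶠ u} {p *ᶠ u} {x} (*ᶠ-monoˡ-≤ {w} {p} {u} f) m)
                       (≤ᶠ-trans {w *ᶠ v} {p′ *ᶠ v} {y} (*ᶠ-monoˡ-≤ {w} {p′} {v} g) m′)) l)))

   *ᴿ-distribʳ : ∀ r s t → (s +ᴿ t) *ᴿ r ≡ s *ᴿ r +ᴿ t *ᴿ r
   *ᴿ-distribʳ r s t = trans (*ᴿ-comm _ r) (trans (*ᴿ-distribˡ r s t) (cong₂ _+ᴿ_ (*ᴿ-comm r s) (*ᴿ-comm r t)))

   1*ᴿ : ∀ r → 1ᴿ *ᴿ r ≡ r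
   1*ᴿ r = real-ext λ q →
     (λ i → let (p , x , a , b , l) = proj₁ *-∋ i in
       up r b (≤ᶠ-trans {x} {1ᶠ *ᶠ x} {q} (≈⇒≤ {x} {1ᶠ *ᶠ x} (≈-sym {1ᶠ *ᶠ x} {x} (1*ᶠ x)))
         (≤ᶠ-trans {1ᶠ *ᶠ x} {p *ᶠ x} {q} (*ᶠ-monoˡ-≤ {1ᶠ} {p} {x} (<ᶠ⇒≤ᶠ {1ᶠ} {p} (proj₁ ι-∋ a))) l))) ,
     (λ i → let (p , l , a) = round r i
                (y , _ , e) = divide {p} (∋-Pos r a) q
                1<y : 1ᶠ <ᶠ y
                1<y = ⊎-elim (λ k → ⊥-elim (<ᶠ⇒≱ᶠ {p} {q} l (≤ᶠ-trans {q} {p *ᶠ y} {p}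
                          (≈⇒≤ {q} {p *ᶠ y} (≈-sym {p *ᶠ y} {q} e))
                          (≤ᶠ-trans {p *ᶠ y} {1ᶠ *ᶠ p} {p} (subst (p *ᶠ y ≤ᶠ_) (*ᶠ-comm p 1ᶠ)
                             (*ᶠ-mono-≤ {p} {p} {y} {1ᶠ} (≤ᶠ-refl p) k)) (≈⇒≤ {1ᶠ *ᶠ p} {p} (1*ᶠ p))))))
                        (λ k → k) (≤ᶠ-total y 1ᶠ)
            in proj₂ *-∋ (y , p , proj₂ ι-∋ 1<y , a , ≈⇒≤ {y *ᶠ p} {q} (subst (_≈ q) (*ᶠ-comm p y) e)))

   *ᴿ-1 : ∀ r → r *ᴿ 1ᴿ ≡ r
   *ᴿ-1 r = trans (*ᴿ-comm r 1ᴿ) (1*ᴿ r)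

   *ᴿ-nonzero : ¬ (r ≡ 0ᴿ) → ¬ (s ≡ 0ᴿ) → ¬ (r *ᴿ s ≡ 0ᴿ)
   *ᴿ-nonzero {r} {s} h k e =
     let (a , a>0 , i) = ≢0⇒ h
         (b , b>0 , j) = ≢0⇒ k
         (p , p′ , c , d , l) = proj₁ *-∋ (subst (_∋ a *ᶠ b) (sym e) (proj₂ 0ᴿ-∋ (*ᶠ-pos {a} {b} a>0 b>0)))
     in <ᶠ⇒≱ᶠ {a *ᶠ b} {p *ᶠ p′} (<-≤ᶠ-trans {a *ᶠ b} {p *ᶠ b} {p *ᶠ p′} (*ᶠ-monoˡ-< {a} {p} {b} (∋-< r c i) b>0)
          (*ᶠ-mono-≤ {p} {p} {b} {p′} (≤ᶠ-refl p) (<ᶠ⇒≤ᶠ {b} {p′} (∋-< s d j)))) l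

   ≤*ι⇒0 : q <ᶠ 1ᶠ → r ≤ r *ᴿ ι q → r ≡ 0ᴿ
   ≤*ι⇒0 {q} {r} l h with em {r ≡ 0ᴿ}
   ... | yes e = e
   ... | no ne =
     let (d , d>0 , e) = subtract {q} {1ᶠ} l
         rd≤0 : r *ᴿ ι d ≤ 0ᴿ
         rd≤0 = +ᴿ-cancelʳ (r *ᴿ ι q) (≤ᴿ-trans
           (≡⇒≤ (trans (+ᴿ-comm _ _) (trans (sym (*ᴿ-distribˡ r (ι q) (ι d)))
             (trans (cong (r *ᴿ_) (trans (ι-+ q d) (ι-≈ {q +ᶠ d} {1ᶠ} e))) (*ᴿ-1 r)))))
           (≤ᴿ-trans h (≡⇒≤ (sym (0+ᴿ _)))))
         d≢0 : ¬ (ι d ≡ 0ᴿ)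
         d≢0 z = let (m , _ , m<d) = dense {0ᶠ} {d} (Pos⇒< {d} d>0) in
           <ᶠ⇒≱ᶠ {m} {d} m<d (<ᶠ⇒≤ᶠ {d} {m} (proj₁ ι-∋ (subst (_∋ m) (sym z) (proj₂ 0ᴿ-∋ (<⇒Pos {0ᶠ} {m} (proj₁ (proj₂ (dense {0ᶠ} {d} (Pos⇒< {d} d>0)))))))))
     in ⊥-elim (*ᴿ-nonzero ne d≢0 (≤0⇒≡0 rd≤0))

   rel-real : {w : W} → R.IsReal (el w) ⟺ IsCut w
   rel-real {w} =
     (λ h → let open R.IsReal h in
       (λ x i → proj₁ (rel-frac {x}) (fractions (el x) (isV x) (ε→∈ i))) ,
       (let (x , vx , i) = R.IsReal.inhabited h ; (q , e) = proj₁ (rel-frac {⟪ x , vx ⟫}) (fractions x vx i) in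
         q , subst (_ε w) e (∈→ε i)) ,
       (λ p q i l → ∈→ε (upward (el (fw p)) (isV (fw p)) (ε→∈ i) (el (fw q)) (isV (fw q)) (proj₂ (rel-frac {fw q}) (q , refl)) (proj₂ (rel-≤ᶠ p q) l))) ,
       (λ q i → let (x , vx , j , l) = open-cut (el (fw q)) (isV (fw q)) (ε→∈ i)
                    (p , e) = proj₁ (rel-frac {⟪ x , vx ⟫}) (fractions x vx j)
                in p , proj₁ (rel-<ᶠ p q) (subst (λ z → el z R.<ᶠ el (fw q)) e l) , subst (_ε w) e (∈→ε j))) ,
     (λ (f , (q₀ , i₀) , u , o) → record
       { fractions = λ x vx i → proj₂ (rel-frac {⟪ x , vx ⟫}) (f ⟪ x , vx ⟫ (∈→ε i))
       ; inhabited = el (fw q₀) , isV (fw q₀) , ε→∈ i₀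
       ; upward = λ x vx i y vy fy l →
           let (p , e) = f ⟪ x , vx ⟫ (∈→ε i) ; (q , e′) = proj₁ (rel-frac {⟪ y , vy ⟫}) fy in
           ε→∈ (subst (_ε w) (sym e′) (u p q (subst (_ε w) e (∈→ε i))
             (proj₁ (rel-≤ᶠ p q) (subst₂ (λ a b → el a R.≤ᶠ el b) e e′ l))))
       ; open-cut = λ x vx i →
           let (q , e) = f ⟪ x , vx ⟫ (∈→ε i) ; (p , l , j) = o q (subst (_ε w) e (∈→ε i)) in
           el (fw p) , isV (fw p) , ε→∈ j , subst (λ z → el (fw p) R.<ᶠ el z) (sym e) (proj₂ (rel-<ᶠ p q) l) })

   rel-cut-ext : (r : Real) {w : W} {Q : 𝕌 → Set ℓ} → (∀ q → r ∋ q ⟺ Q (el (fw q))) →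
                 (∀ x → V x → x ∈ el w ⇔ (R.IsFrac x × Q x)) ⟺ (w ≡ rw r)
   rel-cut-ext r {w} {Q} h =
     (λ k → ext λ x →
       (λ i → let (f , p) = Equivalence.to (k (el x) (isV x)) (ε→∈ i)
                  (q , e) = proj₁ (rel-frac {x}) f
              in subst (_ε rw r) (sym e) (proj₂ (h q) (subst (λ z → Q (el z)) e p))) ,
       (λ i → let (q , e) = proj₁ (isCut r) x i in
         ∈→ε (Equivalence.from (k (el x) (isV x)) (proj₂ (rel-frac {x}) (q , e) ,
           subst (λ z → Q (el z)) (sym e) (proj₁ (h q) (subst (_ε rw r) e i)))))) ,
     (λ { refl x vx → mk⇔
       (λ i → let (q , e) = proj₁ (isCut r) ⟪ x , vx ⟫ (∈→ε i) in
         proj₂ (rel-frac {⟪ x , vx ⟫}) (q , e) , subst (λ z → Q (el z)) (sym e) (proj₁ (h q) (subst (_ε rw r) e (∈→ε i))))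
       (λ (f , p) → let (q , e) = proj₁ (rel-frac {⟪ x , vx ⟫}) f in
         ε→∈ (subst (_ε rw r) (sym e) (proj₂ (h q) (subst (λ z → Q (el z)) e p)))) })

   rel-fracReal : ∀ q {w : W} → R.IsFracReal (el (fw q)) (el w) ⟺ (w ≡ rw (ι q))
   rel-fracReal q = rel-cut-ext (ι q) λ x → ⟺-trans ι-∋ (⟺-sym (rel-<ᶠ q x))

   private
     rel-op : (op : Frac → Frac → Frac) {Op : 𝕌 → 𝕌 → 𝕌 → Set ℓ} →
              (∀ p q {z : W} → Op (el (fw p)) (el (fw q)) (el z) ⟺ (z ≡ fw (op p q))) → ∀ r s q →
              (Σ Frac λ p → Σ Frac λ p′ → r ∋ p × s ∋ p′ × op p p′ ≤ᶠ q) ⟺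
              R.∃∈ (el (rw r)) (λ p → R.∃∈ (el (rw s)) λ p′ → R.∃ⱽ λ z → Op p p′ z × z R.≤ᶠ el (fw q))
     rel-op op {Op} h r s q =
       (λ (p , p′ , a , b , l) → el (fw p) , isV (fw p) , ε→∈ a , el (fw p′) , isV (fw p′) , ε→∈ b ,
          el (fw (op p p′)) , isV (fw (op p p′)) , proj₂ (h p p′ {fw (op p p′)}) refl , proj₂ (rel-≤ᶠ (op p p′) q) l) ,
       (λ (x , vx , a , y , vy , b , z , vz , o , l) →
          let (p , e) = proj₁ (isCut r) ⟪ x , vx ⟫ (∈→ε a)
              (p′ , e′) = proj₁ (isCut s) ⟪ y , vy ⟫ (∈→ε b)
              ez = proj₁ (h p p′ {⟪ z , vz ⟫}) (subst₂ (λ u v → Op (el u) (el v) z) e e′ o)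
          in p , p′ , subst (_ε rw r) e (∈→ε a) , subst (_ε rw s) e′ (∈→ε b) ,
             proj₁ (rel-≤ᶠ (op p p′) q) (subst (λ u → el u R.≤ᶠ el (fw q)) ez l))

   rel-plusᴿ : ∀ r s {w : W} → R.Plusᴿ (el (rw r)) (el (rw s)) (el w) ⟺ (w ≡ rw (r +ᴿ s))
   rel-plusᴿ r s = rel-cut-ext (r +ᴿ s) λ q → ⟺-trans +-∋ (rel-op _+ᶠ_ {R.FracPlus} rel-fplus r s q)

   rel-timesᴿ : ∀ r s {w : W} → R.Timesᴿ (el (rw r)) (el (rw s)) (el w) ⟺ (w ≡ rw (r *ᴿ s))
   rel-timesᴿ r s = rel-cut-ext (r *ᴿ s) λ q → ⟺-trans *-∋ (rel-op _*ᶠ_ {R.FracTimes} rel-ftimes r s q)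

   private
     wd-1 : wd 1ᴺ ≡ S ∅
     wd-1 = trans (wd-s 0ᴺ) (cong S wd-0)

   rel-zeroᴿ : {w : W} → R.IsZeroᴿ (el w) ⟺ (w ≡ rw 0ᴿ)
   rel-zeroᴿ {w} =
     (λ (q , vq , m , vm , n , vn , h , k , p , f) → proj₁ (rel-fracReal 0ᶠ) (subst (λ z → R.IsFracReal (el z) (el w))
        (trans (proj₁ (rel-pair {⟪ q , vq ⟫} {⟪ m , vm ⟫} {⟪ n , vn ⟫}) p)
          (trans (cong₂ ⟨_,_⟩ (trans (proj₁ (rel-empty {⟪ m , vm ⟫}) h) (sym wd-0)) (trans (proj₁ (rel-one {⟪ n , vn ⟫}) k) (sym wd-1)))
            (sym (fw-def 0ᶠ)))) f)) ,
     (λ e → el (fw 0ᶠ) , isV (fw 0ᶠ) , el (wd 0ᴺ) , isV (wd 0ᴺ) , el (wd 1ᴺ) , isV (wd 1ᴺ) ,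
        proj₂ (rel-empty {wd 0ᴺ}) wd-0 , proj₂ (rel-one {wd 1ᴺ}) wd-1 , frac-pair 0ᶠ , proj₂ (rel-fracReal 0ᶠ {w}) e)

   rel-oneᴿ : {w : W} → R.IsOneᴿ (el w) ⟺ (w ≡ rw 1ᴿ)
   rel-oneᴿ {w} =
     (λ (q , vq , n , vn , k , p , f) → proj₁ (rel-fracReal 1ᶠ) (subst (λ z → R.IsFracReal (el z) (el w))
        (trans (proj₁ (rel-pair {⟪ q , vq ⟫} {⟪ n , vn ⟫} {⟪ n , vn ⟫}) p)
          (trans (cong₂ ⟨_,_⟩ (trans (proj₁ (rel-one {⟪ n , vn ⟫}) k) (sym wd-1)) (trans (proj₁ (rel-one {⟪ n , vn ⟫}) k) (sym wd-1)))
            (sym (fw-def 1ᶠ)))) f)) ,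
     (λ e → el (fw 1ᶠ) , isV (fw 1ᶠ) , el (wd 1ᴺ) , isV (wd 1ᴺ) ,
        proj₂ (rel-one {wd 1ᴺ}) wd-1 , frac-pair 1ᶠ , proj₂ (rel-fracReal 1ᶠ {w}) e)

   rel-≤ᴿ : (el (rw r) R.≤ᴿ el (rw s)) ⟺ (r ≤ s)
   rel-≤ᴿ {r} {s} =
     (λ h → le λ q i → ∈→ε (h (el (fw q)) (isV (fw q)) (ε→∈ i))) ,
     (λ h x vx i → let (q , e) = proj₁ (isCut s) ⟪ x , vx ⟫ (∈→ε i) in
       ε→∈ (subst (_ε rw r) (sym e) (at h q (subst (_ε rw s) e (∈→ε i)))))

   ι≢0 : Pos q → ¬ (ι q ≡ 0ᴿ)
   ι≢0 {q} h e = <ᶠ⇒≱ᶠ {q} {q} (proj₁ ι-∋ (subst (_∋ q) (sym e) (proj₂ 0ᴿ-∋ h))) (≤ᶠ-refl q)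

   ≤-limit′ : (∀ δ → ¬ (δ ≡ 0ᴿ) → r ≤ s +ᴿ δ) → r ≤ s
   ≤-limit′ h = ≤-limit λ δ p → h (ι δ) (ι≢0 p)

   half : ∀ δ → ¬ (δ ≡ 0ᴿ) → Σ Real λ k → ¬ (k ≡ 0ᴿ) × k +ᴿ k ≤ δ
   half δ h = let (q , q>0 , i) = ≢0⇒ h ; (k , k>0 , e) = halve q in
     ι k , ι≢0 (k>0 q>0) , ≤ᴿ-trans (≡⇒≤ (trans (ι-+ k k) (ι-≈ {k +ᶠ k} {q} e))) (∌⇒ι≤ i)

   double-cancel : r +ᴿ r ≡ s +ᴿ s → r ≡ s
   double-cancel {r} {s} e = ⊎-elim
     (λ l → ≤ᴿ-antisym l (+ᴿ-cancelʳ r (≤ᴿ-trans (≤ᴿ-trans (+ᴿ-mono ≤ᴿ-refl l) (≡⇒≤ (sym e))) ≤ᴿ-refl)))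
     (λ l → ≤ᴿ-antisym (+ᴿ-cancelʳ s (≤ᴿ-trans (+ᴿ-mono ≤ᴿ-refl l) (≡⇒≤ e))) l) (≤ᴿ-total r s)

   +ᴿ-monoid : CommutativeMonoid ℓ ℓ
   +ᴿ-monoid = record
     { Carrier = Real ; _≈_ = _≡_ ; _∙_ = _+ᴿ_ ; ε = 0ᴿ
     ; isCommutativeMonoid = record
       { isMonoid = record
         { isSemigroup = record
           { isMagma = record { isEquivalence = isEquivalence ; ∙-cong = cong₂ _+ᴿ_ } ; assoc = +ᴿ-assoc }
         ; identity = 0+ᴿ , +ᴿ-0 }
       ; comm = +ᴿ-comm } }

   module Sum = MonoidSolver +ᴿ-monoid

 module Infima where

   open Arithmetic using (Nat; toNat; dAllNat; dExNat; dEqNat; dToNat; d+ᴺ; d*ᴺ; dsᴺ)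
   open Fractions
   open Reals

   opaque
     infimum : (P : Real → Set ℓ) → (Def {1} λ ρ → P (toReal (ρ zero))) → Σ Real P →
       Σ Real λ m → (∀ r → P r → m ≤ r) × (∀ δ → ¬ (δ ≡ 0ᴿ) → Σ Real λ r → P r × r ≤ m +ᴿ δ)
     infimum P d (r₀ , p₀) = m , lower-bound , greatest
       where
       Q : Frac → Set ℓ
       Q x = Σ Real λ r → P r × r ∋ x
       dQ : Def {2} λ ρ → Q (toNat (ρ (suc zero)) /s toNat (ρ zero))
       dQ = dExReal ⦃ dAnd ⦃ Def-ren {P = λ ρ → P (toReal (ρ zero))} (λ _ → zero) d ⦄ ⦃ it ⦄ ⦄
       nonempty : Σ Frac Q
       nonempty = let (x , i) = inhabited r₀ in x , r₀ , p₀ , i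
       m : Real
       m = infℝ Q ⦃ dQ ⦄ nonempty
       m-∋ : ∀ {x} → m ∋ x ⟺ (Σ Frac λ p → p <ᶠ x × Q p)
       m-∋ = infℝ-∋ Q ⦃ dQ ⦄ nonempty
       lower-bound : ∀ r → P r → m ≤ r
       lower-bound r p = le λ x i → let (w , l , j) = round r i in proj₂ m-∋ (w , l , r , p , j)
       greatest : ∀ δ → ¬ (δ ≡ 0ᴿ) → Σ Real λ r → P r × r ≤ m +ᴿ δ
       greatest δ δ≢0 = dne λ none → δ≢0 (≤0⇒≡0 (+ᴿ-cancelʳ m (≤ᴿ-trans (≡⇒≤ (+ᴿ-comm δ m))
         (≤ᴿ-trans (le λ x i → let (w , l , r , p , j) = proj₁ m-∋ i in
             up (m +ᴿ δ) (at (⊎-elim (λ k → ⊥-elim (none (r , p , k))) (λ k → k) (≤ᴿ-total r (m +ᴿ δ))) w j) (<ᶠ⇒≤ᶠ {w} {x} l))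
           (≡⇒≤ (sym (0+ᴿ m)))))))

 record Setting : Set ℓ where
   open FiniteSets
   field
     X L D κ 𝒮 i₀ i₁ : W
     lang     : Fun L D ω
     sigma    : R.IsSigma (el κ) (el L) (el X) (el 𝒮)
     full     : OverLanguage.Structures.Str X L D lang ε 𝒮
     ord      : OverLanguage.SigmaAlgebra.Ordinal X L D lang κ
     i₀∈      : i₀ ε κ
     i₁∈      : i₁ ε κ
     i₀≢i₁    : ¬ (i₀ ≡ i₁)
     infinite : ¬ Finite X

   closed : OverLanguage.SigmaAlgebra.Closed X L D lang κ 𝒮
   closed = OverLanguage.SigmaAlgebra.fromClosedFamily X L D lang κ (proj₁ sigma) full

   least : ∀ F → OverLanguage.SigmaAlgebra.Closed X L D lang κ F → 𝒮 ⊆ F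
   least F c = proj₁ rel-⊆ (proj₂ sigma (el F) (isV F) (OverLanguage.SigmaAlgebra.toClosedFamily X L D lang κ c))

 module OverSetting (𝔖 : Setting) where

  open Arithmetic using (0ᴺ; dAllNat; dExNat; dEqNat; dToNat; d+ᴺ; d*ᴺ; dsᴺ)
  open Fractions
  open Reals
  open Infima
  open FiniteSets
  open Setting 𝔖
  open Permutations X
  open OverLanguage X L D lang
  open Structures
  open SigmaAlgebra κ
  open PiLambda κ 𝒮 closed least ord i₀ i₁ i₀∈ i₁∈ i₀≢i₁

  module Measures where

    private variable
      A B : W

    opaque
      image∈𝒮 : ∀ {g} → Perm g → A ε 𝒮 → img[ g ] A ε 𝒮
      image∈𝒮 {A} {g} pg a = proj₂ (proj₁ (H-spec A) (least H H-closed A a)) g pg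
        where
        dH : Def {1} λ ρ → ∀ g → Perm g → img[ g ] (ρ zero) ε 𝒮
        dH = dAll ⦃ dImp ⦃ Def₁ Perm dPerm var₀ ⦄ ⦃ it ⦄ ⦄
        H : W
        H = sep (λ A → ∀ g → Perm g → img[ g ] A ε 𝒮) ⦃ dH ⦄ 𝒮
        H-spec : ∀ A → A ε H ⟺ (A ε 𝒮 × ∀ g → Perm g → img[ g ] A ε 𝒮)
        H-spec = sep-spec (λ A → ∀ g → Perm g → img[ g ] A ε 𝒮) ⦃ dH ⦄ 𝒮
        single : ∀ {r c t} → t ε ｛ ⟨ r , c ⟩ ｝ → t ≡ ⟨ r , c ⟩
        single = proj₁ (｛｝-spec _ _)
        module _ (g : W) (pg : Perm g) (G : W) (s : G ⊆ H) (f : W) (F : Fun f G κ) (inj : Inj f G) where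
          G′ : W
          G′ = img (img[ g ]) G
          G′-spec : ∀ B → B ε G′ ⟺ (Σ W λ A → A ε G × B ≡ img[ g ] A)
          G′-spec = img-spec (img[ g ]) G
          back : ∀ {A B} → A ε G → B ≡ img[ g ] A → img[ inv g ] B ≡ A
          back {A} i refl = trans (image-∘ pg) (image-id (𝒮⊆ (proj₁ (proj₁ (H-spec A) (s A i)))) λ x j → trans (∘-· j) (inv-·ˡ pg j))
          h : W
          h = inv g
          size : SizeLe G′
          size = graph (λ B → f · img[ h ] B) G′ ,
            graph-fun (λ B → f · img[ h ] B) (λ B j → let (A , i , e) = proj₁ (G′-spec B) j in subst (λ A → f · A ε κ) (sym (back i e)) (F .value A i)) ,
            λ B B′ j j′ e → let (A , i , q) = proj₁ (G′-spec B) j ; (A′ , i′ , q′) = proj₁ (G′-spec B′) j′ in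
              trans q (trans (cong (img[ g ]) (inj A A′ i i′ (trans (sym (cong (f ·_) (back i q)))
                (trans (sym (graph-· (λ B → f · img[ h ] B) j)) (trans e (trans (graph-· (λ B → f · img[ h ] B) j′) (cong (f ·_) (back i′ q′)))))))) (sym q′))
          eq : ⋃ G′ ≡ img[ g ] (⋃ G)
          eq = ext λ N →
            (λ j → let (B , k , l) = ⋃⁻ j ; (A , i , e) = proj₁ (G′-spec B) k
                       (m , n) = image⁻ (subst (N ε_) e l)
                   in image⁺ (m , ⋃⁺ (A , i , n))) ,
            (λ j → let (m , n) = image⁻ j ; (A , i , o) = ⋃⁻ n in
              ⋃⁺ (img[ g ] A , proj₂ (G′-spec _) (A , i , refl) , image⁺ (m , o)))
          union∈ : img[ g ] (⋃ G) ε 𝒮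
          union∈ = subst (_ε 𝒮) eq (Closed.unions closed G′ (λ B j → let (A , i , e) = proj₁ (G′-spec B) j in
            subst (_ε 𝒮) (sym e) (proj₂ (proj₁ (H-spec A) (s A i)) g pg)) size)
        H-closed : Closed H
        H-closed = record
          { subset = λ A i → 𝒮⊆ (proj₁ (proj₁ (H-spec A) i))
          ; full   = proj₂ (H-spec Str) (full , λ g _ → subst (_ε 𝒮) (sym image-Str) full)
          ; atoms  = λ r c i t → proj₂ (H-spec _) (Closed.atoms closed r c i t , λ g pg →
              subst (_ε 𝒮) (sym (image-Bas {q = ｛ ⟨ r , cmp g c ⟩ ｝} pg
                (λ r′ c′ k → let (e , e′) = ⟨⟩-inj (single k) in proj₂ (｛｝-spec _ _) (cong₂ (λ u v → ⟨ u , cmp g v ⟩) e e′))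
                (λ t k → r , c , proj₂ (｛｝-spec _ _) refl , single k)
                (λ _ k → r , c , single k , i , t)))
                (Closed.atoms closed r (cmp g c) i (cmp-X t pg)))
          ; compl  = λ A i → let (j , k) = proj₁ (H-spec A) i in proj₂ (H-spec _) (𝒮-∖ j , λ g pg →
              subst (_ε 𝒮) (sym (trans image-∖ (cong (_∖ img[ g ] A) image-Str))) (𝒮-∖ (k g pg)))
          ; unions = λ G s (f , F , inj) → proj₂ (H-spec _)
              ( Closed.unions closed G (λ A i → proj₁ (proj₁ (H-spec A) (s A i))) (f , F , inj)
              , λ g pg → union∈ g pg G s f F inj ) }

    val : W → W → Real
    val μ A = toReal (μ · A)

    dVal : ∀ μ {n} {s : Env n → W} → DefT s → DefT λ ρ → rw (val μ (s ρ))
    dVal μ d = dToReal ⦃ d· ⦃ tCon ⦄ ⦃ d ⦄ ⦄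

    z₀ : W
    z₀ = rw 0ᴿ

    PartialSum : W → W → W → W → Set ℓ
    PartialSum c n e = Rec (_≡ z₀) (λ i x y → y ≡ addW x (c · (e · i))) n

    Selection : W → W → Set ℓ
    Selection n e = n ε ω × Fun e n κ × Inj e n

    SumOf : W → Real → Set ℓ
    SumOf c s = (∀ n e t → Selection n e → PartialSum c n e t → toReal t ≤ s) ×
                (∀ u → (∀ n e t → Selection n e → PartialSum c n e t → toReal t ≤ u) → s ≤ u)

    private
      addW-cut : ∀ {x y} → IsCut x → IsCut y → addW x y ≡ rw (toReal x +ᴿ toReal y)
      addW-cut {x} {y} hx hy = trans (cong₂ addW (sym (rw-toReal hx)) (sym (rw-toReal hy))) (sym (rw-+ _ _))

      cut-addW : ∀ {x y} → IsCut x → IsCut y → IsCut (addW x y)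
      cut-addW {x} {y} hx hy = subst IsCut (sym (addW-cut hx hy)) (isCut (toReal x +ᴿ toReal y))

      rel-plusW : ∀ {x y w} → IsCut x → IsCut y → R.Plusᴿ (el x) (el y) (el w) ⟺ (w ≡ addW x y)
      rel-plusW {x} {y} {w} hx hy = subst₂ (λ u v → R.Plusᴿ (el u) (el v) (el w) ⟺ (w ≡ addW x y)) (rw-toReal hx) (rw-toReal hy)
        (subst (λ u → R.Plusᴿ (el (rw (toReal x))) (el (rw (toReal y))) (el w) ⟺ (w ≡ u)) (sym (addW-cut hx hy)) (rel-plusᴿ (toReal x) (toReal y)))

    CutValued : W → Set ℓ
    CutValued c = FunP c κ IsCut

    module _ {c n e : W} (C : CutValued c) (sel : Selection n e) where
      private
        n∈ = proj₁ sel
        E = proj₁ (proj₂ sel)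

        StepR : 𝕌 → 𝕌 → 𝕌 → Set ℓ
        StepR i x y = R.∃ⱽ λ k → R.∃ⱽ λ d → (el e R.∶ i ↦ k) × (el c R.∶ k ↦ d) × R.Plusᴿ x d y

        step→ : ∀ {i x y} → i ε n → IsCut x → StepR (el i) (el x) (el y) → y ≡ addW x (c · (e · i))
        step→ {i} {x} {y} hi hx (k , vk , d , vd , m , m′ , p) =
          let (_ , ek) = graph-dom E (proj₁ (rel-↦ {e} {i} {⟪ k , vk ⟫}) m)
              (_ , ed) = graph-dom C (proj₁ (rel-↦ {c} {⟪ k , vk ⟫} {⟪ d , vd ⟫}) m′)
              ed′ = trans ed (cong (c ·_) ek)
              hd = C .value (e · i) (E .value i hi)
          in proj₁ (rel-plusW {x} {c · (e · i)} {y} hx hd) (subst (λ d → R.Plusᴿ (el x) (el d) (el y)) ed′ p)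

        step← : ∀ {i x y} → i ε n → IsCut x → y ≡ addW x (c · (e · i)) → StepR (el i) (el x) (el y)
        step← {i} {x} {y} hi hx q = el (e · i) , isV (e · i) , el (c · (e · i)) , isV (c · (e · i)) ,
          proj₂ (rel-↦ {e} {i} {e · i}) (E .total i hi) , proj₂ (rel-↦ {c} {e · i} {c · (e · i)}) (C .total (e · i) (E .value i hi)) ,
          proj₂ (rel-plusW {x} {c · (e · i)} {y} hx (C .value (e · i) (E .value i hi))) q

        cuts : ∀ f → f · ∅ ≡ z₀ → (∀ i → i ε n → IsCut (f · i) → IsCut (f · S i)) → ∀ i → i ε n → IsCut (f · i)
        cuts f z h i hi = ω-ind (λ i → S i ⊆ n → IsCut (f · i)) ⦃ dImp ⦃ it ⦄ ⦃ Def₁ IsCut dIsCut (d· ⦃ tCon {c = f} ⦄ ⦃ var₀ ⦄) ⦄ ⦄ (λ _ → subst IsCut (sym z) (isCut 0ᴿ))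
          (λ i _ IH s → h i (s i (⊆S ∈S)) (IH λ x k → s x (⊆S k))) i (ω-trans hi n∈) (ω-sub n∈ hi)

        to : ∀ {t} → Rec (λ x → R.IsZeroᴿ (el x)) (λ i x y → StepR (el i) (el x) (el y)) n t → PartialSum c n e t
        to (f , z , s , q) = f , z′ , (λ i hi → step→ hi (cuts f z′ next i hi) (s i hi)) , q
          where
          z′ : f · ∅ ≡ z₀
          z′ = proj₁ (rel-zeroᴿ {f · ∅}) z
          next : ∀ i → i ε n → IsCut (f · i) → IsCut (f · S i)
          next i hi h = subst IsCut (sym (step→ hi h (s i hi))) (cut-addW h (C .value _ (E .value i hi)))

        from : ∀ {t} → PartialSum c n e t → Rec (λ x → R.IsZeroᴿ (el x)) (λ i x y → StepR (el i) (el x) (el y)) n t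
        from (f , z , s , q) = f , proj₂ (rel-zeroᴿ {f · ∅}) z , (λ i hi → step← hi (cuts f z next i hi) (s i hi)) , q
          where
          next : ∀ i → i ε n → IsCut (f · i) → IsCut (f · S i)
          next i hi h = subst IsCut (sym (s i hi)) (cut-addW h (C .value _ (E .value i hi)))

      rel-partial : ∀ {t} → R.Rec R.IsZeroᴿ StepR (el n) (el t) ⟺ PartialSum c n e t
      rel-partial {t} = ⟺-trans (rel-rec {n} {t} {R.IsZeroᴿ} {StepR} n∈) (to , from)

      partial-cut : ∀ {t} → PartialSum c n e t → IsCut t
      partial-cut (f , z , s , q) = subst IsCut (sym q) (at-n (ω-cases n∈))
        where
        next : ∀ i → i ε n → IsCut (f · i) → IsCut (f · S i)
        next i hi h = subst IsCut (sym (s i hi)) (cut-addW h (C .value _ (E .value i hi)))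
        at-n : n ≡ ∅ ⊎ (Σ W λ m → m ε ω × n ≡ S m) → IsCut (f · n)
        at-n (inj₁ e₀) = subst (λ n → IsCut (f · n)) (sym e₀) (subst IsCut (sym z) (isCut 0ᴿ))
        at-n (inj₂ (m , _ , em)) = let m∈ = subst (m ε_) (sym em) ∈S in
          subst (λ n → IsCut (f · n)) (sym em) (next m m∈ (cuts f z next m m∈))

    rel-sum : ∀ {c s} → CutValued c → R.IsSum (el κ) (el c) (el (rw s)) ⟺ SumOf c s
    rel-sum {c} {s} C = to , from
      where
      PSR : 𝕌 → Set ℓ
      PSR = R.IsFinitePartialSum (el κ) (el c)
      ps← : ∀ {n e t} → Selection n e → PartialSum c n e t → PSR (el t)
      ps← {n} {e} {t} sel@(n∈ , E , inj) p = el n , isV n , el e , isV e , proj₂ (rel-nat {n}) n∈ ,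
        toIsFun (FunP-map (λ _ → ε→∈) E) , proj₂ (rel-inj E) inj , proj₂ (rel-partial C sel {t}) p
      ps→ : ∀ {t} → PSR (el t) → Σ W λ n → Σ W λ e → Selection n e × PartialSum c n e t
      ps→ {t} (n , vn , e , ve , n∈ , E , inj , p) = ⟪ n , vn ⟫ , ⟪ e , ve ⟫ , sel , proj₁ (rel-partial C sel {t}) p
        where
        E′ : Fun ⟪ e , ve ⟫ ⟪ n , vn ⟫ κ
        E′ = FunP-map (λ _ → ∈→ε) (fromIsFun {⟪ e , ve ⟫} {⟪ n , vn ⟫} E)
        sel : Selection ⟪ n , vn ⟫ ⟪ e , ve ⟫
        sel = proj₁ (rel-nat {⟪ n , vn ⟫}) n∈ , E′ , proj₁ (rel-inj E′) inj
      to : R.IsSum (el κ) (el c) (el (rw s)) → SumOf c s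
      to h = (λ n e t sel p → let ct = partial-cut C sel p in
                proj₁ rel-≤ᴿ (subst (λ t → el t R.≤ᴿ el (rw s)) (sym (rw-toReal ct)) (R.IsSum.upper h (el t) (isV t) (ps← sel p)))) ,
             (λ u k → proj₁ rel-≤ᴿ (R.IsSum.least h (el (rw u)) (isV (rw u)) (proj₂ rel-real (isCut u)) λ t vt p →
                let (n , e , sel , q) = ps→ {⟪ t , vt ⟫} p ; ct = partial-cut C sel q in
                subst (λ t → el t R.≤ᴿ el (rw u)) (rw-toReal ct) (proj₂ rel-≤ᴿ (k n e ⟪ t , vt ⟫ sel q))))
      from : SumOf c s → R.IsSum (el κ) (el c) (el (rw s))
      from (h , k) = record
        { real = proj₂ rel-real (isCut s)
        ; upper = λ t vt p → let (n , e , sel , q) = ps→ {⟪ t , vt ⟫} p ; ct = partial-cut C sel q in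
            subst (λ t → el t R.≤ᴿ el (rw s)) (rw-toReal ct) (proj₂ rel-≤ᴿ (h n e ⟪ t , vt ⟫ sel q))
        ; least = λ u vu ru H → let cu = proj₁ (rel-real {⟪ u , vu ⟫}) ru in
            subst (λ u → el (rw s) R.≤ᴿ el u) (rw-toReal cu) (proj₂ rel-≤ᴿ (k (toReal ⟪ u , vu ⟫) λ n e t sel p →
              let ct = partial-cut C sel p in
              proj₁ rel-≤ᴿ (subst₂ (λ t u → el t R.≤ᴿ el u) (sym (rw-toReal ct)) (sym (rw-toReal cu)) (H (el t) (isV t) (ps← sel p))))) }

  module Additivity where

    open Arithmetic using (Nat; 0ᴺ; 1ᴺ; sᴺ; _*ᴺ_; 0*; nonzero)
    open Measures

    private variable
      A B M e μ n ν : W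

    record IsMeasure (μ : W) : Set ℓ where
      field
        fun      : FunP μ 𝒮 IsCut
        total    : val μ Str ≡ 1ᴿ
        additive : ∀ A → Fun A κ 𝒮 → Disjoint A → seq⋃ A ε 𝒮 → SumOf (cmp μ A) (val μ (seq⋃ A))

    rw-val : FunP μ 𝒮 IsCut → A ε 𝒮 → rw (val μ A) ≡ μ · A
    rw-val F a = rw-toReal (F .value _ a)

    cmp-cut : FunP μ 𝒮 IsCut → Fun A κ 𝒮 → CutValued (cmp μ A)
    cmp-cut F a = cmp-fun a (F .value)

    record FinAdd (ν : W) : Set ℓ where
      field
        fun   : FunP ν 𝒮 IsCut
        empty : val ν ∅ ≡ 0ᴿ
        add   : ∀ {A B} → A ε 𝒮 → B ε 𝒮 → (∀ M → M ε A → M ∉ B) → val ν (A ∪ B) ≡ val ν A +ᴿ val ν B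

    𝒮-∖∖ : A ε 𝒮 → B ε 𝒮 → A ∖ B ε 𝒮
    𝒮-∖∖ {A} {B} a b = subst (_ε 𝒮) (ext λ M →
      (λ i → let (j , k) = ∩⁻ i in ∖⁺ (j , proj₂ (∖⁻ k))) ,
      (λ i → let (j , k) = ∖⁻ i in ∩⁺ (j , ∖⁺ (𝒮⊆ a M j , k))))
      (𝒮-∩ a (𝒮-∖ b))

    module FinAddFacts (N : FinAdd ν) where
      open FinAdd N

      split : A ε 𝒮 → B ε 𝒮 → val ν (A ∩ B) +ᴿ val ν (A ∖ B) ≡ val ν A
      split {A} {B} a b = trans (sym (add (𝒮-∩ a b) (𝒮-∖∖ a b) λ M i j → proj₂ (∖⁻ j) (proj₂ (∩⁻ i))))
        (cong (val ν) (ext λ M →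
          (λ i → ⊎-elim (λ j → proj₁ (∩⁻ j)) (λ j → proj₁ (∖⁻ j)) (∪⁻ i)) ,
          (λ i → back M i em)))
        where
        back : ∀ M → M ε A → Dec (M ε B) → M ε (A ∩ B) ∪ (A ∖ B)
        back M i (yes j) = ∪⁺ (inj₁ (∩⁺ (i , j)))
        back M i (no j)  = ∪⁺ (inj₂ (∖⁺ (i , j)))

      ∩-sub : B ⊆ A → A ∩ B ≡ B
      ∩-sub {B} {A} s = ext λ M → (λ i → proj₂ (∩⁻ i)) , (λ i → ∩⁺ (s M i , i))

      diff : A ε 𝒮 → B ε 𝒮 → B ⊆ A → val ν B +ᴿ val ν (A ∖ B) ≡ val ν A
      diff {A} {B} a b s = trans (cong (λ C → val ν C +ᴿ val ν (A ∖ B)) (sym (∩-sub s))) (split a b)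

      mono : A ε 𝒮 → B ε 𝒮 → B ⊆ A → val ν B ≤ val ν A
      mono a b s = ≤ᴿ-trans (≤+ _ _) (≡⇒≤ (diff a b s))

      compl : A ε 𝒮 → val ν A +ᴿ val ν (Str ∖ A) ≡ val ν Str
      compl a = diff full a (𝒮⊆ a)

      modular : A ε 𝒮 → B ε 𝒮 → val ν (A ∩ B) +ᴿ val ν (A ∪ B) ≡ val ν A +ᴿ val ν B
      modular {A} {B} a b = trans (cong (val ν (A ∩ B) +ᴿ_) (trans (cong (val ν) eq) (add (𝒮-∖∖ a b) b λ M i → proj₂ (∖⁻ i))))
        (trans (sym (+ᴿ-assoc _ _ _)) (cong (_+ᴿ val ν B) (split a b)))
        where
        back : ∀ M → M ε A → Dec (M ε B) → M ε (A ∖ B) ∪ B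
        back M i (yes j) = ∪⁺ (inj₂ j)
        back M i (no j)  = ∪⁺ (inj₁ (∖⁺ (i , j)))
        eq : A ∪ B ≡ (A ∖ B) ∪ B
        eq = ext λ M → (λ i → ⊎-elim (λ j → back M j em) (λ j → ∪⁺ (inj₂ j)) (∪⁻ i)) ,
                       (λ i → ∪⁺ (⊎-map (λ j → proj₁ (∖⁻ j)) (λ j → j) (∪⁻ i)))

    selection-∅ : Selection ∅ ∅
    selection-∅ = let (n , h , f , F , inj , _) = finite-∅ in ∅∈ω ,
      record { pairs = λ p i → ∅-elim i ; total = λ x i → ∅-elim i ; value = λ x i → ∅-elim i } ,
      (λ x y i → ∅-elim i)

    -- The union of A(e(0)), …, A(e(k-1)).
    private
      PU-body : W → W → W → W → Set ℓ
      PU-body A e k M = Σ W λ i → i ε k × M ε A · (e · i)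

      dPU-body : ∀ A → Def {3} λ ρ → PU-body A (ρ (suc zero)) (ρ (suc (suc zero))) (ρ zero)
      dPU-body A = it

      dPU-body₁ : ∀ A e k → Def {1} λ ρ → PU-body A e k (ρ zero)
      dPU-body₁ A e k = it

    opaque
      PU : W → W → W → W
      PU A e k = sep (PU-body A e k) ⦃ dPU-body₁ A e k ⦄ Str

      PU-spec : ∀ A e k M → M ε PU A e k ⟺ (M ε Str × Σ W λ i → i ε k × M ε A · (e · i))
      PU-spec A e k M = sep-spec (PU-body A e k) ⦃ dPU-body₁ A e k ⦄ Str M

    opaque
     instance
      dPU : ∀ {n} {A : W} {s t : Env n → W} → ⦃ DefT s ⦄ → ⦃ DefT t ⦄ → DefT λ ρ → PU A (s ρ) (t ρ)
      dPU {A = A} = dSet₂ (PU A) (PU-spec A) ⦃ dAnd ⦃ it ⦄ ⦃ dPU-body A ⦄ ⦄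

    module _ {A : W} (F : Fun A κ 𝒮) where

      PU-∅ : ∀ {e} → PU A e ∅ ≡ ∅
      PU-∅ {e} = ⊆-antisym (λ M i → let (_ , j , k , _) = proj₁ (PU-spec A e ∅ M) i in ∅-elim k) (λ M i → ∅-elim i)

      PU-⊆ : Selection n e → PU A e n ⊆ seq⋃ A
      PU-⊆ {n} {e} (_ , E , _) M i = let (s , j , k , m) = proj₁ (PU-spec A e n M) i in
        proj₂ (seq⋃-spec A M) (s , e · j , E .value j k , m)

      PU-S : ∀ {e k} → e · k ε κ → PU A e (S k) ≡ PU A e k ∪ A · (e · k)
      PU-S {e} {k} h = ext λ M →
        (λ i → let (s , j , l , m) = proj₁ (PU-spec A e _ M) i in ∪⁺
          (⊎-map (λ l → proj₂ (PU-spec A e k M) (s , j , l , m)) (λ q → subst (λ j → M ε A · (e · j)) q m) (S⁻ l))) ,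
        (λ i → ⊎-elim (λ l → let (s , j , l , m) = proj₁ (PU-spec A e k M) l in proj₂ (PU-spec A e _ M) (s , j , ⊆S l , m))
                      (λ m → proj₂ (PU-spec A e _ M) (𝒮⊆ (F .value _ h) M m , k , ∈S , m)) (∪⁻ i))

      module _ (dis : Disjoint A) where

        PU-disjoint : ∀ {k} → Selection n e → k ε n → ∀ M → M ε PU A e k → M ∉ A · (e · k)
        PU-disjoint {n} {e} {k} (n∈ , E , inj) hk M i m =
          let (_ , j , l , m′) = proj₁ (PU-spec A e k M) i
              hj = ω-sub n∈ hk j (⊆S l)
          in dis (e · j) (e · k) (E .value j hj) (E .value k hk) (λ q → ε-irrefl (subst (_ε k) (inj j k hj hk q) l)) M m′ m

        opaque
          PU-ind : (Q : W → Set ℓ) ⦃ d : Def {1} λ ρ → Q (ρ zero) ⦄ → Q ∅ →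
                   (∀ U i → i ε κ → U ε 𝒮 → Q U → (∀ M → M ε U → M ∉ A · i) → Q (U ∪ A · i)) →
                   Selection n e → ∀ k → k ε S n → PU A e k ε 𝒮 × Q (PU A e k)
          PU-ind {n} {e} Q ⦃ d ⦄ z s sel@(n∈ , E , inj) k hk = ω-ind (λ k → k ε S n → Good (PU A e k))
            ⦃ dImp ⦃ it′ ⦄ ⦃ Def₁ Good (dAnd ⦃ it ⦄ ⦃ d ⦄) (dPU {A = A} ⦃ tCon ⦄ ⦃ var₀ ⦄) ⦄ ⦄
            (λ _ → subst (_ε 𝒮) (sym PU-∅) ∅ˢ∈ , subst Q (sym PU-∅) z)
            (λ k _ IH h → let hk = S-below n∈ h ; (a , b) = IH (⊆S hk) ; hi = E .value k hk in
              subst (λ U → U ε 𝒮 × Q U) (sym (PU-S hi)) (𝒮-∪ a (F .value _ hi) , s (PU A e k) (e · k) hi a b (PU-disjoint sel hk)))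
            k (ω-trans hk (S∈ω n∈)) hk
            where
            Good : W → Set ℓ
            Good U = U ε 𝒮 × Q U
            it′ : Def {1} λ ρ → ρ zero ε S n
            it′ = dMem ⦃ var₀ ⦄ ⦃ tCon ⦄

        PU∈𝒮 : Selection n e → PU A e n ε 𝒮
        PU∈𝒮 sel = proj₁ (PU-ind (λ U → U ≡ U) refl (λ _ _ _ _ _ _ → refl) sel _ ∈S)

        module _ (N : FinAdd ν) where
          open FinAdd N

          private
            c = cmp ν A

            c-· : ∀ {i} → i ε κ → c · i ≡ rw (val ν (A · i))
            c-· hi = trans (cmp-· F hi) (sym (rw-val fun (F .value _ hi)))

            Pv : W → W → W
            Pv e k = rw (val ν (PU A e k))

            dPv : ∀ e → DefT {1} λ ρ → Pv e (ρ zero)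
            dPv e = it

            dHit : ∀ e f m → Def {1} λ ρ → ρ zero ε m → f · ρ zero ≡ Pv e (ρ zero)
            dHit e f m = dImp ⦃ it ⦄ ⦃ dEqn ⦃ it ⦄ ⦃ dPv e ⦄ ⦄

            base : ∀ e → Pv e ∅ ≡ z₀
            base e = cong rw (trans (cong (val ν) PU-∅) empty)

            next : ∀ {k} → Selection n e → k ε n → addW (Pv e k) (c · (e · k)) ≡ Pv e (S k)
            next {n} {e} {k} sel@(_ , E , _) hk = trans (cong (addW _) (c-· (E .value k hk))) (trans (sym (rw-+ _ _))
              (cong rw (trans (sym (add (proj₁ (PU-ind (λ U → U ≡ U) refl (λ _ _ _ _ _ _ → refl) sel k (⊆S hk))) (F .value _ (E .value k hk)) (PU-disjoint sel hk)))
                              (cong (val ν) (sym (PU-S (E .value k hk)))))))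

          opaque
            partial-value : ∀ {t} → Selection n e → PartialSum c n e t ⟺ (t ≡ Pv e n)
            partial-value {n} {e} {t} sel@(n∈ , E , _) =
              (λ (f , z , s , q) → trans q (ω-ind (λ k → k ε S n → f · k ≡ Pv e k) ⦃ dHit e f (S n) ⦄
                (λ _ → trans z (sym (base e)))
                (λ k _ IH h → let hk = S-below n∈ h in
                  trans (s k hk) (trans (cong (λ x → addW x (c · (e · k))) (IH (⊆S hk))) (next sel hk))) n n∈ ∈S)) ,
              (λ q → graph (Pv e) ⦃ dPv e ⦄ (S n) , trans (graph-· (Pv e) ⦃ dPv e ⦄ (∅∈S n∈)) (base e) ,
                (λ i hi → trans (graph-· (Pv e) ⦃ dPv e ⦄ (ω-mono hi n∈)) (trans (sym (next sel hi))
                   (cong (λ x → addW x (c · (e · i))) (sym (graph-· (Pv e) ⦃ dPv e ⦄ (⊆S hi)))))) ,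
                trans q (sym (graph-· (Pv e) ⦃ dPv e ⦄ ∈S)))

            sum-value : ∀ {s} → SumOf c s ⟺ ((∀ n e → Selection n e → val ν (PU A e n) ≤ s) ×
                                             (∀ u → (∀ n e → Selection n e → val ν (PU A e n) ≤ u) → s ≤ u))
            sum-value {s} =
              (λ (h , k) → (λ n e sel → subst (_≤ s) (toReal-rw _) (h n e _ sel (proj₂ (partial-value sel) refl))) ,
                (λ u h′ → k u λ n e t sel p → subst (_≤ u) (sym (back sel p)) (h′ n e sel))) ,
              (λ (h , k) → (λ n e t sel p → subst (_≤ s) (sym (back sel p)) (h n e sel)) ,
                (λ u h′ → k u λ n e sel → subst (_≤ u) (toReal-rw _) (h′ n e _ sel (proj₂ (partial-value sel) refl))))
              where
              back : ∀ {n e t} → Selection n e → PartialSum c n e t → toReal t ≡ val ν (PU A e n)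
              back sel p = trans (cong toReal (proj₁ (partial-value sel) p)) (toReal-rw _)

    module _ (m : IsMeasure μ) where
      open IsMeasure m

      private
        ≤0⇒ : ∀ {r} → r +ᴿ r ≤ r → r ≡ 0ᴿ
        ≤0⇒ {r} h = ≤0⇒≡0 (+ᴿ-cancelʳ r (≤ᴿ-trans h (≡⇒≤ (sym (0+ᴿ r)))))

      private
        e₂ : W
        e₂ = graph (choose i₀ i₀ i₁ ∅ (S ∅)) ⦃ dChoose i₀ i₀ i₁ ∅ (S ∅) ⦄ (S (S ∅))

        e₂-0 : e₂ · ∅ ≡ i₀
        e₂-0 = trans (graph-· (choose i₀ i₀ i₁ ∅ (S ∅)) ⦃ dChoose i₀ i₀ i₁ ∅ (S ∅) ⦄ (⊆S ∈S)) (choose₀ i₀ i₀ i₁ ∅ (S ∅))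

        e₂-1 : e₂ · S ∅ ≡ i₁
        e₂-1 = trans (graph-· (choose i₀ i₀ i₁ ∅ (S ∅)) ⦃ dChoose i₀ i₀ i₁ ∅ (S ∅) ⦄ ∈S) (choose₁ i₀ i₀ i₁ λ q → S≢∅ (sym q))

        below-2 : ∀ {x} → x ε S (S ∅) → x ≡ ∅ ⊎ x ≡ S ∅
        below-2 {x} i = ⊎-elim (λ j → inj₁ (⊎-elim (λ k → ∅-elim k) (λ q → q) (S⁻ j))) inj₂ (S⁻ i)

        sel₂ : Selection (S (S ∅)) e₂
        sel₂ = S∈ω (S∈ω ∅∈ω) , graph-fun (choose i₀ i₀ i₁ ∅ (S ∅)) ⦃ dChoose i₀ i₀ i₁ ∅ (S ∅) ⦄
            (λ x i → ⊎-elim (λ q → subst (λ x → choose i₀ i₀ i₁ ∅ (S ∅) x ε κ) (sym q) (subst (_ε κ) (sym (choose₀ i₀ i₀ i₁ ∅ (S ∅))) i₀∈))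
                            (λ q → subst (λ x → choose i₀ i₀ i₁ ∅ (S ∅) x ε κ) (sym q) (subst (_ε κ) (sym (choose₁ i₀ i₀ i₁ λ q → S≢∅ (sym q))) i₁∈)) (below-2 i)) ,
          λ x y i j q → inj x y (below-2 i) (below-2 j) q
          where
          inj : ∀ x y → x ≡ ∅ ⊎ x ≡ S ∅ → y ≡ ∅ ⊎ y ≡ S ∅ → e₂ · x ≡ e₂ · y → x ≡ y
          inj x y (inj₁ p) (inj₁ q) e = trans p (sym q)
          inj x y (inj₂ p) (inj₂ q) e = trans p (sym q)
          inj x y (inj₁ refl) (inj₂ refl) e = ⊥-elim (i₀≢i₁ (trans (sym e₂-0) (trans e e₂-1)))
          inj x y (inj₂ refl) (inj₁ refl) e = ⊥-elim (i₀≢i₁ (sym (trans (sym e₂-1) (trans e e₂-0))))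

        partial₂ : ∀ c {a b} → c · i₀ ≡ rw a → c · i₁ ≡ rw b → PartialSum c (S (S ∅)) e₂ (rw (a +ᴿ b))
        partial₂ c {a} {b} ha hb = proj₂ (Rec-suc {Z = _≡ z₀} {step = λ i x y → y ≡ addW x (c · (e₂ · i))} (S∈ω ∅∈ω))
          (rw a , proj₂ (Rec-suc {Z = _≡ z₀} {step = λ i x y → y ≡ addW x (c · (e₂ · i))} ∅∈ω)
            (z₀ , proj₂ (Rec-zero {Z = _≡ z₀} {step = λ i x y → y ≡ addW x (c · (e₂ · i))}) refl ,
              sym (trans (cong (addW z₀) (trans (cong (c ·_) e₂-0) ha)) (trans (sym (rw-+ 0ᴿ a)) (cong rw (0+ᴿ a))))) ,
            sym (trans (cong (addW (rw a)) (trans (cong (c ·_) e₂-1) hb)) (sym (rw-+ a b))))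

      module TwoSets {A B : W} (a : A ε 𝒮) (b : B ε 𝒮) (dis : ∀ M → M ε A → M ∉ B) where
        open Pair ∅ˢ∈ a b (𝒮⊆ a) (𝒮⊆ b) dis public

        sum : SumOf (cmp μ seq) (val μ (A ∪ B))
        sum = subst (λ C → SumOf (cmp μ seq) (val μ C)) ⋃≡ (additive seq seq-fun disj (subst (_ε 𝒮) (sym ⋃≡) (𝒮-∪ a b)))

        c-· : ∀ {i} → i ε κ → cmp μ seq · i ≡ rw (val μ (seq · i))
        c-· hi = trans (cmp-· seq-fun hi) (sym (rw-val fun (seq-fun .value _ hi)))

        at-least : val μ A +ᴿ val μ B ≤ val μ (A ∪ B)
        at-least = subst (_≤ val μ (A ∪ B)) (toReal-rw _) (proj₁ sum _ _ _ sel₂ (partial₂ (cmp μ seq)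
          (trans (c-· i₀∈) (cong (λ C → rw (val μ C)) seq₀)) (trans (c-· i₁∈) (cong (λ C → rw (val μ C)) seq₁))))

      measure-∅ : val μ ∅ ≡ 0ᴿ
      measure-∅ = ≤0⇒ (subst (λ C → val μ ∅ +ᴿ val μ ∅ ≤ val μ C) (⊆-antisym (λ M i → reduce (∪⁻ i)) (λ M i → ∅-elim i))
        (TwoSets.at-least ∅ˢ∈ ∅ˢ∈ λ M i → ∅-elim i))

      private
        module Upper {A B : W} (a : A ε 𝒮) (b : B ε 𝒮) (dis : ∀ M → M ε A → M ∉ B) where
          open TwoSets a b dis

          c : W
          c = cmp μ seq

          u v : Real
          u = val μ A
          v = val μ B

          c-else : ∀ {i} → i ε κ → ¬ (i ≡ i₀) → ¬ (i ≡ i₁) → c · i ≡ rw 0ᴿ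
          c-else hi h k = trans (c-· hi) (cong rw (trans (cong (val μ) (seq-else hi h k)) measure-∅))

          Used : W → W → W → Real → Real → Set ℓ
          Used e k j w x = x ≡ 0ᴿ ⊎ (x ≡ w × Σ W λ i → i ε k × e · i ≡ j)

          Bounded : Real → Real → W → W → W → Set ℓ
          Bounded u v f e k = Σ Real λ x → Σ Real λ y → f · k ≡ rw (x +ᴿ y) × Used e k i₀ u x × Used e k i₁ v y

          dBounded : ∀ u v f e m → Def {1} λ ρ → ρ zero ε m → Bounded u v f e (ρ zero)
          dBounded u v f e m = dImp ⦃ it ⦄ ⦃ dExReal ⦃ dExReal ⦃ dAnd ⦃ it ⦄ ⦃ dAnd ⦃ used i₀ u var₁ ⦄ ⦃ used i₁ v var₀ ⦄ ⦄ ⦄ ⦄ ⦄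
            where
            dUsed : ∀ j w → Def {2} λ ρ → Used e (ρ (suc zero)) j w (toReal (ρ zero))
            dUsed j w = it
            used : ∀ j w {t : Env 3 → W} → DefT t → Def λ ρ → Used e (ρ (suc (suc zero))) j w (toReal (t ρ))
            used j w d = Def₂ (λ x k → Used e k j w (toReal x)) (dUsed j w) d var₂

          used-S : ∀ {e k j w x} → Used e k j w x → Used e (S k) j w x
          used-S (inj₁ q) = inj₁ q
          used-S (inj₂ (q , i , h , l)) = inj₂ (q , i , ⊆S h , l)

          unused : ∀ {n e k j w x} → Selection n e → k ε n → e · k ≡ j → Used e k j w x → x ≡ 0ᴿ
          unused sel hk l (inj₁ q) = q
          unused (n∈ , _ , inj) hk l (inj₂ (_ , i , h , l′)) =
            ⊥-elim (ε-irrefl (subst (_ε _) (inj i _ (ω-sub n∈ hk i (⊆S h)) hk (trans l′ (sym l))) h))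

          used≤ : ∀ {e k j w x} → Used e k j w x → x ≤ w
          used≤ {w = w} (inj₁ q) = subst (_≤ w) (sym q) (0≤ w)
          used≤ (inj₂ (q , _)) = ≡⇒≤ q

          module _ {n e f : W} (sel : Selection n e) (z : f · ∅ ≡ z₀) (st : ∀ i → i ε n → f · S i ≡ addW (f · i) (c · (e · i))) where

            step : ∀ {k} → k ε n → Bounded u v f e k → Bounded u v f e (S k)
            step {k} hk (x , y , q , hx , hy) = go em em
              where
              hi : e · k ε κ
              hi = proj₁ (proj₂ sel) .value k hk
              plus : ∀ {d} → c · (e · k) ≡ rw d → f · S k ≡ rw ((x +ᴿ y) +ᴿ d)
              plus {d} r = trans (st k hk) (trans (cong₂ addW q r) (sym (rw-+ (x +ᴿ y) d)))
              go : Dec (e · k ≡ i₀) → Dec (e · k ≡ i₁) → Bounded u v f e (S k)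
              go (yes l) _ = let x0 = unused sel hk l hx in
                u , y , trans (plus (trans (cong (c ·_) l) (trans (c-· i₀∈) (cong (λ C → rw (val μ C)) seq₀))))
                  (cong rw (trans (cong (λ x → (x +ᴿ y) +ᴿ u) x0) (trans (cong (_+ᴿ u) (0+ᴿ y)) (+ᴿ-comm y u)))) ,
                inj₂ (refl , k , ∈S , l) , used-S hy
              go (no _) (yes l) = let y0 = unused sel hk l hy in
                x , v , trans (plus (trans (cong (c ·_) l) (trans (c-· i₁∈) (cong (λ C → rw (val μ C)) seq₁))))
                  (cong rw (trans (cong (λ y → (x +ᴿ y) +ᴿ v) y0) (cong (_+ᴿ v) (+ᴿ-0 x)))) ,
                used-S hx , inj₂ (refl , k , ∈S , l)
              go (no l) (no l′) = x , y , trans (plus (c-else hi l l′)) (cong rw (+ᴿ-0 (x +ᴿ y))) , used-S hx , used-S hy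

            bounded-at : ∀ k → k ε ω → k ε S n → Bounded u v f e k
            bounded-at = ω-ind (λ k → k ε S n → Bounded u v f e k) ⦃ dBounded u v f e (S n) ⦄
              (λ _ → 0ᴿ , 0ᴿ , trans z (cong rw (sym (+ᴿ-0 0ᴿ))) , inj₁ refl , inj₁ refl)
              (λ k _ IH h → let hk = S-below (proj₁ sel) h in step hk (IH (⊆S hk)))

          at-most : val μ (A ∪ B) ≤ u +ᴿ v
          at-most = proj₂ sum (u +ᴿ v) λ n e t sel (f , z , st , q) →
            let (x , y , r , hx , hy) = bounded-at sel z st n (proj₁ sel) ∈S in
            subst (_≤ u +ᴿ v) (sym (trans (cong toReal (trans q r)) (toReal-rw _))) (+ᴿ-mono (used≤ hx) (used≤ hy))

      finitely-additive : FinAdd μ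
      finitely-additive = record
        { fun = fun ; empty = measure-∅
        ; add = λ a b dis → ≤ᴿ-antisym (Upper.at-most a b dis) (TwoSets.at-least a b dis) }

      private
        module μF = FinAddFacts finitely-additive

      opaque
        exhaust : ∀ {A δ} → Fun A κ 𝒮 → Disjoint A → seq⋃ A ε 𝒮 → Pos δ →
               Σ W λ n → Σ W λ e → Selection n e × val μ (seq⋃ A) ≤ val μ (PU A e n) +ᴿ ι δ
        exhaust {A} {δ} F dis s δ>0 = dne λ none →
          let (h , h>0 , e2) = halve δ
              hp = h>0 δ>0
              r = val μ (seq⋃ A)
              (k , lo , hi) = near r {h} hp
              ιδ : ι δ ≡ ι h +ᴿ ι h
              ιδ = sym (trans (ι-+ h h) (ι-≈ {h +ᶠ h} {δ} e2))
              ιS : ∀ k → ι (sᴺ k • h) ≡ ι (k • h) +ᴿ ι h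
              ιS k = sym (trans (ι-+ (k • h) h) (ι-≈ {k • h +ᶠ h} {sᴺ k • h} (•-suc k h)))
              pu : ∀ n e → Selection n e → val μ (PU A e n) +ᴿ ι h ≤ ι (k • h)
              pu n e sel = +ᴿ-cancelʳ (ι h) (≤ᴿ-trans (≡⇒≤ (trans (+ᴿ-assoc _ _ _) (cong (val μ (PU A e n) +ᴿ_) (sym ιδ))))
                (≤ᴿ-trans (⊎-elim (λ l → ⊥-elim (none (n , e , sel , l))) (λ l → l) (≤ᴿ-total r (val μ (PU A e n) +ᴿ ι δ)))
                  (≤ᴿ-trans (∋⇒≤ι hi) (≡⇒≤ (ιS k)))))
              ιh≰0 : ∀ x → ¬ (x +ᴿ ι h ≤ x)
              ιh≰0 x l = ≤ᶠ-≰ h hp (+ᴿ-cancelʳ x (≤ᴿ-trans (≡⇒≤ (+ᴿ-comm _ x)) (≤ᴿ-trans l (≡⇒≤ (sym (0+ᴿ x))))))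
          in ⊎-elim
               (λ q → ιh≰0 0ᴿ (≤ᴿ-trans (+ᴿ-mono (0≤ _) ≤ᴿ-refl) (≤ᴿ-trans (pu ∅ ∅ selection-∅)
                  (≡⇒≤ (ι-≈ {k • h} {0ᶠ} (zero-• k h q))))))
               (λ (j , q) → ιh≰0 (ι (j • h)) (≤ᴿ-trans (≡⇒≤ (sym (ιS j))) (≤ᴿ-trans (≡⇒≤ (cong (λ k → ι (k • h)) (sym q)))
                  (≤ᴿ-trans (∌⇒ι≤ lo) (proj₂ (proj₁ (sum-value F dis finitely-additive) (additive A F dis s)) (ι (j • h))
                    λ n e sel → +ᴿ-cancelʳ (ι h) (≤ᴿ-trans (pu n e sel) (≡⇒≤ (trans (cong (λ k → ι (k • h)) q) (ιS j)))))))))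
               (nonzero k)
          where
          ≤ᶠ-≰ : ∀ h → Pos h → ¬ (ι h ≤ 0ᴿ)
          ≤ᶠ-≰ h hp l = <ᶠ⇒≱ᶠ {h} {h} (proj₁ ι-∋ (at l h (proj₂ 0ᴿ-∋ hp))) (≤ᶠ-refl h)
          zero-• : ∀ k h → k ≡ 0ᴺ → k • h ≈ 0ᶠ
          zero-• k h refl = trans (cong (_*ᴺ 1ᴺ) (0* (num h))) (trans (0* 1ᴺ) (sym (0* _)))

        -- The π-λ theorem for predicates that are continuous with respect to μ.
        π-λ-approx : (P : W → Set ℓ) ⦃ d : Def {1} λ ρ → P (ρ zero) ⦄ → (∀ p → Condition p → P (Bas p)) →
                     (∀ A → A ε 𝒮 → P A → P (Str ∖ A)) →
                     (∀ A B → A ε 𝒮 → B ε 𝒮 → P A → P B → (∀ M → M ε A → M ∉ B) → P (A ∪ B)) →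
                     (∀ B → B ε 𝒮 → (∀ δ → Pos δ → Σ W λ C → C ε 𝒮 × P C × C ⊆ B × val μ B ≤ val μ C +ᴿ ι δ) → P B) →
                     ∀ A → A ε 𝒮 → P A
        π-λ-approx P ⦃ d ⦄ bas com uni app A a = proj₂ (proj₁ (F-spec A) (π-λ Fλ A a))
          where
          F₀ : W
          F₀ = sep P 𝒮
          F-spec : ∀ A → A ε F₀ ⟺ (A ε 𝒮 × P A)
          F-spec = sep-spec P 𝒮
          P∅ : P ∅
          P∅ = subst P (⊆-antisym (λ M i → ⊥-elim (Str∖Str i)) (λ M i → ∅-elim i))
            (com Str full (subst P Bas-∅ (bas ∅ condition-∅)))
          Fλ : Lambda F₀
          Fλ = record
            { within = λ A i → proj₁ (proj₁ (F-spec A) i)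
            ; basic  = λ p c → proj₂ (F-spec _) (Bas∈ c , bas p c)
            ; compl  = λ A i → let (j , k) = proj₁ (F-spec A) i in proj₂ (F-spec _) (𝒮-∖ j , com A j k)
            ; unions = λ A f dis s → let f′ = FunP-map (λ B i → proj₁ (proj₁ (F-spec B) i)) f in
                proj₂ (F-spec _) (s , app _ s λ δ δ>0 → let (n , e , sel , l) = exhaust f′ dis s δ>0 in
                  PU A e n , PU∈𝒮 f′ dis sel ,
                  proj₂ (PU-ind f′ dis P P∅ (λ U i hi U∈ PU h → uni U _ U∈ (f′ .value i hi) PU (proj₂ (proj₁ (F-spec _) (f .value i hi))) h) sel n ∈S) ,
                  PU-⊆ f′ sel , l) }

        dominated : FinAdd ν → val ν Str ≡ 1ᴿ → (∀ A → A ε 𝒮 → val ν A ≤ val μ A +ᴿ val μ A) → IsMeasure ν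
        dominated {ν} N tot dom = record
          { fun = FinAdd.fun N ; total = tot
          ; additive = λ A F dis s → proj₂ (sum-value F dis N)
              ( (λ n e sel → νF.mono s (PU∈𝒮 F dis sel) (PU-⊆ F sel))
              , λ u h → ≤-limit λ δ δ>0 →
                  let (k , k>0 , e2) = halve δ
                      (n , e , sel , l) = exhaust F dis s (k>0 δ>0)
                      U∈ = PU∈𝒮 F dis sel
                      r = val μ (seq⋃ A ∖ PU A e n)
                      small : r ≤ ι k
                      small = +ᴿ-cancelʳ (val μ (PU A e n)) (≤ᴿ-trans (≡⇒≤ (trans (+ᴿ-comm r _) (μF.diff s U∈ (PU-⊆ F sel))))
                        (≤ᴿ-trans l (≡⇒≤ (+ᴿ-comm _ _))))
                  in ≤ᴿ-trans (≡⇒≤ (sym (νF.diff s U∈ (PU-⊆ F sel))))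
                       (+ᴿ-mono (h n e sel) (≤ᴿ-trans (dom _ (𝒮-∖∖ s U∈)) (≤ᴿ-trans (+ᴿ-mono small small)
                         (≡⇒≤ (trans (ι-+ k k) (ι-≈ {k +ᶠ k} {δ} e2)))))) ) }
          where
          module νF = FinAddFacts N

  module Convergence where

    open Measures
    open Additivity

    private variable
      A B M g h μ Y Z p q : W

    rel-val : FunP μ 𝒮 IsCut → A ε 𝒮 → ∀ {y} → (el μ R.∶ el A ↦ el y) ⟺ (y ≡ rw (val μ A))
    rel-val {μ} {A} F a {y} =
      (λ m → trans (proj₂ (graph-dom F (proj₁ (rel-↦ {μ} {A} {y}) m))) (sym (rw-val F a))) ,
      (λ e → proj₂ (rel-↦ {μ} {A} {y}) (subst (λ y → ⟨ A , y ⟩ ε μ) (sym (trans e (rw-val F a))) (F .total A a)))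

    rel-measure : R.IsProbabilityMeasure (el κ) (el L) (el X) (el μ) ⟺ IsMeasure μ
    rel-measure {μ} = to , from
      where
      disj← : ∀ {A} → Fun A κ 𝒮 → Disjoint A → R.∀ⱽ λ i → R.∀ⱽ λ j → R.∀ⱽ λ C → R.∀ⱽ λ D → ¬ (i ≡ j) →
              (el A R.∶ i ↦ C) → (el A R.∶ j ↦ D) → R.∀∈ C λ M → ¬ (M ∈ D)
      disj← {A} F d i vi j vj C vC D vD ne m m′ M vM k l =
        let (hi , e) = graph-dom F (proj₁ (rel-↦ {A} {⟪ i , vi ⟫} {⟪ C , vC ⟫}) m)
            (hj , e′) = graph-dom F (proj₁ (rel-↦ {A} {⟪ j , vj ⟫} {⟪ D , vD ⟫}) m′)
        in d ⟪ i , vi ⟫ ⟪ j , vj ⟫ hi hj (λ q → ne (cong el q)) ⟪ M , vM ⟫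
             (subst (⟪ M , vM ⟫ ε_) e (∈→ε k)) (subst (⟪ M , vM ⟫ ε_) e′ (∈→ε l))
      disj→ : ∀ {A} → Fun A κ 𝒮 → (R.∀ⱽ λ i → R.∀ⱽ λ j → R.∀ⱽ λ C → R.∀ⱽ λ D → ¬ (i ≡ j) →
              (el A R.∶ i ↦ C) → (el A R.∶ j ↦ D) → R.∀∈ C λ M → ¬ (M ∈ D)) → Disjoint A
      disj→ {A} F d i j hi hj ne M k l = d (el i) (isV i) (el j) (isV j) (el (A · i)) (isV (A · i)) (el (A · j)) (isV (A · j))
        (λ q → ne (el-inj q)) (proj₂ (rel-↦ {A} {i} {A · i}) (F .total i hi)) (proj₂ (rel-↦ {A} {j} {A · j}) (F .total j hj))
        (el M) (isV M) (ε→∈ k) (ε→∈ l)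
      Union : 𝕌 → 𝕌 → Set ℓ
      Union A B = ∀ M → V M → M ∈ B ⇔ (R.∃ⱽ λ i → R.∃ⱽ λ C → (A R.∶ i ↦ C) × (M ∈ C))
      union⟺ : ∀ {A B} → Fun A κ 𝒮 → Union (el A) (el B) ⟺ (B ≡ seq⋃ A)
      union⟺ {A} {B} F =
        (λ H → ext λ M → ⟺-trans (⟺-trans (ε→∈ , ∈→ε) (from⇔ (H (el M) (isV M)))) (mid M)) ,
        (λ { refl M vM → to⇔ (⟺-trans (⟺-trans (∈→ε , ε→∈) (⟺-sym (mid ⟪ M , vM ⟫))) ((λ z → z) , (λ z → z))) })
        where
        mid : ∀ M → (R.∃ⱽ λ i → R.∃ⱽ λ C → (el A R.∶ i ↦ C) × (el M ∈ C)) ⟺ (M ε seq⋃ A)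
        mid M =
          (λ (i , vi , C , vC , m , k) → let (hi , e) = graph-dom F (proj₁ (rel-↦ {A} {⟪ i , vi ⟫} {⟪ C , vC ⟫}) m)
                                             k′ = subst (M ε_) e (∈→ε k)
                                         in proj₂ (seq⋃-spec A M) (𝒮⊆ (F .value _ hi) M k′ , ⟪ i , vi ⟫ , hi , k′)) ,
          (λ k → let (_ , i , hi , l) = proj₁ (seq⋃-spec A M) k in el i , isV i , el (A · i) , isV (A · i) ,
            proj₂ (rel-↦ {A} {i} {A · i}) (F .total i hi) , ε→∈ l)
      isStr : ∀ {S′} → R.IsStr (el L) (el X) (el S′) ⟺ (S′ ≡ Str)
      isStr {S′} = ⟺-trans (rel-with {S′} {λ _ → ⊤}) ((λ h → ext λ M → (λ i → proj₁ (proj₁ (h M) i)) , (λ i → proj₂ (h M) (i , tt))) ,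
        (λ { refl M → (λ i → i , tt) , proj₁ }))
      to : R.IsProbabilityMeasure (el κ) (el L) (el X) (el μ) → IsMeasure μ
      to m = record { fun = F ; total = tot ; additive = add }
        where
        S≡ : ∀ {S′} → R.IsSigma (el κ) (el L) (el X) (el S′) → S′ ≡ 𝒮
        S≡ {S′} (c , l) = ⊆-antisym (proj₁ rel-⊆ (l (el 𝒮) (isV 𝒮) (proj₁ sigma))) (proj₁ rel-⊆ (proj₂ sigma (el S′) (isV S′) c))
        F : FunP μ 𝒮 IsCut
        F = let (S′ , vS , sg , f) = R.IsProbabilityMeasure.domain m in subst (λ a → FunP μ a IsCut) (S≡ {⟪ S′ , vS ⟫} sg)
              (FunP-map (λ w → proj₁ (rel-real {w})) (fromIsFun {μ} {⟪ S′ , vS ⟫} {R.IsReal} f))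
        tot : val μ Str ≡ 1ᴿ
        tot = let (u , vu , o , k) = R.IsProbabilityMeasure.total m (el Str) (isV Str) (proj₂ (isStr {Str}) refl) in
          rw-inj (trans (sym (proj₁ (rel-val F full {⟪ u , vu ⟫}) k)) (proj₁ (rel-oneᴿ {⟪ u , vu ⟫}) o))
        add : ∀ A → Fun A κ 𝒮 → Disjoint A → seq⋃ A ε 𝒮 → SumOf (cmp μ A) (val μ (seq⋃ A))
        add A G d s = proj₁ (rel-sum (cmp-cut F G)) (R.IsProbabilityMeasure.additive m (el 𝒮) (isV 𝒮) sigma (el A) (isV A) (toIsFun (FunP-map (λ _ → ε→∈) G)) (disj← G d)
          (el (seq⋃ A)) (isV (seq⋃ A)) (proj₂ (union⟺ G) refl) (el (cmp μ A)) (isV (cmp μ A)) (proj₂ (rel-comp G F) refl)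
          (el (rw (val μ (seq⋃ A)))) (isV (rw (val μ (seq⋃ A)))) (proj₂ (rel-val F s) refl))
      from : IsMeasure μ → R.IsProbabilityMeasure (el κ) (el L) (el X) (el μ)
      from m = record
        { domain = el 𝒮 , isV 𝒮 , sigma , toIsFun (FunP-map (λ w → proj₂ (rel-real {w})) fun)
        ; total = λ S′ vS h → el (rw 1ᴿ) , isV (rw 1ᴿ) , proj₂ (rel-oneᴿ {rw 1ᴿ}) refl ,
            subst (λ S′ → el μ R.∶ el S′ ↦ el (rw 1ᴿ)) (sym (proj₁ (isStr {⟪ S′ , vS ⟫}) h))
              (proj₂ (rel-val fun full) (cong rw (sym (IsMeasure.total m))))
        ; additive = λ S′ vS sg A vA G dj B vB un c vc ce t vt k →
            let A₀ = ⟪ A , vA ⟫ ; B₀ = ⟪ B , vB ⟫ ; c₀ = ⟪ c , vc ⟫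
                G₁ = subst (Fun A₀ κ) (S≡′ {⟪ S′ , vS ⟫} sg) (FunP-map (λ _ → ∈→ε) (fromIsFun {A₀} {κ} G))
                B≡ = proj₁ (union⟺ {A₀} {B₀} G₁) un
                c≡ = proj₁ (rel-comp {A₀} {κ} {𝒮} {μ} {c₀} G₁ fun) ce
                B∈ = proj₁ (graph-dom fun (proj₁ (rel-↦ {μ} {B₀} {⟪ t , vt ⟫}) k))
                t≡ = proj₁ (rel-val fun B∈ {⟪ t , vt ⟫}) k
            in subst₂ (λ c t → R.IsSum (el κ) (el c) (el t)) (sym c≡) (trans (cong (λ B → rw (val μ B)) (sym B≡)) (sym t≡))
                 (proj₂ (rel-sum (cmp-cut fun G₁)) (additive A₀ G₁ (disj→ G₁ dj) (subst (_ε 𝒮) B≡ B∈))) }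
        where
        open IsMeasure m
        S≡′ : ∀ {S′} → R.IsSigma (el κ) (el L) (el X) (el S′) → S′ ≡ 𝒮
        S≡′ {S′} (c , l) = ⊆-antisym (proj₁ rel-⊆ (l (el 𝒮) (isV 𝒮) (proj₁ sigma))) (proj₁ rel-⊆ (proj₂ sigma (el S′) (isV S′) c))

    Invariant : W → Set ℓ
    Invariant μ = ∀ g → Perm g → ∀ A → A ε 𝒮 → val μ (img[ g ] A) ≡ val μ A

    rel-invariant : R.IsInvariantMeasure (el κ) (el L) (el X) (el μ) ⟺ (IsMeasure μ × Invariant μ)
    rel-invariant {μ} =
      (λ h → let m = proj₁ rel-measure (R.IsInvariantMeasure.measure h) ; F = IsMeasure.fun m in
        m , λ g pg A a → sym (rw-inj (proj₁ (rel-val F (image∈𝒮 pg a) {rw (val μ A)})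
          (R.IsInvariantMeasure.invariant h (el g) (isV g) (proj₂ (rel-bij {g} {X} {X}) pg) (el A) (isV A) (el (img[ g ] A)) (isV (img[ g ] A))
            (proj₂ (rel-image (𝒮⊆ a) pg) refl) (el (rw (val μ A))) (isV (rw (val μ A))) (proj₂ (rel-val F a) refl))))) ,
      (λ (m , inv) → let F = IsMeasure.fun m in record
        { measure = proj₂ rel-measure m
        ; invariant = λ g vg b A vA B vB im y vy k →
            let g₀ = ⟪ g , vg ⟫ ; A₀ = ⟪ A , vA ⟫ ; B₀ = ⟪ B , vB ⟫ ; y₀ = ⟪ y , vy ⟫
                a = proj₁ (graph-dom F (proj₁ (rel-↦ {μ} {A₀} {y₀}) k))
                pg = proj₁ (rel-bij {g₀} {X} {X}) b
                B≡ = proj₁ (rel-image {A₀} {g₀} {B₀} (𝒮⊆ a) pg) im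
            in subst (λ B → el μ R.∶ el B ↦ y) (sym B≡) (proj₂ (rel-val F (image∈𝒮 pg a) {y₀})
                 (trans (proj₁ (rel-val F a {y₀}) k) (cong rw (sym (inv g₀ pg A₀ a))))) })

    -- The filter of permutations tending to infinity is generated by the sets
    -- of all g with g[Y] ∩ Y = ∅, for Y finite.
    Far : W → W → Set ℓ
    Far Y g = Perm g × Away g Y Y

    Small : W → Set ℓ
    Small Y = Finite Y × Y ⊆ X

    dSmall : Def {1} λ ρ → Small (ρ zero)
    dSmall = dAnd ⦃ Def₁ Finite dFinite var₀ ⦄ ⦃ it ⦄

    dFar : Def {2} λ ρ → Far (ρ zero) (ρ (suc zero))
    dFar = dAnd ⦃ Def₁ Perm dPerm var₁ ⦄ ⦃ it ⦄

    small-∪ : Small Y → Small Z → Small (Y ∪ Z)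
    small-∪ (f , s) (f′ , s′) = finite-∪ f f′ , λ x i → ⊎-elim (s x) (s′ x) (∪⁻ i)

    far-⊆ : Z ⊆ Y → Far Y g → Far Z g
    far-⊆ s (p , a) = p , λ z i j → a z (s z i) (s _ j)

    ∪ˡ : Y ⊆ Y ∪ Z
    ∪ˡ x i = ∪⁺ (inj₁ i)

    ∪ʳ : Z ⊆ Y ∪ Z
    ∪ʳ x i = ∪⁺ (inj₂ i)

    far-exists : Small Y → Σ W λ g → Far Y g
    far-exists (f , s) = away infinite f f s

    module Uniform {μ : W} (m : IsMeasure μ) (T : W → W → Set ℓ) (dT : Def {2} λ ρ → T (ρ zero) (ρ (suc zero)))
      (T-⊆ : ∀ Y Z θ → Z ⊆ Y → T Y θ → T Z θ) (T-add : ∀ Y θ → T Y θ → FinAdd θ) (T-total : ∀ Y θ θ′ → T Y θ → T Y θ′ → val θ Str ≡ val θ′ Str)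
      (T-dom : ∀ Y θ A → T Y θ → A ε 𝒮 → val θ A ≤ val μ A) where

      Close : W → Set ℓ
      Close B = ∀ (δ : Real) → ¬ (δ ≡ 0ᴿ) → Σ W λ Y → Small Y × (∀ θ θ′ → T Y θ → T Y θ′ → val θ B ≤ val θ′ B +ᴿ δ)

      private
        dClose : Def {1} λ ρ → Close (ρ zero)
        dClose = dAllReal ⦃ dImp ⦃ it ⦄ ⦃ dEx ⦃ dAnd ⦃ Def₁ Small dSmall var₀ ⦄ ⦃ dAll ⦃ dAll ⦃ dImp
          ⦃ Def₂ T dT var₂ var₁ ⦄ ⦃ dImp
          ⦃ Def₂ T dT var₂ var₀ ⦄ ⦃ it ⦄ ⦄ ⦄ ⦄ ⦄ ⦄ ⦄ ⦄

        module μF = FinAddFacts (finitely-additive m)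

        compl : ∀ A → A ε 𝒮 → Close A → Close (Str ∖ A)
        compl A a c δ δ≢0 = let (Y , sY , h) = c δ δ≢0 in Y , sY , λ θ θ′ t t′ →
          let e = FinAddFacts.compl (T-add Y θ t) a ; e′ = FinAddFacts.compl (T-add Y θ′ t′) a in
          +ᴿ-cancelʳ (val θ A) (≤ᴿ-trans (≡⇒≤ (trans (+ᴿ-comm _ _) (trans e (trans (T-total Y θ θ′ t t′) (sym e′)))))
            (≤ᴿ-trans (+ᴿ-mono (h θ′ θ t′ t) ≤ᴿ-refl)
              (≡⇒≤ (Sum.solve 3 (λ x y d → (x Sum.⊕ d) Sum.⊕ y Sum.⊜ (y Sum.⊕ d) Sum.⊕ x) refl (val θ A) (val θ′ (Str ∖ A)) δ))))

        union : ∀ A B → A ε 𝒮 → B ε 𝒮 → Close A → Close B → (∀ M → M ε A → M ∉ B) → Close (A ∪ B)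
        union A B a b c c′ dis δ δ≢0 =
          let (k , k≢0 , k+k) = half δ δ≢0
              (Y , sY , h) = c k k≢0
              (Z , sZ , h′) = c′ k k≢0
          in Y ∪ Z , small-∪ sY sZ , λ θ θ′ t t′ →
            ≤ᴿ-trans (≡⇒≤ (FinAdd.add (T-add _ θ t) a b dis))
              (≤ᴿ-trans (+ᴿ-mono (h θ θ′ (T-⊆ _ _ θ ∪ˡ t) (T-⊆ _ _ θ′ ∪ˡ t′)) (h′ θ θ′ (T-⊆ _ _ θ ∪ʳ t) (T-⊆ _ _ θ′ ∪ʳ t′)))
                (≤ᴿ-trans (≡⇒≤ (+ᴿ-swap _ k _ k)) (+ᴿ-mono (≡⇒≤ (sym (FinAdd.add (T-add _ θ′ t′) a b dis))) k+k)))

        approx : ∀ B → B ε 𝒮 → (∀ δ → Pos δ → Σ W λ C → C ε 𝒮 × Close C × C ⊆ B × val μ B ≤ val μ C +ᴿ ι δ) → Close B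
        approx B b ap δ δ≢0 =
          let (k , k≢0 , k+k) = half δ δ≢0
              (x , x>0 , i) = ≢0⇒ k≢0
              (C , c , cl , s , l) = ap x x>0
              (Y , sY , h) = cl k k≢0
              small : val μ (B ∖ C) ≤ k
              small = +ᴿ-cancelʳ (val μ C) (≤ᴿ-trans (≡⇒≤ (trans (+ᴿ-comm _ _) (μF.diff b c s)))
                (≤ᴿ-trans l (≤ᴿ-trans (≡⇒≤ (+ᴿ-comm _ _)) (+ᴿ-mono (∌⇒ι≤ i) ≤ᴿ-refl))))
          in Y , sY , λ θ θ′ t t′ →
            ≤ᴿ-trans (≡⇒≤ (sym (FinAddFacts.diff (T-add Y θ t) b c s)))
              (≤ᴿ-trans (+ᴿ-mono (h θ θ′ t t′) (≤ᴿ-trans (T-dom Y θ _ t (𝒮-∖∖ b c)) small))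
                (≤ᴿ-trans (≡⇒≤ (+ᴿ-assoc _ k k)) (+ᴿ-mono (FinAddFacts.mono (T-add Y θ′ t′) b c s) k+k)))

      opaque
        uniform : (∀ p → Condition p → Close (Bas p)) → ∀ A → A ε 𝒮 → Close A
        uniform bas = π-λ-approx m Close ⦃ dClose ⦄ bas compl union approx

  module Decomposition where

    open Measures
    open Additivity
    open Convergence

    private variable
      A B E F M g h μ Y Z p q : W

    Occurs : W → W → Set ℓ
    Occurs x p = Σ W λ r → Σ W λ c → Σ W λ i → ⟨ r , c ⟩ ε p × i ε L · r × x ≡ c · i

    Apart : W → W → Set ℓ
    Apart p q = ∀ x → Occurs x p → ¬ Occurs x q

    private
      dOccurs : ∀ p → Def {1} λ ρ → Occurs (ρ zero) p
      dOccurs p = it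

    exact-support : Condition p → Σ W λ Y → Small Y × Supports Y p × (∀ x → x ε Y → Occurs x p)
    exact-support {p} c = let (Y , fin , s , sup) = support c in
      sep (λ x → Occurs x p) ⦃ dOccurs p ⦄ Y ,
      (finite-⊆ fin (λ x i → proj₁ (out Y x i)) , λ x i → s x (proj₁ (out Y x i))) ,
      (λ r c i j k → proj₂ (sep-spec (λ x → Occurs x p) ⦃ dOccurs p ⦄ Y _) (sup r c i j k , r , c , j , i , k , refl)) ,
      (λ x i → proj₂ (out Y x i))
      where
      out : ∀ Y x → x ε sep (λ x → Occurs x p) ⦃ dOccurs p ⦄ Y → x ε Y × Occurs x p
      out Y x = proj₁ (sep-spec (λ x → Occurs x p) ⦃ dOccurs p ⦄ Y x)

    Dissociated : W → Set ℓ
    Dissociated μ = ∀ p q → Condition p → Condition q → Apart p q → val μ (Bas (p ∪ q)) ≡ val μ (Bas p) *ᴿ val μ (Bas q)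

    opaque
      far-constant : Invariant μ → Condition p → Condition q → Small Y → Small Z → Supports Y p → Supports Z q →
                     Perm g → Perm h → Away g Z Y → Away h Z Y → val μ (Bas p ∩ img[ g ] (Bas q)) ≡ val μ (Bas p ∩ img[ h ] (Bas q))
      far-constant {μ} {p} {q} {Y} {Z} {g} {h} inv cp cq (fY , Y⊆) (fZ , Z⊆) sp sq pg ph ag ah =
        let (f , pf , fx , mv) = transport fY fZ Y⊆ Z⊆ pg ph ag ah
            pfg = perm-∘ pf pg
            k = inv′ h ∘ (f ∘ g)
            fixed : img[ k ] (Bas q) ≡ Bas q
            fixed = image-Bas-fixed (perm-∘ (perm-inv ph) pfg) (proj₂ cq) sq λ z i → let z∈ = Z⊆ z i in
              trans (∘-· z∈) (trans (cong (inv′ h ·_) (trans (∘-· z∈) (mv z i))) (inv-·ˡ ph z∈))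
            moved : img[ f ∘ g ] (Bas q) ≡ img[ h ] (Bas q)
            moved = sym (trans (cong (img[ h ]) (sym fixed)) (trans (image-∘ (perm-∘ (perm-inv ph) pfg))
              (image-cong λ x i → trans (∘-· i) (trans (cong (h ·_) (∘-· i)) (inv-·ʳ ph (perm-in pfg i))))))
        in trans (sym (inv f pf _ (𝒮-∩ (Bas∈ cp) (image∈𝒮 pg (Bas∈ cq)))))
             (cong (val μ) (trans image-∩ (cong₂ _∩_ (image-Bas-fixed pf (proj₂ cp) sp fx) (trans (image-∘ pg) moved))))
        where
        inv′ : W → W
        inv′ = Permutations.inv X

    FarConstant : W → W → Set ℓ
    FarConstant μ D₀ = ∀ p → Condition p → Σ W λ Y → Small Y × (∀ g h → Far Y g → Far Y h →
      val μ (Bas p ∩ img[ g ] D₀) ≡ val μ (Bas p ∩ img[ h ] D₀))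

    Complementary : W → W → W → Set ℓ
    Complementary μ D₀ D₁ = ∀ B g → B ε 𝒮 → Perm g → val μ (B ∩ img[ g ] D₀) +ᴿ val μ (B ∩ img[ g ] D₁) ≡ val μ B

    module Limit {μ : W} (m : IsMeasure μ) (inv : Invariant μ) (D₀ : W) (D∈ : D₀ ε 𝒮)
      (basic : FarConstant μ D₀) where

      private
        module μF = FinAddFacts (finitely-additive m)
        module mM = IsMeasure m

      Traces : W → W → Set ℓ
      Traces Y θ = Σ W λ g → Far Y g × (∀ B → B ε 𝒮 → θ · B ≡ rw (val μ (B ∩ img[ g ] D₀))) × (∀ y → y ε θ → Σ W λ B → B ε 𝒮 × y ≡ ⟨ B , θ · B ⟩) ×
                         (∀ B → B ε 𝒮 → ⟨ B , θ · B ⟩ ε θ)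

      private
        dT : Def {2} λ ρ → Traces (ρ zero) (ρ (suc zero))
        dT = dEx ⦃ dAnd ⦃ Def₂ Far dFar var₁ var₀ ⦄ ⦃ dAnd ⦃ dAll ⦃ dImp ⦃ it ⦄
          ⦃ dEqn ⦃ it ⦄ ⦃ dVal μ (d∩ ⦃ var₀ ⦄ ⦃ dImg ⦃ var₁ ⦄ ⦃ tCon ⦄ ⦄) ⦄ ⦄ ⦄ ⦄ ⦃ it ⦄ ⦄ ⦄

      trace-fun : ∀ {θ} → Traces Y θ → FunP θ 𝒮 IsCut
      trace-fun (g , _ , e , h , k) = record { pairs = h ; total = k ; value = λ B b → subst IsCut (sym (e B b)) (isCut (val μ (B ∩ img[ g ] D₀))) }

      trace-val : ∀ {θ} (t : Traces Y θ) → B ε 𝒮 → val θ B ≡ val μ (B ∩ img[ proj₁ t ] D₀)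
      trace-val (g , _ , e , _) b = trans (cong toReal (e _ b)) (toReal-rw _)

      trace : ∀ Y g → Far Y g → Σ W λ θ → Traces Y θ × (∀ B → B ε 𝒮 → val θ B ≡ val μ (B ∩ img[ g ] D₀))
      trace Y g far = θ , t , λ B b → trace-val t b
        where
        E₀ : W
        E₀ = img[ g ] D₀
        f : W → W → W
        f E B = rw (val μ (B ∩ E))
        df : ∀ E → DefT {1} λ ρ → f E (ρ zero)
        df E = it
        θ : W
        θ = graph (f E₀) ⦃ df E₀ ⦄ 𝒮
        Θ : FunP θ 𝒮 IsCut
        Θ = graph-fun (f E₀) ⦃ df E₀ ⦄ λ B b → isCut (val μ (B ∩ E₀))
        t : Traces Y θ
        t = g , far , (λ B b → graph-· (f E₀) ⦃ df E₀ ⦄ b) , Θ .pairs , Θ .total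

      private
        add : ∀ Y θ → Traces Y θ → FinAdd θ
        add Y θ t@(g , (pg , _) , _) = record
          { fun = trace-fun t
          ; empty = trans (trace-val t ∅ˢ∈) (trans (cong (val μ) (⊆-antisym (λ M i → proj₁ (∩⁻ i)) (λ M i → ∅-elim i))) (measure-∅ m))
          ; add = λ {A} {B} a b dis → trans (trace-val t (𝒮-∪ a b)) (trans (cong (val μ) ∩-distribʳ-∪)
              (trans (FinAdd.add (finitely-additive m) (𝒮-∩ a E∈) (𝒮-∩ b E∈)
                       (λ M i j → dis M (proj₁ (∩⁻ i)) (proj₁ (∩⁻ j))))
                (sym (cong₂ _+ᴿ_ (trace-val t a) (trace-val t b))))) }
          where
          E₀ : W
          E₀ = img[ g ] D₀
          E∈ : E₀ ε 𝒮
          E∈ = image∈𝒮 pg D∈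

        Str∩ : ∀ {E} → E ⊆ Str → Str ∩ E ≡ E
        Str∩ s = ext λ M → (λ i → proj₂ (∩⁻ i)) , (λ i → ∩⁺ (s M i , i))

        mass : ∀ Y θ → Traces Y θ → val θ Str ≡ val μ D₀
        mass Y θ t@(g , (pg , _) , _) = trans (trace-val t full) (trans (cong (val μ) (Str∩ image-⊆)) (inv g pg D₀ D∈))

        dom : ∀ Y θ A → Traces Y θ → A ε 𝒮 → val θ A ≤ val μ A
        dom Y θ A t@(g , (pg , _) , _) a = ≤ᴿ-trans (≡⇒≤ (trace-val t a)) (μF.mono a (𝒮-∩ a (image∈𝒮 pg D∈)) λ M i → proj₁ (∩⁻ i))

        shrink : ∀ Y Z θ → Z ⊆ Y → Traces Y θ → Traces Z θ
        shrink Y Z θ s (g , far , r) = g , far-⊆ s far , r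

        module U = Uniform m Traces dT shrink add (λ Y θ θ′ t t′ → trans (mass Y θ t) (sym (mass Y θ′ t′))) dom

        cauchy : ∀ A → A ε 𝒮 → U.Close A
        cauchy = U.uniform λ p c δ _ → let (Y , sY , h) = basic p c in Y , sY , λ θ θ′ t t′ →
          ≤ᴿ-trans (≡⇒≤ (trans (trace-val t (Bas∈ c)) (trans (h _ _ (proj₁ (proj₂ t)) (proj₁ (proj₂ t′))) (sym (trace-val t′ (Bas∈ c)))))) (≤+ _ δ)

      IsLim : W → Real → Set ℓ
      IsLim B r = ∀ (δ : Real) → ¬ (δ ≡ 0ᴿ) → Σ W λ Y → Small Y × (∀ θ → Traces Y θ → (val θ B ≤ r +ᴿ δ) × (r ≤ val θ B +ᴿ δ))

      private
        dLim : Def {2} λ ρ → IsLim (ρ (suc zero)) (toReal (ρ zero))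
        dLim = dAllReal ⦃ dImp ⦃ it ⦄ ⦃ dEx ⦃ dAnd ⦃ Def₁ Small dSmall var₀ ⦄ ⦃ dAll ⦃ dImp ⦃ Def₂ Traces dT var₁ var₀ ⦄ ⦃ it ⦄ ⦄ ⦄ ⦄ ⦄ ⦄

      lim-unique : ∀ {B r s} → IsLim B r → IsLim B s → r ≡ s
      lim-unique {B} {r} {s} h k = ≤ᴿ-antisym (half-way h k) (half-way k h)
        where
        half-way : ∀ {r s} → IsLim B r → IsLim B s → r ≤ s
        half-way h k = ≤-limit′ λ δ δ≢0 →
          let (x , x≢0 , x+x) = half δ δ≢0
              (Y , sY , a) = h x x≢0
              (Z , sZ , b) = k x x≢0
              (g , far) = far-exists (small-∪ sY sZ)
              (θ , t , _) = trace (Y ∪ Z) g far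
          in ≤ᴿ-trans (proj₂ (a θ (shrink _ _ θ ∪ˡ t))) (≤ᴿ-trans (+ᴿ-mono (proj₁ (b θ (shrink _ _ θ ∪ʳ t))) ≤ᴿ-refl)
               (≤ᴿ-trans (≡⇒≤ (+ᴿ-assoc _ x x)) (+ᴿ-mono ≤ᴿ-refl x+x)))

      private
        Below : W → Frac → Set ℓ
        Below B x = Σ W λ Y → Small Y × (∀ θ → Traces Y θ → val θ B ∋ x)

        dBelow : ∀ B → Def {2} λ ρ → Below B (Arithmetic.toNat (ρ (suc zero)) /s Arithmetic.toNat (ρ zero))
        dBelow B = dEx ⦃ dAnd ⦃ Def₁ Small dSmall var₀ ⦄ ⦃ dAll ⦃ dImp ⦃ Def₂ Traces dT var₁ var₀ ⦄ ⦃ it ⦄ ⦄ ⦄ ⦄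

      opaque
        lim-exists : ∀ B → B ε 𝒮 → Σ Real (IsLim B)
        lim-exists B b = r , λ δ δ≢0 →
          let (k , k≢0 , k+k) = half δ δ≢0
              (Y , sY , h) = cauchy B b k k≢0
          in Y , sY , λ θ t →
            (≤ᴿ-trans (upper Y sY k θ λ θ′ t′ → h θ θ′ t t′) (+ᴿ-mono ≤ᴿ-refl (≤ᴿ-trans (≤+ k k) k+k))) ,
            (≤ᴿ-trans (lower′ Y sY k k≢0 θ λ θ′ t′ → h θ′ θ t′ t) (≤ᴿ-trans (≡⇒≤ (+ᴿ-assoc _ k k)) (+ᴿ-mono ≤ᴿ-refl k+k)))
          where
          nonempty : Σ Frac (Below B)
          nonempty = let (x , i) = inhabited (val μ B) in x , ∅ , (finite-∅ , λ y j → ∅-elim j) , λ θ t → at (dom ∅ θ B t b) x i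
          r : Real
          r = infℝ (Below B) ⦃ dBelow B ⦄ nonempty
          upper : ∀ Y → Small Y → ∀ k θ → (∀ θ′ → Traces Y θ′ → val θ B ≤ val θ′ B +ᴿ k) → val θ B ≤ r +ᴿ k
          upper Y sY k θ h = le λ x i →
            let (u , v , hu , hv , l) = proj₁ +-∋ i
                (w , w<u , Z , sZ , b) = proj₁ (infℝ-∋ (Below B) ⦃ dBelow B ⦄ nonempty) hu
                (g , far) = far-exists (small-∪ sY sZ)
                (θ′ , t , _) = trace (Y ∪ Z) g far
            in at (h θ′ (shrink _ _ θ′ ∪ˡ t)) x (proj₂ +-∋ (w , v , b θ′ (shrink _ _ θ′ ∪ʳ t) , hv ,
                 ≤ᶠ-trans {w +ᶠ v} {u +ᶠ v} {x} (+ᶠ-monoˡ-≤ {w} {u} {v} (<ᶠ⇒≤ᶠ {w} {u} w<u)) l))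
          lower′ : ∀ Y → Small Y → ∀ k → ¬ (k ≡ 0ᴿ) → ∀ θ → (∀ θ′ → Traces Y θ′ → val θ′ B ≤ val θ B +ᴿ k) → r ≤ (val θ B +ᴿ k) +ᴿ k
          lower′ Y sY k k≢0 θ h = le λ x i →
            let (u , v , hu , hv , l) = proj₁ +-∋ i
            in proj₂ (infℝ-∋ (Below B) ⦃ dBelow B ⦄ nonempty) (u , <-≤ᶠ-trans {u} {u +ᶠ v} {x} (+ᶠ-increasing u (∋-Pos k hv)) l ,
                 Y , sY , λ θ′ t → at (h θ′ t) u hu)

      private
        dLimits : Def {2} λ ρ → IsCut (ρ zero) × IsLim (ρ (suc zero)) (toReal (ρ zero))
        dLimits = dAnd ⦃ Def₁ IsCut dIsCut var₀ ⦄ ⦃ dLim ⦄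

        dLimits₁ : ∀ B → Def {1} λ ρ → IsCut (ρ zero) × IsLim B (toReal (ρ zero))
        dLimits₁ B = Def₂ (λ y B → IsCut y × IsLim B (toReal y)) dLimits var₀ tCon

      opaque
        Cuts : W
        Cuts = 𝒫 Fracs

        cut∈ : ∀ r → rw r ε Cuts
        cut∈ r = proj₂ (𝒫-spec Fracs _) (λ z j → proj₂ (Fracs-spec z) (proj₁ (isCut r) z j))

      opaque
        lim : W → W
        lim B = ⋃ (sep (λ y → IsCut y × IsLim B (toReal y)) ⦃ dLimits₁ B ⦄ Cuts)

        lim-elems : ∀ B x → x ε lim B ⟺ (Σ W λ y → (y ε Cuts × IsCut y × IsLim B (toReal y)) × x ε y)
        lim-elems B x =
          (λ i → let (y , j , k) = ⋃⁻ i in y , proj₁ (sep-spec (λ y → IsCut y × IsLim B (toReal y)) ⦃ dLimits₁ B ⦄ Cuts y) j , k) ,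
          (λ (y , j , k) → ⋃⁺ (y , proj₂ (sep-spec (λ y → IsCut y × IsLim B (toReal y)) ⦃ dLimits₁ B ⦄ Cuts y) j , k))

      dLimT : ∀ {n} {s : Env n → W} → DefT s → DefT λ ρ → lim (s ρ)
      dLimT d = dSet₁ lim lim-elems ⦃ dEx ⦃ dAnd ⦃ dAnd ⦃ it ⦄ ⦃ Def₂ (λ y B → IsCut y × IsLim B (toReal y)) dLimits var₀ var₂ ⦄ ⦄ ⦃ it ⦄ ⦄ ⦄ ⦃ d ⦄

      lim≡ : ∀ {r} → IsLim B r → lim B ≡ rw r
      lim≡ {B} {r} h = ext λ x →
        (λ i → let (y , (_ , c , k) , l) = proj₁ (lim-elems B x) i in
          subst (x ε_) (trans (sym (rw-toReal c)) (cong rw (lim-unique k h))) l) ,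
        (λ i → proj₂ (lim-elems B x) (rw r , (cut∈ r , isCut r ,
           subst (IsLim B) (sym (toReal-rw r)) h) , i))

      ρ : W → Real
      ρ B = toReal (lim B)

      ρ-is : ∀ {r} → IsLim B r → ρ B ≡ r
      ρ-is h = trans (cong toReal (lim≡ h)) (toReal-rw _)

      ρ-lim : B ε 𝒮 → IsLim B (ρ B)
      ρ-lim b = let (r , h) = lim-exists _ b in subst (IsLim _) (sym (ρ-is h)) h

      eventually : ∀ {r} → Small Y → (∀ g → Far Y g → val μ (B ∩ img[ g ] D₀) ≡ r) → B ε 𝒮 → ρ B ≡ r
      eventually {Y} {B} {r} sY h b = ρ-is λ δ _ → Y , sY , λ θ t →
        let e = trans (trace-val t b) (h (proj₁ t) (proj₁ (proj₂ t))) in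
        (≤ᴿ-trans (≡⇒≤ e) (≤+ r δ)) , (≤ᴿ-trans (≡⇒≤ (sym e)) (≤+ _ δ))

      ρ-add : A ε 𝒮 → B ε 𝒮 → (∀ M → M ε A → M ∉ B) → ρ (A ∪ B) ≡ ρ A +ᴿ ρ B
      ρ-add {A} {B} a b dis = ρ-is λ δ δ≢0 →
        let (k , k≢0 , k+k) = half δ δ≢0
            (Y , sY , h) = ρ-lim a k k≢0
            (Z , sZ , h′) = ρ-lim b k k≢0
        in Y ∪ Z , small-∪ sY sZ , λ θ t →
          let e = FinAdd.add (add _ θ t) a b dis
              (u , v) = h θ (shrink _ _ θ ∪ˡ t)
              (u′ , v′) = h′ θ (shrink _ _ θ ∪ʳ t)
          in (≤ᴿ-trans (≡⇒≤ e) (≤ᴿ-trans (+ᴿ-mono u u′) (≤ᴿ-trans (≡⇒≤ (+ᴿ-swap _ k _ k)) (+ᴿ-mono ≤ᴿ-refl k+k)))) ,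
             (≤ᴿ-trans (+ᴿ-mono v v′) (≤ᴿ-trans (≡⇒≤ (+ᴿ-swap _ k _ k)) (+ᴿ-mono (≡⇒≤ (sym e)) k+k)))

      ρ-Str : ρ Str ≡ val μ D₀
      ρ-Str = eventually {Y = ∅} (finite-∅ , λ x i → ∅-elim i) (λ g (pg , _) → trans (cong (val μ) (Str∩ image-⊆)) (inv g pg D₀ D∈)) full

      ρ-∅ : ρ ∅ ≡ 0ᴿ
      ρ-∅ = eventually {Y = ∅} (finite-∅ , λ x i → ∅-elim i)
        (λ g _ → trans (cong (val μ) (⊆-antisym (λ M i → proj₁ (∩⁻ i)) (λ M i → ∅-elim i))) (measure-∅ m)) ∅ˢ∈

      ρ-inv : ∀ h → Perm h → B ε 𝒮 → ρ (img[ h ] B) ≡ ρ B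
      ρ-inv {B} h ph b = ρ-is λ δ δ≢0 →
        let (Y , (fY , Y⊆) , lim) = ρ-lim b δ δ≢0
            (hY , fhY , hY-in) = finite-img (h ·_) fY
            k = inv′ h
            pk = perm-inv ph
        in Y ∪ (hY ∩ X) , (finite-∪ fY (finite-⊆ fhY λ x i → proj₁ (∩⁻ i)) ,
             λ x i → ⊎-elim (Y⊆ x) (λ j → proj₂ (∩⁻ j)) (∪⁻ i)) , λ θ t →
           let (g , (pg , ag) , _) = t
               far : Far Y (k ∘ g)
               far = perm-∘ pk pg , λ z z∈ i → ag z (∪ˡ z z∈) (∪ʳ _ (∩⁺
                 (subst (_ε hY) (trans (cong (h ·_) (∘-· (Y⊆ z z∈))) (inv-·ʳ ph (perm-in pg (Y⊆ z z∈)))) (hY-in _ i) , perm-in pg (Y⊆ z z∈))))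
               (θ′ , t′ , v) = trace Y (k ∘ g) far
               same : val θ (img[ h ] B) ≡ val θ′ B
               same = trans (trace-val t (image∈𝒮 ph b)) (trans (sym (inv k pk _ (𝒮-∩ (image∈𝒮 ph b) (image∈𝒮 pg D∈))))
                 (trans (cong (val μ) (trans image-∩ (cong₂ _∩_
                   (trans (image-∘ ph) (image-id (𝒮⊆ b) λ x i → trans (∘-· i) (inv-·ˡ ph i))) (image-∘ pg)))) (sym (v B b))))
               (u , w) = lim θ′ t′
           in ≤ᴿ-trans (≡⇒≤ same) u , ≤ᴿ-trans w (+ᴿ-mono (≡⇒≤ (sym same)) ≤ᴿ-refl)
        where
        inv′ : W → W
        inv′ = Permutations.inv X

    module TwoLimits {μ : W} (m : IsMeasure μ) (inv : Invariant μ) (D₀ D₁ : W) (D₀∈ : D₀ ε 𝒮) (D₁∈ : D₁ ε 𝒮)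
      (basic₀ : FarConstant μ D₀) (basic₁ : FarConstant μ D₁) (complement : Complementary μ D₀ D₁)
      (p-sum : val μ D₀ +ᴿ val μ D₁ ≡ 1ᴿ) where

      module L₀ = Limit m inv D₀ D₀∈ basic₀
      module L₁ = Limit m inv D₁ D₁∈ basic₁

      ρ-sum : B ε 𝒮 → L₀.ρ B +ᴿ L₁.ρ B ≡ val μ B
      ρ-sum {B} b = ≤ᴿ-antisym
        (≤-limit′ λ δ δ≢0 → let (k , k≢0 , k+k) = half δ δ≢0 ; (_ , _ , e , u , w , u′ , w′) = near′ k k≢0 in
          ≤ᴿ-trans (+ᴿ-mono w w′) (≤ᴿ-trans (≡⇒≤ (+ᴿ-swap _ k _ k)) (+ᴿ-mono (≡⇒≤ e) k+k)))
        (≤-limit′ λ δ δ≢0 → let (k , k≢0 , k+k) = half δ δ≢0 ; (_ , _ , e , u , w , u′ , w′) = near′ k k≢0 in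
          ≤ᴿ-trans (≡⇒≤ (sym e)) (≤ᴿ-trans (+ᴿ-mono u u′) (≤ᴿ-trans (≡⇒≤ (+ᴿ-swap _ k _ k)) (+ᴿ-mono ≤ᴿ-refl k+k))))
        where
        near′ : ∀ k → ¬ (k ≡ 0ᴿ) → Σ Real λ x → Σ Real λ y → (x +ᴿ y ≡ val μ B) × (x ≤ L₀.ρ B +ᴿ k) × (L₀.ρ B ≤ x +ᴿ k) × (y ≤ L₁.ρ B +ᴿ k) × (L₁.ρ B ≤ y +ᴿ k)
        near′ k k≢0 =
          let (Y , sY , h) = L₀.ρ-lim b k k≢0
              (Z , sZ , h′) = L₁.ρ-lim b k k≢0
              (g , far) = far-exists (small-∪ sY sZ)
              (θ , t , v) = L₀.trace Y g (far-⊆ ∪ˡ far)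
              (θ′ , t′ , v′) = L₁.trace Z g (far-⊆ ∪ʳ far)
              (u , w) = h θ t ; (u′ , w′) = h′ θ′ t′
          in val θ B , val θ′ B , trans (cong₂ _+ᴿ_ (v B b) (v′ B b)) (complement B g b (proj₁ far)) , u , w , u′ , w′

      p₀ p₁ half₀ : Real
      p₀ = val μ D₀
      p₁ = val μ D₁
      half₀ = ι (proj₁ (halve 1ᶠ))

      halves : half₀ +ᴿ half₀ ≡ 1ᴿ
      halves = let (h , _ , e) = halve 1ᶠ in trans (ι-+ h h) (ι-≈ {h +ᶠ h} {1ᶠ} e)

      half≢0 : ¬ (half₀ ≡ 0ᴿ)
      half≢0 e = ι≢0 {1ᶠ} (suc-pos 0ᴺ) (trans (sym halves) (trans (cong₂ _+ᴿ_ e e) (0+ᴿ 0ᴿ)))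

      private
        mix : Real → (W → W) → W → W
        mix w lim B = rw (w *ᴿ val μ B +ᴿ toReal (lim B))

        dMix : ∀ w (lim : W → W) → DefT {1} (λ ρ → lim (ρ zero)) → DefT {1} λ ρ → mix w lim (ρ zero)
        dMix w lim d = d+ᴿ ⦃ it ⦄ ⦃ dToReal ⦃ d ⦄ ⦄

      mixture : Real → (lim : W → W) → DefT {1} (λ ρ → lim (ρ zero)) → W
      mixture w lim d = graph (mix w lim) ⦃ dMix w lim d ⦄ 𝒮

      mixture-val : ∀ w lim d → B ε 𝒮 → val (mixture w lim d) B ≡ w *ᴿ val μ B +ᴿ toReal (lim B)
      mixture-val w lim d b = trans (cong toReal (graph-· (mix w lim) ⦃ dMix w lim d ⦄ b)) (toReal-rw _)

      mixture-measure : ∀ w lim d → (∀ {A B} → A ε 𝒮 → B ε 𝒮 → (∀ M → M ε A → M ∉ B) → toReal (lim (A ∪ B)) ≡ toReal (lim A) +ᴿ toReal (lim B)) →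
        toReal (lim ∅) ≡ 0ᴿ → (∀ {B} → B ε 𝒮 → toReal (lim B) ≤ val μ B) → w +ᴿ toReal (lim Str) ≡ 1ᴿ →
        (∀ {B} g → Perm g → B ε 𝒮 → toReal (lim (img[ g ] B)) ≡ toReal (lim B)) →
        IsMeasure (mixture w lim d) × Invariant (mixture w lim d)
      mixture-measure w lim d add emp dom tot ρ-inv =
        dominated m record
          { fun = graph-fun (mix w lim) ⦃ dMix w lim d ⦄ λ B _ → isCut (w *ᴿ val μ B +ᴿ toReal (lim B))
          ; empty = trans (mv ∅ˢ∈) (trans (cong₂ _+ᴿ_ (trans (cong (w *ᴿ_) (measure-∅ m)) w*0) emp) (0+ᴿ 0ᴿ))
          ; add = λ {A} {B} a b dis → trans (mv (𝒮-∪ a b)) (trans (cong₂ _+ᴿ_ (trans (cong (w *ᴿ_) (FinAdd.add (finitely-additive m) a b dis)) (*ᴿ-distribˡ w _ _)) (add a b dis))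
              (trans (+ᴿ-swap _ _ _ _) (sym (cong₂ _+ᴿ_ (mv a) (mv b))))) }
          (trans (mv full) (trans (cong (λ r → w *ᴿ r +ᴿ toReal (lim Str)) (IsMeasure.total m)) (trans (cong (_+ᴿ toReal (lim Str)) (*ᴿ-1 w)) tot)))
          (λ A a → ≤ᴿ-trans (≡⇒≤ (mv a)) (+ᴿ-mono (≤ᴿ-trans (*ᴿ-mono w≤1 ≤ᴿ-refl) (≡⇒≤ (1*ᴿ _))) (dom a))) ,
        λ g pg A a → trans (mv (image∈𝒮 pg a)) (trans (cong₂ _+ᴿ_ (cong (w *ᴿ_) (inv g pg A a)) (ρ-inv g pg a)) (sym (mv a)))
        where
        mv : ∀ {B} → B ε 𝒮 → val (mixture w lim d) B ≡ w *ᴿ val μ B +ᴿ toReal (lim B)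
        mv = mixture-val w lim d
        w≤1 : w ≤ 1ᴿ
        w≤1 = ≤ᴿ-trans (≤+ w _) (≡⇒≤ tot)
        w*0 : w *ᴿ 0ᴿ ≡ 0ᴿ
        w*0 = +ᴿ-cancel-≡ (w *ᴿ 0ᴿ) (trans (sym (*ᴿ-distribˡ w 0ᴿ 0ᴿ)) (trans (cong (w *ᴿ_) (0+ᴿ 0ᴿ)) (sym (0+ᴿ _))))

      ν₀ η₀ : W
      ν₀ = mixture p₁ L₀.lim (L₀.dLimT var₀)
      η₀ = mixture p₀ L₁.lim (L₁.dLimT var₀)

      private
        νv : B ε 𝒮 → val ν₀ B ≡ p₁ *ᴿ val μ B +ᴿ L₀.ρ B
        νv = mixture-val p₁ L₀.lim (L₀.dLimT var₀)

        ηv : B ε 𝒮 → val η₀ B ≡ p₀ *ᴿ val μ B +ᴿ L₁.ρ B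
        ηv = mixture-val p₀ L₁.lim (L₁.dLimT var₀)

        p-split : ∀ r → p₀ *ᴿ r +ᴿ p₁ *ᴿ r ≡ r
        p-split r = trans (sym (*ᴿ-distribʳ r p₀ p₁)) (trans (cong (_*ᴿ r) p-sum) (1*ᴿ r))

      ν-measure : IsMeasure ν₀ × Invariant ν₀
      ν-measure = mixture-measure p₁ L₀.lim (L₀.dLimT var₀) L₀.ρ-add L₀.ρ-∅ (λ b → ≤ᴿ-trans (≤+ _ _) (≡⇒≤ (ρ-sum b)))
        (trans (cong (p₁ +ᴿ_) L₀.ρ-Str) (trans (+ᴿ-comm p₁ p₀) p-sum)) L₀.ρ-inv

      η-measure : IsMeasure η₀ × Invariant η₀
      η-measure = mixture-measure p₀ L₁.lim (L₁.dLimT var₀) L₁.ρ-add L₁.ρ-∅ (λ b → ≤ᴿ-trans (≤+ _ _) (≡⇒≤ (trans (+ᴿ-comm _ _) (ρ-sum b))))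
        (trans (cong (p₀ +ᴿ_) L₁.ρ-Str) p-sum) L₁.ρ-inv

      average : B ε 𝒮 → half₀ *ᴿ val ν₀ B +ᴿ half₀ *ᴿ val η₀ B ≡ val μ B
      average {B} b = begin
        half₀ *ᴿ val ν₀ B +ᴿ half₀ *ᴿ val η₀ B ≡⟨ sym (*ᴿ-distribˡ half₀ _ _) ⟩
        half₀ *ᴿ (val ν₀ B +ᴿ val η₀ B) ≡⟨ cong (half₀ *ᴿ_) (cong₂ _+ᴿ_ (νv b) (ηv b)) ⟩
        half₀ *ᴿ ((p₁ *ᴿ r +ᴿ L₀.ρ B) +ᴿ (p₀ *ᴿ r +ᴿ L₁.ρ B)) ≡⟨ cong (half₀ *ᴿ_) (+ᴿ-swap _ _ _ _) ⟩
        half₀ *ᴿ ((p₁ *ᴿ r +ᴿ p₀ *ᴿ r) +ᴿ (L₀.ρ B +ᴿ L₁.ρ B)) ≡⟨ cong (half₀ *ᴿ_) (cong₂ _+ᴿ_ (trans (+ᴿ-comm _ _) (p-split r)) (ρ-sum b)) ⟩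
        half₀ *ᴿ (r +ᴿ r) ≡⟨ *ᴿ-distribˡ half₀ r r ⟩
        half₀ *ᴿ r +ᴿ half₀ *ᴿ r ≡⟨ sym (*ᴿ-distribʳ r half₀ half₀) ⟩
        (half₀ +ᴿ half₀) *ᴿ r ≡⟨ cong (_*ᴿ r) halves ⟩
        1ᴿ *ᴿ r ≡⟨ 1*ᴿ r ⟩
        r ∎
        where
        open ≡-Reasoning
        r : Real
        r = val μ B

      independent : ν₀ ≡ η₀ → B ε 𝒮 → L₀.ρ B ≡ p₀ *ᴿ val μ B
      independent {B} e b = double-cancel (+ᴿ-cancel-≡ r (begin
        (x +ᴿ x) +ᴿ r ≡⟨ cong ((x +ᴿ x) +ᴿ_) (sym (p-split r)) ⟩
        (x +ᴿ x) +ᴿ (u +ᴿ v) ≡⟨ Sum.solve 3 (λ x u v → (x Sum.⊕ x) Sum.⊕ (u Sum.⊕ v) Sum.⊜ ((v Sum.⊕ x) Sum.⊕ u) Sum.⊕ x) refl x u v ⟩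
        ((v +ᴿ x) +ᴿ u) +ᴿ x ≡⟨ cong (λ z → (z +ᴿ u) +ᴿ x) (trans (sym (νv b)) (trans (cong (λ θ → val θ B) e) (ηv b))) ⟩
        ((u +ᴿ y) +ᴿ u) +ᴿ x ≡⟨ Sum.solve 3 (λ x u y → ((u Sum.⊕ y) Sum.⊕ u) Sum.⊕ x Sum.⊜ (u Sum.⊕ u) Sum.⊕ (x Sum.⊕ y)) refl x u y ⟩
        (u +ᴿ u) +ᴿ (x +ᴿ y) ≡⟨ cong ((u +ᴿ u) +ᴿ_) (ρ-sum b) ⟩
        (u +ᴿ u) +ᴿ r ∎))
        where
        open ≡-Reasoning
        r x y u v : Real
        r = val μ B
        x = L₀.ρ B
        y = L₁.ρ B
        u = p₀ *ᴿ r
        v = p₁ *ᴿ r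

      rel-average : R.IsCombination (el μ) (el (rw half₀)) (el ν₀) (el (rw half₀)) (el η₀)
      rel-average A vA y vy a va b vb c vc d vd h k l t t′ =
        let A₀ = ⟪ A , vA ⟫
            F = IsMeasure.fun m
            A∈ = proj₁ (graph-dom F (proj₁ (rel-↦ {μ} {A₀} {⟪ y , vy ⟫}) h))
            y≡ = proj₁ (rel-val F A∈ {⟪ y , vy ⟫}) h
            a≡ = proj₁ (rel-val (IsMeasure.fun (proj₁ ν-measure)) A∈ {⟪ a , va ⟫}) k
            b≡ = proj₁ (rel-val (IsMeasure.fun (proj₁ η-measure)) A∈ {⟪ b , vb ⟫}) l
            c≡ = proj₁ (rel-timesᴿ half₀ (val ν₀ A₀) {⟪ c , vc ⟫}) (subst (λ a → R.Timesᴿ (el (rw half₀)) (el a) c) a≡ t)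
            d≡ = proj₁ (rel-timesᴿ half₀ (val η₀ A₀) {⟪ d , vd ⟫}) (subst (λ b → R.Timesᴿ (el (rw half₀)) (el b) d) b≡ t′)
        in subst₂ (λ c d → R.Plusᴿ (el c) (el d) y) (sym c≡) (sym d≡) (proj₂ (rel-plusᴿ (half₀ *ᴿ val ν₀ A₀) (half₀ *ᴿ val η₀ A₀) {⟪ y , vy ⟫})
             (trans y≡ (cong rw (sym (average A∈)))))

      extreme⇒equal : R.IsExtreme (el κ) (el L) (el X) (el μ) → ν₀ ≡ η₀
      extreme⇒equal ex = dne λ ne → reduce (⊎-map zero-half zero-half
        (R.IsExtreme.extreme ex (el ν₀) (isV ν₀) (el η₀) (isV η₀) (proj₂ rel-invariant ν-measure) (proj₂ rel-invariant η-measure)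
          (λ q → ne (el-inj q)) (el (rw half₀)) (isV (rw half₀)) (el (rw half₀)) (isV (rw half₀)) (proj₂ rel-real (isCut half₀)) (proj₂ rel-real (isCut half₀))
          (el (rw 1ᴿ) , isV (rw 1ᴿ) , proj₂ (rel-oneᴿ {rw 1ᴿ}) refl , proj₂ (rel-plusᴿ half₀ half₀ {rw 1ᴿ}) (cong rw (sym halves))) rel-average))
        where
        zero-half : R.IsZeroᴿ (el (rw half₀)) → ⊥
        zero-half z = half≢0 (rw-inj (proj₁ (rel-zeroᴿ {rw half₀}) z))

    module _ {μ : W} (m : IsMeasure μ) (inv : Invariant μ) where

      private
        module μF = FinAddFacts (finitely-additive m)

      module Along {q : W} (cq : Condition q) where
        private
          D₀ D₁ : W
          D₀ = Bas q
          D₁ = Str ∖ Bas q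

        far₀ : FarConstant μ (Bas q)
        far₀ p cp =
          let (Y , sY , sp , _) = exact-support cp ; (Z , sZ , sq , _) = exact-support cq in
          Y ∪ Z , small-∪ sY sZ , λ g h (pg , ag) (ph , ah) → far-constant inv cp cq sY sZ sp sq pg ph
            (λ z i j → ag z (∪ʳ z i) (∪ˡ _ j)) (λ z i j → ah z (∪ʳ z i) (∪ˡ _ j))

        complement : Complementary μ (Bas q) (Str ∖ Bas q)
        complement B g b pg = trans (cong (val μ (B ∩ img[ g ] D₀) +ᴿ_) (cong (val μ) eq)) (μF.split b (image∈𝒮 pg (Bas∈ cq)))
          where
          eq : B ∩ img[ g ] D₁ ≡ B ∖ img[ g ] D₀
          eq = ext λ M →
            (λ i → let (j , k) = ∩⁻ i in ∖⁺ (j , proj₂ (∖⁻ (subst (M ε_) image-∖ k)))) ,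
            (λ i → let (j , k) = ∖⁻ i in ∩⁺ (j , subst (M ε_) (sym image-∖)
              (∖⁺ (subst (M ε_) (sym image-Str) (𝒮⊆ b M j) , k))))

        far₁ : FarConstant μ (Str ∖ Bas q)
        far₁ p cp = let (Y , sY , h) = far₀ p cp in Y , sY , λ g g′ far far′ →
          +ᴿ-cancel-≡ (val μ (Bas p ∩ img[ g ] D₀)) (trans (+ᴿ-comm _ _) (trans (complement _ g (Bas∈ cp) (proj₁ far))
            (trans (sym (complement _ g′ (Bas∈ cp) (proj₁ far′))) (trans (+ᴿ-comm _ _) (cong (val μ (Bas p ∩ img[ g′ ] D₁) +ᴿ_) (sym (h g g′ far far′)))))))

      opaque
        limit-independent : R.IsExtreme (el κ) (el L) (el X) (el μ) → ∀ {D₀ D₁} → D₀ ε 𝒮 → D₁ ε 𝒮 →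
          FarConstant μ D₀ → FarConstant μ D₁ → Complementary μ D₀ D₁ → val μ D₀ +ᴿ val μ D₁ ≡ 1ᴿ → ∀ {B} → B ε 𝒮 → ∀ Y → Small Y →
          (∀ g → Far Y g → val μ (B ∩ img[ g ] D₀) ≡ val μ (B ∩ D₀)) → val μ (B ∩ D₀) ≡ val μ D₀ *ᴿ val μ B
        limit-independent ex {D₀} {D₁} d₀ d₁ b₀ b₁ c s b Y sY h =
          trans (sym (Limit.eventually m inv D₀ d₀ b₀ sY h b))
            (TwoLimits.independent m inv D₀ D₁ d₀ d₁ b₀ b₁ c s (TwoLimits.extreme⇒equal m inv D₀ D₁ d₀ d₁ b₀ b₁ c s ex) b)

      extreme⇒dissociated : R.IsExtreme (el κ) (el L) (el X) (el μ) → Dissociated μ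
      extreme⇒dissociated ex p q cp cq ap =
        let (Y , sY , sp , oY) = exact-support cp ; (Z , sZ , sq , oZ) = exact-support cq
            apart : Away idP Z Y
            apart z i j = ap z (oY z (subst (_ε Y) (idP-· (proj₂ sZ z i)) j)) (oZ z i)
        in trans (cong (val μ) Bas-∪) (trans (limit-independent ex (Bas∈ cq) (𝒮-∖ (Bas∈ cq)) (Along.far₀ cq) (Along.far₁ cq) (Along.complement cq)
             (trans (μF.compl (Bas∈ cq)) (IsMeasure.total m)) (Bas∈ cp) (Y ∪ Z) (small-∪ sY sZ)
             λ g (pg , ag) → trans (far-constant inv cp cq sY sZ sp sq pg perm-id (λ z i j → ag z (∪ʳ z i) (∪ˡ _ j)) apart)
               (cong (λ C → val μ (Bas p ∩ C)) (image-id Bas-⊆ λ x → idP-·)))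
             (*ᴿ-comm _ _))

  module Mixing where

    open Measures
    open Additivity
    open Convergence
    open Decomposition using (Occurs; Apart; exact-support; Dissociated)

    private variable
      A B C E M g h μ Y Z p q : W

    module _ {μ : W} (m : IsMeasure μ) (inv : Invariant μ) where

      private
        module μF = FinAddFacts (finitely-additive m)

      Near : Real → Real → Real → Set ℓ
      Near r s δ = (r ≤ s +ᴿ δ) × (s ≤ r +ᴿ δ)

      near-≡ : ∀ {r s} → r ≡ s → ∀ δ → Near r s δ
      near-≡ e δ = ≤ᴿ-trans (≡⇒≤ e) (≤+ _ δ) , ≤ᴿ-trans (≡⇒≤ (sym e)) (≤+ _ δ)

      Mixes : W → Real → W → Set ℓ
      Mixes E v C = ∀ (δ : Real) → ¬ (δ ≡ 0ᴿ) → Σ W λ Y → Small Y × (∀ g → Far Y g → Near (val μ (C ∩ img[ g ] E)) (val μ C *ᴿ v) δ)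

      private
        dMixes : ∀ E v → Def {1} λ ρ → Mixes E v (ρ zero)
        dMixes E v = dAllReal ⦃ dImp ⦃ it ⦄ ⦃ dEx ⦃ dAnd ⦃ Def₁ Small dSmall var₀ ⦄ ⦃ dAll ⦃ dImp ⦃ Def₂ Far dFar var₁ var₀ ⦄
          ⦃ dAnd ⦃ d≤ ⦃ image ⦄ ⦃ d+ᴿ ⦃ product ⦄ ⦃ it ⦄ ⦄ ⦄ ⦃ d≤ ⦃ product ⦄ ⦃ d+ᴿ ⦃ image ⦄ ⦃ it ⦄ ⦄ ⦄ ⦄ ⦄ ⦄ ⦄ ⦄ ⦄
          where
          image : DefT {4} λ ρ → rw (val μ (ρ (suc (suc (suc zero))) ∩ img[ ρ zero ] E))
          image = dVal μ (d∩ ⦃ tVar {i = suc (suc (suc zero))} ⦄ ⦃ dImg ⦃ var₀ ⦄ ⦃ tCon ⦄ ⦄)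
          product : DefT {4} λ ρ → rw (val μ (ρ (suc (suc (suc zero)))) *ᴿ v)
          product = d*ᴿ ⦃ dVal μ (tVar {i = suc (suc (suc zero))}) ⦄ ⦃ tCon ⦄

        *≤ : ∀ {r v} → v ≤ 1ᴿ → r *ᴿ v ≤ r
        *≤ {r} l = ≤ᴿ-trans (*ᴿ-mono ≤ᴿ-refl l) (≡⇒≤ (*ᴿ-1 r))

      val≤1 : A ε 𝒮 → val μ A ≤ 1ᴿ
      val≤1 a = ≤ᴿ-trans (μF.mono full a (𝒮⊆ a)) (≡⇒≤ (IsMeasure.total m))

      opaque
        mixing : E ε 𝒮 → ∀ v → v ≡ val μ E → (∀ p → Condition p → Mixes E v (Bas p)) → ∀ C → C ε 𝒮 → Mixes E v C
        mixing {E} e v v≡ bas = π-λ-approx m (Mixes E v) ⦃ dMixes E v ⦄ bas compl union approx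
          where
          v≤1 : v ≤ 1ᴿ
          v≤1 = subst (_≤ 1ᴿ) (sym v≡) (val≤1 e)
          gE : ∀ {g} → Perm g → img[ g ] E ε 𝒮
          gE pg = image∈𝒮 pg e
          -- Both sides of the limit are finitely additive in C.
          combine : ∀ {a a′ b b′ x : Real} k → a +ᴿ b ≡ x → a′ +ᴿ b′ ≡ x → Near a a′ k → Near b b′ k
          combine {a} {a′} {b} {b′} k s s′ (u , w) = half-way s s′ w , half-way s′ s u
            where
            half-way : ∀ {a a′ b b′ x} → a +ᴿ b ≡ x → a′ +ᴿ b′ ≡ x → a′ ≤ a +ᴿ k → b ≤ b′ +ᴿ k
            half-way {a} {a′} {b} {b′} s s′ w = +ᴿ-cancelʳ a (≤ᴿ-trans (≡⇒≤ (trans (+ᴿ-comm b a) (trans s (sym s′))))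
              (≤ᴿ-trans (+ᴿ-mono w ≤ᴿ-refl) (≡⇒≤ (Sum.solve 3 (λ a k b′ → (a Sum.⊕ k) Sum.⊕ b′ Sum.⊜ (b′ Sum.⊕ k) Sum.⊕ a) refl a k b′))))
          compl : ∀ A → A ε 𝒮 → Mixes E v A → Mixes E v (Str ∖ A)
          compl A a h δ δ≢0 = let (Y , sY , f) = h δ δ≢0 in Y , sY , λ g far@(pg , _) →
            combine δ
              (trans (cong₂ _+ᴿ_ (cong (val μ) ∩-comm) (cong (val μ) (∩∖ g))) (trans (μF.split (gE pg) a) (inv g pg E e)))
              (trans (sym (*ᴿ-distribʳ v _ _)) (trans (cong (_*ᴿ v) (trans (μF.compl a) (IsMeasure.total m))) (trans (1*ᴿ v) v≡)))
              (f g far)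
            where
            ∩∖ : ∀ g → (Str ∖ A) ∩ img[ g ] E ≡ img[ g ] E ∖ A
            ∩∖ g = ext λ M → (λ i → let (j , k) = ∩⁻ i in ∖⁺ (k , proj₂ (∖⁻ j))) ,
                             (λ i → let (j , k) = ∖⁻ i in ∩⁺ (∖⁺ (image-⊆ M j , k) , j))
          union : ∀ A B → A ε 𝒮 → B ε 𝒮 → Mixes E v A → Mixes E v B → (∀ M → M ε A → M ∉ B) → Mixes E v (A ∪ B)
          union A B a b h h′ dis δ δ≢0 =
            let (k , k≢0 , k+k) = half δ δ≢0
                (Y , sY , f) = h k k≢0
                (Z , sZ , f′) = h′ k k≢0
            in Y ∪ Z , small-∪ sY sZ , λ g far@(pg , _) →
              let (u , w) = f g (far-⊆ ∪ˡ far) ; (u′ , w′) = f′ g (far-⊆ ∪ʳ far)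
                  s = trans (cong (val μ) ∩-distribʳ-∪) (FinAdd.add (finitely-additive m) (𝒮-∩ a (gE pg)) (𝒮-∩ b (gE pg))
                        (λ M i j → dis M (proj₁ (∩⁻ i)) (proj₁ (∩⁻ j))))
                  t = trans (cong (_*ᴿ v) (FinAdd.add (finitely-additive m) a b dis)) (*ᴿ-distribʳ v _ _)
              in ≤ᴿ-trans (≡⇒≤ s) (≤ᴿ-trans (+ᴿ-mono u u′) (≤ᴿ-trans (≡⇒≤ (+ᴿ-swap _ k _ k)) (+ᴿ-mono (≡⇒≤ (sym t)) k+k))) ,
                 ≤ᴿ-trans (≡⇒≤ t) (≤ᴿ-trans (+ᴿ-mono w w′) (≤ᴿ-trans (≡⇒≤ (+ᴿ-swap _ k _ k)) (+ᴿ-mono (≡⇒≤ (sym s)) k+k)))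
          approx : ∀ B → B ε 𝒮 → (∀ δ → Pos δ → Σ W λ C → C ε 𝒮 × Mixes E v C × C ⊆ B × val μ B ≤ val μ C +ᴿ ι δ) → Mixes E v B
          approx B b ap δ δ≢0 =
            let (k , k≢0 , k+k) = half δ δ≢0
                (x , x>0 , i) = ≢0⇒ k≢0
                (C , c , mx , s , l) = ap x x>0
                (Y , sY , f) = mx k k≢0
                l′ : val μ B ≤ val μ C +ᴿ k
                l′ = ≤ᴿ-trans l (+ᴿ-mono ≤ᴿ-refl (∌⇒ι≤ i))
                extra : val μ (B ∖ C) ≤ k
                extra = +ᴿ-cancelʳ (val μ C) (≤ᴿ-trans (≡⇒≤ (trans (+ᴿ-comm _ _) (μF.diff b c s))) (≤ᴿ-trans l′ (≡⇒≤ (+ᴿ-comm _ _))))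
            in Y , sY , λ g far@(pg , _) →
              let (u , w) = f g far
                  C⊆ : C ∩ img[ g ] E ⊆ B ∩ img[ g ] E
                  C⊆ = λ M j → let (j₁ , j₂) = ∩⁻ j in ∩⁺ (s M j₁ , j₂)
                  rest : (B ∩ img[ g ] E) ∖ (C ∩ img[ g ] E) ⊆ B ∖ C
                  rest = λ M j → let (j₁ , j₂) = ∖⁻ j ; (j₃ , j₄) = ∩⁻ j₁ in
                    ∖⁺ (j₃ , λ l → j₂ (∩⁺ (l , j₄)))
                  b∩ = 𝒮-∩ b (gE pg) ; c∩ = 𝒮-∩ c (gE pg)
              in ≤ᴿ-trans (≡⇒≤ (sym (μF.diff b∩ c∩ C⊆)))
                   (≤ᴿ-trans (+ᴿ-mono u (≤ᴿ-trans (μF.mono (𝒮-∖∖ b c) (𝒮-∖∖ b∩ c∩) rest) extra))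
                     (≤ᴿ-trans (≡⇒≤ (+ᴿ-assoc _ k k)) (+ᴿ-mono (*ᴿ-mono (μF.mono b c s) ≤ᴿ-refl) k+k))) ,
                 ≤ᴿ-trans (*ᴿ-mono l′ ≤ᴿ-refl) (≤ᴿ-trans (≡⇒≤ (*ᴿ-distribʳ v _ k))
                   (≤ᴿ-trans (+ᴿ-mono w (*≤ v≤1)) (≤ᴿ-trans (≡⇒≤ (+ᴿ-assoc _ k k)) (+ᴿ-mono (μF.mono b∩ c∩ C⊆) k+k))))

      module _ (diss : Dissociated μ) where

        mixes-Bas : Condition p → Condition q → Mixes (Bas q) (val μ (Bas q)) (Bas p)
        mixes-Bas {p} {q} cp cq δ _ =
          let (Y , sY , sp , _) = exact-support cp ; (Z , sZ , sq , _) = exact-support cq in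
          Y ∪ Z , small-∪ sY sZ , λ g (pg , ag) →
            let (q′ , cq′ , sh) = shift pg cq
                im = image-shift pg cq sh
            in near-≡ (trans (cong (λ G → val μ (Bas p ∩ G)) im) (trans (cong (val μ) (sym Bas-∪)) (trans
                 (diss p q′ cp cq′ λ x (r , c , i , j , k , e) (r′ , c′ , i′ , j′ , k′ , e′) →
                   let (u , d , o , e₀) = proj₂ sh _ j′
                       (e₁ , e₂) = ⟨⟩-inj e₀
                       k″ = subst (λ r → i′ ε L · r) e₁ k′
                       gz = trans e′ (trans (cong (_· i′) e₂) (cmp-· (proj₂ (atom (proj₂ cq) o)) k″))
                   in ag (d · i′) (∪ʳ _ (sq u d o i′ k″)) (subst (_ε Y ∪ Z) gz (∪ˡ _ (subst (_ε Y) (sym e) (sp r c j i k)))))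
                 (cong (val μ (Bas p) *ᴿ_) (trans (cong (val μ) (sym im)) (inv g pg _ (Bas∈ cq))))))) δ

        opaque
          mixes : E ε 𝒮 → C ε 𝒮 → Mixes E (val μ E) C
          mixes {E} e c = mixing e (val μ E) refl (λ p cp → flip cp) _ c
            where
            flip : Condition p → Mixes E (val μ E) (Bas p)
            flip {p} cp δ δ≢0 =
              let (Y , sY , f) = mixing (Bas∈ cp) (val μ (Bas p)) refl (λ q cq → mixes-Bas cq cp) E e δ δ≢0 in
              Y , sY , λ g (pg , ag) →
                let k = inv′ g ; pk = perm-inv pg
                    far : Far Y k
                    far = pk , λ z i j → ag (k · z) j (subst (_ε Y) (sym (inv-·ʳ pg (proj₂ sY z i))) i)
                    (u , w) = f k far
                    same : val μ (E ∩ img[ k ] (Bas p)) ≡ val μ (Bas p ∩ img[ g ] E)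
                    same = trans (sym (inv g pg _ (𝒮-∩ e (image∈𝒮 pk (Bas∈ cp))))) (cong (val μ) (trans image-∩
                      (trans (cong (img[ g ] E ∩_) (trans (image-∘ pk) (image-id Bas-⊆ λ x i → trans (∘-· i) (inv-·ʳ pg i)))) ∩-comm)))
                in ≤ᴿ-trans (≡⇒≤ (sym same)) (≤ᴿ-trans u (+ᴿ-mono (≡⇒≤ (*ᴿ-comm _ _)) ≤ᴿ-refl)) ,
                   ≤ᴿ-trans (≡⇒≤ (*ᴿ-comm _ _)) (≤ᴿ-trans w (+ᴿ-mono (≡⇒≤ same) ≤ᴿ-refl))
              where
              inv′ : W → W
              inv′ = Permutations.inv X

  module Extremality where

    open Measures
    open Additivity
    open Convergence
    open Decomposition using (Dissociated)
    open Mixing using (mixes)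

    private variable
      A B C F M g h μ ν η Y p q : W

    -- An invariant ν with rν ≤ μ equals μ.  If the infimum e* of μ(C) + ν(Str ∖ C) were
    -- below 1, intersecting a nearly optimal C with a far translate of itself would
    -- keep it nearly optimal while squaring μ(C), so μ(C) could be made arbitrarily
    -- small; but then rν(C) is small too and e* is close to 1.
    module Dominated {μ ν : W} (m : IsMeasure μ) (inv : Invariant μ) (diss : Dissociated μ)
      (n : IsMeasure ν) (inv′ : Invariant ν) (r : Real) (r≢0 : ¬ (r ≡ 0ᴿ))
      (dom : ∀ A → A ε 𝒮 → r *ᴿ val ν A ≤ val μ A) where

      private
        module μF = FinAddFacts (finitely-additive m)
        module νF = FinAddFacts (finitely-additive n)

        e : W → Real
        e C = val μ C +ᴿ val ν (Str ∖ C)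

        dE : ∀ {n} {s : Env n → W} → DefT s → DefT λ ρ → rw (e (s ρ))
        dE d = d+ᴿ ⦃ dVal μ d ⦄ ⦃ dVal ν (d∖ ⦃ tCon ⦄ ⦃ d ⦄) ⦄

        IsCost : Real → Set ℓ
        IsCost x = Σ W λ C → C ε 𝒮 × x ≡ e C

        dCost : Def {1} λ ρ → IsCost (toReal (ρ zero))
        dCost = dEx ⦃ dAnd ⦃ it ⦄ ⦃ dEqReal ⦃ it ⦄ ⦃ dE var₀ ⦄ ⦄ ⦄

        opaque
          cost-inf : Σ Real λ m → (∀ x → IsCost x → m ≤ x) × (∀ δ → ¬ (δ ≡ 0ᴿ) → Σ Real λ x → IsCost x × x ≤ m +ᴿ δ)
          cost-inf = infimum IsCost dCost (e Str , Str , full , refl)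

        e* : Real
        e* = proj₁ cost-inf

        e*≤ : C ε 𝒮 → e* ≤ e C
        e*≤ {C} c = proj₁ (proj₂ cost-inf) (e C) (C , c , refl)

        Good : W → Real → Set ℓ
        Good C δ = C ε 𝒮 × e C ≤ e* +ᴿ δ

        good : ∀ δ → ¬ (δ ≡ 0ᴿ) → Σ W λ C → Good C δ
        good δ δ≢0 = let (x , (C , c , x≡) , l) = proj₂ (proj₂ cost-inf) δ δ≢0 in C , c , subst (_≤ e* +ᴿ δ) x≡ l

        e-modular : A ε 𝒮 → B ε 𝒮 → e (A ∩ B) +ᴿ e (A ∪ B) ≡ e A +ᴿ e B
        e-modular {A} {B} a b = trans (+ᴿ-swap _ _ _ _) (trans (cong₂ _+ᴿ_ (μF.modular a b)
          (trans (cong₂ _+ᴿ_ (cong (val ν) dm∩) (cong (val ν) dm∪)) (trans (+ᴿ-comm _ _) (νF.modular (𝒮-∖ a) (𝒮-∖ b))))) (+ᴿ-swap _ _ _ _))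
          where
          dm∩ : Str ∖ (A ∩ B) ≡ (Str ∖ A) ∪ (Str ∖ B)
          dm∩ = ext λ M →
            (λ i → let (j , k) = ∖⁻ i in cases M j k em) ,
            (λ i → ⊎-elim (λ j → let (k , l) = ∖⁻ j in ∖⁺ (k , λ o → l (proj₁ (∩⁻ o))))
                          (λ j → let (k , l) = ∖⁻ j in ∖⁺ (k , λ o → l (proj₂ (∩⁻ o))))
                          (∪⁻ i))
            where
            cases : ∀ M → M ε Str → M ∉ A ∩ B → Dec (M ε A) → M ε (Str ∖ A) ∪ (Str ∖ B)
            cases M j k (yes a) = ∪ʳ M (∖⁺ (j , λ b → k (∩⁺ (a , b))))
            cases M j k (no a)  = ∪ˡ M (∖⁺ (j , a))
          dm∪ : Str ∖ (A ∪ B) ≡ (Str ∖ A) ∩ (Str ∖ B)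
          dm∪ = ext λ M →
            (λ i → let (j , k) = ∖⁻ i in ∩⁺
              (∖⁺ (j , λ a → k (∪ˡ M a)) , ∖⁺ (j , λ b → k (∪ʳ M b)))) ,
            (λ i → let (j , k) = ∩⁻ i ; (j₁ , j₂) = ∖⁻ j ; (_ , k₂) = ∖⁻ k in
              ∖⁺ (j₁ , λ o → ⊎-elim j₂ k₂ (∪⁻ o)))

        e-inv : Perm g → C ε 𝒮 → e (img[ g ] C) ≡ e C
        e-inv {g} {C} pg c = cong₂ _+ᴿ_ (inv g pg C c)
          (trans (cong (val ν) (sym (trans image-∖ (cong (_∖ img[ g ] C) image-Str)))) (inv′ g pg _ (𝒮-∖ c)))

        Reachable : Real → Set ℓ
        Reachable x = ∀ (δ : Real) → ¬ (δ ≡ 0ᴿ) → Σ W λ C → Good C δ × val μ C ≤ x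

        dReachable : ∀ e* → Def {1} λ ρ → ∀ (δ : Real) → ¬ (δ ≡ 0ᴿ) → Σ W λ C → (C ε 𝒮 × e C ≤ e* +ᴿ δ) × val μ C ≤ toReal (ρ zero)
        dReachable e* = dAllReal ⦃ dImp ⦃ it ⦄ ⦃ dEx ⦃ dAnd ⦃ dAnd ⦃ it ⦄ ⦃ d≤ ⦃ dE var₀ ⦄ ⦃ d+ᴿ ⦃ tCon ⦄ ⦃ it ⦄ ⦄ ⦄ ⦄ ⦃ d≤ ⦃ dVal μ var₀ ⦄ ⦃ it ⦄ ⦄ ⦄ ⦄ ⦄

        square : ∀ {x} → Reachable x → ∀ δ → ¬ (δ ≡ 0ᴿ) → Reachable (x *ᴿ x +ᴿ δ)
        square {x} w δ δ≢0 ε′ ε≢0 =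
          let (k , k≢0 , k+k) = half ε′ ε≢0
              (C , (c , l) , u) = w k k≢0
              (Y , sY , f) = mixes m inv diss c c δ δ≢0
              (g , far@(pg , _)) = far-exists sY
              gc = image∈𝒮 pg c
              bound : e (C ∩ img[ g ] C) ≤ e* +ᴿ (k +ᴿ k)
              bound = +ᴿ-cancelʳ e* (≤ᴿ-trans (+ᴿ-mono ≤ᴿ-refl (e*≤ (𝒮-∪ c gc)))
                (≤ᴿ-trans (≡⇒≤ (trans (e-modular c gc) (cong (e C +ᴿ_) (e-inv pg c))))
                  (≤ᴿ-trans (+ᴿ-mono l l) (≡⇒≤ (Sum.solve 2 (λ z k → (z Sum.⊕ k) Sum.⊕ (z Sum.⊕ k) Sum.⊜ (z Sum.⊕ (k Sum.⊕ k)) Sum.⊕ z) refl e* k)))))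
          in C ∩ img[ g ] C , (𝒮-∩ c gc , ≤ᴿ-trans bound (+ᴿ-mono ≤ᴿ-refl k+k)) ,
             ≤ᴿ-trans (proj₁ (f g far)) (+ᴿ-mono (*ᴿ-mono u u) ≤ᴿ-refl)

        r≤1 : r ≤ 1ᴿ
        r≤1 = ≤ᴿ-trans (≡⇒≤ (sym (trans (cong (r *ᴿ_) (IsMeasure.total n)) (*ᴿ-1 r)))) (≤ᴿ-trans (dom Str full) (≡⇒≤ (IsMeasure.total m)))

        shrink : ∀ q → q <ᶠ 1ᶠ → Reachable (ι q) → Σ Real λ w → (∀ δ → ¬ (δ ≡ 0ᴿ) → Reachable (w +ᴿ δ)) × w ≡ 0ᴿ
        shrink q q<1 h =
          let (w , lower-bound , greatest) = infimum Reachable (dReachable e*) (ι q , h)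
              w≤² : ∀ {x} → Reachable x → w ≤ x *ᴿ x
              w≤² p = ≤-limit′ λ δ δ≢0 → lower-bound _ (square p δ δ≢0)
              w≤ : ∀ x → Reachable x → w ≤ x *ᴿ ι q
              w≤ x p = ⊎-elim (λ l → ≤ᴿ-trans (w≤² p) (*ᴿ-mono ≤ᴿ-refl l)) (λ l → ≤ᴿ-trans (w≤² h) (*ᴿ-mono l ≤ᴿ-refl)) (≤ᴿ-total x (ι q))
          in w ,
             (λ δ δ≢0 ε′ ε≢0 → let (x , p , l) = greatest δ δ≢0 ; (C , gd , u) = p ε′ ε≢0 in C , gd , ≤ᴿ-trans u l) ,
             ≤*ι⇒0 {q} {w} q<1 (≤-limit′ λ δ δ≢0 → let (x , p , l) = greatest δ δ≢0 in
               ≤ᴿ-trans (w≤ x p) (≤ᴿ-trans (*ᴿ-mono l ≤ᴿ-refl) (≤ᴿ-trans (≡⇒≤ (*ᴿ-distribʳ (ι q) w δ))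
                 (+ᴿ-mono ≤ᴿ-refl (≤ᴿ-trans (*ᴿ-mono ≤ᴿ-refl (ι-mono {q} {1ᶠ} (<ᶠ⇒≤ᶠ {q} {1ᶠ} q<1))) (≡⇒≤ (*ᴿ-1 δ)))))))

        reachable : ∀ {w p} → e* ∋ w → w <ᶠ p → Reachable (ι p)
        reachable {w} {p} i w<p δ δ≢0 =
          let (d , d>0 , d≈) = subtract {w} {p} w<p
              top : e* +ᴿ ι d ≤ ι p
              top = ≤ᴿ-trans (+ᴿ-mono (∋⇒≤ι i) ≤ᴿ-refl) (≡⇒≤ (trans (ι-+ w d) (ι-≈ {w +ᶠ d} {p} d≈)))
              found : ∀ k → ¬ (k ≡ 0ᴿ) → k ≤ δ → k ≤ ι d → Σ W λ C → Good C δ × val μ C ≤ ι p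
              found k k≢0 l l′ = let (C , c , u) = good k k≢0 in
                C , (c , ≤ᴿ-trans u (+ᴿ-mono ≤ᴿ-refl l)) , ≤ᴿ-trans (≤+ _ _) (≤ᴿ-trans u (≤ᴿ-trans (+ᴿ-mono ≤ᴿ-refl l′) top))
          in ⊎-elim (λ l → found δ δ≢0 ≤ᴿ-refl l) (λ l → found (ι d) (ι≢0 d>0) l ≤ᴿ-refl) (≤ᴿ-total δ (ι d))

        contraction : ∀ p → e* ≤ ι p → (∀ δ → ¬ (δ ≡ 0ᴿ) → Reachable δ) → r ≤ r *ᴿ ι p
        contraction p l w = ≤-limit′ λ δ δ≢0 →
          let (k , k≢0 , k+k) = half δ δ≢0
              (C , (c , u) , v) = w k k≢0 k k≢0
          in ≤ᴿ-trans (≡⇒≤ (sym (trans (sym (*ᴿ-distribˡ r (val ν C) (val ν (Str ∖ C)))) (trans (cong (r *ᴿ_) (trans (νF.compl c) (IsMeasure.total n))) (*ᴿ-1 r)))))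
               (≤ᴿ-trans (+ᴿ-mono (≤ᴿ-trans (dom C c) v) (≤ᴿ-trans (*ᴿ-mono ≤ᴿ-refl (≤ᴿ-trans (≤ᴿ-trans (≤+ _ _) (≡⇒≤ (+ᴿ-comm _ (val μ C)))) u))
                   (≤ᴿ-trans (≡⇒≤ (*ᴿ-distribˡ r e* k)) (+ᴿ-mono (*ᴿ-mono ≤ᴿ-refl l) (≤ᴿ-trans (*ᴿ-mono r≤1 ≤ᴿ-refl) (≡⇒≤ (1*ᴿ k)))))))
                 (≤ᴿ-trans (≡⇒≤ (Sum.solve 2 (λ k z → k Sum.⊕ (z Sum.⊕ k) Sum.⊜ z Sum.⊕ (k Sum.⊕ k)) refl k (r *ᴿ ι p))) (+ᴿ-mono ≤ᴿ-refl k+k)))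

        1≤e* : 1ᴿ ≤ e*
        1≤e* = dne λ n≤ →
          let (q , i , j) = ≰⇒ n≤
              (p , p<q , ip) = round e* i
              (w , w<p , iw) = round e* ip
              p<1 = <-≤ᶠ-trans {p} {q} {1ᶠ} p<q (⊎-elim (λ l → l) (λ l → ⊥-elim (j (proj₂ ι-∋ l))) (≤ᶠ-total q 1ᶠ))
              (z , reach , z≡0) = shrink p p<1 (reachable iw w<p)
          in r≢0 (≤*ι⇒0 {p} {r} p<1 (contraction p (∋⇒≤ι ip) λ δ δ≢0 →
               subst Reachable (trans (cong (_+ᴿ δ) z≡0) (0+ᴿ δ)) (reach δ δ≢0)))

      opaque
        ν≤μ : A ε 𝒮 → val ν A ≤ val μ A
        ν≤μ {A} a = +ᴿ-cancelʳ (val ν (Str ∖ A)) (≤ᴿ-trans (≡⇒≤ (trans (νF.compl a) (IsMeasure.total n))) (≤ᴿ-trans 1≤e* (e*≤ a)))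

      agree : A ε 𝒮 → val ν A ≡ val μ A
      agree {A} a = ≤ᴿ-antisym (ν≤μ a) (+ᴿ-cancelʳ (val ν (Str ∖ A))
        (≤ᴿ-trans (+ᴿ-mono ≤ᴿ-refl (ν≤μ (𝒮-∖ a))) (≡⇒≤
          (trans (μF.compl a) (trans (IsMeasure.total m) (sym (trans (νF.compl a) (IsMeasure.total n))))))))

    module _ {μ : W} (m : IsMeasure μ) (inv : Invariant μ) (diss : Dissociated μ) where

      module _ {ν η : W} (n : IsMeasure ν × Invariant ν) (n′ : IsMeasure η × Invariant η) {r s : Real} (sum : r +ᴿ s ≡ 1ᴿ)
        (c : ∀ A → A ε 𝒮 → r *ᴿ val ν A +ᴿ s *ᴿ val η A ≡ val μ A) where

        combination-trivial : ¬ (r ≡ 0ᴿ) → ¬ (s ≡ 0ᴿ) → ν ≡ η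
        combination-trivial r≢0 s≢0 = fun-ext (IsMeasure.fun (proj₁ n)) (IsMeasure.fun (proj₁ n′)) λ A a →
          trans (sym (rw-val (IsMeasure.fun (proj₁ n)) a)) (trans (cong rw (trans
            (Dominated.agree m inv diss (proj₁ n) (proj₂ n) r r≢0 (λ A a → ≤ᴿ-trans (≤+ _ _) (≡⇒≤ (c A a))) a)
            (sym (Dominated.agree m inv diss (proj₁ n′) (proj₂ n′) s s≢0 (λ A a → ≤ᴿ-trans (≤+ _ _) (≡⇒≤ (trans (+ᴿ-comm _ _) (c A a)))) a))))
            (rw-val (IsMeasure.fun (proj₁ n′)) a))

      combination-values : ∀ {ν η} → FunP ν 𝒮 IsCut → FunP η 𝒮 IsCut → ∀ r s →
        R.IsCombination (el μ) (el (rw r)) (el ν) (el (rw s)) (el η) → ∀ A → A ε 𝒮 → r *ᴿ val ν A +ᴿ s *ᴿ val η A ≡ val μ A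
      combination-values {ν} {η} F G r s c A a = sym (rw-inj (proj₁ (rel-plusᴿ (r *ᴿ val ν A) (s *ᴿ val η A) {rw (val μ A)})
        (c (el A) (isV A) (el (rw (val μ A))) (isV (rw (val μ A))) (el (rw (val ν A))) (isV (rw (val ν A))) (el (rw (val η A))) (isV (rw (val η A)))
           (el (rw (r *ᴿ val ν A))) (isV (rw (r *ᴿ val ν A))) (el (rw (s *ᴿ val η A))) (isV (rw (s *ᴿ val η A)))
           (proj₂ (rel-val (IsMeasure.fun m) a) refl) (proj₂ (rel-val F a) refl) (proj₂ (rel-val G a) refl)
           (proj₂ (rel-timesᴿ r (val ν A)) refl) (proj₂ (rel-timesᴿ s (val η A)) refl))))

      dissociated⇒extreme : R.IsExtreme (el κ) (el L) (el X) (el μ)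
      dissociated⇒extreme = record
        { invariant = proj₂ rel-invariant (m , inv)
        ; extreme = λ ν vν η vη iν iη ne r vr s vs ir is (u , vu , one , plus) comb →
            let n = proj₁ (rel-invariant {⟪ ν , vν ⟫}) iν ; n′ = proj₁ (rel-invariant {⟪ η , vη ⟫}) iη
                cr = proj₁ (rel-real {⟪ r , vr ⟫}) ir ; cs = proj₁ (rel-real {⟪ s , vs ⟫}) is
                r₀ = toReal ⟪ r , vr ⟫ ; s₀ = toReal ⟪ s , vs ⟫
                r≡ = cong el (rw-toReal cr) ; s≡ = cong el (rw-toReal cs)
                sum : r₀ +ᴿ s₀ ≡ 1ᴿ
                sum = rw-inj (trans (sym (proj₁ (rel-plusᴿ r₀ s₀ {⟪ u , vu ⟫}) (subst₂ (λ r s → R.Plusᴿ r s u) (sym r≡) (sym s≡) plus)))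
                        (proj₁ (rel-oneᴿ {⟪ u , vu ⟫}) one))
                values = combination-values (IsMeasure.fun (proj₁ n)) (IsMeasure.fun (proj₁ n′)) r₀ s₀
                  (subst₂ (λ r s → R.IsCombination (el μ) r ν s η) (sym r≡) (sym s≡) comb)
                zero? : ∀ {x} (i : IsCut x) → toReal x ≡ 0ᴿ → R.IsZeroᴿ (el x)
                zero? {x} i e = proj₂ (rel-zeroᴿ {x}) (trans (sym (rw-toReal i)) (cong rw e))
            in dne λ none → ne (cong el (combination-trivial n n′ sum values
                 (λ e → none (inj₁ (zero? {⟪ r , vr ⟫} cr e))) (λ e → none (inj₂ (zero? {⟪ s , vs ⟫} cs e))))) }

  module BasicInvariance where

    open Measures
    open Additivity
    open Convergence

    private variable
      A F c g μ : W

    sum-unique : ∀ {r s} → SumOf c r → SumOf c s → r ≡ s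
    sum-unique (h , k) (h′ , k′) = ≤ᴿ-antisym (k _ h′) (k′ _ h)

    module _ {μ : W} (m : IsMeasure μ) (basic : ∀ p → Condition p → ∀ g → Perm g → val μ (img[ g ] (Bas p)) ≡ val μ (Bas p)) where

      private
        module μF = FinAddFacts (finitely-additive m)

        Stable : W → Set ℓ
        Stable A = ∀ g → Perm g → val μ (img[ g ] A) ≡ val μ A

        dStable : Def {1} λ ρ → Stable (ρ zero)
        dStable = dAll ⦃ dImp ⦃ Def₁ Perm dPerm var₀ ⦄ ⦃ it ⦄ ⦄

        H : W
        H = sep Stable ⦃ dStable ⦄ 𝒮

        H-spec : ∀ A → A ε H ⟺ (A ε 𝒮 × Stable A)
        H-spec = sep-spec Stable ⦃ dStable ⦄ 𝒮

        compl-stable : A ε 𝒮 → Stable A → Stable (Str ∖ A)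
        compl-stable {A} a h g pg = trans (cong (val μ) (trans image-∖ (cong (_∖ img[ g ] A) image-Str)))
          (+ᴿ-cancel-≡ (val μ A) (trans (+ᴿ-comm _ _) (trans (cong (_+ᴿ val μ (Str ∖ img[ g ] A)) (sym (h g pg)))
            (trans (μF.compl (image∈𝒮 pg a)) (trans (sym (μF.compl a)) (+ᴿ-comm _ _))))))

        module Union (s : W) (F : Fun s κ H) (dis : Disjoint s) (s∈ : seq⋃ s ε 𝒮) (g : W) (pg : Perm g) where
          f : W → W
          f i = img[ g ] (s · i)
          df : ∀ g s → DefT {1} λ ρ → img[ g ] (s · ρ zero)
          df g s = it
          s′ : W
          s′ = graph f ⦃ df g s ⦄ κ
          s′-· : ∀ {i} → i ε κ → s′ · i ≡ f i
          s′-· = graph-· f ⦃ df g s ⦄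
          F𝒮 : Fun s κ 𝒮
          F𝒮 = FunP-map (λ A i → proj₁ (proj₁ (H-spec A) i)) F
          F′ : Fun s′ κ 𝒮
          F′ = graph-fun f ⦃ df g s ⦄ λ i hi → image∈𝒮 pg (F𝒮 .value i hi)
          dis′ : Disjoint s′
          dis′ i j hi hj ne N k l =
            let (_ , k′) = image⁻ (subst (N ε_) (s′-· hi) k)
                (_ , l′) = image⁻ (subst (N ε_) (s′-· hj) l)
            in dis i j hi hj ne (pull g N) k′ l′
          union : seq⋃ s′ ≡ img[ g ] (seq⋃ s)
          union = ext λ N →
            (λ k → let (n , i , hi , l) = proj₁ (seq⋃-spec s′ N) k ; (_ , l′) = image⁻ (subst (N ε_) (s′-· hi) l) in
              image⁺ (n , proj₂ (seq⋃-spec s _) (pull-Str g N , i , hi , l′))) ,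
            (λ k → let (n , l) = image⁻ k ; (_ , i , hi , l′) = proj₁ (seq⋃-spec s _) l in
              proj₂ (seq⋃-spec s′ N) (n , i , hi , subst (N ε_) (sym (s′-· hi)) (image⁺ (n , l′))))
          values : cmp μ s′ ≡ cmp μ s
          values = fun-ext (cmp-cut (IsMeasure.fun m) F′) (cmp-cut (IsMeasure.fun m) F𝒮) λ i hi →
            trans (cmp-· F′ hi) (trans (cong (μ ·_) (s′-· hi)) (trans (sym (rw-val (IsMeasure.fun m) (image∈𝒮 pg (F𝒮 .value i hi))))
              (trans (cong rw (proj₂ (proj₁ (H-spec _) (F .value i hi)) g pg)) (trans (rw-val (IsMeasure.fun m) (F𝒮 .value i hi)) (sym (cmp-· F𝒮 hi))))))
          same : val μ (img[ g ] (seq⋃ s)) ≡ val μ (seq⋃ s)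
          same = sum-unique (subst₂ SumOf values (cong (val μ) union) (IsMeasure.additive m s′ F′ dis′ (subst (_ε 𝒮) (sym union) (image∈𝒮 pg s∈))))
            (IsMeasure.additive m s F𝒮 dis s∈)

        H-lambda : Lambda H
        H-lambda = record
          { within = λ A i → proj₁ (proj₁ (H-spec A) i)
          ; basic  = λ p c → proj₂ (H-spec _) (Bas∈ c , basic p c)
          ; compl  = λ A i → let (j , k) = proj₁ (H-spec A) i in proj₂ (H-spec _) (𝒮-∖ j , compl-stable j k)
          ; unions = λ s F dis s∈ → proj₂ (H-spec _) (s∈ , Union.same s F dis s∈) }

      opaque
        basic⇒invariant : Invariant μ
        basic⇒invariant g pg A a = proj₂ (proj₁ (H-spec A) (π-λ H-lambda A a)) g pg

 module Domain where

   open FiniteSets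

   measure-domain : (X L D κ μ : W) (lang : Fun L D ω) → R.IsProbabilityMeasure (el κ) (el L) (el X) (el μ) →
     Σ W λ 𝒮 → R.IsSigma (el κ) (el L) (el X) (el 𝒮) × OverLanguage.Structures.Str X L D lang ε 𝒮
   measure-domain X L D κ μ lang m =
     let (S , vS , sigma , f) = R.IsProbabilityMeasure.domain m
         F = fromIsFun {μ} {⟪ S , vS ⟫} {R.IsReal} f
         (u , vu , _ , k) = R.IsProbabilityMeasure.total m (el Str) (isV Str) (proj₂ (OverLanguage.Structures.rel-with X L D lang {Str} {λ _ → ⊤})
           λ M → (λ i → i , tt) , proj₁)
     in ⟪ S , vS ⟫ , sigma , proj₁ (graph-dom F (proj₁ (rel-↦ {μ} {Str} {⟪ u , vu ⟫}) k))
     where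
     Str : W
     Str = OverLanguage.Structures.Str X L D lang

   language : ∀ {L D} → R.IsFun (el L) (el D) R.IsNat → Fun L D ω
   language {L} {D} f = FunP-map (λ n → proj₁ (rel-nat {n})) (fromIsFun {L} {D} {R.IsNat} f)

   setting : (κ X L D μ : W) → R.IsOrdinal (el κ) → R.Infinite (el κ) → R.Infinite (el X) →
             R.IsFun (el L) (el D) R.IsNat → R.IsProbabilityMeasure (el κ) (el L) (el X) (el μ) → Setting
   setting κ X L D μ ordinal infinite-κ infinite-X f m = record
     { X = X ; L = L ; D = D ; κ = κ ; 𝒮 = proj₁ dom ; i₀ = proj₁ first ; i₁ = proj₁ second ; lang = language f
     ; sigma = proj₁ (proj₂ dom) ; full = proj₂ (proj₂ dom) ; ord = proj₁ (OverLanguage.SigmaAlgebra.rel-ordinal X L D (language f) κ) ordinal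
     ; i₀∈ = proj₁ (proj₂ first) ; i₁∈ = proj₁ (proj₂ second)
     ; i₀≢i₁ = λ e → proj₂ (proj₂ second) (subst (_ε ∅ ∪ ｛ proj₁ first ｝) e adj-new)
     ; infinite = proj₁ rel-infinite infinite-X }
     where
     dom : Σ W λ 𝒮 → R.IsSigma (el κ) (el L) (el X) (el 𝒮) × OverLanguage.Structures.Str X L D (language f) ε 𝒮
     dom = measure-domain X L D κ μ (language f) m
     first : Σ W λ i → i ε κ × i ∉ ∅
     first = Permutations.fresh κ (proj₁ rel-infinite infinite-κ) finite-∅
     second : Σ W λ i → i ε κ × i ∉ ∅ ∪ ｛ proj₁ first ｝
     second = Permutations.fresh κ (proj₁ rel-infinite infinite-κ) (finite-adj _ finite-∅)

record ModelPair (ℓ : Level) : Set (lsuc ℓ) where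
  field
    lem    : ExcludedMiddle ℓ
    𝕌      : Set ℓ
    _∈_    : Rel 𝕌 ℓ
    V₀ V₁  : Pred 𝕌 ℓ
    model₀ : Relative.IsModelOfSetTheory _∈_ V₀
    model₁ : Relative.IsModelOfSetTheory _∈_ V₁
    V₀⊆V₁  : V₀ ⊆ᵖ V₁

  𝔐₀ 𝔐₁ : Model ℓ
  𝔐₀ = record { em = lem ; 𝕌 = 𝕌 ; _∈_ = _∈_ ; V = V₀ ; isModel = model₀ }
  𝔐₁ = record { em = lem ; 𝕌 = 𝕌 ; _∈_ = _∈_ ; V = V₁ ; isModel = model₁ }

module TwoModels {ℓ : Level} (𝔓 : ModelPair ℓ) where

 open ModelPair 𝔓

 module TA = Theory 𝔐₀
 module TB = Theory 𝔐₁

 module A where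
   open TA.Core public
   open TA.Sets public
   open TA.Naturals public
   open TA.FiniteSets public

 module B where
   open TB.Core public
   open TB.Sets public
   open TB.Naturals public
   open TB.FiniteSets public

 open TA using () renaming (module Arithmetic to NA; module Fractions to FA; module Reals to RA)
 open TB using () renaming (module Arithmetic to NB; module Fractions to FB; module Reals to RB)

 module Lifting where

   private variable
     a b f j k m n p x y z : A.W
     u v w : B.W

   up : A.W → B.W
   up x = B.⟪ A.el x , V₀⊆V₁ (A.isV x) ⟫

   up-inj : up x ≡ up y → x ≡ y
   up-inj e = A.el-inj (cong B.el e)

   up-ε : x A.ε y → up x B.ε up y
   up-ε i = B.∈→ε (A.ε→∈ i)

   down-ε : up x B.ε up y → x A.ε y
   down-ε i = A.∈→ε (B.ε→∈ i)

   descend : w B.ε up a → Σ A.W λ x → w ≡ up x × x A.ε a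
   descend {w} {a} i = let (x , e , j) = A.lower {B.el w} {a} (B.ε→∈ i) in x , B.el-inj (sym e) , j

   up-⊆ : a A.⊆ b → up a B.⊆ up b
   up-⊆ s w i = let (x , e , j) = descend i in subst (B._ε _) (sym e) (up-ε (s x j))

   up-ext : (∀ w → w B.ε u → Σ A.W λ x → w ≡ up x × x A.ε a) → (∀ x → x A.ε a → up x B.ε u) → up a ≡ u
   up-ext {u} h k = B.⊆-antisym (λ w i → let (x , e , j) = descend i in subst (B._ε u) (sym e) (k x j))
     (λ w i → let (x , e , j) = h w i in subst (B._ε _) (sym e) (up-ε j))

   up-∅ : up A.∅ ≡ B.∅
   up-∅ = up-ext (λ w i → ⊥-elim (B.∉∅ i)) (λ x i → ⊥-elim (A.∉∅ i))

   up-upair : up (A.upair x y) ≡ B.upair (up x) (up y)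
   up-upair {x} {y} = up-ext
     (λ w i → ⊎-elim (λ e → x , e , A.upair⁺ (inj₁ refl)) (λ e → y , e , A.upair⁺ (inj₂ refl))
       (B.upair⁻ i))
     (λ z i → B.upair⁺ (⊎-map (cong up) (cong up) (A.upair⁻ i)))

   up-｛｝ : up A.｛ x ｝ ≡ B.｛ up x ｝
   up-｛｝ {x} = up-ext
     (λ w i → x , proj₁ (B.｛｝-spec _ w) i , proj₂ (A.｛｝-spec x x) refl)
     (λ z i → proj₂ (B.｛｝-spec _ _) (cong up (proj₁ (A.｛｝-spec x z) i)))

   up-∪ : up (a A.∪ b) ≡ up a B.∪ up b
   up-∪ {a} {b} = up-ext
     (λ w i → ⊎-elim (λ l → let (x , e , k) = descend l in x , e , A.∪⁺ (inj₁ k))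
                     (λ l → let (x , e , k) = descend l in x , e , A.∪⁺ (inj₂ k)) (B.∪⁻ i))
     (λ z i → B.∪⁺ (⊎-map up-ε up-ε (A.∪⁻ i)))

   up-S : up (A.S x) ≡ B.S (up x)
   up-S {x} = trans up-∪ (cong (up x B.∪_) up-｛｝)

   up-⟨⟩ : up A.⟨ x , y ⟩ ≡ B.⟨ up x , up y ⟩
   up-⟨⟩ {x} {y} = trans (cong up (A.⟨⟩-spec x y)) (trans up-upair (trans (cong₂ B.upair up-upair up-upair) (sym (B.⟨⟩-spec _ _))))

   descend-⟨⟩ : B.⟨ u , v ⟩ ≡ up p → Σ A.W λ x → Σ A.W λ y → p ≡ A.⟨ x , y ⟩ × u ≡ up x × v ≡ up y
   descend-⟨⟩ {u} {v} {p} e =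
     let (q , e₁ , q∈) = descend {B.upair u v} {p} (subst (B.upair u v B.ε_) (trans (sym (B.⟨⟩-spec u v)) e) (B.upair⁺ (inj₂ refl)))
         (x , ex , _) = descend {u} {q} (subst (u B.ε_) e₁ (B.upair⁺ (inj₁ refl)))
         (y , ey , _) = descend {v} {q} (subst (v B.ε_) e₁ (B.upair⁺ (inj₂ refl)))
     in x , y , up-inj (trans (sym e) (trans (cong₂ B.⟨_,_⟩ ex ey) (sym up-⟨⟩))) , ex , ey

   up-mem : A.⟨ x , y ⟩ A.ε f → B.⟨ up x , up y ⟩ B.ε up f
   up-mem {x} {y} {f} i = subst (B._ε up f) up-⟨⟩ (up-ε i)

   down-mem : B.⟨ up x , up y ⟩ B.ε up f → A.⟨ x , y ⟩ A.ε f
   down-mem {x} {y} {f} i = down-ε (subst (B._ε up f) (sym up-⟨⟩) i)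

   descend-mem : B.⟨ u , v ⟩ B.ε up f → Σ A.W λ x → Σ A.W λ y → A.⟨ x , y ⟩ A.ε f × u ≡ up x × v ≡ up y
   descend-mem {u} {v} {f} i =
     let (p , e , p∈) = descend i ; (x , y , e′ , ex , ey) = descend-⟨⟩ e in x , y , subst (A._ε f) e′ p∈ , ex , ey

   up-· : up (f A.· x) ≡ up f B.· up x
   up-· {f} {x} = up-ext
     (λ w i → let (v , p , q) = proj₁ (B.·-spec (up f) (up x) w) i
                  (x′ , y , p′ , ex , ey) = descend-mem p
                  (z , ez , q′) = descend (subst (w B.ε_) ey q)
              in z , ez , proj₂ (A.·-spec f x z) (y , subst (λ x → A.⟨ x , y ⟩ A.ε f) (sym (up-inj ex)) p′ , q′))
     (λ z i → let (y , p , q) = proj₁ (A.·-spec f x z) i in proj₂ (B.·-spec _ _ _) (up y , up-mem p , up-ε q))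

   up-fun : {P : A.W → Set ℓ} {Q : B.W → Set ℓ} → (∀ y → P y → Q (up y)) → A.FunP f a P → B.FunP (up f) (up a) Q
   up-fun {f} {a} {P} {Q} h F = record
     { pairs = λ w i → let (p , e , p∈) = descend i ; (x , x∈ , q) = A.FunP.pairs F p p∈ in
         up x , up-ε x∈ , trans e (trans (cong up q) (trans up-⟨⟩ (cong B.⟨ up x ,_⟩ up-·)))
     ; total = λ w i → let (x , e , x∈) = descend i in
         subst (λ w → B.⟨ w , up f B.· w ⟩ B.ε up f) (sym e) (subst (λ y → B.⟨ up x , y ⟩ B.ε up f) up-· (up-mem (A.FunP.total F x x∈)))
     ; value = λ w i → let (x , e , x∈) = descend i in
         subst (λ w → Q (up f B.· w)) (sym e) (subst Q up-· (h _ (A.FunP.value F x x∈))) }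

   down-fun : {P : A.W → Set ℓ} {Q : B.W → Set ℓ} → (∀ y → Q (up y) → P y) → B.FunP (up f) (up a) Q → A.FunP f a P
   down-fun {f} {a} {P} {Q} h F = record
     { pairs = λ p i → let (w , w∈ , e) = B.FunP.pairs F (up p) (up-ε i) ; (x , ex , x∈) = descend w∈ in
         x , x∈ , up-inj (trans e (trans (cong (λ w → B.⟨ w , up f B.· w ⟩) ex) (trans (cong B.⟨ up x ,_⟩ (sym up-·)) (sym up-⟨⟩))))
     ; total = λ x i → down-mem (subst (λ y → B.⟨ up x , y ⟩ B.ε up f) (sym up-·) (B.FunP.total F (up x) (up-ε i)))
     ; value = λ x i → h _ (subst Q (sym up-·) (B.FunP.value F (up x) (up-ε i))) }

   up-Fun : A.Fun f a b → B.Fun (up f) (up a) (up b)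
   up-Fun = up-fun (λ _ → up-ε)

   down-Fun : B.Fun (up f) (up a) (up b) → A.Fun f a b
   down-Fun = down-fun (λ _ → down-ε)

   up-inj-fun : A.Inj f a → B.Inj (up f) (up a)
   up-inj-fun {f} {a} h u v i j e =
     let (x , ex , x∈) = descend i ; (y , ey , y∈) = descend j in
     trans ex (trans (cong up (h x y x∈ y∈ (up-inj (trans up-· (trans (cong (up f B.·_) (sym ex)) (trans e (trans (cong (up f B.·_) ey) (sym up-·)))))))) (sym ey))

   up-Bij : A.Bij f a b → B.Bij (up f) (up a) (up b)
   up-Bij {f} (F , inj , sur) = up-Fun F , up-inj-fun inj , λ w i →
     let (y , e , y∈) = descend i ; (x , x∈ , q) = sur y y∈ in up x , up-ε x∈ , trans (sym up-·) (trans (cong up q) (sym e))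

   -- A foundation argument in V₁: the set of all n ∈ ω with n ∉ ω in the sense of
   -- V₁ has no ∈-minimal element.
   opaque
     up-ω : up A.ω ≡ B.ω
     up-ω = B.⊆-antisym (λ w i → B.dne λ w∉ → bad w i w∉)
       (λ w i → proj₁ (B.ω-spec w) i (up A.ω) (subst (B._ε up A.ω) up-∅ (up-ε A.∅∈ω) , λ u k →
         let (x , e , x∈) = descend k in subst (B._ε up A.ω) (trans up-S (cong B.S (sym e))) (up-ε (A.S∈ω x∈))))
       where
       bad : ∀ w → w B.ε up A.ω → w B.∉ B.ω → ⊥
       bad w i w∉ =
         let (u , u∈ , minimal) = B.foundation (w , B.∖⁺ (i , w∉))
             (k , u∉) = B.∖⁻ u∈
             (n , e , n∈) = descend k
         in ⊎-elim
              (λ q → u∉ (subst (B._ε B.ω) (sym (trans e (trans (cong up q) up-∅))) B.∅∈ω))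
              (λ (m , m∈ , q) → let u≡ = trans e (trans (cong up q) up-S) in
                 u∉ (subst (B._ε B.ω) (sym u≡) (B.S∈ω (B.dne λ m∉ →
                   minimal (up m) (subst (up m B.ε_) (sym u≡) B.∈S) (B.∖⁺ (up-ε m∈ , m∉))))))
              (A.ω-cases n∈)

   up-nat : n A.ε A.ω → up n B.ε B.ω
   up-nat {n} i = subst (up n B.ε_) up-ω (up-ε i)

   descend-nat : w B.ε B.ω → Σ A.W λ n → w ≡ up n × n A.ε A.ω
   descend-nat {w} i = descend (subst (w B.ε_) (sym up-ω) i)

   up-Finite : A.Finite a → B.Finite (up a)
   up-Finite (n , n∈ , f , b) = up n , up-nat n∈ , up f , up-Bij b

   opaque
     descend-Finite : ∀ b → B.Finite w → w B.⊆ up b → Σ A.W λ a → w ≡ up a × A.Finite a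
     descend-Finite {w} b fin s =
       let (a , e , a∈) = descend (B.finite-ind (λ q → q B.⊆ w → q B.ε up K) ⦃ closed w (up K) ⦄ start step fin λ _ i → i)
       in a , e , proj₂ (proj₁ (K-spec a) a∈)
       where
       K : A.W
       K = A.sep A.Finite ⦃ A.dFinite ⦄ (A.𝒫 b)
       K-spec : ∀ q → q A.ε K ⟺ (q A.ε A.𝒫 b × A.Finite q)
       K-spec = A.sep-spec A.Finite ⦃ A.dFinite ⦄ (A.𝒫 b)
       closed : ∀ w k → B.Def {1} λ ρ → ρ zero B.⊆ w → ρ zero B.ε k
       closed w k = B.it
       start : B.∅ B.⊆ w → B.∅ B.ε up K
       start _ = subst (B._ε up K) up-∅ (up-ε (proj₂ (K-spec A.∅) (proj₂ (A.𝒫-spec _ _) (λ x i → ⊥-elim (A.∉∅ i)) , A.finite-∅)))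
       step : ∀ q x → q B.⊆ w → x B.ε w → x B.∉ q → B.Finite q → (q B.⊆ w → q B.ε up K) → q B.∪ B.｛ x ｝ B.⊆ w → q B.∪ B.｛ x ｝ B.ε up K
       step q x q⊆ x∈ _ _ IH _ =
         let (q₀ , e , q∈) = descend (IH q⊆)
             (x₀ , e′ , x₀∈) = descend (s x x∈)
             (q⊆b , fq) = proj₁ (K-spec q₀) q∈
         in subst (B._ε up K) (trans up-∪ (trans (cong (up q₀ B.∪_) up-｛｝) (sym (cong₂ (λ q x → q B.∪ B.｛ x ｝) e e′))))
              (up-ε (proj₂ (K-spec _) (proj₂ (A.𝒫-spec _ _) (λ y i → ⊎-elim (proj₁ (A.𝒫-spec _ _) q⊆b y) (λ y≡ → subst (A._ε b) (sym y≡) x₀∈) (A.adj-∈ i)) , A.finite-adj x₀ fq)))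

   down-Finite : B.Finite (up a) → A.Finite a
   down-Finite {a} fin = let (b , e , fb) = descend-Finite a fin (λ _ i → i) in subst A.Finite (sym (up-inj e)) fb

 open Lifting

 module RealAbsoluteness where

   up-+ : ∀ {m n} → m A.ε A.ω → n A.ε A.ω → up (m A.+ n) ≡ up m B.+ up n
   up-+ {m} {n} m∈ n∈ =
     let (f , z , s , e) = proj₂ (A.+-spec m∈ n∈) refl in
     proj₁ (B.+-spec (up-nat m∈) (up-nat n∈)) (up f , trans (cong (up f B.·_) (sym up-∅)) (trans (sym up-·) (cong up z)) ,
       (λ w i → let (x , ex , x∈) = descend i in
         subst (λ w → up f B.· B.S w ≡ B.S (up f B.· w)) (sym ex)
           (trans (cong (up f B.·_) (sym up-S)) (trans (sym up-·) (trans (cong up (s x x∈)) (trans up-S (cong B.S up-·)))))) ,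
       trans (cong up e) up-·)

   private
     partial : A.W → A.W → A.W
     partial m n = A.graph (m A.*_) n

     partial-· : ∀ m {n i} → i A.ε n → up (partial m n) B.· up i ≡ up (m A.* i)
     partial-· m i = trans (sym up-·) (cong up (A.graph-· (m A.*_) i))

   up-* : ∀ {m n} → m A.ε A.ω → n A.ε A.ω → up (m A.* n) ≡ up m B.* up n
   up-* {m} {n} m∈ n∈ = proj₁ (B.*-spec (up-nat m∈) (up-nat n∈)) (up (partial m (A.S n)) ,
     trans (cong (up (partial m (A.S n)) B.·_) (sym up-∅)) (trans (partial-· m (A.∅∈S n∈)) (trans (cong up (A.*-∅ m∈)) up-∅)) ,
     (λ w i → let (x , ex , x∈) = descend i ; x∈ω = A.ω-trans x∈ n∈ in
       subst (λ w → up (partial m (A.S n)) B.· B.S w ≡ (up (partial m (A.S n)) B.· w) B.+ up m) (sym ex)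
         (trans (cong (up (partial m (A.S n)) B.·_) (sym up-S)) (trans (partial-· m (A.ω-mono x∈ n∈))
           (trans (cong up (A.*-S m∈ x∈ω)) (trans (up-+ (A.*∈ω m∈ x∈ω) m∈) (cong (B._+ up m) (sym (partial-· m (A.⊆S x∈))))))))) ,
     sym (partial-· m A.∈S))

   upᴺ : NA.Nat → NB.Nat
   upᴺ n = NB.nat (up (NA.wd n)) (up-nat (NA.wd∈ω n))

   upᴺ-+ : ∀ m n → upᴺ (m NA.+ᴺ n) ≡ upᴺ m NB.+ᴺ upᴺ n
   upᴺ-+ m n = NB.wd-inj (trans (cong up (NA.wd-+ m n)) (trans (up-+ (NA.wd∈ω m) (NA.wd∈ω n)) (sym (NB.wd-+ (upᴺ m) (upᴺ n)))))

   upᴺ-* : ∀ m n → upᴺ (m NA.*ᴺ n) ≡ upᴺ m NB.*ᴺ upᴺ n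
   upᴺ-* m n = NB.wd-inj (trans (cong up (NA.wd-* m n)) (trans (up-* (NA.wd∈ω m) (NA.wd∈ω n)) (sym (NB.wd-* (upᴺ m) (upᴺ n)))))

   upᴺ-s : ∀ n → upᴺ (NA.sᴺ n) ≡ NB.sᴺ (upᴺ n)
   upᴺ-s n = NB.wd-inj (trans (cong up (NA.wd-s n)) (trans up-S (sym (NB.wd-s (upᴺ n)))))

   upᶠ : FA.Frac → FB.Frac
   upᶠ q = upᴺ (FA.num q) FB./s upᴺ (FA.pre q)

   up-den : ∀ q → upᴺ (FA.den q) ≡ FB.den (upᶠ q)
   up-den q = upᴺ-s (FA.pre q)

   up-fw : ∀ q → up (FA.fw q) ≡ FB.fw (upᶠ q)
   up-fw q = trans (cong up (FA.fw-def q)) (trans up-⟨⟩ (trans (cong (λ d → B.⟨ up (NA.wd (FA.num q)) , NB.wd d ⟩) (up-den q)) (sym (FB.fw-def (upᶠ q)))))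

   up-*ᶠ : ∀ p q → upᶠ (p FA.*ᶠ q) ≡ upᶠ p FB.*ᶠ upᶠ q
   up-*ᶠ p q = FB.fw-inj (trans (sym (up-fw (p FA.*ᶠ q))) (trans (cong up (FA.fw-def (p FA.*ᶠ q)))
     (trans up-⟨⟩ (trans (cong₂ (λ a b → B.⟨ NB.wd a , NB.wd b ⟩)
       (trans (cong upᴺ (FA.num-* p q)) (trans (upᴺ-* _ _) (sym (FB.num-* (upᶠ p) (upᶠ q)))))
       (trans (cong upᴺ (FA.den-* p q)) (trans (upᴺ-* _ _) (trans (cong₂ NB._*ᴺ_ (up-den p) (up-den q)) (sym (FB.den-* (upᶠ p) (upᶠ q)))))))
       (sym (FB.fw-def (upᶠ p FB.*ᶠ upᶠ q)))))))

   up-≤ : ∀ {m n} → m NA.≤ᴺ n → upᴺ m NB.≤ᴺ upᴺ n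
   up-≤ {m} (k , e) = upᴺ k , trans (sym (upᴺ-+ m k)) (cong upᴺ e)

   up-≤ᶠ : ∀ p q → p FA.≤ᶠ q → upᶠ p FB.≤ᶠ upᶠ q
   up-≤ᶠ p q h = subst₂ NB._≤ᴺ_
     (trans (upᴺ-* _ _) (cong (upᴺ (FA.num p) NB.*ᴺ_) (up-den q)))
     (trans (upᴺ-* _ _) (cong (upᴺ (FA.num q) NB.*ᴺ_) (up-den p))) (up-≤ h)

   descendᴺ : ∀ n → Σ NA.Nat λ m → n ≡ upᴺ m
   descendᴺ n = let (m , e , m∈) = descend-nat (NB.wd∈ω n) in NA.nat m m∈ , NB.wd-inj e

   down-≤ : ∀ {m n} → upᴺ m NB.≤ᴺ upᴺ n → m NA.≤ᴺ n
   down-≤ {m} {n} (k , e) = let (j , q) = descendᴺ k in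
     j , NA.wd-inj (up-inj (cong NB.wd (trans (upᴺ-+ m j) (trans (cong (upᴺ m NB.+ᴺ_) (sym q)) e))))

   down-≤ᶠ : ∀ p q → upᶠ p FB.≤ᶠ upᶠ q → p FA.≤ᶠ q
   down-≤ᶠ p q h = down-≤ (subst₂ NB._≤ᴺ_
     (sym (trans (upᴺ-* _ _) (cong (upᴺ (FA.num p) NB.*ᴺ_) (up-den q))))
     (sym (trans (upᴺ-* _ _) (cong (upᴺ (FA.num q) NB.*ᴺ_) (up-den p)))) h)

   upᶠ-surjective : ∀ q → Σ FA.Frac λ p → q ≡ upᶠ p
   upᶠ-surjective (m FB./s n) = let (i , e) = descendᴺ m ; (j , e′) = descendᴺ n in (i FA./s j) , cong₂ FB._/s_ e e′

   descend-frac : ∀ (q : FB.Frac) {a} → FB.fw q B.ε up (RA.rw a) → Σ FA.Frac λ p → q ≡ upᶠ p × a RA.∋ p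
   descend-frac q {a} i =
     let (x , e , j) = descend i
         (p , e′) = proj₁ (RA.isCut a) x j
     in p , FB.fw-inj (trans e (trans (cong up e′) (up-fw p))) , subst (A._ε RA.rw a) e′ j

   up-∋ : ∀ (r : RA.Real) (s : RB.Real) → up (RA.rw r) ≡ RB.rw s → ∀ q → r RA.∋ q → s RB.∋ upᶠ q
   up-∋ _ _ e q i = subst₂ B._ε_ (up-fw q) e (up-ε i)

   down-∋ : ∀ (r : RA.Real) (s : RB.Real) → up (RA.rw r) ≡ RB.rw s → ∀ q → s RB.∋ q → Σ FA.Frac λ p → q ≡ upᶠ p × r RA.∋ p
   down-∋ r _ e q i = descend-frac q {r} (subst (FB.fw q B.ε_) (sym e) i)

   up-timesᴿ : ∀ (r r′ : RA.Real) (s s′ : RB.Real) → up (RA.rw r) ≡ RB.rw s → up (RA.rw r′) ≡ RB.rw s′ → up (RA.rw (r RA.*ᴿ r′)) ≡ RB.rw (s RB.*ᴿ s′)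
   up-timesᴿ r r′ s s′ e e′ = B.⊆-antisym
     (λ w i → let (x , ex , j) = descend i
                  (q , eq) = proj₁ (RA.isCut (r RA.*ᴿ r′)) x j
                  (p , p′ , h , h′ , l) = proj₁ RA.*-∋ (subst (A._ε RA.rw (r RA.*ᴿ r′)) eq j)
              in subst (B._ε RB.rw (s RB.*ᴿ s′)) (sym (trans ex (trans (cong up eq) (up-fw q))))
                   (proj₂ RB.*-∋ (upᶠ p , upᶠ p′ , up-∋ r s e p h , up-∋ r′ s′ e′ p′ h′ , subst (FB._≤ᶠ upᶠ q) (up-*ᶠ p p′) (up-≤ᶠ (p FA.*ᶠ p′) q l))))
     (λ w i → let (q , eq) = proj₁ (RB.isCut (s RB.*ᴿ s′)) w i
                  (u , u′ , h , h′ , l) = proj₁ RB.*-∋ (subst (B._ε RB.rw (s RB.*ᴿ s′)) eq i)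
                  (p , ep , k) = down-∋ r s e u h ; (p′ , ep′ , k′) = down-∋ r′ s′ e′ u′ h′
                  (q₀ , eq₀) = upᶠ-surjective q
              in subst (B._ε up (RA.rw (r RA.*ᴿ r′))) (sym (trans eq (trans (cong FB.fw eq₀) (sym (up-fw q₀)))))
                   (up-ε (proj₂ RA.*-∋ (p , p′ , k , k′ , down-≤ᶠ (p FA.*ᶠ p′) q₀
                     (subst₂ FB._≤ᶠ_ (trans (cong₂ FB._*ᶠ_ ep ep′) (sym (up-*ᶠ p p′))) eq₀ l)))))

 module StructureAbsoluteness (X L D : A.W) (lang : A.Fun L D A.ω) where

   private variable
     a b c g h j k m n p q r v x y z Φ Y : A.W
     w : B.W

   lang₁ : B.Fun (up L) (up D) B.ω
   lang₁ = subst (B.Fun (up L) (up D)) up-ω (up-Fun lang)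

   module LA = TA.OverLanguage X L D lang
   module LB = TB.OverLanguage (up X) (up L) (up D) lang₁
   module PA = TA.Permutations X
   module PB = TB.Permutations (up X)
   open LA using () renaming (module Structures to SA; module Conjunctions to CA) public
   open LB using () renaming (module Structures to SB; module Conjunctions to CB) public

   up-Tuple : SA.Tuple r c → SB.Tuple (up r) (up c)
   up-Tuple {r} {c} C = subst (λ k → B.Fun (up c) k (up X)) up-· (up-Fun C)

   down-Tuple : SB.Tuple (up r) (up c) → SA.Tuple r c
   down-Tuple {r} {c} C = down-Fun (subst (λ k → B.Fun (up c) k (up X)) (sym up-·) C)

   opaque
     descend-Tuple : r A.ε D → SB.Tuple (up r) w → Σ A.W λ c → w ≡ up c × SA.Tuple r c
     descend-Tuple {r} {w} r∈ C =
       let (_ , fin , h) = B.finite-img (λ i → B.⟨ i , w B.· i ⟩) ⦃ pairing w ⦄ (B.finite-nat (SB.arity∈ω (up-ε r∈)))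
           (c , e , _) = descend-Finite (A.𝒫 (A.𝒫 ((L A.· r) A.∪ X)))
             (B.finite-⊆ fin λ t i → let (u , u∈ , e) = B.FunP.pairs C t i in subst (B._ε _) (sym e) (h u u∈))
             (λ t i → let (u , u∈ , e) = B.FunP.pairs C t i
                          (x , ex , x∈) = descend (subst (u B.ε_) (sym up-·) u∈)
                          (y , ey , y∈) = descend (B.FunP.value C u u∈)
                      in subst (B._ε _) (sym (trans e (trans (cong₂ B.⟨_,_⟩ ex ey) (sym up-⟨⟩)))) (up-ε (A.pair∈ x∈ y∈)))
       in c , e , down-Tuple (subst (SB.Tuple (up r)) e C)
       where
       pairing : ∀ w → B.DefT {1} λ ρ → B.⟨ ρ zero , w B.· ρ zero ⟩
       pairing w = B.it

   up-Condition : SA.Condition p → SB.Condition (up p)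
   up-Condition (fin , at) = up-Finite fin , λ t i →
     let (t₀ , e , t∈) = descend i ; (r , c , e′ , r∈ , C) = at t₀ t∈ in
     up r , up c , trans e (trans (cong up e′) up-⟨⟩) , up-ε r∈ , up-Tuple C

   opaque
     descend-Condition : SB.Condition w → Σ A.W λ p → w ≡ up p × SA.Condition p
     descend-Condition {w} (fin , at) =
       let (p , e , fp) = descend-Finite (A.𝒫 (A.𝒫 (D A.∪ SA.Tuples))) fin λ t i →
             let (r , c , r∈ , C , e) = in-V₀ t i in subst (B._ε _) (sym e) (up-ε (A.pair∈ r∈ (SA.tuple∈ r∈ C)))
       in p , e , fp , λ t i → let (r , c , r∈ , C , e′) = in-V₀ (up t) (subst (up t B.ε_) (sym e) (up-ε i)) in r , c , up-inj e′ , r∈ , C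
       where
       in-V₀ : ∀ t → t B.ε w → Σ A.W λ r → Σ A.W λ c → r A.ε D × SA.Tuple r c × t ≡ up A.⟨ r , c ⟩
       in-V₀ t i =
         let (u , v , e , u∈ , C) = at t i
             (r , er , r∈) = descend u∈
             (c , ec , C′) = descend-Tuple r∈ (subst (λ u → SB.Tuple u v) er C)
         in r , c , r∈ , C′ , trans e (trans (cong₂ B.⟨_,_⟩ er ec) (sym up-⟨⟩))

   up-cmp : A.Fun c k a → up (SA.cmp g c) ≡ SB.cmp (up g) (up c)
   up-cmp {c} {k} {a} {g} C = B.fun-ext {B = λ y → y ≡ y} {C = λ y → y ≡ y}
     (up-fun {P = λ y → y ≡ y} (λ _ _ → refl) (SA.cmp-fun {C = λ y → y ≡ y} C λ _ _ → refl))
     (SB.cmp-fun (up-Fun C) λ _ _ → refl)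
     λ w i → let (x , e , x∈) = descend i in
       trans (cong (up (SA.cmp g c) B.·_) e) (trans (sym up-·) (trans (cong up (SA.cmp-· C x∈)) (trans up-· (trans (cong (up g B.·_) up-·)
         (sym (trans (SB.cmp-· (up-Fun C) i) (cong (λ w → up g B.· (up c B.· w)) e)))))))

   up-lit : up (CA.lit r v) ≡ CB.lit (up r) (up v)
   up-lit = trans up-⟨⟩ (cong₂ B.⟨_,_⟩ up-∅ (trans up-⟨⟩ (cong₂ B.⟨_,_⟩ up-∅ up-⟨⟩)))

   up-atom : A.Fun v k n → up A.⟨ r , SA.cmp a v ⟩ ≡ B.⟨ up r , SB.cmp (up a) (up v) ⟩
   up-atom {r = r} V = trans up-⟨⟩ (cong B.⟨ up r ,_⟩ (up-cmp V))

   up-Encodes : CA.Encodes a n p m Φ → CB.Encodes (up a) (up n) (up p) (up m) (up Φ)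
   up-Encodes {a} {n} {p} {m} {Φ} (m∈ , ps , vs , en) = up-nat m∈ ,
     (λ t ht → let (t₀ , e , t∈) = descend ht ; (i , i∈ , q) = ps t₀ t∈ in
       up i , up-ε i∈ , trans e (trans (cong up q) (trans up-⟨⟩ (cong B.⟨ up i ,_⟩ up-·)))) ,
     (λ i hi → let (i₀ , e , i∈) = descend hi ; (t , r , v , q , r∈ , V , k) = vs i₀ i∈ in
       subst (λ i → B.⟨ i , up Φ B.· i ⟩ B.ε up Φ) (sym e) (subst (λ y → B.⟨ up i₀ , y ⟩ B.ε up Φ) up-· (up-mem t)) ,
       up r , up v , trans (cong (up Φ B.·_) e) (trans (sym up-·) (trans (cong up q) up-lit)) , up-ε r∈ ,
       subst (λ k → B.Fun (up v) k (up n)) up-· (up-Fun V) , subst (B._ε up p) (up-atom V) (up-ε k)) ,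
     (λ t ht → let (t₀ , e , t∈) = descend ht ; (i , r , v , i∈ , q , q′) = en t₀ t∈
                   (_ , r′ , v′ , q″ , _ , V , _) = vs i i∈
                   (_ , v≡) = A.⟨⟩-inj (proj₂ (A.⟨⟩-inj (proj₂ (A.⟨⟩-inj (trans (sym q) q″)))))
                   V′ = subst (λ v → A.Fun v (L A.· r′) n) (sym v≡) V in
       up i , up r , up v , up-ε i∈ , trans (sym up-·) (trans (cong up q) up-lit) , trans e (trans (cong up q′) (up-atom V′)))

   opaque
     descend-Perm : ∀ {g} → PB.Perm g → A.Finite Y → Y A.⊆ X → Σ A.W λ h → PA.Perm h × (∀ y → y A.ε Y → g B.· up y ≡ up (h A.· y))
     descend-Perm {Y} {g} pg fin Y⊆ =
       let (h , h∈ , ext) = PA.Extension.extend PA.symmetric (proj₂ (PA.symmetric-spec PA.idP) PA.perm-id) (λ h → proj₁ (PA.symmetric-spec h))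
             (λ h a b i k l → proj₂ (PA.symmetric-spec _) (PA.perm-∘ (PA.perm-tr k l) (proj₁ (PA.symmetric-spec h) i))) fj pj
       in h , proj₁ (PA.symmetric-spec h) h∈ , λ y y∈ →
            let (z , e , z∈) = value y y∈ in trans e (cong up (sym (ext y z (down-mem (subst₂ (λ z j → B.⟨ up y , z ⟩ B.ε j) e j≡
              (proj₂ (B.graph-spec (g B.·_) (up Y) _) (up y , up-ε y∈ , refl)))))))
       where
       value : ∀ y → y A.ε Y → Σ A.W λ z → g B.· up y ≡ up z × z A.ε X
       value y i = descend (PB.perm-in pg (up-ε (Y⊆ y i)))
       graph-∈ : ∀ t → t B.ε B.graph (g B.·_) (up Y) → Σ A.W λ y → Σ A.W λ z → t ≡ up A.⟨ y , z ⟩ × y A.ε Y × z A.ε X × up z ≡ g B.· up y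
       graph-∈ t i =
         let (u , u∈ , e) = proj₁ (B.graph-spec (g B.·_) (up Y) t) i
             (y , ey , y∈) = descend u∈
             (z , ez , z∈) = value y y∈
         in y , z , trans e (trans (cong (λ u → B.⟨ u , g B.· u ⟩) ey) (trans (cong B.⟨ up y ,_⟩ ez) (sym up-⟨⟩))) , y∈ , z∈ , sym ez
       pairing : ∀ g → B.DefT {1} λ ρ → B.⟨ ρ zero , g B.· ρ zero ⟩
       pairing g = B.it
       J : Σ A.W λ j → B.graph (g B.·_) (up Y) ≡ up j × A.Finite j
       J = let (_ , fb , h) = B.finite-img (λ i → B.⟨ i , g B.· i ⟩) ⦃ pairing g ⦄ (up-Finite fin) in
         descend-Finite (A.𝒫 (A.𝒫 (X A.∪ X)))
           (B.finite-⊆ fb λ t i → let (u , u∈ , e) = proj₁ (B.graph-spec (g B.·_) (up Y) t) i in subst (B._ε _) (sym e) (h u u∈))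
           (λ t i → let (y , z , e , y∈ , z∈ , _) = graph-∈ t i in subst (B._ε _) (sym e) (up-ε (A.pair∈ (Y⊆ y y∈) z∈)))
       j₀ : A.W
       j₀ = proj₁ J
       j≡ : B.graph (g B.·_) (up Y) ≡ up j₀
       j≡ = proj₁ (proj₂ J)
       fj : A.Finite j₀
       fj = proj₂ (proj₂ J)
       j-out : ∀ {u v} → A.⟨ u , v ⟩ A.ε j₀ → u A.ε X × up v ≡ g B.· up u
       j-out {u} {v} i = let (y , z , e , y∈ , z∈ , q) = graph-∈ _ (subst (up A.⟨ u , v ⟩ B.ε_) (sym j≡) (up-ε i)) ; (e₁ , e₂) = A.⟨⟩-inj (up-inj e) in
         subst (A._ε X) (sym e₁) (Y⊆ y y∈) , trans (cong up e₂) (trans q (cong (λ y → g B.· up y) (sym e₁)))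
       pj : PA.PartialInj j₀
       pj = (λ t i → let (y , z , e , y∈ , z∈ , _) = graph-∈ (up t) (subst (up t B.ε_) (sym j≡) (up-ε i)) in y , z , up-inj e , Y⊆ y y∈ , z∈) ,
            (λ u v v′ i i′ → up-inj (trans (proj₂ (j-out i)) (sym (proj₂ (j-out i′))))) ,
            (λ u u′ v i i′ → let (u∈ , e) = j-out i ; (u∈′ , e′) = j-out i′ in
              up-inj (PB.perm-inj pg (up-ε u∈) (up-ε u∈′) (trans (sym e) e′)))

 module MeasureAbsoluteness (𝔖 : TA.Setting) where

   open RealAbsoluteness using (up-timesᴿ)
   open TA.Setting 𝔖
   open StructureAbsoluteness X L D lang

   private variable
     p q x : A.W
     w : B.W

   module _ (𝒮₁ : B.W) (sigma₁ : B.R.IsSigma (A.el κ) (A.el L) (A.el X) (B.el 𝒮₁)) (full₁ : SB.Str B.ε 𝒮₁) where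

     𝔖₁ : TB.Setting
     𝔖₁ = record
       { X = up X ; L = up L ; D = up D ; κ = up κ ; 𝒮 = 𝒮₁ ; i₀ = up i₀ ; i₁ = up i₁ ; lang = lang₁
       ; sigma = sigma₁ ; full = full₁
       ; ord = (λ u i → let (x , e , x∈) = descend i in subst (B._⊆ up κ) (sym e) (up-⊆ (proj₁ ord x x∈))) ,
               (λ u i v j → let (x , e , x∈) = descend i ; (y , e′ , y∈) = descend (subst (v B.ε_) e j) in
                 subst₂ B._⊆_ (sym e′) (sym e) (up-⊆ (proj₂ ord x x∈ y y∈)))
       ; i₀∈ = up-ε i₀∈ ; i₁∈ = up-ε i₁∈ ; i₀≢i₁ = λ e → i₀≢i₁ (up-inj e)
       ; infinite = λ fin → infinite (down-Finite fin) }

     module OA = TA.OverSetting 𝔖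
     module OB = TB.OverSetting 𝔖₁
     open OA using () renaming (module Measures to MA; module Additivity to AdA; module Convergence to CvA; module Decomposition to DcA)
     open OB using () renaming (module Measures to MB; module Additivity to AdB; module Convergence to CvB; module Decomposition to DcB)

     bas∈ : SA.Condition p → SA.Bas p A.ε 𝒮
     bas∈ = LA.PiLambda.Bas∈ κ 𝒮 closed least ord i₀ i₁ i₀∈ i₁∈ i₀≢i₁

     bas∈₁ : SB.Condition w → SB.Bas w B.ε 𝒮₁
     bas∈₁ = LB.PiLambda.Bas∈ (up κ) 𝒮₁ (TB.Setting.closed 𝔖₁) (TB.Setting.least 𝔖₁) (TB.Setting.ord 𝔖₁)
       (up i₀) (up i₁) (TB.Setting.i₀∈ 𝔖₁) (TB.Setting.i₁∈ 𝔖₁) (TB.Setting.i₀≢i₁ 𝔖₁)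

     Agree : A.W → B.W → Set ℓ
     Agree μ μ₁ = ∀ p → SA.Condition p → up (RA.rw (MA.val μ (SA.Bas p))) ≡ RB.rw (MB.val μ₁ (SB.Bas (up p)))

     up-Occurs : DcA.Occurs x p → DcB.Occurs (up x) (up p)
     up-Occurs (r , c , i , t∈ , i∈ , e) = up r , up c , up i , up-mem t∈ , subst (up i B.ε_) up-· (up-ε i∈) , trans (cong up e) up-·

     descend-Occurs : DcB.Occurs w (up p) → Σ A.W λ x → w ≡ up x × DcA.Occurs x p
     descend-Occurs (u , v , t , t∈ , i∈ , e) =
       let (r , c , rc∈ , er , ec) = descend-mem t∈
           (i , ei , i∈′) = descend (subst (t B.ε_) (trans (cong (up L B.·_) er) (sym up-·)) i∈)
       in c A.· i , trans e (trans (cong₂ B._·_ ec ei) (sym up-·)) , r , c , i , rc∈ , i∈′ , refl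

     module _ {μ : A.W} {μ₁ : B.W} (agree : Agree μ μ₁) where

       private
         product₀ : SA.Condition p → SA.Condition q → RB.rw (MB.val μ₁ (SB.Bas (up p)) RB.*ᴿ MB.val μ₁ (SB.Bas (up q))) ≡
                    up (RA.rw (MA.val μ (SA.Bas p) RA.*ᴿ MA.val μ (SA.Bas q)))
         product₀ cp cq = sym (up-timesᴿ _ _ _ _ (agree _ cp) (agree _ cq))

         joint : SA.Condition p → SA.Condition q → RB.rw (MB.val μ₁ (SB.Bas (up p B.∪ up q))) ≡ up (RA.rw (MA.val μ (SA.Bas (p A.∪ q))))
         joint {p} {q} cp cq = trans (cong (λ w → RB.rw (MB.val μ₁ (SB.Bas w))) (sym up-∪)) (sym (agree (p A.∪ q) (SA.condition-∪ cp cq)))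

       up-Dissociated : DcA.Dissociated μ → DcB.Dissociated μ₁
       up-Dissociated d u v cu cv ap =
         let (p , ep , cp) = descend-Condition cu
             (q , eq , cq) = descend-Condition cv
         in subst₂ (λ u v → MB.val μ₁ (SB.Bas (u B.∪ v)) ≡ MB.val μ₁ (SB.Bas u) RB.*ᴿ MB.val μ₁ (SB.Bas v)) (sym ep) (sym eq)
              (RB.rw-inj (trans (joint cp cq) (trans (cong (λ r → up (RA.rw r)) (d p q cp cq λ x o o′ →
                ap (up x) (subst (DcB.Occurs (up x)) (sym ep) (up-Occurs o)) (subst (DcB.Occurs (up x)) (sym eq) (up-Occurs o′)))) (sym (product₀ cp cq)))))

       down-Dissociated : DcB.Dissociated μ₁ → DcA.Dissociated μ
       down-Dissociated d p q cp cq ap = RA.rw-inj (up-inj (trans (sym (joint cp cq))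
         (trans (cong RB.rw (d (up p) (up q) (up-Condition cp) (up-Condition cq) λ w o o′ →
           let (x , e , o₀) = descend-Occurs o ; (y , e′ , o₁) = descend-Occurs o′ in
           ap x o₀ (subst (λ z → DcA.Occurs z q) (up-inj (trans (sym e′) e)) o₁))) (product₀ cp cq))))

       basic-invariant : CvA.Invariant μ → ∀ p → SB.Condition p → ∀ g → PB.Perm g → MB.val μ₁ (SB.img[ g ] (SB.Bas p)) ≡ MB.val μ₁ (SB.Bas p)
       basic-invariant inv w cw g pg =
         let (p , ep , cp) = descend-Condition cw
             (Y , fY , Y⊆ , sp) = SA.support cp
             (h , ph , same) = descend-Perm pg fY Y⊆
             (q , cq , sh , sh′) = SA.shift ph cp
             moved : SB.img[ g ] (SB.Bas (up p)) ≡ SB.Bas (up q)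
             moved = SB.image-Bas pg
               (λ u v t∈ → let (r , c , k , er , ec) = descend-mem t∈ in
                 subst₂ (λ u v → B.⟨ u , v ⟩ B.ε up q) (sym er) (sym (trans (cong (SB.cmp g) ec) (cmp-same same sp cp k))) (up-mem (sh r c k)))
               (λ t t∈ → let (t₀ , e , t₀∈) = descend t∈ ; (r , c , k , e′) = sh′ t₀ t₀∈ in
                 up r , up c , up-mem k , trans e (trans (cong up e′) (trans up-⟨⟩ (cong B.⟨ up r ,_⟩ (sym (cmp-same same sp cp k))))))
               (proj₂ (up-Condition cp))
         in subst (λ w → MB.val μ₁ (SB.img[ g ] (SB.Bas w)) ≡ MB.val μ₁ (SB.Bas w)) (sym ep)
              (trans (cong (MB.val μ₁) moved) (RB.rw-inj (trans (sym (agree q cq)) (trans (cong (λ r → up (RA.rw r))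
                (trans (cong (MA.val μ) (sym (SA.image-shift ph cp (sh , sh′)))) (inv h ph _ (bas∈ cp)))) (agree p cp)))))
         where
         cmp-same : ∀ {g h p Y r c} → (∀ y → y A.ε Y → g B.· up y ≡ up (h A.· y)) → SA.Supports Y p → SA.Condition p → A.⟨ r , c ⟩ A.ε p →
                    SB.cmp g (up c) ≡ up (SA.cmp h c)
         cmp-same {g} {h} {p} {Y} {r} {c} same sp cp k = B.fun-ext {B = λ y → y ≡ y} {C = λ y → y ≡ y} (SB.cmp-fun C₁ λ _ _ → refl)
           (up-fun {P = λ y → y ≡ y} (λ _ _ → refl) (SA.cmp-fun {C = λ y → y ≡ y} C λ _ _ → refl))
           λ w i → let (x , e , x∈) = descend i in
             trans (SB.cmp-· C₁ i) (trans (cong (g B.·_) (trans (cong (up c B.·_) e) (sym up-·))) (trans (same _ (sp r c k x x∈))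
               (trans (cong up (sym (SA.cmp-· C x∈))) (trans up-· (cong (up (SA.cmp h c) B.·_) (sym e))))))
           where
           C : A.Fun c (L A.· r) X
           C = proj₂ (SA.atom (proj₂ cp) k)
           C₁ : B.Fun (up c) (up (L A.· r)) (up X)
           C₁ = up-Fun C

     relativization-agrees : ∀ {μ μ₁} → AdA.IsMeasure μ → AdB.IsMeasure μ₁ →
       IsRelativization _∈_ V₀ V₁ (A.el κ) (A.el L) (A.el X) (A.el μ) (B.el μ₁) → Agree μ μ₁
     relativization-agrees {μ} {μ₁} m m₁ rel p cp =
       let (n , a , n∈ , F , j , Φ , E) = CA.encode cp
           y = RA.rw (MA.val μ (SA.Bas p))
       in proj₁ (CvB.rel-val {μ₁} {SB.Bas (up p)} (AdB.IsMeasure.fun m₁) (bas∈₁ {up p} (up-Condition cp)) {up y})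
            (Equivalence.to (IsRelativization.agrees rel (A.el n) (A.isV n) (A.el a) (A.isV a) (A.el Φ) (A.isV Φ)
               (CA.isTuple F n∈ E) (CA.isConjunction F n∈ E) (A.el (SA.Bas p)) (A.isV (SA.Bas p)) (B.el (SB.Bas (up p))) (B.isV (SB.Bas (up p)))
               (CA.structuresWith F n∈ E) (CB.structuresWith (up-Fun F) (up-nat n∈) (up-Encodes E)) (A.el y) (A.isV y))
             (proj₂ (CvA.rel-val {μ} {SA.Bas p} (AdA.IsMeasure.fun m) (bas∈ {p} cp) {y}) refl))

     module _ {μ : A.W} {μ₁ : B.W} (invariant : A.R.IsInvariantMeasure (A.el κ) (A.el L) (A.el X) (A.el μ))
       (rel : IsRelativization _∈_ V₀ V₁ (A.el κ) (A.el L) (A.el X) (A.el μ) (B.el μ₁)) where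

       private
         measure₀ : AdA.IsMeasure μ
         measure₀ = proj₁ (proj₁ (CvA.rel-invariant {μ}) invariant)

         invariant₀ : CvA.Invariant μ
         invariant₀ = proj₂ (proj₁ (CvA.rel-invariant {μ}) invariant)

         measure₁ : AdB.IsMeasure μ₁
         measure₁ = proj₁ (CvB.rel-measure {μ₁}) (IsRelativization.measure rel)

         agree : Agree μ μ₁
         agree = relativization-agrees {μ} {μ₁} measure₀ measure₁ rel

         invariant₁ : CvB.Invariant μ₁
         invariant₁ = OB.BasicInvariance.basic⇒invariant {μ₁} measure₁ (basic-invariant {μ} {μ₁} agree invariant₀)

       extreme-up : A.R.IsExtreme (A.el κ) (A.el L) (A.el X) (A.el μ) → B.R.IsExtreme (A.el κ) (A.el L) (A.el X) (B.el μ₁)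
       extreme-up ex = OB.Extremality.dissociated⇒extreme {μ₁} measure₁ invariant₁ (up-Dissociated {μ} {μ₁} agree (DcA.extreme⇒dissociated {μ} measure₀ invariant₀ ex))

       extreme-down : B.R.IsExtreme (A.el κ) (A.el L) (A.el X) (B.el μ₁) → A.R.IsExtreme (A.el κ) (A.el L) (A.el X) (A.el μ)
       extreme-down ex = OA.Extremality.dissociated⇒extreme {μ} measure₀ invariant₀ (down-Dissociated {μ} {μ₁} agree (DcB.extreme⇒dissociated {μ₁} measure₁ invariant₁ ex))

       extreme⟺extreme : A.R.IsExtreme (A.el κ) (A.el L) (A.el X) (A.el μ) ⟺ B.R.IsExtreme (A.el κ) (A.el L) (A.el X) (B.el μ₁)
       extreme⟺extreme = extreme-up , extreme-down

   relativization-extreme : ∀ {μ μ₁} → A.R.IsInvariantMeasure (A.el κ) (A.el L) (A.el X) (A.el μ) →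
     IsRelativization _∈_ V₀ V₁ (A.el κ) (A.el L) (A.el X) (A.el μ) (B.el μ₁) →
     A.R.IsExtreme (A.el κ) (A.el L) (A.el X) (A.el μ) ⟺ B.R.IsExtreme (A.el κ) (A.el L) (A.el X) (B.el μ₁)
   relativization-extreme {μ} {μ₁} invariant rel =
     let (𝒮₁ , sigma₁ , full₁) = TB.Domain.measure-domain (up X) (up L) (up D) (up κ) μ₁ lang₁ (IsRelativization.measure rel) in
     extreme⟺extreme 𝒮₁ sigma₁ full₁ {μ} {μ₁} invariant rel

 extreme⟺ : ∀ {κ X L D μ μ₁} → V₀ κ → V₀ X → V₀ L → V₀ D → V₀ μ → A.R.IsOrdinal κ → A.R.Infinite κ → A.R.Infinite X →
   A.R.IsFun L D A.R.IsNat → A.R.IsInvariantMeasure κ L X μ → IsRelativization _∈_ V₀ V₁ κ L X μ μ₁ →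
   A.R.IsExtreme κ L X μ ⟺ B.R.IsExtreme κ L X μ₁
 extreme⟺ {κ} {X} {L} {D} {μ} {μ₁} vκ vX vL vD vμ ordinal infinite-κ infinite-X f inv rel =
   MeasureAbsoluteness.relativization-extreme 𝔖 {A.⟪ μ , vμ ⟫} {B.⟪ μ₁ , IsRelativization.member rel ⟫} inv rel
   where
   𝔖 : TA.Setting
   𝔖 = TA.Domain.setting A.⟪ κ , vκ ⟫ A.⟪ X , vX ⟫ A.⟪ L , vL ⟫ A.⟪ D , vD ⟫ A.⟪ μ , vμ ⟫ ordinal infinite-κ infinite-X f
     (A.R.IsInvariantMeasure.measure inv)

proposition5p20 : ∀ {ℓ : Level} → ExcludedMiddle ℓ →
    (𝕌 : Set ℓ) (_∈_ : Rel 𝕌 ℓ) → Relative.ZFC _∈_ (λ _ → ⊤) →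
    (V₀ V₁ : Pred 𝕌 ℓ) →
    Relative.IsModelOfSetTheory _∈_ V₀ →
    Relative.IsModelOfSetTheory _∈_ V₁ →
    V₀ ⊆ᵖ V₁ →
    (κ X L μ : 𝕌) → V₀ κ → V₀ X → V₀ L → V₀ μ →
    Relative.IsOrdinal _∈_ V₀ κ → Relative.Infinite _∈_ V₀ κ →
    Relative.Infinite _∈_ V₀ X → Relative.IsLanguage _∈_ V₀ L →
    Relative.IsInvariantMeasure _∈_ V₀ κ L X μ →
    (μ₁ : 𝕌) → IsRelativization _∈_ V₀ V₁ κ L X μ μ₁ →
    Relative.IsExtreme _∈_ V₀ κ L X μ ⇔ Relative.IsExtreme _∈_ V₁ κ L X μ₁
proposition5p20 em 𝕌 _∈_ _ V₀ V₁ model₀ model₁ V₀⊆V₁ κ X L μ vκ vX vL vμ ordinal infinite-κ infinite-X (D , vD , f) inv μ₁ rel =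
  mk⇔ (proj₁ equivalence) (proj₂ equivalence)
  where
  equivalence : Relative.IsExtreme _∈_ V₀ κ L X μ ⟺ Relative.IsExtreme _∈_ V₁ κ L X μ₁
  equivalence = TwoModels.extreme⟺ (record { lem = em ; 𝕌 = 𝕌 ; _∈_ = _∈_ ; V₀ = V₀ ; V₁ = V₁ ; model₀ = model₀ ; model₁ = model₁ ; V₀⊆V₁ = V₀⊆V₁ })
    vκ vX vL vD vμ ordinal infinite-κ infinite-X f inv rel
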